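{- Let $n\geq 2$ be an integer and $p$ a prime. Then the flasque class $\rho_{S_n}(J_{S_n/S_{n-1}})$ is $p$-invertible if and only if either $n$ is a prime, or $n$ is composite and $p$ does not divide $n$.
   Context: $S_n$ is the symmetric group on $\{1,\dots,n\}$ and $S_{n-1}\leq S_n$ is the stabilizer of the letter $n$. A $G$-lattice is a finitely generated $\mathbb{Z}[G]$-module that is free as an abelian group. It is permutation if it has a $\mathbb{Z}$-basis permuted by $G$; flasque if $\hat{H}^{ -1}(H',M)=0$ for all subgroups $H'\leq G$ (Tate cohomology). Two $G$-lattices $M_1,M_2$ are similar if $M_1\oplus P_1\cong M_2\oplus P_2$ for permutation $G$-lattices $P_1,P_2$. Every $G$-lattice $M$ has a flasque resolution $0\to M\to P\to F\to 0$ with $P$ permutation and $F$ flasque, and the similarity class of $F$ depends only on that of $M$; it is denoted $\rho_G(M)$ (the flasque class). For a prime $p$, a $G$-lattice $M$ is $p$-invertible if there is a permutation $G$-lattice $P$ such that $M\otimes\mathbb{Z}_{(p)}$ is a direct summand of $P\otimes\mathbb{Z}_{(p)}$ as $\mathbb{Z}_{(p)}[G]$-modules; a similarity class is $p$-invertible if some (equivalently every) lattice in it is $p$-invertible. For $H\leq G$, $J_{G/H}$ is the $\mathbb{Z}$-dual lattice of the kernel of the augmentation map $\mathbb{Z}[G/H]\to\mathbb{Z}$, $gH\mapsto 1$. -}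

module Defs where

open import Data.Nat as ℕ using (ℕ; zero; suc)
open import Data.Nat.Divisibility using (_∣_)
open import Data.Integer as ℤ using (ℤ)
open import Data.Rational as ℚ using (ℚ)
open import Data.Fin using (Fin; zero; suc; fromℕ; inject₁; _≟_)
open import Data.Fin.Permutation using (Permutation′; _⟨$⟩ʳ_; _∘ₚ_; flip)
  renaming (id to idₚ)
open import Data.Product using (Σ; ∃; _×_; _,_)
open import Relation.Nullary using (¬_; yes; no)
open import Relation.Binary.PropositionalEquality using (_≡_)

module Lin {A : Set} (0# 1# : A) (_+_ _*_ : A → A → A) where

  sumF : ∀ {r} → (Fin r → A) → A
  sumF {zero}  f = 0#
  sumF {suc r} f = f zero + sumF (λ i → f (suc i))

  Mat : ℕ → ℕ → Set
  Mat a b = Fin a → Fin b → A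

  Vect : ℕ → Set
  Vect a = Fin a → A

  _⊗_ : ∀ {a b c} → Mat a b → Mat b c → Mat a c
  (M ⊗ N) i k = sumF (λ j → M i j * N j k)

  _·_ : ∀ {a b} → Mat a b → Vect b → Vect a
  (M · x) i = sumF (λ j → M i j * x j)

  I : ∀ {a} → Mat a a
  I i j with i ≟ j
  ... | yes _ = 1#
  ... | no  _ = 0#

  _≋_ : ∀ {a b} → Mat a b → Mat a b → Set
  M ≋ N = ∀ i j → M i j ≡ N i j

  transpose : ∀ {a b} → Mat a b → Mat b a
  transpose M i j = M j i

module Zl = Lin (ℤ.+ 0) (ℤ.+ 1) ℤ._+_ ℤ._*_
module Ql = Lin ℚ.0ℚ ℚ.1ℚ ℚ._+_ ℚ._*_

open Zl using () renaming (Mat to ZMat; Vect to ZVec; _⊗_ to _⊗ᶻ_; _·_ to _·ᶻ_;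
  I to Iᶻ; _≋_ to _≋ᶻ_; sumF to sumᶻ; transpose to transposeᶻ) public
open Ql using () renaming (Mat to QMat; _⊗_ to _⊗ᑫ_; I to Iᑫ; _≋_ to _≋ᑫ_) public

Sym : ℕ → Set
Sym n = Permutation′ n

-- group law: (σ ∙ τ) = σ after τ, i.e. (σ ∙ τ)(i) = σ(τ(i))
_∙_ : ∀ {n} → Sym n → Sym n → Sym n
σ ∙ τ = τ ∘ₚ σ

_⁻¹ : ∀ {n} → Sym n → Sym n
σ ⁻¹ = flip σ

_≈ₚ_ : ∀ {n} → Sym n → Sym n → Set
σ ≈ₚ τ = ∀ i → σ ⟨$⟩ʳ i ≡ τ ⟨$⟩ʳ i

-- A subgroup H ≤ S_n, given by a duplicate-free enumeration e : Fin k → S_n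
-- of its elements, containing the identity and closed under the group law
-- (closure under inverses is automatic for finite subsets).
record IsSubgroup {n k : ℕ} (e : Fin k → Sym n) : Set where
  field
    has-id  : ∃ λ a → e a ≈ₚ idₚ
    closed  : ∀ a b → ∃ λ c → e c ≈ₚ (e a ∙ e b)
    no-dups : ∀ a b → e a ≈ₚ e b → a ≡ b

record Rep (n : ℕ) : Set where
  field
    rank : ℕ
    act  : Sym n → ZMat rank rank
open Rep public

record IsGLattice {n : ℕ} (M : Rep n) : Set where
  field
    act-cong : ∀ {σ τ} → σ ≈ₚ τ → act M σ ≋ᶻ act M τ
    act-id   : act M idₚ ≋ᶻ Iᶻ
    act-∙    : ∀ σ τ → act M (σ ∙ τ) ≋ᶻ (act M σ ⊗ᶻ act M τ)

record GMap {n : ℕ} (M N : Rep n) : Set where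
  field
    mat   : ZMat (rank N) (rank M)
    equiv : ∀ σ → (mat ⊗ᶻ act M σ) ≋ᶻ (act N σ ⊗ᶻ mat)
open GMap public

zeroV : ∀ {r} → ZVec r
zeroV _ = ℤ.+ 0

_≐_ : ∀ {r} → ZVec r → ZVec r → Set
x ≐ y = ∀ i → x i ≡ y i

-- permutation lattice: there is a ℤ-basis (columns of the invertible matrix Q)
-- permuted by S_n: σ(b_j) = b_{f σ j}.
permMat : ∀ {r} → (Fin r → Fin r) → ZMat r r
permMat f i j with i ≟ f j
... | yes _ = ℤ.+ 1
... | no  _ = ℤ.+ 0

IsPermutationLattice : ∀ {n} → Rep n → Set
IsPermutationLattice M =
  IsGLattice M ×
  Σ (ZMat (rank M) (rank M)) λ Q → Σ (ZMat (rank M) (rank M)) λ Q' →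
  Σ (Sym _ → Fin (rank M) → Fin (rank M)) λ f →
    ((Q ⊗ᶻ Q') ≋ᶻ Iᶻ) × ((Q' ⊗ᶻ Q) ≋ᶻ Iᶻ) ×
    (∀ σ → (act M σ ⊗ᶻ Q) ≋ᶻ (Q ⊗ᶻ permMat (f σ)))

-- Tate cohomology Ĥ^{-1}(H, M) = ker(N_H) / I_H M vanishes
H⁻¹-vanishes : ∀ {n k} → (e : Fin k → Sym n) → Rep n → Set
H⁻¹-vanishes {k = k} e M =
  ∀ (x : ZVec (rank M)) →
    (∀ i → sumᶻ (λ h → (act M (e h) ·ᶻ x) i) ≡ ℤ.+ 0) →
    Σ (Fin k → ZVec (rank M)) λ ys →
      ∀ i → x i ≡ sumᶻ (λ h → (act M (e h) ·ᶻ ys h) i ℤ.- ys h i)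

IsFlasque : ∀ {n} → Rep n → Set
IsFlasque {n} M = IsGLattice M ×
  (∀ (k : ℕ) (e : Fin k → Sym n) → IsSubgroup e → H⁻¹-vanishes e M)

record FlasqueResolution {n : ℕ} (M : Rep n) : Set where
  field
    P F   : Rep n
    P-perm : IsPermutationLattice P
    F-flasque : IsFlasque F
    ι : GMap M P
    π : GMap P F
    ι-inj  : ∀ x → (mat ι ·ᶻ x) ≐ zeroV → x ≐ zeroV
    π-surj : ∀ z → ∃ λ y → (mat π ·ᶻ y) ≐ z
    exact  : ∀ y → (mat π ·ᶻ y) ≐ zeroV → ∃ λ x → (mat ι ·ᶻ x) ≐ y
    comp0  : ∀ x → (mat π ·ᶻ (mat ι ·ᶻ x)) ≐ zeroV

-- p-invertibility: M ⊗ ℤ_(p) is a ℤ_(p)[G]-direct summand of P ⊗ ℤ_(p).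

toℚ : ℤ → ℚ
toℚ z = z ℚ./ 1

toQMat : ∀ {a b} → ZMat a b → QMat a b
toQMat M i j = toℚ (M i j)

Inℤ₍_₎ : ℕ → ℚ → Set
Inℤ₍ p ₎ q = ¬ (p ∣ ℚ.↧ₙ q)

IsPInvertible : ∀ {n} → ℕ → Rep n → Set
IsPInvertible {n} p M =
  Σ (Rep n) λ P → IsPermutationLattice P ×
  Σ (QMat (rank P) (rank M)) λ s → Σ (QMat (rank M) (rank P)) λ r →
    (∀ i j → Inℤ₍ p ₎ (s i j)) × (∀ i j → Inℤ₍ p ₎ (r i j)) ×
    (∀ σ → (s ⊗ᑫ toQMat (act M σ)) ≋ᑫ (toQMat (act P σ) ⊗ᑫ s)) ×
    (∀ σ → (r ⊗ᑫ toQMat (act P σ)) ≋ᑫ (toQMat (act M σ) ⊗ᑫ r)) ×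
    ((r ⊗ᑫ s) ≋ᑫ Iᑫ)

-- the flasque class ρ_G(M) is p-invertible: some lattice in it is, i.e. the
-- flasque term F of some flasque resolution of M is p-invertible (p-invertibility
-- is a similarity invariant, and every lattice of the class is similar to F).
FlasqueClassPInvertible : ∀ {n} → ℕ → Rep n → Set
FlasqueClassPInvertible p M =
  Σ (FlasqueResolution M) λ R → IsPInvertible p (FlasqueResolution.F R)

-- J_{S_n/S_{n-1}}.
-- ℤ[S_n/S_{n-1}] ≅ ℤ^n via σS_{n-1} ↦ e_{σ(n)}, σ·e_i = e_{σ(i)}.
-- I = ker(augmentation) has ℤ-basis b_i = e_i − e_n (i < n), and
-- σ·b_i = e_{σ i} − e_{σ n} = b_{σ i} − b_{σ n}  (with b_n := 0).
-- J is the ℤ-dual of I: in the dual basis σ acts by transpose(act_I(σ⁻¹)).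

indic : ∀ {m} → Fin m → Fin m → ℤ
indic a b with a ≟ b
... | yes _ = ℤ.+ 1
... | no  _ = ℤ.+ 0

Irep : (n : ℕ) → Rep n
Irep zero = record { rank = 0 ; act = λ _ () }
Irep (suc m) = record
  { rank = m
  ; act  = λ σ k i →
      indic (σ ⟨$⟩ʳ inject₁ i) (inject₁ k) ℤ.- indic (σ ⟨$⟩ʳ fromℕ m) (inject₁ k)
  }

dualRep : ∀ {n} → Rep n → Rep n
dualRep M = record { rank = rank M ; act = λ σ → transposeᶻ (act M (σ ⁻¹)) }

J : (n : ℕ) → Rep n
J n = dualRep (Irep n)

{-# OPTIONS --safe #-}

-- J is ℤⁿ/ℤ, and a flasque resolution 0 → J → ℤ[X] → F → 0 is obtained from the finite S_n-set X of integral vectors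
-- v of sum zero with bounded entries, u ↦ (⟨v,u⟩)_v; that Ĥ⁰(H,J) → Ĥ⁰(H,ℤ[X]) is injective for every subgroup H comes
-- down to a Bézout relation between the orbit sizes of H.
--
-- If p ∤ n, then u ↦ Σ_j (u_i − u_j) e_i = n u shows that ℤ[X] → F splits up to the factor n.  If n = p, a cyclic order
-- of the letters identifies J with the augmentation ideal of ℤ[C_p]; hence F becomes a summand of ℤ[X] ⊕ ℤ for C_p,
-- with an explicit splitting (a floor function), and summing over the (p − 1)! cyclic orders gives an S_p-equivariant
-- splitting of F in ℤ[X] ⊕ ℤ[cyclic orders] up to the factor (p − 1)!.
--
-- Conversely let n = p m be composite and F a summand of ℤ[Y] up to a factor N.  For odd p let a rotate one block of p
-- letters and b all the other blocks.  The orbit sum c of the first block is a norm from every subgroup of order p of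
-- H = ⟨a,b⟩, so in ℤ[X] it is c = p u + N_H v.  The image of u in F is a sum of transfers from subgroups of order p, and
-- these lift to ℤ[X] with p-th multiple in N_H ℤ[X], precisely because p(p − 1)/2 is divisible by p.  As F is flasque,
-- N c is then a norm modulo p in J, which forces p ∣ N.  For p = 2 a Klein four-group is used instead, acting regularly
-- if n = 4 and with three different point stabilisers otherwise: a class in Ĥ⁻¹(J) dies in ℤ[X], and since
-- H₁(V₄, ℤ[Y]) is generated by the homology of the subgroups of order two, N times this class comes from them.

module Submission where

open import Defs
import Algebra.Properties.Semiring.Sum as SemiringSum
open import Algebra.Properties.CommutativeSemigroup using (interchange)
open import Data.Empty using (⊥-elim)
open import Data.Fin using (Fin; zero; suc; _≟_; toℕ; fromℕ; fromℕ<; inject₁; punchIn; punchOut; combine; remQuot; finToFun; funToFin; _↑ˡ_; _↑ʳ_; splitAt; join)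
open import Data.Fin.Permutation using (Permutation′; _⟨$⟩ʳ_; _⟨$⟩ˡ_; permutation; inverseˡ; inverseʳ; flip; insert; remove; insert-remove; remove-insert; punchIn-permute; lift₀; lift₀-remove; lift₀-cong) renaming (id to idₚ)
open import Data.Fin.Properties using (any?; injective⇒≤; punchOut-injective; punchInᵢ≢i; inject₁-injective; fromℕ≢inject₁; toℕ-inject₁; toℕ-fromℕ; toℕ<n; remQuot-combine; combine-remQuot; toℕ-injective; toℕ-fromℕ<; combine-injectiveʳ; combine-injectiveˡ; punchIn-punchOut; punchOut-punchIn; punchOut-cong; finToFun-funToFin; funToFin-finToFin; suc-injective; punchIn-injective; splitAt-↑ˡ; splitAt-↑ʳ; join-splitAt; splitAt-join)
open import Data.Integer as ℤ using (ℤ; +_; -[1+_]; +≤+; _+_; _*_; -_; _-_; ∣_∣)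
open import Data.Integer.DivMod using (_/ℕ_; _%ℕ_; a≡a%ℕn+[a/ℕn]*n; n%ℕd<d)
open import Data.Integer.GCD using (gcd)
import Data.Integer.Properties as ℤₚ
open import Data.Integer.Tactic.RingSolver using (solve-∀)
open import Data.Nat as ℕ using (ℕ; zero; suc; _≤_; _!)
open import Data.Nat.Coprimality using (coprime-Bézout; prime⇒coprime)
open import Data.Nat.Divisibility using (_∣_; _∣?_; divides; ∣-trans; ∣-refl; ∣⇒≤; _∣0; ∣1⇒≡1)
import Data.Nat.DivMod as ℕ
open import Data.Nat.GCD using (module Bézout; module GCD)
open import Data.Nat.Primality using (Prime; prime?; euclidsLemma; prime⇒nonTrivial; prime⇒nonZero; prime⇒irreducible)
import Data.Nat.Properties as ℕₚ
import Data.Nat.Solver as ℕSolver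
open import Data.Product using (Σ; ∃; ∃₂; _×_; _,_; proj₁; proj₂)
open import Data.Rational as ℚ using (ℚ; mkℚ; 1ℚ; toℚᵘ; ↥_; ↧_; ↧ₙ_)
import Data.Rational.Properties as ℚₚ
open import Data.Rational.Unnormalised as ℚᵘ using (mkℚᵘ; *≡*)
import Data.Rational.Unnormalised.Properties as ℚᵘₚ
open import Data.Sum as Sum using (_⊎_; inj₁; inj₂; [_,_]′)
open import Function.Bundles using (_⇔_; mk⇔)
open import Relation.Binary.Definitions using (tri<; tri≈; tri>)
open import Relation.Binary.PropositionalEquality using (_≡_; _≢_; refl; sym; trans; cong; cong₂; subst; subst₂; module ≡-Reasoning)
open import Relation.Nullary using (¬_; Dec; yes; no)

open ≡-Reasoning

open Zl using () renaming (sumF to ∑)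

-- Why Bézout: let z in ℤ[X] have norm ι u, with u invariant under H. Since J is ℤⁿ modulo
-- constants, u is a norm from J once some constant c makes every u_i - c divisible by the order of
-- the stabiliser of i. Let s_i be the orbit sizes and g = Σ c_l s_l their gcd. The vector x =
-- 1_{Hi} - (s_i / g) Σ c_l 1_{Hl} is H-fixed and has sum zero, so the norm of z at x is |H| z(x) =
-- s_i |Stab(i)| z(x). It is also the pairing of x with u, which is s_i (u_i - c) for c = Σ c_l (s_l
-- / g) u_l, the same c for all i. A single X must serve every subgroup, so these vectors are needed
-- for all possible orbit relations at once, and they determine how large the entries must be
-- allowed to be. In the converse every relation pulled back from ℤ[X] to ℤⁿ holds only up to a
-- constant. It is therefore tested by comparing two letters if p is odd, and by a functional θ that
-- is even on constants if p = 2.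

private module S = SemiringSum ℤₚ.+-*-semiring

-- Finite sums

∑≡sum : ∀ {r} (f : Fin r → ℤ) → ∑ f ≡ S.sum f
∑≡sum {zero} f = refl
∑≡sum {suc r} f = cong (_+_ (f zero)) (∑≡sum (λ i → f (suc i)))

∑-cong : ∀ {r} {f g : Fin r → ℤ} → (∀ i → f i ≡ g i) → ∑ f ≡ ∑ g
∑-cong {zero} eq = refl
∑-cong {suc r} eq = cong₂ _+_ (eq zero) (∑-cong (λ i → eq (suc i)))

∑-+ : ∀ {r} (f g : Fin r → ℤ) → ∑ (λ i → f i + g i) ≡ ∑ f + ∑ g
∑-+ f g = trans (∑≡sum (λ i → f i + g i)) (trans (S.∑-distrib-+ f g) (sym (cong₂ _+_ (∑≡sum f) (∑≡sum g))))

∑-*ˡ : ∀ {r} (c : ℤ) (f : Fin r → ℤ) → ∑ (λ i → c * f i) ≡ c * ∑ f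
∑-*ˡ c f = trans (∑≡sum (λ i → c * f i)) (trans (sym (S.*-distribˡ-sum c f)) (cong (c *_) (sym (∑≡sum f))))

∑-*ʳ : ∀ {r} (c : ℤ) (f : Fin r → ℤ) → ∑ (λ i → f i * c) ≡ ∑ f * c
∑-*ʳ c f = trans (∑≡sum (λ i → f i * c)) (trans (sym (S.*-distribʳ-sum c f)) (cong (_* c) (sym (∑≡sum f))))

∑-neg : ∀ {r} (f : Fin r → ℤ) → ∑ (λ i → - f i) ≡ - ∑ f
∑-neg f = trans (∑-cong (λ i → sym (ℤₚ.-1*i≡-i (f i)))) (trans (∑-*ˡ (- + 1) f) (ℤₚ.-1*i≡-i (∑ f)))

∑-- : ∀ {r} (f g : Fin r → ℤ) → ∑ (λ i → f i - g i) ≡ ∑ f - ∑ g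
∑-- f g = trans (∑-+ f (λ i → - g i)) (cong (_+_ (∑ f)) (∑-neg g))

∑-0 : ∀ {r} {f : Fin r → ℤ} → (∀ i → f i ≡ + 0) → ∑ f ≡ + 0
∑-0 {zero} eq = refl
∑-0 {suc r} eq = cong₂ _+_ (eq zero) (∑-0 (λ i → eq (suc i)))

∑-swap : ∀ {a b} (f : Fin a → Fin b → ℤ) → ∑ (λ i → ∑ (λ j → f i j)) ≡ ∑ (λ j → ∑ (λ i → f i j))
∑-swap f = begin
  ∑ (λ i → ∑ (f i))                ≡⟨ ∑-cong (λ i → ∑≡sum (f i)) ⟩
  ∑ (λ i → S.sum (f i))            ≡⟨ ∑≡sum (λ i → S.sum (f i)) ⟩
  S.sum (λ i → S.sum (f i))        ≡⟨ S.∑-comm f ⟩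
  S.sum (λ j → S.sum (λ i → f i j)) ≡⟨ sym (∑≡sum (λ j → S.sum (λ i → f i j))) ⟩
  ∑ (λ j → S.sum (λ i → f i j))    ≡⟨ ∑-cong (λ j → sym (∑≡sum (λ i → f i j))) ⟩
  ∑ (λ j → ∑ (λ i → f i j)) ∎

∑-const : ∀ r (c : ℤ) → ∑ {r} (λ _ → c) ≡ + r * c
∑-const zero c = sym (ℤₚ.*-zeroˡ c)
∑-const (suc r) c = trans (cong (_+_ c) (∑-const r c)) (sym (ℤₚ.suc-* (+ r) c))

∑-punch : ∀ {r} (i : Fin (suc r)) (f : Fin (suc r) → ℤ) → ∑ f ≡ f i + ∑ (λ j → f (punchIn i j))
∑-punch i f = trans (∑≡sum f) (trans (S.sum-remove {i = i} f) (cong (_+_ (f i)) (sym (∑≡sum (λ j → f (punchIn i j))))))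

∑-permute : ∀ {r} (f : Fin r → ℤ) (π : Permutation′ r) → ∑ f ≡ ∑ (λ i → f (π ⟨$⟩ʳ i))
∑-permute f π = trans (∑≡sum f) (trans (S.sum-permute f π) (sym (∑≡sum (λ i → f (π ⟨$⟩ʳ i)))))

∑-last : ∀ {m} (f : Fin (suc m) → ℤ) → ∑ f ≡ ∑ (λ i → f (inject₁ i)) + f (fromℕ m)
∑-last {zero} f = ℤₚ.+-comm (f zero) (+ 0)
∑-last {suc m} f = trans (cong (_+_ (f zero)) (∑-last (λ i → f (suc i)))) (sym (ℤₚ.+-assoc (f zero) _ _))

∑-++ : ∀ a {b} (f : Fin (a ℕ.+ b) → ℤ) → ∑ f ≡ ∑ (λ i → f (i ↑ˡ b)) + ∑ (λ j → f (a ↑ʳ j))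
∑-++ zero f = sym (ℤₚ.+-identityˡ _)
∑-++ (suc a) f = trans (cong (_+_ (f zero)) (∑-++ a (λ i → f (suc i)))) (sym (ℤₚ.+-assoc (f zero) _ _))

∑-combine : ∀ a {b} (f : Fin (a ℕ.* b) → ℤ) → ∑ f ≡ ∑ (λ i → ∑ (λ j → f (combine {a} {b} i j)))
∑-combine zero f = refl
∑-combine (suc a) {b} f = trans (∑-++ b f) (cong (_+_ (∑ (λ j → f (j ↑ˡ (a ℕ.* b))))) (∑-combine a (λ x → f (b ↑ʳ x))))

∑-single : ∀ {r} (f : Fin r → ℤ) i → (∀ j → j ≢ i → f j ≡ + 0) → ∑ f ≡ f i
∑-single {suc r} f i z = trans (∑-punch i f) (trans (cong (_+_ (f i)) (∑-0 (λ j → z _ (punchInᵢ≢i i j)))) (ℤₚ.+-identityʳ (f i)))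

-- Indicators of decidable statements

χ : ∀ {P : Set} → Dec P → ℤ
χ (yes _) = + 1
χ (no _) = + 0

χ-yes : ∀ {P : Set} (d : Dec P) → P → χ d ≡ + 1
χ-yes (yes _) _ = refl
χ-yes (no ¬p) p = ⊥-elim (¬p p)

χ-no : ∀ {P : Set} (d : Dec P) → ¬ P → χ d ≡ + 0
χ-no (yes p) ¬p = ⊥-elim (¬p p)
χ-no (no _) _ = refl

χ-cong : ∀ {P Q : Set} (d : Dec P) (d' : Dec Q) → (P → Q) → (Q → P) → χ d ≡ χ d'
χ-cong (yes p) d' f g = sym (χ-yes d' (f p))
χ-cong (no ¬p) d' f g = sym (χ-no d' (λ q → ¬p (g q)))

χ-*-cong : ∀ {P : Set} (d : Dec P) {x y : ℤ} → (P → x ≡ y) → χ d * x ≡ χ d * y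
χ-*-cong (yes p) e = cong (+ 1 *_) (e p)
χ-*-cong (no _) {x} {y} e = trans (ℤₚ.*-zeroˡ x) (sym (ℤₚ.*-zeroˡ y))

∑-χ : ∀ {r} (i : Fin r) (f : Fin r → ℤ) → ∑ (λ j → χ (i ≟ j) * f j) ≡ f i
∑-χ i f = trans (∑-single _ i off) (trans (cong (_* f i) (χ-yes (i ≟ i) refl)) (ℤₚ.*-identityˡ (f i)))
  where
  off : ∀ j → j ≢ i → χ (i ≟ j) * f j ≡ + 0
  off j j≢i = trans (cong (_* f j) (χ-no (i ≟ j) (λ e → j≢i (sym e)))) (ℤₚ.*-zeroˡ (f j))

indic≡χ : ∀ {m} (a b : Fin m) → indic a b ≡ χ (a ≟ b)
indic≡χ a b with a ≟ b
... | yes _ = refl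
... | no _ = refl

I≡χ : ∀ {m} (a b : Fin m) → Iᶻ a b ≡ χ (a ≟ b)
I≡χ a b with a ≟ b
... | yes _ = refl
... | no _ = refl

permMat≡χ : ∀ {r} (f : Fin r → Fin r) a b → permMat f a b ≡ χ (a ≟ f b)
permMat≡χ f a b with a ≟ f b
... | yes _ = refl
... | no _ = refl

-- Matrices acting on vectors

infixl 6 _⊞_ _⊟_
infixr 7 _⊡_

_⊞_ _⊟_ : ∀ {r} → ZVec r → ZVec r → ZVec r
(x ⊞ y) i = x i + y i
(x ⊟ y) i = x i - y i

_⊡_ : ∀ {r} → ℤ → ZVec r → ZVec r
(c ⊡ x) i = c * x i

vsum : ∀ {k r} → (Fin k → ZVec r) → ZVec r
vsum X i = ∑ (λ h → X h i)

≐-trans : ∀ {r} {x y z : ZVec r} → x ≐ y → y ≐ z → x ≐ z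
≐-trans e e' i = trans (e i) (e' i)

module _ {a b : ℕ} (A : ZMat a b) where

  ·-cong : ∀ {x y} → x ≐ y → (A ·ᶻ x) ≐ (A ·ᶻ y)
  ·-cong e i = ∑-cong (λ j → cong (A i j *_) (e j))

  ·-⊞ : ∀ x y → (A ·ᶻ (x ⊞ y)) ≐ ((A ·ᶻ x) ⊞ (A ·ᶻ y))
  ·-⊞ x y i = trans (∑-cong (λ j → ℤₚ.*-distribˡ-+ (A i j) (x j) (y j))) (∑-+ (λ j → A i j * x j) (λ j → A i j * y j))

  ·-⊟ : ∀ x y → (A ·ᶻ (x ⊟ y)) ≐ ((A ·ᶻ x) ⊟ (A ·ᶻ y))
  ·-⊟ x y i = trans (∑-cong (λ j → lem (A i j) (x j) (y j))) (∑-- (λ j → A i j * x j) (λ j → A i j * y j))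
    where
    lem : ∀ p q r → p * (q - r) ≡ p * q - p * r
    lem = solve-∀

  ·-⊡ : ∀ c x → (A ·ᶻ (c ⊡ x)) ≐ (c ⊡ (A ·ᶻ x))
  ·-⊡ c x i = trans (∑-cong (λ j → lem (A i j) c (x j))) (∑-*ˡ c (λ j → A i j * x j))
    where
    lem : ∀ p q r → p * (q * r) ≡ q * (p * r)
    lem = solve-∀

  ·-vsum : ∀ {k} (X : Fin k → ZVec b) → (A ·ᶻ vsum X) ≐ vsum (λ h → A ·ᶻ X h)
  ·-vsum X i = trans (∑-cong (λ j → sym (∑-*ˡ (A i j) (λ h → X h j)))) (∑-swap (λ j h → A i j * X h j))

  ·-zero : (A ·ᶻ zeroV) ≐ zeroV
  ·-zero i = ∑-0 (λ j → ℤₚ.*-zeroʳ (A i j))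

⊗-· : ∀ {a b c} (A : ZMat a b) (B : ZMat b c) x → ((A ⊗ᶻ B) ·ᶻ x) ≐ (A ·ᶻ (B ·ᶻ x))
⊗-· A B x i = begin
  ∑ (λ k → ∑ (λ j → A i j * B j k) * x k)   ≡⟨ ∑-cong (λ k → sym (∑-*ʳ (x k) (λ j → A i j * B j k))) ⟩
  ∑ (λ k → ∑ (λ j → A i j * B j k * x k))   ≡⟨ ∑-swap (λ k j → A i j * B j k * x k) ⟩
  ∑ (λ j → ∑ (λ k → A i j * B j k * x k))   ≡⟨ ∑-cong (λ j → ∑-cong (λ k → ℤₚ.*-assoc (A i j) (B j k) (x k))) ⟩
  ∑ (λ j → ∑ (λ k → A i j * (B j k * x k))) ≡⟨ ∑-cong (λ j → ∑-*ˡ (A i j) (λ k → B j k * x k)) ⟩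
  ∑ (λ j → A i j * ∑ (λ k → B j k * x k))   ∎

≋-· : ∀ {a b} {A B : ZMat a b} → A ≋ᶻ B → ∀ x → (A ·ᶻ x) ≐ (B ·ᶻ x)
≋-· e x i = ∑-cong (λ j → cong (_* x j) (e i j))

I-· : ∀ {r} (x : ZVec r) → (Iᶻ ·ᶻ x) ≐ x
I-· x i = trans (∑-cong (λ j → cong (_* x j) (I≡χ i j))) (∑-χ i x)

unit : ∀ {r} → Fin r → ZVec r
unit i j = χ (i ≟ j)

·-unit : ∀ {a b} (A : ZMat a b) j i → (A ·ᶻ unit j) i ≡ A i j
·-unit A j i = trans (∑-cong (λ k → ℤₚ.*-comm (A i k) (unit j k))) (∑-χ j (A i))

-- Unit vectors recover the columns. Matrix identities are reduced by this to identities on vectors,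
-- where sums can be rearranged.
≋-ext : ∀ {a b} {A B : ZMat a b} → (∀ x → (A ·ᶻ x) ≐ (B ·ᶻ x)) → A ≋ᶻ B
≋-ext {A = A} {B} e i j = trans (sym (·-unit A j i)) (trans (e (unit j) i) (·-unit B j i))

permMat-· : ∀ {r} (π : Permutation′ r) (f : Fin r → Fin r) → (∀ i → f i ≡ π ⟨$⟩ʳ i) →
            ∀ z x → (permMat f ·ᶻ z) x ≡ z (π ⟨$⟩ˡ x)
permMat-· π f fπ z x = begin
  ∑ (λ y → permMat f x y * z y)  ≡⟨ ∑-single _ y₀ off ⟩
  permMat f x y₀ * z y₀          ≡⟨ cong (_* z y₀) (trans (permMat≡χ f x y₀) (χ-yes (x ≟ f y₀) (sym (trans (fπ y₀) (inverseʳ π))))) ⟩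
  + 1 * z y₀                     ≡⟨ ℤₚ.*-identityˡ (z y₀) ⟩
  z y₀ ∎
  where
  y₀ = π ⟨$⟩ˡ x
  off : ∀ y → y ≢ y₀ → permMat f x y * z y ≡ + 0
  off y y≢ = trans (cong (_* z y) (trans (permMat≡χ f x y) (χ-no (x ≟ f y)
    λ e → y≢ (trans (sym (inverseˡ π)) (cong (π ⟨$⟩ˡ_) (sym (trans e (fπ y)))))))) (ℤₚ.*-zeroˡ (z y))

-- Finite G-sets and their permutation lattices

record GSet (n : ℕ) : Set where
  infixr 8 _⋆_
  field
    size   : ℕ
    _⋆_    : Sym n → Fin size → Fin size
    ⋆-cong : ∀ {σ τ} → σ ≈ₚ τ → ∀ x → σ ⋆ x ≡ τ ⋆ x
    ⋆-id   : ∀ x → idₚ ⋆ x ≡ x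
    ⋆-∙    : ∀ σ τ x → (σ ∙ τ) ⋆ x ≡ σ ⋆ (τ ⋆ x)

  ⋆-⁻¹ˡ : ∀ σ x → (σ ⁻¹) ⋆ (σ ⋆ x) ≡ x
  ⋆-⁻¹ˡ σ x = trans (sym (⋆-∙ (σ ⁻¹) σ x)) (trans (⋆-cong (λ i → inverseˡ σ) x) (⋆-id x))

  ⋆-⁻¹ʳ : ∀ σ x → σ ⋆ ((σ ⁻¹) ⋆ x) ≡ x
  ⋆-⁻¹ʳ σ x = trans (sym (⋆-∙ σ (σ ⁻¹) x)) (trans (⋆-cong (λ i → inverseʳ σ) x) (⋆-id x))

  ⋆-perm : Sym n → Permutation′ size
  ⋆-perm σ = permutation (σ ⋆_) ((σ ⁻¹) ⋆_) (⋆-⁻¹ʳ σ) (⋆-⁻¹ˡ σ)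

  ⋆-injective : ∀ σ {x y} → σ ⋆ x ≡ σ ⋆ y → x ≡ y
  ⋆-injective σ {x} {y} e = trans (sym (⋆-⁻¹ˡ σ x)) (trans (cong ((σ ⁻¹) ⋆_) e) (⋆-⁻¹ˡ σ y))

  ∑-⋆ : ∀ σ f → ∑ f ≡ ∑ (λ x → f (σ ⋆ x))
  ∑-⋆ σ f = ∑-permute f (⋆-perm σ)

  lattice : Rep n
  lattice = record { rank = size ; act = λ σ → permMat (σ ⋆_) }

  act-lattice : ∀ σ z x → (act lattice σ ·ᶻ z) x ≡ z ((σ ⁻¹) ⋆ x)
  act-lattice σ = permMat-· (⋆-perm σ) (σ ⋆_) (λ i → refl)

  lattice-isGLattice : IsGLattice lattice
  lattice-isGLattice = record
    { act-cong = λ {σ} {τ} e i j → trans (permMat≡χ (σ ⋆_) i j) (trans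
        (χ-cong (i ≟ σ ⋆ j) (i ≟ τ ⋆ j) (λ q → trans q (⋆-cong e j)) (λ q → trans q (sym (⋆-cong e j))))
        (sym (permMat≡χ (τ ⋆_) i j)))
    ; act-id = λ i j → trans (permMat≡χ _ i j) (trans
        (χ-cong (i ≟ _) (i ≟ j) (λ q → trans q (⋆-id j)) (λ q → trans q (sym (⋆-id j)))) (sym (I≡χ i j)))
    ; act-∙ = λ σ τ → ≋-ext λ z x → trans (act-lattice (σ ∙ τ) z x) (trans
        (cong z (trans (⋆-cong {(σ ∙ τ) ⁻¹} {(τ ⁻¹) ∙ (σ ⁻¹)} (λ i → refl) x) (⋆-∙ (τ ⁻¹) (σ ⁻¹) x)))
        (sym (trans (⊗-· (act lattice σ) (act lattice τ) z x) (trans (act-lattice σ _ x) (act-lattice τ z _)))))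
    }

  lattice-isPermutation : IsPermutationLattice lattice
  lattice-isPermutation = lattice-isGLattice , Iᶻ , Iᶻ , (λ σ x → σ ⋆ x) , II , II ,
    λ σ → ≋-ext λ z x → trans (⊗-· (act lattice σ) Iᶻ z x)
      (trans (·-cong (act lattice σ) (I-· z) x) (sym (trans (⊗-· Iᶻ (act lattice σ) z x) (I-· _ x))))
    where
    II : ∀ {r} → (Iᶻ {r} ⊗ᶻ Iᶻ) ≋ᶻ Iᶻ
    II = ≋-ext λ z x → trans (⊗-· Iᶻ Iᶻ z x) (I-· _ x)

-- A missed value could be punched out, leaving an injection into a smaller set.
injective⇒surjective : ∀ {k} (f : Fin k → Fin k) → (∀ {x y} → f x ≡ f y → x ≡ y) → ∀ y → ∃ λ x → f x ≡ y
injective⇒surjective {suc k} f inj y with any? (λ x → f x ≟ y)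
... | yes w = w
... | no ¬w = ⊥-elim (ℕₚ.<-irrefl refl (injective⇒≤ {f = λ x → punchOut (λ e → ¬w (x , sym e))}
                (λ {x} {x'} e → inj (punchOut-injective (λ q → ¬w (x , sym q)) (λ q → ¬w (x' , sym q)) e))))

∑χ-nonneg : ∀ {r} {P : Fin r → Set} (d : ∀ i → Dec (P i)) → ∃ λ m → ∑ (λ i → χ (d i)) ≡ + m
∑χ-nonneg {zero} d = 0 , refl
∑χ-nonneg {suc r} d with d zero | ∑χ-nonneg (λ i → d (suc i))
... | yes _ | m , e = suc m , cong (_+_ (+ 1)) e
... | no _  | m , e = m , trans (ℤₚ.+-identityˡ _) e

∑χ-pos : ∀ {r} {P : Fin r → Set} (d : ∀ i → Dec (P i)) i → P i → ∃ λ m → ∑ (λ i → χ (d i)) ≡ + suc m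
∑χ-pos {suc r} d zero p with ∑χ-nonneg (λ i → d (suc i))
... | m , e = m , cong₂ _+_ (χ-yes (d zero) p) e
∑χ-pos {suc r} d (suc i) p with d zero | ∑χ-pos (λ i → d (suc i)) i p
... | yes _ | m , e = suc m , cong (_+_ (+ 1)) e
... | no _  | m , e = m , trans (ℤₚ.+-identityˡ _) e

-- first P? d is the least index satisfying P, provided that P d holds.
first : ∀ {r} {P : Fin r → Set} → (∀ i → Dec (P i)) → Fin r → Fin r
first {suc r} P? d with P? zero
first {suc r} P? d       | yes _ = zero
first {suc r} P? zero    | no _  = zero
first {suc r} P? (suc d) | no _  = suc (first (λ i → P? (suc i)) d)

first-holds : ∀ {r} {P : Fin r → Set} (P? : ∀ i → Dec (P i)) d → P d → P (first P? d)
first-holds {suc r} P? d p with P? zero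
first-holds {suc r} P? d p       | yes p₀ = p₀
first-holds {suc r} P? zero p    | no ¬p₀ = p
first-holds {suc r} P? (suc d) p | no _   = first-holds (λ i → P? (suc i)) d p

-- The least witness depends on the predicate alone and not on the witness that starts the search.
-- Applied to orbit predicates, this makes the chosen representative constant on orbits.
first-cong : ∀ {r} {P Q : Fin r → Set} (P? : ∀ i → Dec (P i)) (Q? : ∀ i → Dec (Q i)) →
             (∀ i → P i → Q i) → (∀ i → Q i → P i) → ∀ d d' → P d → Q d' → first P? d ≡ first Q? d'
first-cong {suc r} P? Q? f g d d' p q with P? zero | Q? zero
first-cong {suc r} P? Q? f g d d' p q | yes _ | yes _ = refl
first-cong {suc r} P? Q? f g d d' p q | yes p₀ | no ¬q₀ = ⊥-elim (¬q₀ (f zero p₀))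
first-cong {suc r} P? Q? f g d d' p q | no ¬p₀ | yes q₀ = ⊥-elim (¬p₀ (g zero q₀))
first-cong {suc r} P? Q? f g zero d' p q | no ¬p₀ | no _ = ⊥-elim (¬p₀ p)
first-cong {suc r} P? Q? f g (suc d) zero p q | no _ | no ¬q₀ = ⊥-elim (¬q₀ q)
first-cong {suc r} P? Q? f g (suc d) (suc d') p q | no _ | no _ =
  cong suc (first-cong (λ i → P? (suc i)) (λ i → Q? (suc i)) (λ i → f (suc i)) (λ i → g (suc i)) d d' p q)

pos-*-zero : ∀ {t s : ℤ} {m} → t ≡ + suc m → t * s ≡ + 0 → s ≡ + 0
pos-*-zero {t} {s} {m} t≡ e with ℤₚ.i*j≡0⇒i≡0∨j≡0 (+ suc m) {s} (trans (cong (_* s) (sym t≡)) e)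
... | inj₂ z = z

pos-*-cancel : ∀ {t x y : ℤ} {m} → t ≡ + suc m → t * x ≡ t * y → x ≡ y
pos-*-cancel {t} {x} {y} t≡ e = ℤₚ.i-j≡0⇒i≡j x y (pos-*-zero t≡ (trans (lem t x y) (ℤₚ.i≡j⇒i-j≡0 e)))
  where
  lem : ∀ a b c → a * (b - c) ≡ a * b - a * c
  lem = solve-∀

-- Sums over a subgroup, and its orbits on a finite set

module Subgroup {n k : ℕ} (e : Fin k → Sym n) (H : IsSubgroup e) where

  open IsSubgroup H

  mul : Fin k → Fin k → Fin k
  mul a b = proj₁ (closed a b)

  e-mul : ∀ a b → e (mul a b) ≈ₚ (e a ∙ e b)
  e-mul a b = proj₂ (closed a b)

  Perm-injective : ∀ (σ : Sym n) {i j} → σ ⟨$⟩ʳ i ≡ σ ⟨$⟩ʳ j → i ≡ j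
  Perm-injective σ q = trans (sym (inverseˡ σ)) (trans (cong (σ ⟨$⟩ˡ_) q) (inverseˡ σ))

  mul-injective : ∀ a {b c} → mul a b ≡ mul a c → b ≡ c
  mul-injective a {b} {c} q = no-dups b c λ i → Perm-injective (e a)
    (trans (sym (e-mul a b i)) (trans (cong (λ h → e h ⟨$⟩ʳ i) q) (e-mul a c i)))

  -- A subgroup is given without inverses. Left multiplication by a is injective on a finite set,
  -- hence surjective, and the inverse is the preimage of the identity.
  inv : Fin k → Fin k
  inv a = proj₁ (injective⇒surjective (mul a) (mul-injective a) (proj₁ has-id))

  e-inv : ∀ a → e (inv a) ≈ₚ (e a ⁻¹)
  e-inv a i = Perm-injective (e a) (trans (sym (e-mul a (inv a) i)) (trans
    (cong (λ h → e h ⟨$⟩ʳ i) (proj₂ (injective⇒surjective (mul a) (mul-injective a) (proj₁ has-id))))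
    (trans (proj₂ has-id i) (sym (inverseʳ (e a))))))

  inv-inv : ∀ a → inv (inv a) ≡ a
  inv-inv a = no-dups _ _ λ i → trans (e-inv (inv a) i) (Perm-injective (e (inv a))
    (trans (inverseʳ (e (inv a))) (sym (trans (e-inv a _) (inverseˡ (e a))))))

  mul-inv : ∀ a b → mul a (mul (inv a) b) ≡ b
  mul-inv a b = no-dups _ _ λ i → trans (e-mul a _ i) (trans (cong (e a ⟨$⟩ʳ_) (trans (e-mul (inv a) b i) (e-inv a _))) (inverseʳ (e a)))

  inv-mul : ∀ a b → mul (inv a) (mul a b) ≡ b
  inv-mul a b = no-dups _ _ λ i → trans (e-mul (inv a) _ i) (trans (e-inv a _) (trans (cong (e a ⟨$⟩ˡ_) (e-mul a b i)) (inverseˡ (e a))))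

  -- Permutations are compared pointwise by `≈ₚ`, so a sum over the subgroup can be reindexed for
  -- functions that respect this relation.
  module _ (F : Sym n → ℤ) (F-cong : ∀ {σ τ} → σ ≈ₚ τ → F σ ≡ F τ) where

    ∑-left : ∀ a → ∑ (λ h → F (e a ∙ e h)) ≡ ∑ (λ h → F (e h))
    ∑-left a = sym (trans (∑-permute (λ h → F (e h)) (permutation (mul a) (mul (inv a)) (mul-inv a) (inv-mul a)))
                 (∑-cong (λ h → F-cong (e-mul a h))))

    ∑-inv : ∑ (λ h → F (e h ⁻¹)) ≡ ∑ (λ h → F (e h))
    ∑-inv = sym (trans (∑-permute (λ h → F (e h)) (permutation inv inv inv-inv inv-inv))
                 (∑-cong (λ h → F-cong (e-inv h))))

  module Orbits (X : GSet n) where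

    open GSet X

    Orb : Fin size → Fin size → Set
    Orb x y = ∃ λ h → e h ⋆ x ≡ y

    Orb? : ∀ x y → Dec (Orb x y)
    Orb? x y = any? (λ h → e h ⋆ x ≟ y)

    Orb-refl : ∀ x → Orb x x
    Orb-refl x = proj₁ has-id , trans (⋆-cong (proj₂ has-id) x) (⋆-id x)

    Orb-sym : ∀ {x y} → Orb x y → Orb y x
    Orb-sym {x} (h , refl) = inv h , trans (⋆-cong (e-inv h) _) (⋆-⁻¹ˡ (e h) x)

    Orb-trans : ∀ {x y z} → Orb x y → Orb y z → Orb x z
    Orb-trans {x} (h , refl) (h' , refl) = mul h' h , trans (⋆-cong (e-mul h' h) x) (⋆-∙ (e h') (e h) x)

    rep : Fin size → Fin size
    rep x = first (Orb? x) x

    rep-Orb : ∀ x → Orb x (rep x)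
    rep-Orb x = first-holds (Orb? x) x (Orb-refl x)

    rep-cong : ∀ {x y} → Orb x y → rep x ≡ rep y
    rep-cong {x} {y} o = first-cong (Orb? x) (Orb? y) (λ _ → Orb-trans (Orb-sym o)) (λ _ → Orb-trans o) x y (Orb-refl x) (Orb-refl y)

    stab : Fin size → ℤ
    stab x = ∑ (λ h → χ (e h ⋆ x ≟ x))

    stab-pos : ∀ x → ∃ λ m → stab x ≡ + suc m
    stab-pos x = ∑χ-pos (λ h → e h ⋆ x ≟ x) (proj₁ has-id) (proj₂ (Orb-refl x))

    -- The elements taking x to `e a ⋆ x` form a coset of the stabiliser; left translation by a
    -- counts them.
    transporters : ∀ {x y} → Orb x y → ∑ (λ h → χ (e h ⋆ x ≟ y)) ≡ stab x
    transporters {x} {y} (a , refl) = begin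
      ∑ (λ h → χ (e h ⋆ x ≟ e a ⋆ x))         ≡⟨ sym (∑-left (λ σ → χ (σ ⋆ x ≟ e a ⋆ x)) (λ {σ} {τ} q → cong (λ u → χ (u ≟ e a ⋆ x)) (⋆-cong q x)) a) ⟩
      ∑ (λ h → χ ((e a ∙ e h) ⋆ x ≟ e a ⋆ x)) ≡⟨ ∑-cong (λ h → χ-cong ((e a ∙ e h) ⋆ x ≟ e a ⋆ x) (e h ⋆ x ≟ x)
                                                    (λ q → ⋆-injective (e a) (trans (sym (⋆-∙ (e a) (e h) x)) q))
                                                    (λ q → trans (⋆-∙ (e a) (e h) x) (cong (e a ⋆_) q))) ⟩
      ∑ (λ h → χ (e h ⋆ x ≟ x)) ∎

    transporters-swap : ∀ x y → ∑ (λ h → χ (e h ⋆ x ≟ y)) ≡ ∑ (λ h → χ (e h ⋆ y ≟ x))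
    transporters-swap x y = begin
      ∑ (λ h → χ (e h ⋆ x ≟ y))      ≡⟨ ∑-cong (λ h → χ-cong (e h ⋆ x ≟ y) ((e h ⁻¹) ⋆ y ≟ x)
                                           (λ { refl → ⋆-⁻¹ˡ (e h) x }) (λ { refl → ⋆-⁻¹ʳ (e h) y })) ⟩
      ∑ (λ h → χ ((e h ⁻¹) ⋆ y ≟ x)) ≡⟨ ∑-inv (λ σ → χ (σ ⋆ y ≟ x)) (λ q → cong (λ u → χ (u ≟ x)) (⋆-cong q y)) ⟩
      ∑ (λ h → χ (e h ⋆ y ≟ x)) ∎

    -- Inversion exchanges the transporters from x to y with those from y to x, which replaces the
    -- usual conjugation of stabilisers.
    stab-cong : ∀ {x y} → Orb x y → stab x ≡ stab y
    stab-cong {x} {y} o = trans (sym (transporters o)) (trans (transporters-swap x y) (transporters (Orb-sym o)))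

    onReps : (Fin size → ℤ) → (Fin size → ℤ)
    onReps f x = f x * χ (rep x ≟ x)

    -- Only the elements carrying x to its representative contribute, and their number is the order
    -- of the stabiliser. An invariant function is thus a norm when its value at each representative
    -- is a multiple of that order.
    norm-onReps : ∀ f x → ∑ (λ h → onReps f ((e h ⁻¹) ⋆ x)) ≡ f (rep x) * stab (rep x)
    norm-onReps f x = begin
      ∑ (λ h → onReps f ((e h ⁻¹) ⋆ x))            ≡⟨ ∑-inv (λ σ → onReps f (σ ⋆ x)) (λ q → cong (onReps f) (⋆-cong q x)) ⟩
      ∑ (λ h → onReps f (e h ⋆ x))                 ≡⟨ ∑-cong step ⟩
      ∑ (λ h → f (rep x) * χ (e h ⋆ x ≟ rep x))    ≡⟨ ∑-*ˡ (f (rep x)) (λ h → χ (e h ⋆ x ≟ rep x)) ⟩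
      f (rep x) * ∑ (λ h → χ (e h ⋆ x ≟ rep x))    ≡⟨ cong (f (rep x) *_) (trans (transporters (rep-Orb x)) (stab-cong (rep-Orb x))) ⟩
      f (rep x) * stab (rep x) ∎
      where
      step : ∀ h → onReps f (e h ⋆ x) ≡ f (rep x) * χ (e h ⋆ x ≟ rep x)
      step h with e h ⋆ x ≟ rep x
      ... | yes q = cong₂ _*_ (cong f q) (χ-yes (rep (e h ⋆ x) ≟ e h ⋆ x) (trans (sym (rep-cong (h , refl))) (sym q)))
      ... | no ¬q = trans (cong (f (e h ⋆ x) *_) (χ-no (rep (e h ⋆ x) ≟ e h ⋆ x) (λ q → ¬q (sym (trans (rep-cong (h , refl)) q)))))
                      (trans (ℤₚ.*-zeroʳ (f (e h ⋆ x))) (sym (ℤₚ.*-zeroʳ (f (rep x)))))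

    -- x = (x - rep x) + rep x moves the mass of each orbit to its representative.
    H⁻¹-functions : ∀ (z : Fin size → ℤ) → (∀ x → ∑ (λ h → z ((e h ⁻¹) ⋆ x)) ≡ + 0) →
                    ∃ λ (ys : Fin k → Fin size → ℤ) → ∀ x → z x ≡ ∑ (λ h → ys h ((e h ⁻¹) ⋆ x) - ys h x)
    H⁻¹-functions z Nz = ys , λ y → sym (begin
      ∑ (λ h → ys h ((e h ⁻¹) ⋆ y) - ys h y)
        ≡⟨ ∑-cong (λ h → trans (sym (∑-- (λ x → χ (tr x ≟ h) * (χ (rep x ≟ (e h ⁻¹) ⋆ y) * z x)) (λ x → χ (tr x ≟ h) * (χ (rep x ≟ y) * z x))))
             (∑-cong (λ x → dist (χ (tr x ≟ h)) (χ (rep x ≟ (e h ⁻¹) ⋆ y) * z x) (χ (rep x ≟ y) * z x)))) ⟩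
      ∑ (λ h → ∑ (λ x → χ (tr x ≟ h) * (χ (rep x ≟ (e h ⁻¹) ⋆ y) * z x - χ (rep x ≟ y) * z x)))
        ≡⟨ ∑-swap (λ h x → χ (tr x ≟ h) * (χ (rep x ≟ (e h ⁻¹) ⋆ y) * z x - χ (rep x ≟ y) * z x)) ⟩
      ∑ (λ x → ∑ (λ h → χ (tr x ≟ h) * (χ (rep x ≟ (e h ⁻¹) ⋆ y) * z x - χ (rep x ≟ y) * z x)))
        ≡⟨ ∑-cong (λ x → ∑-χ (tr x) (λ h → χ (rep x ≟ (e h ⁻¹) ⋆ y) * z x - χ (rep x ≟ y) * z x)) ⟩
      ∑ (λ x → χ (rep x ≟ (e (tr x) ⁻¹) ⋆ y) * z x - χ (rep x ≟ y) * z x)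
        ≡⟨ ∑-cong (λ x → cong (λ u → u * z x - χ (rep x ≟ y) * z x) (χ-cong (rep x ≟ (e (tr x) ⁻¹) ⋆ y) (y ≟ x)
             (λ q → trans (sym (⋆-⁻¹ʳ (e (tr x)) y)) (trans (cong (e (tr x) ⋆_) (sym q)) (tr-rep x)))
             (λ { refl → trans (sym (⋆-⁻¹ˡ (e (tr x)) (rep x))) (cong ((e (tr x) ⁻¹) ⋆_) (tr-rep x)) }))) ⟩
      ∑ (λ x → χ (y ≟ x) * z x - χ (rep x ≟ y) * z x)
        ≡⟨ ∑-- (λ x → χ (y ≟ x) * z x) (λ x → χ (rep x ≟ y) * z x) ⟩
      ∑ (λ x → χ (y ≟ x) * z x) - ∑ (λ x → χ (rep x ≟ y) * z x)
        ≡⟨ cong₂ _-_ (∑-χ y z) (mass y) ⟩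
      z y - + 0
        ≡⟨ ℤₚ.+-identityʳ (z y) ⟩
      z y ∎)
      where
      tr : Fin size → Fin k
      tr x = proj₁ (Orb-sym (rep-Orb x))

      tr-rep : ∀ x → e (tr x) ⋆ rep x ≡ x
      tr-rep x = proj₂ (Orb-sym (rep-Orb x))

      -- The mass `z x` of a point is placed on its representative and filed under the element
      -- `tr x` that carries the representative back to x.
      ys : Fin k → Fin size → ℤ
      ys h y = ∑ (λ x → χ (tr x ≟ h) * (χ (rep x ≟ y) * z x))

      dist : ∀ a b c → a * b - a * c ≡ a * (b - c)
      dist = solve-∀

      mass : ∀ y → ∑ (λ x → χ (rep x ≟ y) * z x) ≡ + 0
      mass y with rep y ≟ y
      ... | no ¬r = ∑-0 (λ x → trans (cong (_* z x) (χ-no (rep x ≟ y) λ { refl → ¬r (sym (rep-cong (rep-Orb x))) })) (ℤₚ.*-zeroˡ (z x)))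
      -- Multiplied by the order of the stabiliser, the mass of an orbit is the value of the norm of
      -- z at its representative, which is zero.
      ... | yes r = pos-*-zero (proj₂ (stab-pos y)) (begin
        stab y * ∑ (λ x → χ (rep x ≟ y) * z x)          ≡⟨ sym (∑-*ˡ (stab y) (λ x → χ (rep x ≟ y) * z x)) ⟩
        ∑ (λ x → stab y * (χ (rep x ≟ y) * z x))        ≡⟨ ∑-cong (λ x → trans (sym (ℤₚ.*-assoc (stab y) (χ (rep x ≟ y)) (z x))) (cong (_* z x) (weight x))) ⟩
        ∑ (λ x → ∑ (λ h → χ (e h ⋆ y ≟ x)) * z x)       ≡⟨ ∑-cong (λ x → sym (∑-*ʳ (z x) (λ h → χ (e h ⋆ y ≟ x)))) ⟩
        ∑ (λ x → ∑ (λ h → χ (e h ⋆ y ≟ x) * z x))       ≡⟨ ∑-swap (λ x h → χ (e h ⋆ y ≟ x) * z x) ⟩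
        ∑ (λ h → ∑ (λ x → χ (e h ⋆ y ≟ x) * z x))       ≡⟨ ∑-cong (λ h → ∑-χ (e h ⋆ y) z) ⟩
        ∑ (λ h → z (e h ⋆ y))                           ≡⟨ sym (∑-inv (λ σ → z (σ ⋆ y)) (λ q → cong z (⋆-cong q y))) ⟩
        ∑ (λ h → z ((e h ⁻¹) ⋆ y))                      ≡⟨ Nz y ⟩
        + 0 ∎)
        where
        weight : ∀ x → stab y * χ (rep x ≟ y) ≡ ∑ (λ h → χ (e h ⋆ y ≟ x))
        weight x with rep x ≟ y
        ... | yes refl = trans (ℤₚ.*-identityʳ (stab y)) (sym (transporters (Orb-sym (rep-Orb x))))
        ... | no ¬q = trans (ℤₚ.*-zeroʳ (stab y)) (sym (∑-0 (λ h → χ-no (e h ⋆ y ≟ x) λ { refl → ¬q (trans (sym (rep-cong (h , refl))) r) })))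

-- Clearing denominators

/-toℚᵘ : ∀ z d → toℚᵘ (z ℚ./ suc d) ℚᵘ.≃ mkℚᵘ z d
/-toℚᵘ z d = ℚₚ.toℚᵘ-fromℚᵘ (mkℚᵘ z d)

toℚ-+ : ∀ a b → toℚ (a + b) ≡ toℚ a ℚ.+ toℚ b
toℚ-+ a b = ℚₚ.toℚᵘ-injective (ℚᵘₚ.≃-trans (/-toℚᵘ (a + b) 0) (ℚᵘₚ.≃-sym (ℚᵘₚ.≃-trans (ℚₚ.toℚᵘ-homo-+ (toℚ a) (toℚ b))
  (ℚᵘₚ.≃-trans (ℚᵘₚ.+-cong (/-toℚᵘ a 0) (/-toℚᵘ b 0)) (*≡* (lem a b))))))
  where
  lem : ∀ a b → (a * + 1 + b * + 1) * + 1 ≡ (a + b) * + 1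
  lem = solve-∀

toℚ-* : ∀ a b → toℚ (a * b) ≡ toℚ a ℚ.* toℚ b
toℚ-* a b = ℚₚ.toℚᵘ-injective (ℚᵘₚ.≃-trans (/-toℚᵘ (a * b) 0) (ℚᵘₚ.≃-sym (ℚᵘₚ.≃-trans (ℚₚ.toℚᵘ-homo-* (toℚ a) (toℚ b))
  (ℚᵘₚ.≃-trans (ℚᵘₚ.*-cong (/-toℚᵘ a 0) (/-toℚᵘ b 0)) (*≡* refl)))))

toℚ-injective : ∀ {a b} → toℚ a ≡ toℚ b → a ≡ b
toℚ-injective {a} {b} e with ℚᵘₚ.≃-trans (ℚᵘₚ.≃-sym (/-toℚᵘ a 0)) (ℚᵘₚ.≃-trans (ℚᵘₚ.≃-reflexive (cong toℚᵘ e)) (/-toℚᵘ b 0))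
... | *≡* q = trans (sym (ℤₚ.*-identityʳ a)) (trans q (ℤₚ.*-identityʳ b))

/≡*1/ : ∀ z d → z ℚ./ suc d ≡ toℚ z ℚ.* (+ 1 ℚ./ suc d)
/≡*1/ z d = ℚₚ.toℚᵘ-injective (ℚᵘₚ.≃-trans (/-toℚᵘ z d) (ℚᵘₚ.≃-sym (ℚᵘₚ.≃-trans (ℚₚ.toℚᵘ-homo-* (toℚ z) (+ 1 ℚ./ suc d))
  (ℚᵘₚ.≃-trans (ℚᵘₚ.*-cong (/-toℚᵘ z 0) (/-toℚᵘ (+ 1) d)) (*≡* (trans (lem z (+ suc d)) (cong (λ u → z * + u) (sym (ℕₚ.+-identityʳ (suc d))))))))))
  where
  lem : ∀ z d → (z * + 1) * d ≡ z * d
  lem = solve-∀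

*-1/ : ∀ d → toℚ (+ suc d) ℚ.* (+ 1 ℚ./ suc d) ≡ 1ℚ
*-1/ d = trans (sym (/≡*1/ (+ suc d) d)) (ℚₚ.toℚᵘ-injective (ℚᵘₚ.≃-trans (/-toℚᵘ (+ suc d) d) (*≡* (ℤₚ.*-comm (+ suc d) (+ 1)))))

↧*q≡↥ : ∀ q → toℚ (↧ q) ℚ.* q ≡ toℚ (↥ q)
↧*q≡↥ q@(mkℚ n d c) = ℚₚ.toℚᵘ-injective (ℚᵘₚ.≃-trans (ℚₚ.toℚᵘ-homo-* (toℚ (↧ q)) q)
  (ℚᵘₚ.≃-trans (ℚᵘₚ.*-congʳ {mkℚᵘ n d} (/-toℚᵘ (↧ q) 0)) (ℚᵘₚ.≃-trans (*≡* (trans (lem (+ suc d) n) (cong (λ u → n * + u) (sym (ℕₚ.+-identityʳ (suc d)))))) (ℚᵘₚ.≃-sym (/-toℚᵘ n 0)))))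
  where
  lem : ∀ d n → d * n * + 1 ≡ n * d
  lem = solve-∀

-- Reduction cancels the gcd. Hence dividing an integer by an index prime to p gives a p-integral
-- rational.
↧/∣ : ∀ z d → ↧ₙ (z ℚ./ suc d) ∣ suc d
↧/∣ z d = divides (ℤ.∣ gcd z (+ suc d) ∣) (ℤₚ.+-injective (begin
  + suc d                                             ≡⟨ sym (ℚₚ.↧-/ z (suc d)) ⟩
  ↧ (z ℚ./ suc d) * gcd z (+ suc d)                   ≡⟨ ℤₚ.*-comm (↧ (z ℚ./ suc d)) _ ⟩
  + ℤ.∣ gcd z (+ suc d) ∣ * + ↧ₙ (z ℚ./ suc d)        ≡⟨ sym (ℤₚ.pos-* ℤ.∣ gcd z (+ suc d) ∣ _) ⟩
  + (ℤ.∣ gcd z (+ suc d) ∣ ℕ.* ↧ₙ (z ℚ./ suc d)) ∎))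

open Ql using () renaming (sumF to ∑ᑫ)

∑ᑫ-cong : ∀ {r} {f g : Fin r → ℚ} → (∀ i → f i ≡ g i) → ∑ᑫ f ≡ ∑ᑫ g
∑ᑫ-cong {zero} eq = refl
∑ᑫ-cong {suc r} eq = cong₂ ℚ._+_ (eq zero) (∑ᑫ-cong (λ i → eq (suc i)))

toℚ-∑ : ∀ {r} (f : Fin r → ℤ) → toℚ (∑ f) ≡ ∑ᑫ (λ i → toℚ (f i))
toℚ-∑ {zero} f = refl
toℚ-∑ {suc r} f = trans (toℚ-+ (f zero) (∑ (λ i → f (suc i)))) (cong (ℚ._+_ (toℚ (f zero))) (toℚ-∑ (λ i → f (suc i))))

*-∑ᑫ : ∀ {r} c (f : Fin r → ℚ) → c ℚ.* ∑ᑫ f ≡ ∑ᑫ (λ i → c ℚ.* f i)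
*-∑ᑫ {zero} c f = ℚₚ.*-zeroʳ c
*-∑ᑫ {suc r} c f = trans (ℚₚ.*-distribˡ-+ c (f zero) _) (cong (ℚ._+_ (c ℚ.* f zero)) (*-∑ᑫ c (λ i → f (suc i))))

toℚ-⊗ : ∀ {a b c} (A : ZMat a b) (B : ZMat b c) i k → toℚ ((A ⊗ᶻ B) i k) ≡ (toQMat A ⊗ᑫ toQMat B) i k
toℚ-⊗ A B i k = trans (toℚ-∑ (λ j → A i j * B j k)) (∑ᑫ-cong (λ j → toℚ-* (A i j) (B j k)))

*-⊗ᑫˡ : ∀ {a b c} x (A : QMat a b) (B : QMat b c) i k → x ℚ.* (A ⊗ᑫ B) i k ≡ ((λ i j → x ℚ.* A i j) ⊗ᑫ B) i k
*-⊗ᑫˡ x A B i k = trans (*-∑ᑫ x (λ j → A i j ℚ.* B j k)) (∑ᑫ-cong (λ j → sym (ℚₚ.*-assoc x (A i j) (B j k))))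

*-swap : ∀ x y z → x ℚ.* (y ℚ.* z) ≡ y ℚ.* (x ℚ.* z)
*-swap x y z = trans (sym (ℚₚ.*-assoc x y z)) (trans (cong (ℚ._* z) (ℚₚ.*-comm x y)) (ℚₚ.*-assoc y x z))

*-⊗ᑫʳ : ∀ {a b c} x (A : QMat a b) (B : QMat b c) i k → x ℚ.* (A ⊗ᑫ B) i k ≡ (A ⊗ᑫ (λ i j → x ℚ.* B i j)) i k
*-⊗ᑫʳ x A B i k = trans (*-∑ᑫ x (λ j → A i j ℚ.* B j k)) (∑ᑫ-cong (λ j → *-swap x (A i j) (B j k)))

⊗ᑫ-cong : ∀ {a b c} {A A' : QMat a b} {B B' : QMat b c} → A ≋ᑫ A' → B ≋ᑫ B' → (A ⊗ᑫ B) ≋ᑫ (A' ⊗ᑫ B')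
⊗ᑫ-cong e e' i k = ∑ᑫ-cong (λ j → cong₂ ℚ._*_ (e i j) (e' j k))

Iᑫ≡ : ∀ {r} (i j : Fin r) → Iᑫ i j ≡ toℚ (Iᶻ i j)
Iᑫ≡ i j with i ≟ j
... | yes _ = refl
... | no _ = refl

-- Retracts up to an index prime to p

prime∤1 : ∀ {p} → Prime p → ¬ p ∣ 1
prime∤1 {p} pp d with ∣1⇒≡1 d | prime⇒nonTrivial pp
... | refl | ()

-- A direct summand after localisation at p, with denominators cleared: two integral equivariant
-- maps composing to an integer prime to p. Dividing `back` by the index leads back to the rational
-- form.
record Retract {n : ℕ} (p : ℕ) (M Q : Rep n) : Set where
  field
    into  : GMap M Q
    back  : GMap Q M
    index : ℕ
    p∤index : ¬ p ∣ index
    back-into : ∀ i j → (mat back ⊗ᶻ mat into) i j ≡ + index * Iᶻ i j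

retract⇒pInvertible : ∀ {n p} {M Q : Rep n} → Prime p → IsPermutationLattice Q → Retract p M Q → IsPInvertible p M
-- p divides 0, so the index is nonzero and can be divided by.
retract⇒pInvertible {n} {p} {M} {Q} pp Qperm record { into = s ; back = r ; index = zero ; p∤index = ∤ } = ⊥-elim (∤ (p ∣0))
retract⇒pInvertible {n} {p} {M} {Q} pp Qperm record { into = s ; back = r ; index = suc d ; p∤index = ∤ ; back-into = rs } =
  Q , Qperm , toQMat (mat s) , (λ i j → mat r i j ℚ./ suc d) ,
  (λ i j q → prime∤1 pp (∣-trans q (↧/∣ (mat s i j) 0))) ,
  (λ i j q → ∤ (∣-trans q (↧/∣ (mat r i j) d))) ,
  (λ σ i j → trans (sym (toℚ-⊗ (mat s) (act M σ) i j)) (trans (cong toℚ (equiv s σ i j)) (toℚ-⊗ (act Q σ) (mat s) i j))) ,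
  (λ σ i j → begin
    ((λ i j → mat r i j ℚ./ suc d) ⊗ᑫ toQMat (act Q σ)) i j   ≡⟨ ⊗ᑫ-cong {B = toQMat (act Q σ)} scaled (λ _ _ → refl) i j ⟩
    ((λ i j → ν ℚ.* toQMat (mat r) i j) ⊗ᑫ toQMat (act Q σ)) i j ≡⟨ sym (*-⊗ᑫˡ ν (toQMat (mat r)) (toQMat (act Q σ)) i j) ⟩
    ν ℚ.* (toQMat (mat r) ⊗ᑫ toQMat (act Q σ)) i j
      ≡⟨ cong (ν ℚ.*_) (trans (sym (toℚ-⊗ (mat r) (act Q σ) i j)) (trans (cong toℚ (equiv r σ i j)) (toℚ-⊗ (act M σ) (mat r) i j))) ⟩
    ν ℚ.* (toQMat (act M σ) ⊗ᑫ toQMat (mat r)) i j            ≡⟨ *-⊗ᑫʳ ν (toQMat (act M σ)) (toQMat (mat r)) i j ⟩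
    (toQMat (act M σ) ⊗ᑫ (λ i j → ν ℚ.* toQMat (mat r) i j)) i j ≡⟨ sym (⊗ᑫ-cong {A = toQMat (act M σ)} (λ _ _ → refl) scaled i j) ⟩
    (toQMat (act M σ) ⊗ᑫ (λ i j → mat r i j ℚ./ suc d)) i j ∎) ,
  λ i j → begin
    ((λ i j → mat r i j ℚ./ suc d) ⊗ᑫ toQMat (mat s)) i j     ≡⟨ ⊗ᑫ-cong {B = toQMat (mat s)} scaled (λ _ _ → refl) i j ⟩
    ((λ i j → ν ℚ.* toQMat (mat r) i j) ⊗ᑫ toQMat (mat s)) i j ≡⟨ sym (*-⊗ᑫˡ ν (toQMat (mat r)) (toQMat (mat s)) i j) ⟩
    ν ℚ.* (toQMat (mat r) ⊗ᑫ toQMat (mat s)) i j              ≡⟨ cong (ν ℚ.*_) (sym (toℚ-⊗ (mat r) (mat s) i j)) ⟩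
    ν ℚ.* toℚ ((mat r ⊗ᶻ mat s) i j)                          ≡⟨ cong (λ u → ν ℚ.* toℚ u) (rs i j) ⟩
    ν ℚ.* toℚ (+ suc d * Iᶻ i j)                              ≡⟨ cong (ν ℚ.*_) (toℚ-* (+ suc d) (Iᶻ i j)) ⟩
    ν ℚ.* (toℚ (+ suc d) ℚ.* toℚ (Iᶻ i j))                    ≡⟨ sym (ℚₚ.*-assoc ν (toℚ (+ suc d)) (toℚ (Iᶻ i j))) ⟩
    ν ℚ.* toℚ (+ suc d) ℚ.* toℚ (Iᶻ i j)                      ≡⟨ cong (ℚ._* toℚ (Iᶻ i j)) (trans (ℚₚ.*-comm ν (toℚ (+ suc d))) (*-1/ d)) ⟩
    1ℚ ℚ.* toℚ (Iᶻ i j)                                       ≡⟨ ℚₚ.*-identityˡ _ ⟩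
    toℚ (Iᶻ i j)                                              ≡⟨ sym (Iᑫ≡ i j) ⟩
    Iᑫ i j ∎
  where
  ν = + 1 ℚ./ suc d
  scaled : ∀ i j → mat r i j ℚ./ suc d ≡ ν ℚ.* toℚ (mat r i j)
  scaled i j = trans (/≡*1/ (mat r i j) d) (ℚₚ.*-comm _ ν)

module _ {p : ℕ} (pp : Prime p) where

  -- The product of the reduced denominators works; Euclid's lemma keeps it prime to p.
  common-denominator : ∀ r (f : Fin r → ℚ) → (∀ i → Inℤ₍ p ₎ (f i)) →
    ∃ λ D → (¬ p ∣ D) × (∀ i → ∃ λ z → toℚ z ≡ toℚ (+ D) ℚ.* f i)
  common-denominator zero f ok = 1 , prime∤1 pp , λ ()
  common-denominator (suc r) f ok with common-denominator r (λ i → f (suc i)) (λ i → ok (suc i))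
  ... | D , p∤D , clear = D ℕ.* ↧ₙ (f zero) , p∤ , cleared
    where
    p∤ : ¬ p ∣ D ℕ.* ↧ₙ (f zero)
    p∤ q with euclidsLemma D (↧ₙ (f zero)) pp q
    ... | inj₁ q₁ = p∤D q₁
    ... | inj₂ q₂ = ok zero q₂
    split : toℚ (+ (D ℕ.* ↧ₙ (f zero))) ≡ toℚ (+ D) ℚ.* toℚ (↧ (f zero))
    split = trans (cong toℚ (ℤₚ.pos-* D (↧ₙ (f zero)))) (toℚ-* (+ D) (↧ (f zero)))
    cleared : ∀ i → ∃ λ z → toℚ z ≡ toℚ (+ (D ℕ.* ↧ₙ (f zero))) ℚ.* f i
    cleared zero = + D * ↥ (f zero) , sym (begin
      toℚ (+ (D ℕ.* ↧ₙ (f zero))) ℚ.* f zero          ≡⟨ cong (ℚ._* f zero) split ⟩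
      toℚ (+ D) ℚ.* toℚ (↧ (f zero)) ℚ.* f zero       ≡⟨ ℚₚ.*-assoc (toℚ (+ D)) _ (f zero) ⟩
      toℚ (+ D) ℚ.* (toℚ (↧ (f zero)) ℚ.* f zero)     ≡⟨ cong (toℚ (+ D) ℚ.*_) (↧*q≡↥ (f zero)) ⟩
      toℚ (+ D) ℚ.* toℚ (↥ (f zero))                  ≡⟨ sym (toℚ-* (+ D) (↥ (f zero))) ⟩
      toℚ (+ D * ↥ (f zero)) ∎)
    cleared (suc i) = ↧ (f zero) * proj₁ (clear i) , (begin
      toℚ (↧ (f zero) * proj₁ (clear i))                 ≡⟨ toℚ-* (↧ (f zero)) (proj₁ (clear i)) ⟩
      toℚ (↧ (f zero)) ℚ.* toℚ (proj₁ (clear i))         ≡⟨ cong (toℚ (↧ (f zero)) ℚ.*_) (proj₂ (clear i)) ⟩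
      toℚ (↧ (f zero)) ℚ.* (toℚ (+ D) ℚ.* f (suc i))     ≡⟨ *-swap (toℚ (↧ (f zero))) (toℚ (+ D)) (f (suc i)) ⟩
      toℚ (+ D) ℚ.* (toℚ (↧ (f zero)) ℚ.* f (suc i))     ≡⟨ sym (ℚₚ.*-assoc (toℚ (+ D)) (toℚ (↧ (f zero))) (f (suc i))) ⟩
      toℚ (+ D) ℚ.* toℚ (↧ (f zero)) ℚ.* f (suc i)       ≡⟨ cong (ℚ._* f (suc i)) (sym split) ⟩
      toℚ (+ (D ℕ.* ↧ₙ (f zero))) ℚ.* f (suc i) ∎)

  clear-matrix : ∀ {a b} (A : QMat a b) → (∀ i j → Inℤ₍ p ₎ (A i j)) →
    ∃ λ D → (¬ p ∣ D) × ∃ λ (B : ZMat a b) → ∀ i j → toℚ (B i j) ≡ toℚ (+ D) ℚ.* A i j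
  clear-matrix {zero} A ok = 1 , prime∤1 pp , (λ ()) , λ ()
  clear-matrix {suc a} {b} A ok with clear-matrix {a} {b} (λ i → A (suc i)) (λ i → ok (suc i)) | common-denominator b (A zero) (ok zero)
  ... | D , p∤D , B , Beq | D' , p∤D' , row = D ℕ.* D' , p∤ , B' , B'eq
    where
    p∤ : ¬ p ∣ D ℕ.* D'
    p∤ q with euclidsLemma D D' pp q
    ... | inj₁ q₁ = p∤D q₁
    ... | inj₂ q₂ = p∤D' q₂
    B' : ZMat (suc a) b
    B' zero j = + D * proj₁ (row j)
    B' (suc i) j = + D' * B i j
    split : toℚ (+ (D ℕ.* D')) ≡ toℚ (+ D) ℚ.* toℚ (+ D')
    split = trans (cong toℚ (ℤₚ.pos-* D D')) (toℚ-* (+ D) (+ D'))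
    B'eq : ∀ i j → toℚ (B' i j) ≡ toℚ (+ (D ℕ.* D')) ℚ.* A i j
    B'eq zero j = trans (toℚ-* (+ D) (proj₁ (row j))) (trans (cong (toℚ (+ D) ℚ.*_) (proj₂ (row j)))
      (trans (sym (ℚₚ.*-assoc (toℚ (+ D)) (toℚ (+ D')) (A zero j))) (cong (ℚ._* A zero j) (sym split))))
    B'eq (suc i) j = trans (toℚ-* (+ D') (B i j)) (trans (cong (toℚ (+ D') ℚ.*_) (Beq i j))
      (trans (*-swap (toℚ (+ D')) (toℚ (+ D)) (A (suc i) j))
      (trans (sym (ℚₚ.*-assoc (toℚ (+ D)) (toℚ (+ D')) (A (suc i) j))) (cong (ℚ._* A (suc i) j) (sym split)))))

  pInvertible⇒retract : ∀ {n} {M : Rep n} → IsPInvertible p M → ∃ λ Q → IsPermutationLattice Q × Retract p M Q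
  pInvertible⇒retract {n} {M} (Q , Qperm , s , r , s-ok , r-ok , s-eq , r-eq , rs) with clear-matrix s s-ok | clear-matrix r r-ok
  ... | D , p∤D , S , Seq | D' , p∤D' , R , Req = Q , Qperm , record
    { into = record { mat = S ; equiv = λ σ i j → toℚ-injective (begin
        toℚ ((S ⊗ᶻ act M σ) i j)                     ≡⟨ toℚ-⊗ S (act M σ) i j ⟩
        (toQMat S ⊗ᑫ toQMat (act M σ)) i j           ≡⟨ ⊗ᑫ-cong {B = toQMat (act M σ)} Seq (λ _ _ → refl) i j ⟩
        ((λ i j → toℚ (+ D) ℚ.* s i j) ⊗ᑫ toQMat (act M σ)) i j ≡⟨ sym (*-⊗ᑫˡ (toℚ (+ D)) s (toQMat (act M σ)) i j) ⟩
        toℚ (+ D) ℚ.* (s ⊗ᑫ toQMat (act M σ)) i j    ≡⟨ cong (toℚ (+ D) ℚ.*_) (s-eq σ i j) ⟩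
        toℚ (+ D) ℚ.* (toQMat (act Q σ) ⊗ᑫ s) i j    ≡⟨ *-⊗ᑫʳ (toℚ (+ D)) (toQMat (act Q σ)) s i j ⟩
        (toQMat (act Q σ) ⊗ᑫ (λ i j → toℚ (+ D) ℚ.* s i j)) i j ≡⟨ sym (⊗ᑫ-cong {A = toQMat (act Q σ)} (λ _ _ → refl) Seq i j) ⟩
        (toQMat (act Q σ) ⊗ᑫ toQMat S) i j           ≡⟨ sym (toℚ-⊗ (act Q σ) S i j) ⟩
        toℚ ((act Q σ ⊗ᶻ S) i j) ∎) }
    ; back = record { mat = R ; equiv = λ σ i j → toℚ-injective (begin
        toℚ ((R ⊗ᶻ act Q σ) i j)                     ≡⟨ toℚ-⊗ R (act Q σ) i j ⟩
        (toQMat R ⊗ᑫ toQMat (act Q σ)) i j           ≡⟨ ⊗ᑫ-cong {B = toQMat (act Q σ)} Req (λ _ _ → refl) i j ⟩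
        ((λ i j → toℚ (+ D') ℚ.* r i j) ⊗ᑫ toQMat (act Q σ)) i j ≡⟨ sym (*-⊗ᑫˡ (toℚ (+ D')) r (toQMat (act Q σ)) i j) ⟩
        toℚ (+ D') ℚ.* (r ⊗ᑫ toQMat (act Q σ)) i j   ≡⟨ cong (toℚ (+ D') ℚ.*_) (r-eq σ i j) ⟩
        toℚ (+ D') ℚ.* (toQMat (act M σ) ⊗ᑫ r) i j   ≡⟨ *-⊗ᑫʳ (toℚ (+ D')) (toQMat (act M σ)) r i j ⟩
        (toQMat (act M σ) ⊗ᑫ (λ i j → toℚ (+ D') ℚ.* r i j)) i j ≡⟨ sym (⊗ᑫ-cong {A = toQMat (act M σ)} (λ _ _ → refl) Req i j) ⟩
        (toQMat (act M σ) ⊗ᑫ toQMat R) i j           ≡⟨ sym (toℚ-⊗ (act M σ) R i j) ⟩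
        toℚ ((act M σ ⊗ᶻ R) i j) ∎) }
    ; index = D ℕ.* D'
    ; p∤index = p∤
    ; back-into = λ i j → toℚ-injective (begin
        toℚ ((R ⊗ᶻ S) i j)                               ≡⟨ toℚ-⊗ R S i j ⟩
        (toQMat R ⊗ᑫ toQMat S) i j                       ≡⟨ ⊗ᑫ-cong Req Seq i j ⟩
        ((λ i j → toℚ (+ D') ℚ.* r i j) ⊗ᑫ (λ i j → toℚ (+ D) ℚ.* s i j)) i j ≡⟨ sym (*-⊗ᑫʳ (toℚ (+ D)) (λ i j → toℚ (+ D') ℚ.* r i j) s i j) ⟩
        toℚ (+ D) ℚ.* ((λ i j → toℚ (+ D') ℚ.* r i j) ⊗ᑫ s) i j ≡⟨ cong (toℚ (+ D) ℚ.*_) (sym (*-⊗ᑫˡ (toℚ (+ D')) r s i j)) ⟩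
        toℚ (+ D) ℚ.* (toℚ (+ D') ℚ.* (r ⊗ᑫ s) i j)      ≡⟨ cong (λ u → toℚ (+ D) ℚ.* (toℚ (+ D') ℚ.* u)) (trans (rs i j) (Iᑫ≡ i j)) ⟩
        toℚ (+ D) ℚ.* (toℚ (+ D') ℚ.* toℚ (Iᶻ i j))      ≡⟨ cong (toℚ (+ D) ℚ.*_) (sym (toℚ-* (+ D') (Iᶻ i j))) ⟩
        toℚ (+ D) ℚ.* toℚ (+ D' * Iᶻ i j)                ≡⟨ sym (toℚ-* (+ D) (+ D' * Iᶻ i j)) ⟩
        toℚ (+ D * (+ D' * Iᶻ i j))                      ≡⟨ cong toℚ (trans (sym (ℤₚ.*-assoc (+ D) (+ D') (Iᶻ i j))) (cong (_* Iᶻ i j) (sym (ℤₚ.pos-* D D')))) ⟩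
        toℚ (+ (D ℕ.* D') * Iᶻ i j) ∎)
    }
    where
    p∤ : ¬ p ∣ D ℕ.* D'
    p∤ q with euclidsLemma D D' pp q
    ... | inj₁ q₁ = p∤D q₁
    ... | inj₂ q₂ = p∤D' q₂

-- The left action of σ on functions on the letters, in spite of the order of its arguments.
_◁_ : ∀ {n} → ZVec n → Sym n → ZVec n
(u ◁ σ) i = u (σ ⟨$⟩ˡ i)

gmap-· : ∀ {n} {M N : Rep n} (g : GMap M N) σ v → (mat g ·ᶻ (act M σ ·ᶻ v)) ≐ (act N σ ·ᶻ (mat g ·ᶻ v))
gmap-· {M = M} {N} g σ v i = trans (sym (⊗-· (mat g) (act M σ) v i)) (trans (≋-· (equiv g σ) v i) (⊗-· (act N σ) (mat g) v i))

mkGMap : ∀ {n} {M N : Rep n} (A : ZMat (rank N) (rank M)) →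
         (∀ σ v → (A ·ᶻ (act M σ ·ᶻ v)) ≐ (act N σ ·ᶻ (A ·ᶻ v))) → GMap M N
mkGMap {M = M} {N} A e = record { mat = A ; equiv = λ σ → ≋-ext λ v i →
  trans (⊗-· A (act M σ) v i) (trans (e σ v i) (sym (⊗-· (act N σ) A v i))) }

act-∙-· : ∀ {n} {M : Rep n} → IsGLattice M → ∀ σ τ v → (act M (σ ∙ τ) ·ᶻ v) ≐ (act M σ ·ᶻ (act M τ ·ᶻ v))
act-∙-· {M = M} L σ τ v i = trans (≋-· (IsGLattice.act-∙ L σ τ) v i) (⊗-· (act M σ) (act M τ) v i)

-- J as ℤⁿ modulo constants: the coordinates of u are u_i − u_last.

diff : ∀ m → ZMat m (suc m)
diff m i j = χ (inject₁ i ≟ j) - χ (fromℕ m ≟ j)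

diff-· : ∀ {m} (u : ZVec (suc m)) i → (diff m ·ᶻ u) i ≡ u (inject₁ i) - u (fromℕ m)
diff-· {m} u i = begin
  ∑ (λ j → (χ (inject₁ i ≟ j) - χ (fromℕ m ≟ j)) * u j)   ≡⟨ ∑-cong (λ j → lem (χ (inject₁ i ≟ j)) (χ (fromℕ m ≟ j)) (u j)) ⟩
  ∑ (λ j → χ (inject₁ i ≟ j) * u j - χ (fromℕ m ≟ j) * u j) ≡⟨ ∑-- (λ j → χ (inject₁ i ≟ j) * u j) (λ j → χ (fromℕ m ≟ j) * u j) ⟩
  ∑ (λ j → χ (inject₁ i ≟ j) * u j) - ∑ (λ j → χ (fromℕ m ≟ j) * u j) ≡⟨ cong₂ _-_ (∑-χ (inject₁ i) u) (∑-χ (fromℕ m) u) ⟩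
  u (inject₁ i) - u (fromℕ m) ∎
  where
  lem : ∀ a b c → (a - b) * c ≡ a * c - b * c
  lem = solve-∀

-- The lift from J to ℤⁿ whose last coordinate is zero. By `ext-diff`, passing to J and lifting
-- again changes a vector by a constant only.
ext : ∀ {m} → ZVec m → ZVec (suc m)
ext y j = ∑ (λ k → χ (j ≟ inject₁ k) * y k)

ext-inject₁ : ∀ {m} (y : ZVec m) i → ext y (inject₁ i) ≡ y i
ext-inject₁ y i = trans (∑-cong (λ k → cong (_* y k) (χ-cong (inject₁ i ≟ inject₁ k) (i ≟ k) inject₁-injective (cong inject₁)))) (∑-χ i y)

ext-last : ∀ {m} (y : ZVec m) → ext y (fromℕ m) ≡ + 0
ext-last {m} y = ∑-0 (λ k → trans (cong (_* y k) (χ-no (fromℕ m ≟ inject₁ k) fromℕ≢inject₁)) (ℤₚ.*-zeroˡ (y k)))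

diff-ext : ∀ {m} (y : ZVec m) → (diff m ·ᶻ ext y) ≐ y
diff-ext y i = trans (diff-· (ext y) i) (trans (cong₂ _-_ (ext-inject₁ y i) (ext-last y)) (ℤₚ.+-identityʳ (y i)))

ext-diff : ∀ {m} (u : ZVec (suc m)) j → ext (diff m ·ᶻ u) j ≡ u j - u (fromℕ m)
ext-diff {m} u j = begin
  ∑ (λ k → χ (j ≟ inject₁ k) * (diff m ·ᶻ u) k)                  ≡⟨ ∑-cong (λ k → cong (χ (j ≟ inject₁ k) *_) (diff-· u k)) ⟩
  ∑ (λ k → g (inject₁ k))                                        ≡⟨ sym (ℤₚ.+-identityʳ _) ⟩
  ∑ (λ k → g (inject₁ k)) + + 0                                  ≡⟨ cong (_+_ (∑ (λ k → g (inject₁ k)))) (sym (lem (χ (j ≟ fromℕ m)) (u (fromℕ m)))) ⟩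
  ∑ (λ k → g (inject₁ k)) + g (fromℕ m)                          ≡⟨ sym (∑-last g) ⟩
  ∑ g                                                            ≡⟨ ∑-χ j (λ l → u l - u (fromℕ m)) ⟩
  u j - u (fromℕ m) ∎
  where
  g : ZVec (suc m)
  g l = χ (j ≟ l) * (u l - u (fromℕ m))
  lem : ∀ a b → a * (b - b) ≡ + 0
  lem = solve-∀

-- Dualising the augmentation ideal gives ℤⁿ modulo constants. Concretely, the matrix reads the lift
-- of y at the preimages of i and of the last letter, and the constant by which this lift differs
-- from u cancels in the difference.
J-act : ∀ {m} σ (u : ZVec (suc m)) → (act (J (suc m)) σ ·ᶻ (diff m ·ᶻ u)) ≐ (diff m ·ᶻ (u ◁ σ))
J-act {m} σ u i = begin
  ∑ (λ k → (indic a (inject₁ k) - indic b (inject₁ k)) * y k)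
    ≡⟨ ∑-cong (λ k → trans (cong₂ (λ p q → (p - q) * y k) (indic≡χ a (inject₁ k)) (indic≡χ b (inject₁ k))) (lem (χ (a ≟ inject₁ k)) (χ (b ≟ inject₁ k)) (y k))) ⟩
  ∑ (λ k → χ (a ≟ inject₁ k) * y k - χ (b ≟ inject₁ k) * y k)
    ≡⟨ ∑-- (λ k → χ (a ≟ inject₁ k) * y k) (λ k → χ (b ≟ inject₁ k) * y k) ⟩
  ext y a - ext y b
    ≡⟨ cong₂ _-_ (ext-diff u a) (ext-diff u b) ⟩
  (u a - u (fromℕ m)) - (u b - u (fromℕ m))
    ≡⟨ lem' (u a) (u b) (u (fromℕ m)) ⟩
  u a - u b
    ≡⟨ sym (diff-· (u ◁ σ) i) ⟩
  (diff m ·ᶻ (u ◁ σ)) i ∎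
  where
  y = diff m ·ᶻ u
  a = σ ⟨$⟩ˡ inject₁ i
  b = σ ⟨$⟩ˡ fromℕ m
  lem : ∀ a b c → (a - b) * c ≡ a * c - b * c
  lem = solve-∀
  lem' : ∀ a b c → (a - c) - (b - c) ≡ a - b
  lem' = solve-∀

diff-zero⇒const : ∀ {m} (u : ZVec (suc m)) → (diff m ·ᶻ u) ≐ zeroV → ∀ i → u i ≡ u (fromℕ m)
diff-zero⇒const u e i = ℤₚ.i-j≡0⇒i≡j _ _ (trans (sym (ext-diff u i))
  (∑-0 (λ k → trans (cong (χ (i ≟ inject₁ k) *_) (e k)) (ℤₚ.*-zeroʳ (χ (i ≟ inject₁ k))))))

-- A permutation lattice is ℤ[X] for a finite G-set X

-- Column j has its only nonzero entry in row `f j`.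
permMat-injective : ∀ {r} {f g : Fin r → Fin r} → permMat f ≋ᶻ permMat g → ∀ j → f j ≡ g j
permMat-injective {f = f} {g} e j with f j ≟ g j
... | yes q = q
... | no ¬q with trans (sym (trans (permMat≡χ f (f j) j) (χ-yes (f j ≟ f j) refl)))
                   (trans (e (f j) j) (trans (permMat≡χ g (f j) j) (χ-no (f j ≟ g j) ¬q)))
...   | ()

permMat-∘ : ∀ {r} (f g : Fin r → Fin r) → (permMat f ⊗ᶻ permMat g) ≋ᶻ permMat (λ x → f (g x))
permMat-∘ f g i k = begin
  ∑ (λ j → permMat f i j * permMat g j k)  ≡⟨ ∑-single (λ j → permMat f i j * permMat g j k) (g k) off ⟩
  permMat f i (g k) * permMat g (g k) k    ≡⟨ cong₂ _*_ (permMat≡χ f i (g k)) (trans (permMat≡χ g (g k) k) (χ-yes (g k ≟ g k) refl)) ⟩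
  χ (i ≟ f (g k)) * + 1                    ≡⟨ ℤₚ.*-identityʳ _ ⟩
  χ (i ≟ f (g k))                          ≡⟨ sym (permMat≡χ (λ x → f (g x)) i k) ⟩
  permMat (λ x → f (g x)) i k ∎
  where
  off : ∀ j → j ≢ g k → permMat f i j * permMat g j k ≡ + 0
  off j j≢ = trans (cong (permMat f i j *_) (trans (permMat≡χ g j k) (χ-no (j ≟ g k) j≢))) (ℤₚ.*-zeroʳ (permMat f i j))

record Basis {n : ℕ} (M : Rep n) : Set where
  field
    set : GSet n
    coords : GMap M (GSet.lattice set)
    vectors : GMap (GSet.lattice set) M
    vectors-coords : ∀ v → (mat vectors ·ᶻ (mat coords ·ᶻ v)) ≐ v
    coords-vectors : ∀ v → (mat coords ·ᶻ (mat vectors ·ᶻ v)) ≐ v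

-- The definition of a permutation lattice provides bare maps `f σ`. By `conj` their matrices are
-- conjugates of the action by Q, so the group laws of M pass to f through `permMat-injective`.
permutationBasis : ∀ {n} {M : Rep n} → IsPermutationLattice M → Basis M
permutationBasis {n} {M} (L , Q , Q' , f , QQ' , Q'Q , actQ) = record
  { set = record
    { size = rank M
    ; _⋆_ = f
    ; ⋆-cong = λ {σ} {τ} e → permMat-injective (≋-ext λ z i → trans (conj σ z i) (trans
        (·-cong Q' (≋-· (IsGLattice.act-cong L e) (Q ·ᶻ z)) i) (sym (conj τ z i))))
    ; ⋆-id = permMat-injective {g = λ x → x} (≋-ext λ z i → trans (conj idₚ z i) (trans
        (·-cong Q' (λ j → trans (≋-· (IsGLattice.act-id L) (Q ·ᶻ z) j) (I-· (Q ·ᶻ z) j)) i)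
        (trans (Q'Q-· z i) (sym (permMat-· idₚ (λ x → x) (λ _ → refl) z i)))))
    ; ⋆-∙ = λ σ τ → permMat-injective (≋-ext λ z i → begin
        (permMat (f (σ ∙ τ)) ·ᶻ z) i                                      ≡⟨ conj (σ ∙ τ) z i ⟩
        (Q' ·ᶻ (act M (σ ∙ τ) ·ᶻ (Q ·ᶻ z))) i                             ≡⟨ ·-cong Q' (act-∙-· L σ τ (Q ·ᶻ z)) i ⟩
        (Q' ·ᶻ (act M σ ·ᶻ (act M τ ·ᶻ (Q ·ᶻ z)))) i                      ≡⟨ ·-cong Q' (·-cong (act M σ) (λ j → actQ-· τ z j)) i ⟩
        (Q' ·ᶻ (act M σ ·ᶻ (Q ·ᶻ (permMat (f τ) ·ᶻ z)))) i                ≡⟨ sym (conj σ (permMat (f τ) ·ᶻ z) i) ⟩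
        (permMat (f σ) ·ᶻ (permMat (f τ) ·ᶻ z)) i                         ≡⟨ sym (⊗-· (permMat (f σ)) (permMat (f τ)) z i) ⟩
        ((permMat (f σ) ⊗ᶻ permMat (f τ)) ·ᶻ z) i                         ≡⟨ ≋-· (permMat-∘ (f σ) (f τ)) z i ⟩
        (permMat (λ x → f σ (f τ x)) ·ᶻ z) i ∎)
    }
  ; coords = mkGMap Q' λ σ v i → begin
      (Q' ·ᶻ (act M σ ·ᶻ v)) i                    ≡⟨ ·-cong Q' (·-cong (act M σ) (λ j → sym (QQ'-· v j))) i ⟩
      (Q' ·ᶻ (act M σ ·ᶻ (Q ·ᶻ (Q' ·ᶻ v)))) i     ≡⟨ sym (conj σ (Q' ·ᶻ v) i) ⟩
      (permMat (f σ) ·ᶻ (Q' ·ᶻ v)) i ∎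
  ; vectors = mkGMap Q λ σ z i → sym (actQ-· σ z i)
  ; vectors-coords = QQ'-·
  ; coords-vectors = Q'Q-·
  }
  where
  QQ'-· : ∀ v → (Q ·ᶻ (Q' ·ᶻ v)) ≐ v
  QQ'-· v i = trans (sym (⊗-· Q Q' v i)) (trans (≋-· QQ' v i) (I-· v i))
  Q'Q-· : ∀ v → (Q' ·ᶻ (Q ·ᶻ v)) ≐ v
  Q'Q-· v i = trans (sym (⊗-· Q' Q v i)) (trans (≋-· Q'Q v i) (I-· v i))
  actQ-· : ∀ σ z → (act M σ ·ᶻ (Q ·ᶻ z)) ≐ (Q ·ᶻ (permMat (f σ) ·ᶻ z))
  actQ-· σ z i = trans (sym (⊗-· (act M σ) Q z i)) (trans (≋-· (actQ σ) z i) (⊗-· Q (permMat (f σ)) z i))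
  conj : ∀ σ z → (permMat (f σ) ·ᶻ z) ≐ (Q' ·ᶻ (act M σ ·ᶻ (Q ·ᶻ z)))
  conj σ z i = trans (sym (Q'Q-· _ i)) (·-cong Q' (λ j → sym (actQ-· σ z j)) i)

-- A resolution 0 → ℤⁿ/ℤ → ℤ[X] → F → 0 together with F → ℤ[Y] → F composing to N.

record Setting (n : ℕ) : Set where
  field
    X Y : GSet n
    F : Rep n
    F-flasque : IsFlasque F
  open GSet X public using () renaming (size to sizeX; _⋆_ to infixr 8 _⋆ˣ_)
  open GSet Y public using () renaming (size to sizeY; _⋆_ to infixr 8 _⋆ʸ_)
  field
    ι : ZMat sizeX n
    π : ZMat (rank F) sizeX
    S : ZMat sizeY (rank F)
    R : ZMat (rank F) sizeY
    N : ℕ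
    ι-equiv : ∀ σ u x → (ι ·ᶻ (u ◁ σ)) x ≡ (ι ·ᶻ u) ((σ ⁻¹) ⋆ˣ x)
    ι-const : ∀ u → (∀ i j → u i ≡ u j) → (ι ·ᶻ u) ≐ zeroV
    ι-inj   : ∀ u → (ι ·ᶻ u) ≐ zeroV → ∀ i j → u i ≡ u j
    π-equiv : ∀ σ z → (π ·ᶻ (λ x → z ((σ ⁻¹) ⋆ˣ x))) ≐ (act F σ ·ᶻ (π ·ᶻ z))
    π-surj  : ∀ w → ∃ λ z → (π ·ᶻ z) ≐ w
    exact   : ∀ z → (π ·ᶻ z) ≐ zeroV → ∃ λ u → (ι ·ᶻ u) ≐ z
    comp0   : ∀ u → (π ·ᶻ (ι ·ᶻ u)) ≐ zeroV
    S-equiv : ∀ σ w y → (S ·ᶻ (act F σ ·ᶻ w)) y ≡ (S ·ᶻ w) ((σ ⁻¹) ⋆ʸ y)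
    R-equiv : ∀ σ f → (R ·ᶻ (λ y → f ((σ ⁻¹) ⋆ʸ y))) ≐ (act F σ ·ᶻ (R ·ᶻ f))
    RS      : ∀ w → (R ·ᶻ (S ·ᶻ w)) ≐ (+ N ⊡ w)

-- Everything is rewritten in permuted bases of P and Q, with ℤⁿ in place of J. Both permutation
-- lattices then consist of functions on finite sets, and the kernel of ι consists of the constants.
module Bases {m p : ℕ} {Q : Rep (suc m)} (res : FlasqueResolution (J (suc m))) (BP : Basis (FlasqueResolution.P res)) (BQ : Basis Q)
             (ret : Retract p (FlasqueResolution.F res) Q) where

  open FlasqueResolution res
  open Retract ret
  module BP = Basis BP
  module BQ = Basis BQ
  ι̂ : ZMat (GSet.size BP.set) (suc m)
  ι̂ = mat BP.coords ⊗ᶻ (mat ι ⊗ᶻ diff m)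
  π̂ : ZMat (rank F) (GSet.size BP.set)
  π̂ = mat π ⊗ᶻ mat BP.vectors
  Ŝ : ZMat (GSet.size BQ.set) (rank F)
  Ŝ = mat BQ.coords ⊗ᶻ mat into
  R̂ : ZMat (rank F) (GSet.size BQ.set)
  R̂ = mat back ⊗ᶻ mat BQ.vectors
  ι̂-· : ∀ u → (ι̂ ·ᶻ u) ≐ (mat BP.coords ·ᶻ (mat ι ·ᶻ (diff m ·ᶻ u)))
  ι̂-· u i = trans (⊗-· (mat BP.coords) (mat ι ⊗ᶻ diff m) u i) (·-cong (mat BP.coords) (⊗-· (mat ι) (diff m) u) i)
  ι̂-zero⇒const : ∀ u → (ι̂ ·ᶻ u) ≐ zeroV → ∀ i → u i ≡ u (fromℕ m)
  ι̂-zero⇒const u e = diff-zero⇒const u (ι-inj (diff m ·ᶻ u) (λ x → trans (sym (BP.vectors-coords _ x))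
    (trans (·-cong (mat BP.vectors) (λ x' → trans (sym (ι̂-· u x')) (e x')) x) (·-zero (mat BP.vectors) x))))
  lift : ∀ z → (π̂ ·ᶻ z) ≐ zeroV → ∃ λ y → (mat ι ·ᶻ y) ≐ (mat BP.vectors ·ᶻ z)
  lift z e = exact (mat BP.vectors ·ᶻ z) (λ i → trans (sym (⊗-· (mat π) (mat BP.vectors) z i)) (e i))

  ι-equiv^ : ∀ σ u x → (ι̂ ·ᶻ (u ◁ σ)) x ≡ (ι̂ ·ᶻ u) (GSet._⋆_ BP.set (σ ⁻¹) x)
  ι-equiv^ = λ σ u x → begin
      (ι̂ ·ᶻ (u ◁ σ)) x                                               ≡⟨ ι̂-· (u ◁ σ) x ⟩
      (mat BP.coords ·ᶻ (mat ι ·ᶻ (diff m ·ᶻ (u ◁ σ)))) x             ≡⟨ ·-cong (mat BP.coords) (·-cong (mat ι) (λ i → sym (J-act σ u i))) x ⟩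
      (mat BP.coords ·ᶻ (mat ι ·ᶻ (act (J (suc m)) σ ·ᶻ (diff m ·ᶻ u)))) x ≡⟨ ·-cong (mat BP.coords) (gmap-· ι σ (diff m ·ᶻ u)) x ⟩
      (mat BP.coords ·ᶻ (act P σ ·ᶻ (mat ι ·ᶻ (diff m ·ᶻ u)))) x      ≡⟨ gmap-· BP.coords σ (mat ι ·ᶻ (diff m ·ᶻ u)) x ⟩
      (act (GSet.lattice BP.set) σ ·ᶻ (mat BP.coords ·ᶻ (mat ι ·ᶻ (diff m ·ᶻ u)))) x ≡⟨ GSet.act-lattice BP.set σ (mat BP.coords ·ᶻ (mat ι ·ᶻ (diff m ·ᶻ u))) x ⟩
      (mat BP.coords ·ᶻ (mat ι ·ᶻ (diff m ·ᶻ u))) (GSet._⋆_ BP.set (σ ⁻¹) x) ≡⟨ sym (ι̂-· u _) ⟩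
      (ι̂ ·ᶻ u) (GSet._⋆_ BP.set (σ ⁻¹) x) ∎

  ι-const^ : ∀ u → (∀ i j → u i ≡ u j) → (ι̂ ·ᶻ u) ≐ zeroV
  ι-const^ = λ u c x → trans (ι̂-· u x) (trans (·-cong (mat BP.coords) (·-cong (mat ι)
      (λ i → trans (diff-· u i) (ℤₚ.i≡j⇒i-j≡0 (c (inject₁ i) (fromℕ m))))) x)
      (trans (·-cong (mat BP.coords) (·-zero (mat ι)) x) (·-zero (mat BP.coords) x)))

  ι-inj^ : ∀ u → (ι̂ ·ᶻ u) ≐ zeroV → ∀ i j → u i ≡ u j
  ι-inj^ = λ u e i j → trans (ι̂-zero⇒const u e i) (sym (ι̂-zero⇒const u e j))

  π-equiv^ : ∀ σ z → (π̂ ·ᶻ (λ x → z (GSet._⋆_ BP.set (σ ⁻¹) x))) ≐ (act F σ ·ᶻ (π̂ ·ᶻ z))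
  π-equiv^ = λ σ z i → begin
      (π̂ ·ᶻ (λ x → z (GSet._⋆_ BP.set (σ ⁻¹) x))) i      ≡⟨ ·-cong π̂ (λ x → sym (GSet.act-lattice BP.set σ z x)) i ⟩
      (π̂ ·ᶻ (act (GSet.lattice BP.set) σ ·ᶻ z)) i        ≡⟨ ⊗-· (mat π) (mat BP.vectors) _ i ⟩
      (mat π ·ᶻ (mat BP.vectors ·ᶻ (act (GSet.lattice BP.set) σ ·ᶻ z))) i ≡⟨ ·-cong (mat π) (gmap-· BP.vectors σ z) i ⟩
      (mat π ·ᶻ (act P σ ·ᶻ (mat BP.vectors ·ᶻ z))) i    ≡⟨ gmap-· π σ (mat BP.vectors ·ᶻ z) i ⟩
      (act F σ ·ᶻ (mat π ·ᶻ (mat BP.vectors ·ᶻ z))) i    ≡⟨ ·-cong (act F σ) (λ j → sym (⊗-· (mat π) (mat BP.vectors) z j)) i ⟩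
      (act F σ ·ᶻ (π̂ ·ᶻ z)) i ∎

  π-surj^ : ∀ w → ∃ λ z → (π̂ ·ᶻ z) ≐ w
  π-surj^ = λ w → mat BP.coords ·ᶻ proj₁ (π-surj w) , λ i →
      trans (⊗-· (mat π) (mat BP.vectors) _ i) (trans (·-cong (mat π) (BP.vectors-coords (proj₁ (π-surj w))) i) (proj₂ (π-surj w) i))

  exact^ : ∀ z → (π̂ ·ᶻ z) ≐ zeroV → ∃ λ u → (ι̂ ·ᶻ u) ≐ z
  exact^ = λ z e → ext (proj₁ (lift z e)) , λ x → trans (ι̂-· (ext (proj₁ (lift z e))) x) (trans
      (·-cong (mat BP.coords) (λ j → trans (·-cong (mat ι) (diff-ext (proj₁ (lift z e))) j) (proj₂ (lift z e) j)) x) (BP.coords-vectors z x))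

  comp0^ : ∀ u → (π̂ ·ᶻ (ι̂ ·ᶻ u)) ≐ zeroV
  comp0^ = λ u i → trans (⊗-· (mat π) (mat BP.vectors) _ i) (trans (·-cong (mat π) (λ j → trans (·-cong (mat BP.vectors) (ι̂-· u) j)
      (BP.vectors-coords _ j)) i) (comp0 (diff m ·ᶻ u) i))

  S-equiv^ : ∀ σ w y → (Ŝ ·ᶻ (act F σ ·ᶻ w)) y ≡ (Ŝ ·ᶻ w) (GSet._⋆_ BQ.set (σ ⁻¹) y)
  S-equiv^ = λ σ w y → begin
      (Ŝ ·ᶻ (act F σ ·ᶻ w)) y                             ≡⟨ ⊗-· (mat BQ.coords) (mat into) _ y ⟩
      (mat BQ.coords ·ᶻ (mat into ·ᶻ (act F σ ·ᶻ w))) y   ≡⟨ ·-cong (mat BQ.coords) (gmap-· into σ w) y ⟩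
      (mat BQ.coords ·ᶻ (act Q σ ·ᶻ (mat into ·ᶻ w))) y   ≡⟨ gmap-· BQ.coords σ (mat into ·ᶻ w) y ⟩
      (act (GSet.lattice BQ.set) σ ·ᶻ (mat BQ.coords ·ᶻ (mat into ·ᶻ w))) y ≡⟨ GSet.act-lattice BQ.set σ (mat BQ.coords ·ᶻ (mat into ·ᶻ w)) y ⟩
      (mat BQ.coords ·ᶻ (mat into ·ᶻ w)) (GSet._⋆_ BQ.set (σ ⁻¹) y) ≡⟨ sym (⊗-· (mat BQ.coords) (mat into) w _) ⟩
      (Ŝ ·ᶻ w) (GSet._⋆_ BQ.set (σ ⁻¹) y) ∎

  R-equiv^ : ∀ σ f → (R̂ ·ᶻ (λ y → f (GSet._⋆_ BQ.set (σ ⁻¹) y))) ≐ (act F σ ·ᶻ (R̂ ·ᶻ f))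
  R-equiv^ = λ σ z i → begin
      (R̂ ·ᶻ (λ x → z (GSet._⋆_ BQ.set (σ ⁻¹) x))) i      ≡⟨ ·-cong R̂ (λ x → sym (GSet.act-lattice BQ.set σ z x)) i ⟩
      (R̂ ·ᶻ (act (GSet.lattice BQ.set) σ ·ᶻ z)) i        ≡⟨ ⊗-· (mat back) (mat BQ.vectors) _ i ⟩
      (mat back ·ᶻ (mat BQ.vectors ·ᶻ (act (GSet.lattice BQ.set) σ ·ᶻ z))) i ≡⟨ ·-cong (mat back) (gmap-· BQ.vectors σ z) i ⟩
      (mat back ·ᶻ (act Q σ ·ᶻ (mat BQ.vectors ·ᶻ z))) i ≡⟨ gmap-· back σ (mat BQ.vectors ·ᶻ z) i ⟩
      (act F σ ·ᶻ (mat back ·ᶻ (mat BQ.vectors ·ᶻ z))) i ≡⟨ ·-cong (act F σ) (λ j → sym (⊗-· (mat back) (mat BQ.vectors) z j)) i ⟩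
      (act F σ ·ᶻ (R̂ ·ᶻ z)) i ∎

  RS^ : ∀ w → (R̂ ·ᶻ (Ŝ ·ᶻ w)) ≐ (+ index ⊡ w)
  RS^ = λ w i → begin
      (R̂ ·ᶻ (Ŝ ·ᶻ w)) i                                   ≡⟨ ⊗-· (mat back) (mat BQ.vectors) _ i ⟩
      (mat back ·ᶻ (mat BQ.vectors ·ᶻ (Ŝ ·ᶻ w))) i        ≡⟨ ·-cong (mat back) (λ j → trans (·-cong (mat BQ.vectors) (⊗-· (mat BQ.coords) (mat into) w) j) (BQ.vectors-coords _ j)) i ⟩
      (mat back ·ᶻ (mat into ·ᶻ w)) i                     ≡⟨ sym (⊗-· (mat back) (mat into) w i) ⟩
      ((mat back ⊗ᶻ mat into) ·ᶻ w) i                     ≡⟨ ∑-cong (λ j → trans (cong (_* w j) (back-into i j)) (ℤₚ.*-assoc (+ index) (Iᶻ i j) (w j))) ⟩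
      ∑ (λ j → + index * (Iᶻ i j * w j))                  ≡⟨ ∑-*ˡ (+ index) (λ j → Iᶻ i j * w j) ⟩
      + index * (Iᶻ ·ᶻ w) i                               ≡⟨ cong (+ index *_) (I-· w i) ⟩
      + index * w i ∎

  setting : Setting (suc m)
  setting = record
    { X = BP.set ; Y = BQ.set ; F = F ; F-flasque = F-flasque
    ; ι = ι̂ ; π = π̂ ; S = Ŝ ; R = R̂ ; N = index
    ; ι-equiv = ι-equiv^
    ; ι-const = ι-const^
    ; ι-inj = ι-inj^
    ; π-equiv = π-equiv^
    ; π-surj = π-surj^
    ; exact = exact^
    ; comp0 = comp0^
    ; S-equiv = S-equiv^
    ; R-equiv = R-equiv^
    ; RS = RS^
    }

retractSetting : ∀ {m p} (res : FlasqueResolution (J (suc m))) → (∃ λ Q → IsPermutationLattice Q × Retract p (FlasqueResolution.F res) Q) →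
                 Σ (Setting (suc m)) λ s → ¬ p ∣ Setting.N s
retractSetting res (Q , Qperm , ret) =
  Bases.setting res (permutationBasis (FlasqueResolution.P-perm res)) (permutationBasis Qperm) ret , Retract.p∤index ret

mkSetting : ∀ {m p} → Prime p → FlasqueClassPInvertible p (J (suc m)) → Σ (Setting (suc m)) λ s → ¬ p ∣ Setting.N s
mkSetting pp (res , inv) = retractSetting res (pInvertible⇒retract pp inv)

-- Sums of periodic sequences

∑-suc-toℕ : ∀ p (g : ℕ → ℤ) → g p ≡ g 0 → ∑ {p} (λ t → g (suc (toℕ t))) ≡ ∑ {p} (λ t → g (toℕ t))
∑-suc-toℕ zero g e = refl
∑-suc-toℕ (suc p) g e = begin
  ∑ {suc p} (λ t → g (suc (toℕ t)))
    ≡⟨ ∑-last {p} (λ t → g (suc (toℕ t))) ⟩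
  ∑ {p} (λ t → g (suc (toℕ (inject₁ t)))) + g (suc (toℕ (fromℕ p)))
    ≡⟨ cong₂ _+_ (∑-cong {p} (λ t → cong (λ x → g (suc x)) (toℕ-inject₁ t))) (trans (cong (λ x → g (suc x)) (toℕ-fromℕ p)) e) ⟩
  ∑ {p} (λ t → g (suc (toℕ t))) + g 0
    ≡⟨ ℤₚ.+-comm _ (g 0) ⟩
  ∑ {suc p} (λ t → g (toℕ t)) ∎

∑-shift-toℕ : ∀ p (g : ℕ → ℤ) → (∀ x → g (x ℕ.+ p) ≡ g x) → ∀ c → ∑ {p} (λ t → g (c ℕ.+ toℕ t)) ≡ ∑ {p} (λ t → g (toℕ t))
∑-shift-toℕ p g per zero = refl
∑-shift-toℕ p g per (suc c) = trans (∑-cong {p} (λ t → cong g (sym (ℕₚ.+-suc c (toℕ t)))))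
  (trans (∑-suc-toℕ p (λ x → g (c ℕ.+ x)) (trans (per c) (cong g (sym (ℕₚ.+-identityʳ c))))) (∑-shift-toℕ p g per c))

-- Bézout's identity over ℕ comes with either sign. The unwanted sign is turned by the factor p - 1,
-- which is -1 modulo p.
mod-inverse : ∀ {p} → Prime p → ∀ {t} → t ≢ 0 → t ℕ.< p → ∃₂ λ t' u → t' ℕ.* t ≡ 1 ℕ.+ u ℕ.* p
mod-inverse {p} pp {zero} t≢0 t<p = ⊥-elim (t≢0 refl)
mod-inverse {p} pp {suc t} t≢0 t<p with coprime-Bézout (prime⇒coprime pp t<p)
... | Bézout.-+ x y eq = y , x , sym eq
... | Bézout.+- x y eq = (p ℕ.∸ 1) ℕ.* y , (p ℕ.∸ 1) ℕ.* x ℕ.∸ 1 , go (p ℕ.∸ 1) (ℕₚ.m∸n≢0⇒n<m λ z → 1<p z) x y eq p≡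
  where
  p≡ : p ≡ suc (p ℕ.∸ 1)
  p≡ = sym (ℕₚ.suc-pred p {{prime⇒nonZero pp}})
  1<p : p ℕ.∸ 1 ℕ.∸ 0 ≢ 0
  1<p z with trans p≡ (cong suc z)
  ... | refl = ⊥-elim (ℕₚ.<⇒≱ (ℕ.s≤s (ℕ.s≤s ℕ.z≤n)) t<p)
  -- y t = x p - 1, so (p-1) y t = 1 + ((p-1) x - 1) p when p - 1 and x are positive.
  go : ∀ q → 0 ℕ.< q → ∀ x y → 1 ℕ.+ y ℕ.* suc t ≡ x ℕ.* p → p ≡ suc q → q ℕ.* y ℕ.* suc t ≡ 1 ℕ.+ (q ℕ.* x ℕ.∸ 1) ℕ.* p
  go q _ zero y () _
  go (suc q) _ (suc x) y eq refl = ℕₚ.+-cancelˡ-≡ (suc q) _ _ (begin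
    suc q ℕ.+ suc q ℕ.* y ℕ.* suc t        ≡⟨ solve 3 (λ q y t → q :+ q :* y :* t := q :* (con 1 :+ y :* t)) refl (suc q) y (suc t) ⟩
    suc q ℕ.* (1 ℕ.+ y ℕ.* suc t)          ≡⟨ cong (suc q ℕ.*_) eq ⟩
    suc q ℕ.* (suc x ℕ.* suc (suc q))      ≡⟨ solve 2 (λ q x → (con 1 :+ q) :* ((con 1 :+ x) :* (con 2 :+ q)) :=
                                                 (con 1 :+ q) :+ (con 1 :+ ((x :+ q :* (con 1 :+ x)) :* (con 2 :+ q)))) refl q x ⟩
    suc q ℕ.+ (1 ℕ.+ (x ℕ.+ q ℕ.* suc x) ℕ.* suc (suc q)) ∎)
    where open ℕSolver.+-*-Solver

-- Elementary abelian groups of rank two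

-- `h k l` is a^k b^l with arbitrary natural exponents, so that products and powers are literal sums
-- and multiples; faithfulness is stated for reduced exponents.
record Bicyclic (p n : ℕ) : Set where
  field
    h : ℕ → ℕ → Sym n
    h-∙ : ∀ k l k' l' → (h k l ∙ h k' l') ≈ₚ h (k ℕ.+ k') (l ℕ.+ l')
    h-0 : h 0 0 ≈ₚ idₚ
    h-p0 : h p 0 ≈ₚ idₚ
    h-0p : h 0 p ≈ₚ idₚ
    faithful : ∀ {k l k' l'} → k ℕ.< p → l ℕ.< p → k' ℕ.< p → l' ℕ.< p → h k l ≈ₚ h k' l' → k ≡ k' × l ≡ l'

module BicyclicGroup {p n : ℕ} {{_ : ℕ.NonZero p}} (B : Bicyclic p n) where

  open Bicyclic B

  h-+p0 : ∀ k l → h (k ℕ.+ p) l ≈ₚ h k l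
  h-+p0 k l i = trans (cong (λ x → h (k ℕ.+ p) x ⟨$⟩ʳ i) (sym (ℕₚ.+-identityʳ l))) (trans (sym (h-∙ k l p 0 i)) (cong (h k l ⟨$⟩ʳ_) (h-p0 i)))

  h-+0p : ∀ k l → h k (l ℕ.+ p) ≈ₚ h k l
  h-+0p k l i = trans (cong (λ x → h x (l ℕ.+ p) ⟨$⟩ʳ i) (sym (ℕₚ.+-identityʳ k))) (trans (sym (h-∙ k l 0 p i)) (cong (h k l ⟨$⟩ʳ_) (h-0p i)))

  h-+* : ∀ k l u u' → h (k ℕ.+ u ℕ.* p) (l ℕ.+ u' ℕ.* p) ≈ₚ h k l
  h-+* k l zero zero i = cong₂ (λ x y → h x y ⟨$⟩ʳ i) (ℕₚ.+-identityʳ k) (ℕₚ.+-identityʳ l)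
  h-+* k l zero (suc u') i = trans (cong (λ y → h (k ℕ.+ 0) y ⟨$⟩ʳ i) (trans (cong (l ℕ.+_) (ℕₚ.+-comm p _)) (sym (ℕₚ.+-assoc l _ p))))
    (trans (h-+0p (k ℕ.+ 0) (l ℕ.+ u' ℕ.* p) i) (h-+* k l zero u' i))
  h-+* k l (suc u) u' i = trans (cong (λ x → h x (l ℕ.+ u' ℕ.* p) ⟨$⟩ʳ i) (trans (cong (k ℕ.+_) (ℕₚ.+-comm p _)) (sym (ℕₚ.+-assoc k _ p))))
    (trans (h-+p0 (k ℕ.+ u ℕ.* p) (l ℕ.+ u' ℕ.* p) i) (h-+* k l u u' i))

  h-% : ∀ k l → h (k ℕ.% p) (l ℕ.% p) ≈ₚ h k l
  h-% k l i = trans (sym (h-+* (k ℕ.% p) (l ℕ.% p) (k ℕ./ p) (l ℕ./ p) i))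
    (cong₂ (λ x y → h x y ⟨$⟩ʳ i) (sym (ℕ.m≡m%n+[m/n]*n k p)) (sym (ℕ.m≡m%n+[m/n]*n l p)))

  -- The exponent of a is the low digit: for p = 2 the elements are listed as 1, a, b, ab.
  elem : Fin (p ℕ.* p) → Sym n
  elem x = h (toℕ (proj₂ (remQuot {p} p x))) (toℕ (proj₁ (remQuot {p} p x)))

  index : ℕ → ℕ → Fin (p ℕ.* p)
  index k l = combine (fromℕ< (ℕ.m%n<n l p)) (fromℕ< (ℕ.m%n<n k p))

  elem-combine : ∀ l k → elem (combine l k) ≡ h (toℕ k) (toℕ l)
  elem-combine l k = cong (λ r → h (toℕ (proj₂ r)) (toℕ (proj₁ r))) (remQuot-combine {p} {p} l k)

  elem-index : ∀ k l → elem (index k l) ≈ₚ h k l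
  elem-index k l i = trans (cong (_⟨$⟩ʳ i) (elem-combine (fromℕ< (ℕ.m%n<n l p)) (fromℕ< (ℕ.m%n<n k p))))
    (trans (cong₂ (λ x y → h x y ⟨$⟩ʳ i) (toℕ-fromℕ< (ℕ.m%n<n k p)) (toℕ-fromℕ< (ℕ.m%n<n l p))) (h-% k l i))

  isSubgroup : IsSubgroup elem
  isSubgroup = record
    { has-id = index 0 0 , λ i → trans (elem-index 0 0 i) (h-0 i)
    ; closed = λ a b → _ , λ i → trans (elem-index (kx a ℕ.+ kx b) (lx a ℕ.+ lx b) i) (sym (h-∙ (kx a) (lx a) (kx b) (lx b) i))
    ; no-dups = λ a b e → let (q , r) = faithful (toℕ<n (proj₂ (rq a))) (toℕ<n (proj₁ (rq a))) (toℕ<n (proj₂ (rq b))) (toℕ<n (proj₁ (rq b))) e in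
        trans (sym (combine-remQuot {p} p a)) (trans (cong₂ combine (toℕ-injective r) (toℕ-injective q)) (combine-remQuot {p} p b))
    }
    where
    rq : Fin (p ℕ.* p) → Fin p × Fin p
    rq = remQuot {p} p
    kx lx : Fin (p ℕ.* p) → ℕ
    kx a = toℕ (proj₂ (rq a))
    lx a = toℕ (proj₁ (rq a))

  ∑-elem : (f : Sym n → ℤ) → ∑ (λ x → f (elem x)) ≡ ∑ {p} (λ l → ∑ {p} (λ k → f (h (toℕ k) (toℕ l))))
  ∑-elem f = trans (∑-combine p (λ x → f (elem x))) (∑-cong {p} (λ l → ∑-cong {p} (λ k → cong f (elem-combine l k))))

  -- T k l is the action of a^k b^l on M; Nm i j is the norm from ⟨a^i b^j⟩, and NH the norm from the whole group.
  module Norms (M : Rep n) (L : IsGLattice M) where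

    open IsGLattice L

    T : ℕ → ℕ → ZVec (rank M) → ZVec (rank M)
    T k l v = act M (h k l) ·ᶻ v

    T-cong : ∀ {k l v w} → v ≐ w → T k l v ≐ T k l w
    T-cong {k} {l} = ·-cong (act M (h k l))

    T-≈ : ∀ {k l k' l'} → h k l ≈ₚ h k' l' → ∀ v → T k l v ≐ T k' l' v
    T-≈ e v = ≋-· (act-cong e) v

    T-∙ : ∀ k l k' l' v → T k l (T k' l' v) ≐ T (k ℕ.+ k') (l ℕ.+ l') v
    T-∙ k l k' l' v i = trans (sym (act-∙-· L (h k l) (h k' l') v i)) (≋-· (act-cong (h-∙ k l k' l')) v i)

    T-0 : ∀ v → T 0 0 v ≐ v
    T-0 v i = trans (≋-· (act-cong h-0) v i) (trans (≋-· act-id v i) (I-· v i))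

    T-comm : ∀ k l k' l' v → T k l (T k' l' v) ≐ T k' l' (T k l v)
    T-comm k l k' l' v i = trans (T-∙ k l k' l' v i) (trans (cong₂ (λ x y → T x y v i) (ℕₚ.+-comm k k') (ℕₚ.+-comm l l')) (sym (T-∙ k' l' k l v i)))

    Nm : ℕ → ℕ → ZVec (rank M) → ZVec (rank M)
    Nm i j v = vsum {p} (λ t → T (toℕ t ℕ.* i) (toℕ t ℕ.* j) v)

    NH : ZVec (rank M) → ZVec (rank M)
    NH v = vsum {p} (λ l → vsum {p} (λ k → T (toℕ k) (toℕ l) v))

    Nm-cong : ∀ i j {v w} → v ≐ w → Nm i j v ≐ Nm i j w
    Nm-cong i j e x = ∑-cong {p} (λ t → T-cong e x)

    NH-cong : ∀ {v w} → v ≐ w → NH v ≐ NH w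
    NH-cong e x = ∑-cong {p} (λ l → ∑-cong {p} (λ k → T-cong e x))

    NH≡∑elem : ∀ v x → ∑ (λ y → (act M (elem y) ·ᶻ v) x) ≡ NH v x
    NH≡∑elem v x = ∑-elem (λ σ → (act M σ ·ᶻ v) x)

    private
      periodic : ∀ v x i j t → T ((t ℕ.+ p) ℕ.* i) ((t ℕ.+ p) ℕ.* j) v x ≡ T (t ℕ.* i) (t ℕ.* j) v x
      periodic v x i j t = trans (cong₂ (λ a b → T a b v x) (re i) (re j)) (T-≈ (h-+* (t ℕ.* i) (t ℕ.* j) i j) v x)
        where
        re : ∀ i → (t ℕ.+ p) ℕ.* i ≡ t ℕ.* i ℕ.+ i ℕ.* p
        re i = trans (ℕₚ.*-distribʳ-+ i t p) (cong (t ℕ.* i ℕ.+_) (ℕₚ.*-comm p i))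

    T-Nm : ∀ i j v → T i j (Nm i j v) ≐ Nm i j v
    T-Nm i j v x = begin
      T i j (Nm i j v) x                                                     ≡⟨ ·-vsum (act M (h i j)) {p} (λ t → T (toℕ t ℕ.* i) (toℕ t ℕ.* j) v) x ⟩
      ∑ {p} (λ t → T i j (T (toℕ t ℕ.* i) (toℕ t ℕ.* j) v) x)                ≡⟨ ∑-cong {p} (λ t → T-∙ i j (toℕ t ℕ.* i) (toℕ t ℕ.* j) v x) ⟩
      ∑ {p} (λ t → T (suc (toℕ t) ℕ.* i) (suc (toℕ t) ℕ.* j) v x)            ≡⟨ ∑-suc-toℕ p (λ t → T (t ℕ.* i) (t ℕ.* j) v x) (periodic v x i j 0) ⟩
      Nm i j v x ∎

    Nm-T : ∀ i j k l v → Nm i j (T k l v) ≐ T k l (Nm i j v)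
    Nm-T i j k l v x = trans (∑-cong {p} (λ t → T-comm (toℕ t ℕ.* i) (toℕ t ℕ.* j) k l v x))
      (sym (·-vsum (act M (h k l)) {p} (λ t → T (toℕ t ℕ.* i) (toℕ t ℕ.* j) v) x))

    Nm-invariant : ∀ i j v → T i j v ≐ v → Nm i j v ≐ (+ p ⊡ v)
    Nm-invariant i j v e x = trans (∑-cong {p} (λ t → fixed (toℕ t) x)) (∑-const p (v x))
      where
      fixed : ∀ t → T (t ℕ.* i) (t ℕ.* j) v ≐ v
      fixed zero = T-0 v
      fixed (suc t) y = trans (sym (T-∙ i j (t ℕ.* i) (t ℕ.* j) v y)) (trans (T-cong (fixed t) y) (e y))

    -- (1 - d) Σ t dᵗ = N_d - p
    wNm : ℕ → ℕ → ZVec (rank M) → ZVec (rank M)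
    wNm i j v x = ∑ {p} (λ t → + toℕ t * T (toℕ t ℕ.* i) (toℕ t ℕ.* j) v x)

    T-wNm : ∀ i j v x → T i j (wNm i j v) x ≡ wNm i j v x - Nm i j v x + + p * v x
    T-wNm i j v x = begin
      T i j (wNm i j v) x
        ≡⟨ ·-vsum (act M (h i j)) {p} (λ t → + toℕ t ⊡ T (toℕ t ℕ.* i) (toℕ t ℕ.* j) v) x ⟩
      ∑ {p} (λ t → T i j (+ toℕ t ⊡ T (toℕ t ℕ.* i) (toℕ t ℕ.* j) v) x)
        ≡⟨ ∑-cong {p} (λ t → trans (·-⊡ (act M (h i j)) (+ toℕ t) (T (toℕ t ℕ.* i) (toℕ t ℕ.* j) v) x)
             (cong (+ toℕ t *_) (T-∙ i j (toℕ t ℕ.* i) (toℕ t ℕ.* j) v x))) ⟩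
      ∑ {p} (λ t → + toℕ t * g (suc (toℕ t)))
        ≡⟨ ∑-cong {p} (λ t → lem (+ toℕ t) (g (suc (toℕ t)))) ⟩
      ∑ {p} (λ t → (+ 1 + + toℕ t) * g (suc (toℕ t)) - g (suc (toℕ t)))
        ≡⟨ ∑-- {p} (λ t → + suc (toℕ t) * g (suc (toℕ t))) (λ t → g (suc (toℕ t))) ⟩
      ∑ {p} (λ t → + suc (toℕ t) * g (suc (toℕ t))) - ∑ {p} (λ t → g (suc (toℕ t)))
        ≡⟨ cong₂ _-_ (weighted p) (∑-suc-toℕ p g (periodic v x i j 0)) ⟩
      (wNm i j v x + + p * g p) - Nm i j v x
        ≡⟨ cong (λ y → (wNm i j v x + + p * y) - Nm i j v x) (trans (periodic v x i j 0) (T-0 v x)) ⟩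
      (wNm i j v x + + p * v x) - Nm i j v x
        ≡⟨ lem' (wNm i j v x) (+ p * v x) (Nm i j v x) ⟩
      wNm i j v x - Nm i j v x + + p * v x ∎
      where
      g : ℕ → ℤ
      g t = T (t ℕ.* i) (t ℕ.* j) v x
      lem : ∀ a b → a * b ≡ (+ 1 + a) * b - b
      lem = solve-∀
      lem' : ∀ a b c → (a + b) - c ≡ a - c + b
      lem' = solve-∀
      weighted : ∀ r → ∑ {r} (λ t → + suc (toℕ t) * g (suc (toℕ t))) ≡ ∑ {r} (λ t → + toℕ t * g (toℕ t)) + + r * g r
      weighted r = begin
        ∑ {r} (λ t → G (suc (toℕ t)))                     ≡⟨ sym (ℤₚ.+-identityˡ _) ⟩
        + 0 + ∑ {r} (λ t → G (suc (toℕ t)))               ≡⟨ cong (_+ ∑ {r} (λ t → G (suc (toℕ t)))) (sym (ℤₚ.*-zeroˡ (g 0))) ⟩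
        ∑ {suc r} (λ t → G (toℕ t))                       ≡⟨ ∑-last {r} (λ t → G (toℕ t)) ⟩
        ∑ {r} (λ t → G (toℕ (inject₁ t))) + G (toℕ (fromℕ r)) ≡⟨ cong₂ _+_ (∑-cong {r} (λ t → cong G (toℕ-inject₁ t))) (cong G (toℕ-fromℕ r)) ⟩
        ∑ {r} (λ t → G (toℕ t)) + G r ∎
        where
        G : ℕ → ℤ
        G t = + t * g t

    -- The norm absorbs every power of the generator, so only the weights add up. Their sum p (p -
    -- 1) / 2 is a multiple of p exactly when p is odd.
    Nm-wNm : ∀ i j v x → Nm i j (wNm i j v) x ≡ ∑ {p} (λ t → + toℕ t) * Nm i j v x
    Nm-wNm i j v x = begin
      ∑ {p} (λ s → T (toℕ s ℕ.* i) (toℕ s ℕ.* j) (wNm i j v) x)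
        ≡⟨ ∑-cong {p} (λ s → ·-vsum (act M (h (toℕ s ℕ.* i) (toℕ s ℕ.* j))) {p} (λ t → + toℕ t ⊡ T (toℕ t ℕ.* i) (toℕ t ℕ.* j) v) x) ⟩
      ∑ {p} (λ s → ∑ {p} (λ t → T (toℕ s ℕ.* i) (toℕ s ℕ.* j) (+ toℕ t ⊡ T (toℕ t ℕ.* i) (toℕ t ℕ.* j) v) x))
        ≡⟨ ∑-cong {p} (λ s → ∑-cong {p} (λ t → ·-⊡ (act M (h (toℕ s ℕ.* i) (toℕ s ℕ.* j))) (+ toℕ t) (T (toℕ t ℕ.* i) (toℕ t ℕ.* j) v) x)) ⟩
      ∑ {p} (λ s → ∑ {p} (λ t → + toℕ t * T (toℕ s ℕ.* i) (toℕ s ℕ.* j) (T (toℕ t ℕ.* i) (toℕ t ℕ.* j) v) x))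
        ≡⟨ ∑-swap {p} {p} (λ s t → + toℕ t * T (toℕ s ℕ.* i) (toℕ s ℕ.* j) (T (toℕ t ℕ.* i) (toℕ t ℕ.* j) v) x) ⟩
      ∑ {p} (λ t → ∑ {p} (λ s → + toℕ t * T (toℕ s ℕ.* i) (toℕ s ℕ.* j) (T (toℕ t ℕ.* i) (toℕ t ℕ.* j) v) x))
        ≡⟨ ∑-cong {p} (λ t → trans (∑-*ˡ {p} (+ toℕ t) (λ s → T (toℕ s ℕ.* i) (toℕ s ℕ.* j) (T (toℕ t ℕ.* i) (toℕ t ℕ.* j) v) x))
             (cong (+ toℕ t *_) (trans (Nm-T i j (toℕ t ℕ.* i) (toℕ t ℕ.* j) v x) (fixed (toℕ t))))) ⟩
      ∑ {p} (λ t → + toℕ t * Nm i j v x)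
        ≡⟨ ∑-*ʳ {p} (Nm i j v x) (λ t → + toℕ t) ⟩
      ∑ {p} (λ t → + toℕ t) * Nm i j v x ∎
      where
      fixed : ∀ t → T (t ℕ.* i) (t ℕ.* j) (Nm i j v) x ≡ Nm i j v x
      fixed zero = T-0 (Nm i j v) x
      fixed (suc t) = trans (sym (T-∙ i j (t ℕ.* i) (t ℕ.* j) (Nm i j v) x)) (trans (T-comm i j (t ℕ.* i) (t ℕ.* j) (Nm i j v) x)
        (trans (T-cong {t ℕ.* i} {t ℕ.* j} (T-Nm i j v) x) (fixed t)))

    -- For fixed l the exponent of a may be translated by any amount depending on l. This is why the
    -- powers of a^i b times the powers of a exhaust the group, for every i.
    NH-shift : ∀ (c : ℕ → ℕ) v x → ∑ {p} (λ l → ∑ {p} (λ k → T (c (toℕ l) ℕ.+ toℕ k) (toℕ l) v x)) ≡ NH v x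
    NH-shift c v x = ∑-cong {p} (λ l → ∑-shift-toℕ p (λ k → T k (toℕ l) v x) (λ k → T-≈ (h-+p0 k (toℕ l)) v x) (c (toℕ l)))

    Nm-Nm : ∀ i v → Nm i 1 (Nm 1 0 v) ≐ NH v
    Nm-Nm i v x = begin
      ∑ {p} (λ t → T (toℕ t ℕ.* i) (toℕ t ℕ.* 1) (Nm 1 0 v) x)
        ≡⟨ ∑-cong {p} (λ t → ·-vsum (act M (h (toℕ t ℕ.* i) (toℕ t ℕ.* 1))) {p} (λ s → T (toℕ s ℕ.* 1) (toℕ s ℕ.* 0) v) x) ⟩
      ∑ {p} (λ t → ∑ {p} (λ s → T (toℕ t ℕ.* i) (toℕ t ℕ.* 1) (T (toℕ s ℕ.* 1) (toℕ s ℕ.* 0) v) x))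
        ≡⟨ ∑-cong {p} (λ t → ∑-cong {p} (λ s → trans (T-∙ (toℕ t ℕ.* i) (toℕ t ℕ.* 1) (toℕ s ℕ.* 1) (toℕ s ℕ.* 0) v x)
             (cong₂ (λ a b → T a b v x) (cong (toℕ t ℕ.* i ℕ.+_) (ℕₚ.*-identityʳ (toℕ s)))
               (trans (cong₂ ℕ._+_ (ℕₚ.*-identityʳ (toℕ t)) (ℕₚ.*-zeroʳ (toℕ s))) (ℕₚ.+-identityʳ (toℕ t)))))) ⟩
      ∑ {p} (λ t → ∑ {p} (λ s → T (toℕ t ℕ.* i ℕ.+ toℕ s) (toℕ t) v x))
        ≡⟨ NH-shift (λ t → t ℕ.* i) v x ⟩
      NH v x ∎

    Nm10-Nm01 : ∀ v → Nm 1 0 (Nm 0 1 v) ≐ NH v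
    Nm10-Nm01 v x = trans (∑-cong {p} (λ t → ·-vsum (act M (h (toℕ t ℕ.* 1) (toℕ t ℕ.* 0))) {p} (λ s → T (toℕ s ℕ.* 0) (toℕ s ℕ.* 1) v) x))
      (trans (∑-swap {p} {p} (λ t s → T (toℕ t ℕ.* 1) (toℕ t ℕ.* 0) (T (toℕ s ℕ.* 0) (toℕ s ℕ.* 1) v) x))
      (∑-cong {p} (λ l → ∑-cong {p} (λ k → trans (T-∙ (toℕ k ℕ.* 1) (toℕ k ℕ.* 0) (toℕ l ℕ.* 0) (toℕ l ℕ.* 1) v x)
        (cong₂ (λ a b → T a b v x)
          (trans (cong₂ ℕ._+_ (ℕₚ.*-identityʳ (toℕ k)) (ℕₚ.*-zeroʳ (toℕ l))) (ℕₚ.+-identityʳ (toℕ k)))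
          (trans (cong₂ ℕ._+_ (ℕₚ.*-zeroʳ (toℕ k)) (ℕₚ.*-identityʳ (toℕ l))) refl))))))

    T-NH : ∀ k l v → T k l (NH v) ≐ NH v
    T-NH k l v x = begin
      T k l (NH v) x
        ≡⟨ ·-vsum (act M (h k l)) {p} (λ l' → vsum {p} (λ k' → T (toℕ k') (toℕ l') v)) x ⟩
      ∑ {p} (λ l' → T k l (vsum {p} (λ k' → T (toℕ k') (toℕ l') v)) x)
        ≡⟨ ∑-cong {p} (λ l' → trans (·-vsum (act M (h k l)) {p} (λ k' → T (toℕ k') (toℕ l') v) x)
             (∑-cong {p} (λ k' → T-∙ k l (toℕ k') (toℕ l') v x))) ⟩
      ∑ {p} (λ l' → ∑ {p} (λ k' → T (k ℕ.+ toℕ k') (l ℕ.+ toℕ l') v x))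
        ≡⟨ ∑-cong {p} (λ l' → ∑-shift-toℕ p (λ k' → T k' (l ℕ.+ toℕ l') v x) (λ k' → T-≈ (h-+p0 k' (l ℕ.+ toℕ l')) v x) k) ⟩
      ∑ {p} (λ l' → ∑ {p} (λ k' → T (toℕ k') (l ℕ.+ toℕ l') v x))
        ≡⟨ ∑-shift-toℕ p (λ l' → ∑ {p} (λ k' → T (toℕ k') l' v x)) (λ l' → ∑-cong {p} (λ k' → T-≈ (h-+0p (toℕ k') l') v x)) l ⟩
      NH v x ∎

    NH-T : ∀ k l v → NH (T k l v) ≐ NH v
    NH-T k l v x = trans (∑-cong {p} (λ l' → trans (∑-cong {p} (λ k' → T-comm (toℕ k') (toℕ l') k l v x))
        (sym (·-vsum (act M (h k l)) {p} (λ k' → T (toℕ k') (toℕ l') v) x))))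
      (trans (sym (·-vsum (act M (h k l)) {p} (λ l' → vsum {p} (λ k' → T (toℕ k') (toℕ l') v)) x)) (T-NH k l v x))

    NH-⊞ : ∀ v w → NH (v ⊞ w) ≐ (NH v ⊞ NH w)
    NH-⊞ v w x = trans (∑-cong {p} (λ l → trans (∑-cong {p} (λ k → ·-⊞ (act M (h (toℕ k) (toℕ l))) v w x))
      (∑-+ {p} (λ k → T (toℕ k) (toℕ l) v x) (λ k → T (toℕ k) (toℕ l) w x))))
      (∑-+ {p} (λ l → ∑ {p} (λ k → T (toℕ k) (toℕ l) v x)) (λ l → ∑ {p} (λ k → T (toℕ k) (toℕ l) w x)))

    NH-⊡ : ∀ c v → NH (c ⊡ v) ≐ (c ⊡ NH v)
    NH-⊡ c v x = trans (∑-cong {p} (λ l → trans (∑-cong {p} (λ k → ·-⊡ (act M (h (toℕ k) (toℕ l))) c v x))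
      (∑-*ˡ {p} c (λ k → T (toℕ k) (toℕ l) v x))))
      (∑-*ˡ {p} c (λ l → ∑ {p} (λ k → T (toℕ k) (toℕ l) v x)))

    NH-⊟ : ∀ v w → NH (v ⊟ w) ≐ (NH v ⊟ NH w)
    NH-⊟ v w x = trans (∑-cong {p} (λ l → trans (∑-cong {p} (λ k → ·-⊟ (act M (h (toℕ k) (toℕ l))) v w x))
      (∑-- {p} (λ k → T (toℕ k) (toℕ l) v x) (λ k → T (toℕ k) (toℕ l) w x))))
      (∑-- {p} (λ l → ∑ {p} (λ k → T (toℕ k) (toℕ l) v x)) (λ l → ∑ {p} (λ k → T (toℕ k) (toℕ l) w x)))

    NH-vsum : ∀ {r} (V : Fin r → ZVec (rank M)) → NH (vsum V) ≐ vsum (λ y → NH (V y))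
    NH-vsum V x = trans (∑-cong {p} (λ l → trans (∑-cong {p} (λ k → ·-vsum (act M (h (toℕ k) (toℕ l))) V x))
      (∑-swap {p} (λ k y → T (toℕ k) (toℕ l) (V y) x)))) (∑-swap {p} (λ l y → ∑ {p} (λ k → T (toℕ k) (toℕ l) (V y) x)))

  module NormMap {M N : Rep n} (L : IsGLattice M) (L' : IsGLattice N) (g : GMap M N) where
    private
      module A = Norms M L
      module A' = Norms N L'

    Nm-map : ∀ i j v → (mat g ·ᶻ A.Nm i j v) ≐ A'.Nm i j (mat g ·ᶻ v)
    Nm-map i j v x = trans (·-vsum (mat g) {p} (λ t → A.T (toℕ t ℕ.* i) (toℕ t ℕ.* j) v) x) (∑-cong {p} (λ t → gmap-· g (h (toℕ t ℕ.* i) (toℕ t ℕ.* j)) v x))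

    NH-map : ∀ v → (mat g ·ᶻ A.NH v) ≐ A'.NH (mat g ·ᶻ v)
    NH-map v x = trans (·-vsum (mat g) {p} (λ l → vsum {p} (λ k → A.T (toℕ k) (toℕ l) v)) x)
      (∑-cong {p} (λ l → trans (·-vsum (mat g) {p} (λ k → A.T (toℕ k) (toℕ l) v) x) (∑-cong {p} (λ k → gmap-· g (h (toℕ k) (toℕ l)) v x))))

  module Fixed (pp : Prime p) (X : GSet n) where

    open GSet X

    Fix : ℕ → ℕ → Fin size → Set
    Fix k l x = h k l ⋆ x ≡ x

    Fix? : ∀ k l x → Dec (Fix k l x)
    Fix? k l x = h k l ⋆ x ≟ x

    h⋆ : ∀ k l k' l' x → h k l ⋆ h k' l' ⋆ x ≡ h (k ℕ.+ k') (l ℕ.+ l') ⋆ x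
    h⋆ k l k' l' x = trans (sym (⋆-∙ (h k l) (h k' l') x)) (⋆-cong (h-∙ k l k' l') x)

    Fix-+ : ∀ {k l k' l' x} → Fix k l x → Fix k' l' x → Fix (k ℕ.+ k') (l ℕ.+ l') x
    Fix-+ {k} {l} {k'} {l'} {x} f f' = trans (sym (h⋆ k l k' l' x)) (trans (cong (h k l ⋆_) f') f)

    Fix-* : ∀ t {k l x} → Fix k l x → Fix (t ℕ.* k) (t ℕ.* l) x
    Fix-* zero {x = x} f = trans (⋆-cong h-0 x) (⋆-id x)
    Fix-* (suc t) f = Fix-+ f (Fix-* t f)

    Fix-mod : ∀ {k l} u u' {x} → Fix (k ℕ.+ u ℕ.* p) (l ℕ.+ u' ℕ.* p) x → Fix k l x
    Fix-mod {k} {l} u u' {x} f = trans (sym (⋆-cong (h-+* k l u u') x)) f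

    Fix-move : ∀ {k l x} k' l' → Fix k l x → Fix k l (h k' l' ⋆ x)
    Fix-move {k} {l} {x} k' l' f = trans (h⋆ k l k' l' x) (trans (cong₂ (λ a b → h a b ⋆ x) (ℕₚ.+-comm k k') (ℕₚ.+-comm l l'))
      (trans (sym (h⋆ k' l' k l x)) (cong (h k' l' ⋆_) f)))

    Fix-move⁻¹ : ∀ {k l x} k' l' → Fix k l x → Fix k l ((h k' l' ⁻¹) ⋆ x)
    Fix-move⁻¹ {k} {l} {x} k' l' f = ⋆-injective (h k' l') (trans (h⋆ k' l' k l _) (trans
      (cong₂ (λ a b → h a b ⋆ ((h k' l' ⁻¹) ⋆ x)) (ℕₚ.+-comm k' k) (ℕₚ.+-comm l' l))
      (trans (sym (h⋆ k l k' l' _)) (trans (cong (h k l ⋆_) (⋆-⁻¹ʳ (h k' l') x)) (trans f (sym (⋆-⁻¹ʳ (h k' l') x)))))))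

    -- Since p is prime, a nontrivial power of an element generates the same subgroup.
    Fix-root : ∀ {t k l x} → t ≢ 0 → t ℕ.< p → Fix (t ℕ.* k) (t ℕ.* l) x → Fix k l x
    Fix-root {t} {k} {l} {x} t≢0 t<p f with mod-inverse pp t≢0 t<p
    ... | t' , u , e = Fix-mod (u ℕ.* k) (u ℕ.* l) (subst₂ (λ a b → Fix a b x) (re k) (re l) (Fix-* t' f))
      where
      re : ∀ k → t' ℕ.* (t ℕ.* k) ≡ k ℕ.+ u ℕ.* k ℕ.* p
      re k = trans (sym (ℕₚ.*-assoc t' t k)) (trans (cong (ℕ._* k) e) (solve 3 (λ u p k → (con 1 :+ u :* p) :* k := k :+ u :* k :* p) refl u p k))
        where open ℕSolver.+-*-Solver

    Fix⁻¹ : ∀ {k l x} → Fix k l x → (h k l ⁻¹) ⋆ x ≡ x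
    Fix⁻¹ {k} {l} {x} f = trans (cong ((h k l ⁻¹) ⋆_) (sym f)) (⋆-⁻¹ˡ (h k l) x)

    -- The p + 1 subgroups of order p are generated by the elements (1,0) and (i,1).
    Fix-line : ∀ {k l x} → k ℕ.< p → l ℕ.< p → ¬ (k ≡ 0 × l ≡ 0) → Fix k l x → ¬ Fix 1 0 x → ∃ λ (i : Fin p) → Fix (toℕ i) 1 x
    Fix-line {k} {zero} {x} k<p l<p ≢0 f ¬10 = ⊥-elim (¬10 (Fix-root (λ e → ≢0 (e , refl)) k<p
      (subst₂ (λ a b → Fix a b x) (sym (ℕₚ.*-identityʳ k)) (sym (ℕₚ.*-zeroʳ k)) f)))
    Fix-line {k} {suc l} {x} k<p l<p ≢0 f ¬10 with mod-inverse pp {suc l} (λ ()) l<p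
    ... | t' , u , e = fromℕ< (ℕ.m%n<n (t' ℕ.* k) p) , Fix-mod {toℕ (fromℕ< (ℕ.m%n<n (t' ℕ.* k) p))} {1} ((t' ℕ.* k) ℕ./ p) u
      (subst₂ (λ a b → Fix a b x) (trans (ℕ.m≡m%n+[m/n]*n (t' ℕ.* k) p) (cong (ℕ._+ (t' ℕ.* k) ℕ./ p ℕ.* p) (sym (toℕ-fromℕ< (ℕ.m%n<n (t' ℕ.* k) p))))) e (Fix-* t' f))

-- The natural permutation lattice and the maps of a setting

points : ∀ n → GSet n
points n = record
  { size = n ; _⋆_ = _⟨$⟩ʳ_ ; ⋆-cong = λ e → e ; ⋆-id = λ _ → refl ; ⋆-∙ = λ _ _ _ → refl }

module Maps {n : ℕ} (𝒮 : Setting n) where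

  open Setting 𝒮

  E PX PY : Rep n
  E = GSet.lattice (points n)
  PX = GSet.lattice X
  PY = GSet.lattice Y

  E-lat : IsGLattice E
  E-lat = GSet.lattice-isGLattice (points n)
  PX-lat : IsGLattice PX
  PX-lat = GSet.lattice-isGLattice X
  PY-lat : IsGLattice PY
  PY-lat = GSet.lattice-isGLattice Y
  F-lat : IsGLattice F
  F-lat = proj₁ F-flasque

  ιᵍ : GMap E PX
  ιᵍ = mkGMap ι λ σ u x → trans (·-cong ι (λ i → GSet.act-lattice (points n) σ u i) x)
    (trans (ι-equiv σ u x) (sym (GSet.act-lattice X σ (ι ·ᶻ u) x)))

  πᵍ : GMap PX F
  πᵍ = mkGMap π λ σ z i → trans (·-cong π (λ x → GSet.act-lattice X σ z x) i) (π-equiv σ z i)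

  Sᵍ : GMap F PY
  Sᵍ = mkGMap S λ σ w y → trans (S-equiv σ w y) (sym (GSet.act-lattice Y σ (S ·ᶻ w) y))

  Rᵍ : GMap PY F
  Rᵍ = mkGMap R λ σ z i → trans (·-cong R (λ x → GSet.act-lattice Y σ z x) i) (R-equiv σ z i)

  ι-≡ : ∀ u w → (ι ·ᶻ u) ≐ (ι ·ᶻ w) → ∀ i j → u i - w i ≡ u j - w j
  ι-≡ u w e = ι-inj (u ⊟ w) (λ x → trans (·-⊟ ι u w x) (ℤₚ.i≡j⇒i-j≡0 (e x)))

  ι-≡⁻¹ : ∀ u w → (∀ i j → u i - w i ≡ u j - w j) → (ι ·ᶻ u) ≐ (ι ·ᶻ w)
  ι-≡⁻¹ u w c x = ℤₚ.i-j≡0⇒i≡j _ _ (trans (sym (·-⊟ ι u w x)) (ι-const (u ⊟ w) c x))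

-- The generator of the δ-th subgroup of order p, and of a complement.

dirₖ dirₗ comₖ comₗ : ∀ {p} → Fin (suc p) → ℕ
dirₖ zero = 1
dirₖ (suc i) = toℕ i
dirₗ zero = 0
dirₗ (suc i) = 1
comₖ zero = 0
comₖ (suc i) = 1
comₗ zero = 1
comₗ (suc i) = 0

-- In the example 1A is the indicator of the block moved by a, and supp δ that of the letters fixed by the
-- complement of the δ-th subgroup.
record OddAction {p n : ℕ} {{nz : ℕ.NonZero p}} (B : Bicyclic p n) : Set where
  open BicyclicGroup B using (module Norms)
  open Bicyclic B
  private module En = Norms (GSet.lattice (points n)) (GSet.lattice-isGLattice (points n))
  field
    1A : ZVec n
    supp base gen : Fin (suc p) → ZVec n
    supp-inv : ∀ δ i → supp δ (h (dirₖ δ) (dirₗ δ) ⟨$⟩ˡ i) ≡ supp δ i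
    -- In the example a constant norm κ forces every block sum to be κ. The complement rotates each
    -- block outside `supp δ`, so its norm there is a block sum; it fixes the letters of `supp δ`,
    -- where its norm is p w.
    norm-com : ∀ δ w κ → (∀ i → En.Nm (dirₖ δ) (dirₗ δ) w i ≡ κ) →
               ∀ i → En.Nm (comₖ δ) (comₗ δ) w i ≡ κ + supp δ i * (+ p * w i - κ)
    supp-norm : ∀ δ → (+ p ⊡ supp δ) ≐ En.NH (base δ)
    1A-norm : ∀ δ i j → 1A i - En.Nm (dirₖ δ) (dirₗ δ) (gen δ) i ≡ 1A j - En.Nm (dirₖ δ) (dirₗ δ) (gen δ) j
    α β : Fin n
    1A-α : 1A α ≡ + 1
    1A-β : 1A β ≡ + 0
    norm-α : ∀ w → ∃ λ z → En.NH w α ≡ + p * z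
    norm-β : ∀ w → ∃ λ z → En.NH w β ≡ + p * z

-- Odd p: norms and transfers for the group generated by a and b

module Odd {n : ℕ} (𝒮 : Setting n) {p q : ℕ} {{nz : ℕ.NonZero p}} (pp : Prime p) (p-odd : p ≡ suc (q ℕ.+ q))
           (B : Bicyclic p n) (O : OddAction B) where

  open Setting 𝒮
  open Maps 𝒮
  open Bicyclic B
  open BicyclicGroup B
  open OddAction O

  module En = Norms E E-lat
  module Xn = Norms PX PX-lat
  module Yn = Norms PY PY-lat
  module Fn = Norms F F-lat
  module ιn = NormMap E-lat PX-lat ιᵍ
  module πn = NormMap PX-lat F-lat πᵍ
  module Sn = NormMap F-lat PY-lat Sᵍ
  module Rn = NormMap PY-lat F-lat Rᵍ

  ∑toℕ : ∑ {p} (λ t → + toℕ t) ≡ + p * + q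
  ∑toℕ = pos-*-cancel {+ 2} refl (trans (gauss p) (trans (cong (λ x → + p * (+ x - + 1)) p-odd) (trans (cong (λ x → + p * (+ 1 + x - + 1)) (ℤₚ.pos-+ q q)) (lem (+ p) (+ q)))))
    where
    lem : ∀ a b → a * (+ 1 + (b + b) - + 1) ≡ + 2 * (a * b)
    lem = solve-∀
    lem3 : ∀ a b → + 2 * b ≡ a * (a - + 1) → + 2 * (a + b) ≡ (+ 1 + a) * (+ 1 + a - + 1)
    lem3 a b e = trans (ℤₚ.*-distribˡ-+ (+ 2) a b) (trans (cong (_+_ (+ 2 * a)) e) (lem4 a))
      where
      lem4 : ∀ a → + 2 * a + a * (a - + 1) ≡ (+ 1 + a) * (+ 1 + a - + 1)
      lem4 = solve-∀
    gauss : ∀ r → + 2 * ∑ {r} (λ t → + toℕ t) ≡ + r * (+ r - + 1)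
    gauss zero = refl
    gauss (suc r) = trans (cong (+ 2 *_) (trans (ℤₚ.+-identityˡ _) (trans (∑-+ {r} (λ _ → + 1) (λ t → + toℕ t))
      (cong (_+ ∑ {r} (λ t → + toℕ t)) (trans (∑-const r (+ 1)) (ℤₚ.*-identityʳ (+ r))))))) (lem3 (+ r) (∑ {r} (λ t → + toℕ t)) (gauss r))

  p-pos : ∃ λ m → + p ≡ + suc m
  p-pos = q ℕ.+ q , cong +_ p-odd

  com-dir-norm : ∀ {M} (L : IsGLattice M) (δ : Fin (suc p)) v → Norms.Nm M L (dirₖ δ) (dirₗ δ) (Norms.Nm M L (comₖ δ) (comₗ δ) v) ≐ Norms.NH M L v
  com-dir-norm {M} L zero v = Norms.Nm10-Nm01 M L v
  com-dir-norm {M} L (suc i) v = Norms.Nm-Nm M L (toℕ i) v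

  -- R z has a lift to ℤ[X] whose p-th multiple is a norm from H. The property is additive, so a
  -- vector may be cut into pieces before it is verified.
  Good : ZVec sizeY → Set
  Good z = ∃₂ λ u g → ((π ·ᶻ u) ≐ (R ·ᶻ z)) × ((+ p ⊡ u) ≐ Xn.NH g)

  Good-cong : ∀ {z z'} → z ≐ z' → Good z → Good z'
  Good-cong e (u , g , a , b) = u , g , ≐-trans a (·-cong R e) , b

  Good-⊞ : ∀ {z z'} → Good z → Good z' → Good (z ⊞ z')
  Good-⊞ {z} {z'} (u , g , a , b) (u' , g' , a' , b') = u ⊞ u' , g ⊞ g' ,
    (λ i → trans (·-⊞ π u u' i) (trans (cong₂ _+_ (a i) (a' i)) (sym (·-⊞ R z z' i)))) ,
    (λ x → trans (ℤₚ.*-distribˡ-+ (+ p) (u x) (u' x)) (trans (cong₂ _+_ (b x) (b' x)) (sym (Xn.NH-⊞ g g' x))))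

  Good-norm : ∀ f → Good (Yn.NH f)
  Good-norm f with π-surj (R ·ᶻ f)
  ... | g , e = Xn.NH g , + p ⊡ g ,
    (λ i → trans (πn.NH-map g i) (trans (Fn.NH-cong e i) (sym (Rn.NH-map f i)))) ,
    (λ x → sym (Xn.NH-⊡ (+ p) g x))

  -- Let d generate the δ-th subgroup, e its complement, and let g lift R f. Then (d - 1) g = ι w
  -- with N_d w a constant κ, so N_e g fails to be d-invariant by ι N_e w. The weighted norm v' of w
  -- satisfies (d - 1) v' = p w - κ; cut down to `supp δ` it becomes v with (d - 1) v = N_e w - κ,
  -- by `norm-com`. Hence u = N_e g - ι v is d-invariant and p u = N_d u. The price N_d v = p q κ
  -- `supp δ` is a norm from H by `supp-norm`.
  Good-transfer : ∀ δ f → Yn.T (dirₖ δ) (dirₗ δ) f ≐ f → Good (Yn.Nm (comₖ δ) (comₗ δ) f)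
  Good-transfer δ f finv = u , g ⊟ (+ q * κ) ⊡ (ι ·ᶻ base δ) , πu , pu
    where
    dk = dirₖ δ
    dl = dirₗ δ
    g : ZVec sizeX
    g = proj₁ (π-surj (R ·ᶻ f))
    πg : (π ·ᶻ g) ≐ (R ·ᶻ f)
    πg = proj₂ (π-surj (R ·ᶻ f))
    lift : ∃ λ w → (ι ·ᶻ w) ≐ (Xn.T dk dl g ⊟ g)
    lift = exact (Xn.T dk dl g ⊟ g) (λ i → trans (·-⊟ π (Xn.T dk dl g) g i) (ℤₚ.i≡j⇒i-j≡0 (begin
      (π ·ᶻ Xn.T dk dl g) i     ≡⟨ gmap-· πᵍ (h dk dl) g i ⟩
      Fn.T dk dl (π ·ᶻ g) i     ≡⟨ Fn.T-cong {dk} {dl} πg i ⟩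
      Fn.T dk dl (R ·ᶻ f) i     ≡⟨ sym (gmap-· Rᵍ (h dk dl) f i) ⟩
      (R ·ᶻ Yn.T dk dl f) i     ≡⟨ ·-cong R finv i ⟩
      (R ·ᶻ f) i                ≡⟨ sym (πg i) ⟩
      (π ·ᶻ g) i ∎)))
    w : ZVec n
    w = proj₁ lift
    ιw : (ι ·ᶻ w) ≐ (Xn.T dk dl g ⊟ g)
    ιw = proj₂ lift
    -- N_d (d - 1) = 0, so ι kills N_d w and this vector is constant; its value is read off at α.
    κ : ℤ
    κ = En.Nm dk dl w α
    Nw : ∀ i → En.Nm dk dl w i ≡ κ
    Nw i = ι-inj (En.Nm dk dl w) (λ x → begin
      (ι ·ᶻ En.Nm dk dl w) x                             ≡⟨ ιn.Nm-map dk dl w x ⟩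
      Xn.Nm dk dl (ι ·ᶻ w) x                             ≡⟨ Xn.Nm-cong dk dl ιw x ⟩
      Xn.Nm dk dl (Xn.T dk dl g ⊟ g) x                   ≡⟨ trans (∑-cong {p} (λ t → ·-⊟ (act PX (h (toℕ t ℕ.* dk) (toℕ t ℕ.* dl))) (Xn.T dk dl g) g x))
                                                              (∑-- {p} (λ t → Xn.T (toℕ t ℕ.* dk) (toℕ t ℕ.* dl) (Xn.T dk dl g) x) (λ t → Xn.T (toℕ t ℕ.* dk) (toℕ t ℕ.* dl) g x)) ⟩
      Xn.Nm dk dl (Xn.T dk dl g) x - Xn.Nm dk dl g x     ≡⟨ ℤₚ.i≡j⇒i-j≡0 (trans (Xn.Nm-T dk dl dk dl g x) (Xn.T-Nm dk dl g x)) ⟩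
      + 0 ∎) i α
    v' v : ZVec n
    v' = En.wNm dk dl w
    v i = supp δ i * v' i
    T-v : ∀ k l → (∀ i → supp δ (h k l ⟨$⟩ˡ i) ≡ supp δ i) → ∀ i → En.T k l v i ≡ supp δ i * En.T k l v' i
    T-v k l inv i = trans (GSet.act-lattice (points n) (h k l) v i) (cong₂ _*_ (inv i) (sym (GSet.act-lattice (points n) (h k l) v' i)))
    supp-inv* : ∀ t i → supp δ (h (t ℕ.* dk) (t ℕ.* dl) ⟨$⟩ˡ i) ≡ supp δ i
    supp-inv* zero i = trans (sym (GSet.act-lattice (points n) (h 0 0) (supp δ) i)) (En.T-0 (supp δ) i)
    supp-inv* (suc t) i = begin
      supp δ (h (suc t ℕ.* dk) (suc t ℕ.* dl) ⟨$⟩ˡ i)   ≡⟨ sym (GSet.act-lattice (points n) (h (suc t ℕ.* dk) (suc t ℕ.* dl)) (supp δ) i) ⟩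
      En.T (suc t ℕ.* dk) (suc t ℕ.* dl) (supp δ) i     ≡⟨ sym (En.T-∙ dk dl (t ℕ.* dk) (t ℕ.* dl) (supp δ) i) ⟩
      En.T dk dl (En.T (t ℕ.* dk) (t ℕ.* dl) (supp δ)) i ≡⟨ En.T-cong {dk} {dl} (λ j → trans (GSet.act-lattice (points n) (h (t ℕ.* dk) (t ℕ.* dl)) (supp δ) j) (supp-inv* t j)) i ⟩
      En.T dk dl (supp δ) i                             ≡⟨ GSet.act-lattice (points n) (h dk dl) (supp δ) i ⟩
      supp δ (h dk dl ⟨$⟩ˡ i)                           ≡⟨ supp-inv δ i ⟩
      supp δ i ∎
    -- The correction by v makes the lift of N_e f invariant under d.
    Ne : ZVec sizeX
    Ne = Xn.Nm (comₖ δ) (comₗ δ) g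
    u : ZVec sizeX
    u = Ne ⊟ (ι ·ᶻ v)
    πu : (π ·ᶻ u) ≐ (R ·ᶻ Yn.Nm (comₖ δ) (comₗ δ) f)
    πu i = begin
      (π ·ᶻ u) i                                   ≡⟨ ·-⊟ π Ne (ι ·ᶻ v) i ⟩
      (π ·ᶻ Ne) i - (π ·ᶻ (ι ·ᶻ v)) i               ≡⟨ cong (_-_ ((π ·ᶻ Ne) i)) (comp0 v i) ⟩
      (π ·ᶻ Ne) i - + 0                            ≡⟨ ℤₚ.+-identityʳ _ ⟩
      (π ·ᶻ Ne) i                                  ≡⟨ πn.Nm-map (comₖ δ) (comₗ δ) g i ⟩
      Fn.Nm (comₖ δ) (comₗ δ) (π ·ᶻ g) i           ≡⟨ Fn.Nm-cong (comₖ δ) (comₗ δ) πg i ⟩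
      Fn.Nm (comₖ δ) (comₗ δ) (R ·ᶻ f) i           ≡⟨ sym (Rn.Nm-map (comₖ δ) (comₗ δ) f i) ⟩
      (R ·ᶻ Yn.Nm (comₖ δ) (comₗ δ) f) i ∎
    Tu : Xn.T dk dl u ≐ u
    Tu x = begin
      Xn.T dk dl u x                                      ≡⟨ ·-⊟ (act PX (h dk dl)) Ne (ι ·ᶻ v) x ⟩
      Xn.T dk dl Ne x - Xn.T dk dl (ι ·ᶻ v) x             ≡⟨ cong₂ _-_ TNe (sym (gmap-· ιᵍ (h dk dl) v x)) ⟩
      (Ne x + (ι ·ᶻ NeW) x) - (ι ·ᶻ En.T dk dl v) x       ≡⟨ lem (Ne x) ((ι ·ᶻ NeW) x) ((ι ·ᶻ En.T dk dl v) x) ⟩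
      Ne x + ((ι ·ᶻ NeW) x - (ι ·ᶻ En.T dk dl v) x)       ≡⟨ cong (_+_ (Ne x)) (sym (·-⊟ ι NeW (En.T dk dl v) x)) ⟩
      Ne x + (ι ·ᶻ (NeW ⊟ En.T dk dl v)) x                ≡⟨ cong (_+_ (Ne x)) (ι-≡⁻¹ (NeW ⊟ En.T dk dl v) ((- + 1) ⊡ v) shift x) ⟩
      Ne x + (ι ·ᶻ ((- + 1) ⊡ v)) x                       ≡⟨ cong (_+_ (Ne x)) (trans (·-⊡ ι (- + 1) v x) (ℤₚ.-1*i≡-i _)) ⟩
      u x ∎
      where
      NeW : ZVec n
      NeW = En.Nm (comₖ δ) (comₗ δ) w
      lem : ∀ a b c → (a + b) - c ≡ a + (b - c)
      lem = solve-∀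
      TNe : Xn.T dk dl Ne x ≡ Ne x + (ι ·ᶻ NeW) x
      TNe = begin
        Xn.T dk dl Ne x                                   ≡⟨ sym (Xn.Nm-T (comₖ δ) (comₗ δ) dk dl g x) ⟩
        Xn.Nm (comₖ δ) (comₗ δ) (Xn.T dk dl g) x          ≡⟨ Xn.Nm-cong (comₖ δ) (comₗ δ) (λ y → trans (add (Xn.T dk dl g y) (g y)) (cong (_+_ (g y)) (sym (ιw y)))) x ⟩
        Xn.Nm (comₖ δ) (comₗ δ) (g ⊞ (ι ·ᶻ w)) x          ≡⟨ trans (∑-cong {p} (λ t → ·-⊞ (act PX (h (toℕ t ℕ.* comₖ δ) (toℕ t ℕ.* comₗ δ))) g (ι ·ᶻ w) x))
                                                                (∑-+ {p} (λ t → Xn.T (toℕ t ℕ.* comₖ δ) (toℕ t ℕ.* comₗ δ) g x) (λ t → Xn.T (toℕ t ℕ.* comₖ δ) (toℕ t ℕ.* comₗ δ) (ι ·ᶻ w) x)) ⟩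
        Ne x + Xn.Nm (comₖ δ) (comₗ δ) (ι ·ᶻ w) x         ≡⟨ cong (_+_ (Ne x)) (sym (ιn.Nm-map (comₖ δ) (comₗ δ) w x)) ⟩
        Ne x + (ι ·ᶻ NeW) x ∎
        where
        add : ∀ a b → a ≡ b + (a - b)
        add = solve-∀
      value : ∀ i → (NeW ⊟ En.T dk dl v) i - ((- + 1) ⊡ v) i ≡ κ
      value i = begin
        (NeW i - En.T dk dl v i) - (- + 1) * v i
          ≡⟨ cong₂ (λ a b → (a - b) - (- + 1) * v i) (norm-com δ w κ Nw i) (trans (T-v dk dl (supp-inv δ) i) (cong (supp δ i *_) (trans (En.T-wNm dk dl w i) (cong (λ a → v' i - a + + p * w i) (Nw i))))) ⟩
        (κ + supp δ i * (+ p * w i - κ) - supp δ i * (v' i - κ + + p * w i)) - (- + 1) * (supp δ i * v' i)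
          ≡⟨ lem4 κ (supp δ i) (+ p * w i) (v' i) ⟩
        κ ∎
        where
        lem4 : ∀ k s a b → (k + s * (a - k) - s * (b - k + a)) - (- + 1) * (s * b) ≡ k
        lem4 = solve-∀
      shift : ∀ i j → (NeW ⊟ En.T dk dl v) i - ((- + 1) ⊡ v) i ≡ (NeW ⊟ En.T dk dl v) j - ((- + 1) ⊡ v) j
      shift i j = trans (value i) (sym (value j))
    Nv : ∀ i → En.Nm dk dl v i ≡ + q * κ * En.NH (base δ) i
    Nv i = begin
      En.Nm dk dl v i                                   ≡⟨ ∑-cong {p} (λ t → T-v (toℕ t ℕ.* dk) (toℕ t ℕ.* dl) (supp-inv* (toℕ t)) i) ⟩
      ∑ {p} (λ t → supp δ i * En.T (toℕ t ℕ.* dk) (toℕ t ℕ.* dl) v' i) ≡⟨ ∑-*ˡ {p} (supp δ i) (λ t → En.T (toℕ t ℕ.* dk) (toℕ t ℕ.* dl) v' i) ⟩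
      supp δ i * En.Nm dk dl v' i                       ≡⟨ cong (supp δ i *_) (trans (En.Nm-wNm dk dl w i) (cong₂ _*_ ∑toℕ (Nw i))) ⟩
      supp δ i * (+ p * + q * κ)                        ≡⟨ lem (supp δ i) (+ p) (+ q) κ ⟩
      + q * κ * (+ p * supp δ i)                        ≡⟨ cong (+ q * κ *_) (supp-norm δ i) ⟩
      + q * κ * En.NH (base δ) i ∎
      where
      lem : ∀ s p q k → s * (p * q * k) ≡ q * k * (p * s)
      lem = solve-∀
    pu : (+ p ⊡ u) ≐ Xn.NH (g ⊟ (+ q * κ) ⊡ (ι ·ᶻ base δ))
    pu x = begin
      + p * u x                                          ≡⟨ sym (Xn.Nm-invariant dk dl u Tu x) ⟩
      Xn.Nm dk dl u x                                    ≡⟨ trans (∑-cong {p} (λ t → ·-⊟ (act PX (h (toℕ t ℕ.* dk) (toℕ t ℕ.* dl))) Ne (ι ·ᶻ v) x))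
                                                              (∑-- {p} (λ t → Xn.T (toℕ t ℕ.* dk) (toℕ t ℕ.* dl) Ne x) (λ t → Xn.T (toℕ t ℕ.* dk) (toℕ t ℕ.* dl) (ι ·ᶻ v) x)) ⟩
      Xn.Nm dk dl Ne x - Xn.Nm dk dl (ι ·ᶻ v) x          ≡⟨ cong₂ _-_ (com-dir-norm PX-lat δ g x) (sym (ιn.Nm-map dk dl v x)) ⟩
      Xn.NH g x - (ι ·ᶻ En.Nm dk dl v) x                 ≡⟨ cong (_-_ (Xn.NH g x)) (·-cong ι Nv x) ⟩
      Xn.NH g x - (ι ·ᶻ ((+ q * κ) ⊡ En.NH (base δ))) x  ≡⟨ cong (_-_ (Xn.NH g x)) (trans (·-⊡ ι (+ q * κ) (En.NH (base δ)) x) (cong (+ q * κ *_) (ιn.NH-map (base δ) x))) ⟩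
      Xn.NH g x - (+ q * κ) * Xn.NH (ι ·ᶻ base δ) x      ≡⟨ cong (_-_ (Xn.NH g x)) (sym (Xn.NH-⊡ (+ q * κ) (ι ·ᶻ base δ) x)) ⟩
      Xn.NH g x - Xn.NH ((+ q * κ) ⊡ (ι ·ᶻ base δ)) x    ≡⟨ sym (Xn.NH-⊟ g ((+ q * κ) ⊡ (ι ·ᶻ base δ)) x) ⟩
      Xn.NH (g ⊟ (+ q * κ) ⊡ (ι ·ᶻ base δ)) x ∎

  module Count (Z : GSet n) where

    open GSet Z
    open Fixed pp Z public
    open Subgroup.Orbits elem isSubgroup Z public
    module Zn = Norms lattice lattice-isGLattice

    Line : Fin (suc p) → Fin size → Set
    Line δ = Fix (dirₖ δ) (dirₗ δ)

    Line? : ∀ δ x → Dec (Line δ x)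
    Line? δ = Fix? (dirₖ δ) (dirₗ δ)

    nonfree? : ∀ x → Dec (∃ λ δ → Line δ x)
    nonfree? x = any? (λ δ → Line? δ x)

    T-eval : ∀ k l z x → Zn.T k l z x ≡ z ((h k l ⁻¹) ⋆ x)
    T-eval k l = act-lattice (h k l)

    NH-eval : ∀ z x → Zn.NH z x ≡ ∑ (λ y → z ((elem y ⁻¹) ⋆ x))
    NH-eval z x = trans (sym (Zn.NH≡∑elem z x)) (∑-cong (λ y → act-lattice (elem y) z x))

    Nm-at-fixed : ∀ {k l x} → Fix k l x → ∀ z → Zn.Nm k l z x ≡ + p * z x
    Nm-at-fixed {k} {l} {x} f z = trans (∑-cong {p} (λ t → trans (T-eval (toℕ t ℕ.* k) (toℕ t ℕ.* l) z x) (cong z (Fix⁻¹ (Fix-* (toℕ t) f))))) (∑-const p (z x))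

    -- A nontrivial element fixing x generates one of the p + 1 subgroups of order p, so x would lie
    -- on a line.
    stab-free : ∀ {x} → ¬ (∃ λ δ → Line δ x) → stab x ≡ + 1
    stab-free {x} free = trans (∑-single (λ y → χ (elem y ⋆ x ≟ x)) (index 0 0) (λ y y≢ → χ-no (elem y ⋆ x ≟ x) (off y y≢)))
      (χ-yes (elem (index 0 0) ⋆ x ≟ x) (trans (⋆-cong (λ i → trans (elem-index 0 0 i) (h-0 i)) x) (⋆-id x)))
      where
      off : ∀ y → y ≢ index 0 0 → ¬ (elem y ⋆ x ≡ x)
      off y y≢ f = free (suc (proj₁ line) , proj₂ line)
        where
        line = Fix-line {x = x} (toℕ<n (proj₂ (remQuot {p} p y))) (toℕ<n (proj₁ (remQuot {p} p y)))
          (λ { (e , e') → y≢ (IsSubgroup.no-dups isSubgroup y (index 0 0) λ i → trans (cong₂ (λ a b → h a b ⟨$⟩ʳ i) e e') (sym (elem-index 0 0 i))) })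
          f (λ f10 → free (zero , f10))

    -- The order of the stabiliser is the value at x of the norm of the unit vector at x. Computed
    -- as N_d N_e it is p, since d fixes x while only the trivial power of e does.
    stab-line : ∀ δ {x} → Line δ x → ¬ Fix (comₖ δ) (comₗ δ) x → stab x ≡ + p
    stab-line δ {x} ln ¬c = begin
      stab x                                          ≡⟨ ∑-cong (λ y → χ-cong (elem y ⋆ x ≟ x) (x ≟ (elem y ⁻¹) ⋆ x)
                                                           (λ q → trans (sym (⋆-⁻¹ˡ (elem y) x)) (cong ((elem y ⁻¹) ⋆_) q))
                                                           (λ q → trans (cong (elem y ⋆_) q) (⋆-⁻¹ʳ (elem y) x))) ⟩
      ∑ (λ y → unit x ((elem y ⁻¹) ⋆ x))              ≡⟨ sym (NH-eval (unit x) x) ⟩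
      Zn.NH (unit x) x                                ≡⟨ sym (com-dir-norm lattice-isGLattice δ (unit x) x) ⟩
      Zn.Nm (dirₖ δ) (dirₗ δ) (Zn.Nm (comₖ δ) (comₗ δ) (unit x)) x ≡⟨ Nm-at-fixed ln _ ⟩
      + p * Zn.Nm (comₖ δ) (comₗ δ) (unit x) x        ≡⟨ cong (+ p *_) once ⟩
      + p * + 1                                       ≡⟨ ℤₚ.*-identityʳ (+ p) ⟩
      + p ∎
      where
      t₀ : Fin p
      t₀ = fromℕ< (ℕ.>-nonZero⁻¹ p)
      toℕ-t₀ : toℕ t₀ ≡ 0
      toℕ-t₀ = toℕ-fromℕ< (ℕ.>-nonZero⁻¹ p)
      once : Zn.Nm (comₖ δ) (comₗ δ) (unit x) x ≡ + 1
      once = trans (∑-single {p} (λ t → Zn.T (toℕ t ℕ.* comₖ δ) (toℕ t ℕ.* comₗ δ) (unit x) x) t₀ off)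
        (trans (cong (λ a → Zn.T (a ℕ.* comₖ δ) (a ℕ.* comₗ δ) (unit x) x) toℕ-t₀) (trans (Zn.T-0 (unit x) x) (χ-yes (x ≟ x) refl)))
        where
        off : ∀ t → t ≢ t₀ → Zn.T (toℕ t ℕ.* comₖ δ) (toℕ t ℕ.* comₗ δ) (unit x) x ≡ + 0
        off t t≢ = trans (T-eval (toℕ t ℕ.* comₖ δ) (toℕ t ℕ.* comₗ δ) (unit x) x) (χ-no (x ≟ _) λ q →
          ¬c (Fix-root {toℕ t} (λ z → t≢ (toℕ-injective (trans z (sym toℕ-t₀)))) (toℕ<n t)
            (trans (cong (h (toℕ t ℕ.* comₖ δ) (toℕ t ℕ.* comₗ δ) ⋆_) q) (⋆-⁻¹ʳ (h (toℕ t ℕ.* comₖ δ) (toℕ t ℕ.* comₗ δ)) x))))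

    Fix-all : ∀ δ {x} → Line δ x → Fix (comₖ δ) (comₗ δ) x → ∀ k l → Fix k l x
    Fix-all δ {x} ln cm k l = subst₂ (λ a b → Fix a b x)
      (trans (cong₂ ℕ._+_ (ℕₚ.*-identityʳ k) (ℕₚ.*-zeroʳ l)) (ℕₚ.+-identityʳ k))
      (cong₂ ℕ._+_ (ℕₚ.*-zeroʳ k) (ℕₚ.*-identityʳ l)) (Fix-+ (Fix-* k (f10 δ ln cm)) (Fix-* l (f01 δ ln cm)))
      where
      f10 : ∀ δ → Line δ x → Fix (comₖ δ) (comₗ δ) x → Fix 1 0 x
      f10 zero ln cm = ln
      f10 (suc i) ln cm = cm
      f01 : ∀ δ → Line δ x → Fix (comₖ δ) (comₗ δ) x → Fix 0 1 x
      f01 zero ln cm = cm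
      f01 (suc i) ln cm = trans (cong (h 0 1 ⋆_) (sym (Fix-* (toℕ i) cm))) (trans (h⋆ 0 1 (toℕ i ℕ.* 1) (toℕ i ℕ.* 0) x)
        (trans (cong₂ (λ a b → h a b ⋆ x) (ℕₚ.*-identityʳ (toℕ i)) (cong suc (ℕₚ.*-zeroʳ (toℕ i)))) ln))

    rep-fixed : ∀ {x} → (∀ k l → Fix k l x) → rep x ≡ x
    rep-fixed {x} f = trans (sym (proj₂ (rep-Orb x))) (f _ _)

    Invariant : ZVec size → Set
    Invariant z = ∀ k l x → z ((h k l ⁻¹) ⋆ x) ≡ z x

    inv-rep : ∀ {z} → Invariant z → ∀ x → z (rep x) ≡ z x
    inv-rep {z} inv x = trans (cong z (sym (proj₂ (rep-Orb x)))) (trans (sym (inv _ _ _)) (cong z (⋆-⁻¹ˡ (elem (proj₁ (rep-Orb x))) x)))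

    Fix-rep : ∀ {k l x} → Fix k l x → Fix k l (rep x)
    Fix-rep {k} {l} {x} f = subst (Fix k l) (proj₂ (rep-Orb x)) (Fix-move _ _ f)

    rep-Fix : ∀ {k l x} → Fix k l (rep x) → Fix k l x
    rep-Fix {k} {l} {x} f = subst (Fix k l) (proj₂ (Orb-sym (rep-Orb x))) (Fix-move _ _ f)

    -- On a regular orbit the norm of the restriction to a representative has the value of z there;
    -- on all other orbits both sides vanish.
    free-norm : ∀ z → Invariant z → (∀ x → (∃ λ δ → Line δ x) → z x ≡ + 0) → Zn.NH (onReps z) ≐ z
    free-norm z inv van x = trans (NH-eval (onReps z) x) (trans (norm-onReps z x) (by (nonfree? x)))
      where
      by : Dec (∃ λ δ → Line δ x) → z (rep x) * stab (rep x) ≡ z x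
      by (yes (δ , f)) = trans (cong (_* stab (rep x)) (van (rep x) (δ , Fix-rep f))) (trans (ℤₚ.*-zeroˡ (stab (rep x))) (sym (van x (δ , f))))
      by (no ¬f) = trans (cong₂ _*_ (inv-rep inv x) (stab-free (λ { (δ , f) → ¬f (δ , rep-Fix f) }))) (ℤₚ.*-identityʳ (z x))

  module CX = Count X
  module CY = Count Y

  module _ (δ : Fin (suc p)) (z : ZVec sizeY) (inv : CY.Invariant z)
           (div : ∀ y → CY.Line δ y → CY.Fix (comₖ δ) (comₗ δ) y → ∃ λ a → z y ≡ + p * a)
           (van : ∀ y → ¬ CY.Line δ y → z y ≡ + 0) where
    private
      ck = comₖ δ
      cl = comₗ δ
      C? : ∀ y → Dec (CY.Fix ck cl y)
      C? = CY.Fix? ck cl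
      -- These values lead to a d-invariant f with N_e f = z. On H-fixed points N_e is
      -- multiplication by p, whence the quotient; on orbits whose stabiliser is generated by d it
      -- suffices to keep z at one representative.
      pick : ∀ y → Dec (CY.Line δ y) → Dec (CY.Fix ck cl y) → ℤ
      pick y (yes l) (yes c) = proj₁ (div y l c)
      pick y (yes _) (no _) = z y
      pick y (no _) _ = + 0
      ζ : ZVec sizeY
      ζ y = pick y (CY.Line? δ y) (C? y)
      ζ-no : ∀ y → ¬ CY.Line δ y → ζ y ≡ + 0
      ζ-no y ¬l with CY.Line? δ y
      ... | yes l = ⊥-elim (¬l l)
      ... | no _ = refl
      ζ-yes-no : ∀ y → CY.Line δ y → ¬ CY.Fix ck cl y → ζ y ≡ z y
      ζ-yes-no y l ¬c with CY.Line? δ y | C? y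
      ... | yes _ | yes c = ⊥-elim (¬c c)
      ... | yes _ | no _ = refl
      ... | no ¬l | _ = ⊥-elim (¬l l)
      ζ-yes-yes : ∀ y → CY.Line δ y → CY.Fix ck cl y → + p * ζ y ≡ z y
      ζ-yes-yes y l c with CY.Line? δ y | C? y
      ... | yes l' | yes c' = sym (proj₂ (div y l' c'))
      ... | yes _ | no ¬c = ⊥-elim (¬c c)
      ... | no ¬l | _ = ⊥-elim (¬l l)
      f : ZVec sizeY
      f = CY.onReps ζ
      f-no : ∀ y → ¬ CY.Line δ y → f y ≡ + 0
      f-no y ¬l = trans (cong (_* χ (CY.rep y ≟ y)) (ζ-no y ¬l)) (ℤₚ.*-zeroˡ (χ (CY.rep y ≟ y)))
      moved : ∀ k l y → ¬ CY.Line δ y → ¬ CY.Line δ ((h k l ⁻¹) ⋆ʸ y)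
      moved k l y ¬l l' = ¬l (subst (CY.Line δ) (GSet.⋆-⁻¹ʳ Y (h k l) y) (CY.Fix-move k l l'))
      f-inv : Yn.T (dirₖ δ) (dirₗ δ) f ≐ f
      f-inv y = trans (CY.T-eval (dirₖ δ) (dirₗ δ) f y) (by (CY.Line? δ y))
        where
        by : Dec (CY.Line δ y) → f ((h (dirₖ δ) (dirₗ δ) ⁻¹) ⋆ʸ y) ≡ f y
        by (yes l) = cong f (CY.Fix⁻¹ l)
        by (no ¬l) = trans (f-no _ (moved (dirₖ δ) (dirₗ δ) y ¬l)) (sym (f-no y ¬l))
      f-norm : Yn.Nm ck cl f ≐ z
      f-norm y = by (CY.Line? δ y) (C? y)
        where
        by : Dec (CY.Line δ y) → Dec (CY.Fix ck cl y) → Yn.Nm ck cl f y ≡ z y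
        by (no ¬l) _ = trans (∑-0 {p} (λ t → trans (CY.T-eval (toℕ t ℕ.* ck) (toℕ t ℕ.* cl) f y) (f-no _ (moved (toℕ t ℕ.* ck) (toℕ t ℕ.* cl) y ¬l)))) (sym (van y ¬l))
        by (yes l) (yes c) = trans (CY.Nm-at-fixed c f) (trans (cong (λ a → + p * (ζ y * a)) (χ-yes (CY.rep y ≟ y) (CY.rep-fixed (CY.Fix-all δ l c))))
          (trans (cong (+ p *_) (ℤₚ.*-identityʳ (ζ y))) (ζ-yes-yes y l c)))
        -- At a point fixed by d multiplication by p is N_d, and N_d N_e = N_H is computed by
        -- orbits.
        by (yes l) (no ¬c) = pos-*-cancel (proj₂ p-pos) (begin
          + p * Yn.Nm ck cl f y                           ≡⟨ sym (CY.Nm-at-fixed l (Yn.Nm ck cl f)) ⟩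
          Yn.Nm (dirₖ δ) (dirₗ δ) (Yn.Nm ck cl f) y       ≡⟨ com-dir-norm PY-lat δ f y ⟩
          Yn.NH f y                                       ≡⟨ trans (CY.NH-eval f y) (CY.norm-onReps ζ y) ⟩
          ζ (CY.rep y) * CY.stab (CY.rep y)               ≡⟨ cong₂ _*_ (trans (ζ-yes-no (CY.rep y) (CY.Fix-rep l) ¬c') (CY.inv-rep inv y)) (CY.stab-line δ (CY.Fix-rep l) ¬c') ⟩
          z y * + p                                       ≡⟨ ℤₚ.*-comm (z y) (+ p) ⟩
          + p * z y ∎)
          where
          ¬c' : ¬ CY.Fix ck cl (CY.rep y)
          ¬c' c = ¬c (CY.rep-Fix c)

    Good-line : Good z
    Good-line = Good-cong f-norm (Good-transfer δ f f-inv)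

  Divisible : ZVec sizeY → Set
  Divisible z = ∀ y → (∀ k l → CY.Fix k l y) → ∃ λ a → z y ≡ + p * a

  -- Induction over the lines on which z may still be nonzero. The points fixed by the line with
  -- index j are split off as a transfer, and the rest vanishes on this line as well; when no line
  -- is left, z lives on regular orbits and is a norm. Points fixed by all of H leave with the first
  -- line treated, where their divisibility by p is used.
  Good-sweep : ∀ j z → CY.Invariant z → Divisible z → (∀ δ y → j ℕ.≤ toℕ δ → CY.Line δ y → z y ≡ + 0) → Good z
  Good-sweep zero z inv div van = Good-cong (CY.free-norm z inv (λ { y (δ , l) → van δ y ℕ.z≤n l })) (Good-norm (CY.onReps z))
  Good-sweep (suc j) z inv div van with j ℕ.<? suc p
  ... | no j≮ = Good-sweep j z inv div (λ δ y j≤ l → ⊥-elim (j≮ (ℕₚ.≤-<-trans j≤ (toℕ<n δ))))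
  ... | yes j< = Good-cong (λ y → lem (χ (D? y)) (z y)) (Good-⊞ (Good-line δ₀ z₁ inv₁ div₁ van₁) (Good-sweep j z₂ inv₂ div₂ van₂))
    where
    δ₀ : Fin (suc p)
    δ₀ = fromℕ< j<
    D? : ∀ y → Dec (CY.Line δ₀ y)
    D? = CY.Line? δ₀
    z₁ z₂ : ZVec sizeY
    z₁ y = χ (D? y) * z y
    z₂ y = (+ 1 - χ (D? y)) * z y
    lem : ∀ a b → a * b + (+ 1 - a) * b ≡ b
    lem = solve-∀
    χ-inv : ∀ k l y → χ (D? ((h k l ⁻¹) ⋆ʸ y)) ≡ χ (D? y)
    χ-inv k l y = χ-cong (D? _) (D? y) (λ q → subst (CY.Line δ₀) (GSet.⋆-⁻¹ʳ Y (h k l) y) (CY.Fix-move k l q)) (CY.Fix-move⁻¹ k l)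
    inv₁ : CY.Invariant z₁
    inv₁ k l y = cong₂ _*_ (χ-inv k l y) (inv k l y)
    inv₂ : CY.Invariant z₂
    inv₂ k l y = cong₂ (λ a b → (+ 1 - a) * b) (χ-inv k l y) (inv k l y)
    mul : ∀ c {a b : ℤ} → a ≡ + p * b → c * a ≡ + p * (c * b)
    mul c {a} {b} refl = lem' c (+ p) b
      where
      lem' : ∀ c p b → c * (p * b) ≡ p * (c * b)
      lem' = solve-∀
    div₁ : ∀ y → CY.Line δ₀ y → CY.Fix (comₖ δ₀) (comₗ δ₀) y → ∃ λ a → z₁ y ≡ + p * a
    div₁ y l c = _ , mul (χ (D? y)) (proj₂ (div y (CY.Fix-all δ₀ l c)))
    div₂ : Divisible z₂
    div₂ y f = _ , mul (+ 1 - χ (D? y)) (proj₂ (div y f))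
    van₁ : ∀ y → ¬ CY.Line δ₀ y → z₁ y ≡ + 0
    van₁ y ¬l = trans (cong (_* z y) (χ-no (D? y) ¬l)) (ℤₚ.*-zeroˡ (z y))
    van₂ : ∀ δ y → j ℕ.≤ toℕ δ → CY.Line δ y → z₂ y ≡ + 0
    van₂ δ y j≤ l with δ ≟ δ₀
    ... | yes refl = trans (cong (λ a → (+ 1 - a) * z y) (χ-yes (D? y) l)) (ℤₚ.*-zeroˡ (z y))
    ... | no δ≢ = trans (cong ((+ 1 - χ (D? y)) *_) (van δ y (ℕₚ.≤∧≢⇒< j≤ (λ e → δ≢ (toℕ-injective (trans (sym e) (sym (toℕ-fromℕ< j<)))))) l))
                    (ℤₚ.*-zeroʳ (+ 1 - χ (D? y)))

  Good-invariant : ∀ z → CY.Invariant z → Divisible z → Good z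
  Good-invariant z inv div = Good-sweep (suc p) z inv div (λ δ y p< _ → ⊥-elim (ℕₚ.<-irrefl refl (ℕₚ.≤-trans (toℕ<n δ) p<)))

  -- At a point fixed by the δ-th subgroup c is a norm from it, hence p times the value of
  -- `ι ·ᶻ gen δ`. That quotient is stored in u, which is 0 on regular orbits; since p u = c at
  -- nonfree points, every such δ gives the same value. The remainder c - p u lives on regular
  -- orbits and is the norm of v.
  c u v : ZVec sizeX
  c = ι ·ᶻ 1A
  u x = quot (CX.nonfree? x)
    module quotient where
    quot : Dec (∃ λ δ → CX.Line δ x) → ℤ
    quot (yes (δ , _)) = (ι ·ᶻ gen δ) x
    quot (no _) = + 0
  v = CX.onReps (c ⊟ + p ⊡ u)

  c-norm : ∀ δ x → c x ≡ Xn.Nm (dirₖ δ) (dirₗ δ) (ι ·ᶻ gen δ) x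
  c-norm δ x = trans (ι-≡⁻¹ 1A (En.Nm (dirₖ δ) (dirₗ δ) (gen δ)) (1A-norm δ) x) (ιn.Nm-map (dirₖ δ) (dirₗ δ) (gen δ) x)

  c-nonfree : ∀ x → (∃ λ δ → CX.Line δ x) → c x ≡ + p * u x
  c-nonfree x nf = by (CX.nonfree? x)
    where
    by : (d : Dec (∃ λ δ → CX.Line δ x)) → c x ≡ + p * quotient.quot x d
    by (yes (δ , l)) = trans (c-norm δ x) (CX.Nm-at-fixed l (ι ·ᶻ gen δ))
    by (no ¬f) = ⊥-elim (¬f nf)

  u-free : ∀ x → ¬ (∃ λ δ → CX.Line δ x) → u x ≡ + 0
  u-free x ¬nf = by (CX.nonfree? x)
    where
    by : (d : Dec (∃ λ δ → CX.Line δ x)) → quotient.quot x d ≡ + 0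
    by (yes f) = ⊥-elim (¬nf f)
    by (no _) = refl

  c-fixed : ∀ k l x → Xn.T k l c x ≡ c x
  c-fixed = generated
    where
    t₀ : Fin p
    t₀ = fromℕ< (ℕ.>-nonZero⁻¹ p)
    along : ∀ δ x → Xn.T (dirₖ δ) (dirₗ δ) c x ≡ c x
    along δ x = trans (Xn.T-cong {dirₖ δ} {dirₗ δ} (c-norm δ) x) (trans (Xn.T-Nm (dirₖ δ) (dirₗ δ) (ι ·ᶻ gen δ) x) (sym (c-norm δ x)))
    along01 : ∀ x → Xn.T 0 1 c x ≡ c x
    along01 x = trans (cong (λ a → Xn.T a 1 c x) (sym (toℕ-fromℕ< (ℕ.>-nonZero⁻¹ p)))) (along (suc t₀) x)
    generated : ∀ k l x → Xn.T k l c x ≡ c x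
    generated zero zero x = Xn.T-0 c x
    generated zero (suc l) x = trans (sym (Xn.T-∙ 0 1 0 l c x)) (trans (Xn.T-cong {0} {1} (generated zero l) x) (along01 x))
    generated (suc k) l x = trans (sym (Xn.T-∙ 1 0 k l c x)) (trans (Xn.T-cong {1} {0} (generated k l) x) (along zero x))

  c-inv : CX.Invariant c
  c-inv k l x = trans (sym (CX.T-eval k l c x)) (c-fixed k l x)

  u-inv : CX.Invariant u
  u-inv k l x = by (CX.nonfree? x)
    where
    by : Dec (∃ λ δ → CX.Line δ x) → u ((h k l ⁻¹) ⋆ˣ x) ≡ u x
    by (yes (δ , f)) = pos-*-cancel (proj₂ p-pos) (trans (sym (c-nonfree _ (δ , CX.Fix-move⁻¹ k l f))) (trans (c-inv k l x) (c-nonfree x (δ , f))))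
    by (no ¬f) = trans (u-free _ (λ { (δ , f) → ¬f (δ , subst (CX.Line δ) (GSet.⋆-⁻¹ʳ X (h k l) x) (CX.Fix-move k l f)) })) (sym (u-free x ¬f))

  NH-v : Xn.NH v ≐ (c ⊟ + p ⊡ u)
  NH-v = CX.free-norm (c ⊟ + p ⊡ u) (λ k l x → cong₂ (λ a b → a - + p * b) (c-inv k l x) (u-inv k l x)) (λ x nf → ℤₚ.i≡j⇒i-j≡0 (c-nonfree x nf))

  z : ZVec sizeY
  z = S ·ᶻ (π ·ᶻ u)

  z-inv : CY.Invariant z
  z-inv k l y = begin
    z ((h k l ⁻¹) ⋆ʸ y)              ≡⟨ sym (S-equiv (h k l) (π ·ᶻ u) y) ⟩
    (S ·ᶻ Fn.T k l (π ·ᶻ u)) y       ≡⟨ ·-cong S (λ i → sym (π-equiv (h k l) u i)) y ⟩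
    (S ·ᶻ (π ·ᶻ (λ x → u ((h k l ⁻¹) ⋆ˣ x)))) y ≡⟨ ·-cong S (·-cong π (u-inv k l)) y ⟩
    z y ∎

  πc : (π ·ᶻ c) ≐ zeroV
  πc = comp0 1A

  -- S π kills c, so p z = -N_H g, and at an H-fixed point the norm is multiplication by p².
  z-div : Divisible z
  z-div y fix = - g y , pos-*-cancel (proj₂ p-pos) (begin
    + p * z y                                      ≡⟨ sym (trans (·-cong S (·-⊡ π (+ p) u) y) (·-⊡ S (+ p) (π ·ᶻ u) y)) ⟩
    (S ·ᶻ (π ·ᶻ (+ p ⊡ u))) y                      ≡⟨ ·-cong S (·-cong π (λ x → trans (lem (c x) (+ p * u x)) (cong (_-_ (c x)) (sym (NH-v x))))) y ⟩
    (S ·ᶻ (π ·ᶻ (c ⊟ Xn.NH v))) y                  ≡⟨ ·-cong S (λ i → trans (·-⊟ π c (Xn.NH v) i) (cong₂ _-_ (πc i) (πn.NH-map v i))) y ⟩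
    (S ·ᶻ (zeroV ⊟ Fn.NH (π ·ᶻ v))) y              ≡⟨ trans (·-⊟ S zeroV (Fn.NH (π ·ᶻ v)) y) (cong₂ _-_ (·-zero S y) (Sn.NH-map (π ·ᶻ v) y)) ⟩
    + 0 - Yn.NH g y                                ≡⟨ cong (_-_ (+ 0)) (sym (Yn.Nm10-Nm01 g y)) ⟩
    + 0 - Yn.Nm 1 0 (Yn.Nm 0 1 g) y                ≡⟨ cong (_-_ (+ 0)) (trans (CY.Nm-at-fixed (fix 1 0) (Yn.Nm 0 1 g)) (cong (+ p *_) (CY.Nm-at-fixed (fix 0 1) g))) ⟩
    + 0 - + p * (+ p * g y)                        ≡⟨ lem' (+ p) (g y) ⟩
    + p * (+ p * - g y) ∎)
    where
    g : ZVec sizeY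
    g = S ·ᶻ (π ·ᶻ v)
    lem : ∀ a b → b ≡ a - (a - b)
    lem = solve-∀
    lem' : ∀ p g → + 0 - p * (p * g) ≡ p * (p * - g)
    lem' = solve-∀

  divides-N : p ∣ N
  divides-N = finish (Good-invariant z z-inv z-div)
    where
    finish : Good z → p ∣ N
    finish (u' , g' , πu' , pu') = conclude
      where
      lift : ∃ λ j → (ι ·ᶻ j) ≐ (+ N ⊡ u ⊟ u')
      lift = exact (+ N ⊡ u ⊟ u') (λ i → trans (·-⊟ π (+ N ⊡ u) u' i) (ℤₚ.i≡j⇒i-j≡0
        (trans (·-⊡ π (+ N) u i) (trans (sym (RS (π ·ᶻ u) i)) (sym (πu' i))))))
      j : ZVec n
      j = proj₁ lift
      g₂ : ZVec sizeX
      g₂ = + N ⊡ v ⊞ g'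
      lhs : ZVec n
      lhs = + N ⊡ 1A ⊟ + p ⊡ j
      ι-lhs : (ι ·ᶻ lhs) ≐ Xn.NH g₂
      ι-lhs x = begin
        (ι ·ᶻ lhs) x                                        ≡⟨ trans (·-⊟ ι (+ N ⊡ 1A) (+ p ⊡ j) x) (cong₂ _-_ (·-⊡ ι (+ N) 1A x) (trans (·-⊡ ι (+ p) j x) (cong (+ p *_) (proj₂ lift x)))) ⟩
        + N * c x - + p * (+ N * u x - u' x)                ≡⟨ lem (+ N) (c x) (+ p) (u x) (u' x) ⟩
        + N * (c x - + p * u x) + + p * u' x                ≡⟨ cong₂ _+_ (cong (+ N *_) (sym (NH-v x))) (pu' x) ⟩
        + N * Xn.NH v x + Xn.NH g' x                        ≡⟨ cong (_+ Xn.NH g' x) (sym (Xn.NH-⊡ (+ N) v x)) ⟩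
        Xn.NH (+ N ⊡ v) x + Xn.NH g' x                      ≡⟨ sym (Xn.NH-⊞ (+ N ⊡ v) g' x) ⟩
        Xn.NH g₂ x ∎
        where
        lem : ∀ n c p u u' → n * c - p * (n * u - u') ≡ n * (c - p * u) + p * u'
        lem = solve-∀
      -- The norm of π g₂ is π ι `lhs` = 0, so flasqueness turns g₂ into a sum of terms (a - 1) y
      -- plus some ι j₃. The former have norm zero, which leaves N_H g₂ = ι N_H j₃.
      vanishing : ∃ λ (ys : Fin (p ℕ.* p) → ZVec (rank F)) → ∀ i → (π ·ᶻ g₂) i ≡ ∑ (λ a → (act F (elem a) ·ᶻ ys a) i - ys a i)
      vanishing = proj₂ F-flasque (p ℕ.* p) elem isSubgroup (π ·ᶻ g₂) (λ i → trans (Fn.NH≡∑elem (π ·ᶻ g₂) i)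
        (trans (sym (πn.NH-map g₂ i)) (trans (·-cong π (λ x → sym (ι-lhs x)) i) (comp0 lhs i))))
      ŷ : Fin (p ℕ.* p) → ZVec sizeX
      ŷ a = proj₁ (π-surj (proj₁ vanishing a))
      W : Fin (p ℕ.* p) → ZVec sizeX
      W a = act PX (elem a) ·ᶻ ŷ a ⊟ ŷ a
      rem : ZVec sizeX
      rem = g₂ ⊟ vsum W
      lift₃ : ∃ λ j₃ → (ι ·ᶻ j₃) ≐ rem
      lift₃ = exact rem (λ i → trans (·-⊟ π g₂ (vsum W) i) (ℤₚ.i≡j⇒i-j≡0 (trans (proj₂ vanishing i) (sym (trans (·-vsum π W i)
        (∑-cong (λ a → trans (·-⊟ π (act PX (elem a) ·ᶻ ŷ a) (ŷ a) i) (cong₂ _-_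
          (trans (gmap-· πᵍ (elem a) (ŷ a) i) (·-cong (act F (elem a)) (proj₂ (π-surj (proj₁ vanishing a))) i))
          (proj₂ (π-surj (proj₁ vanishing a)) i)))))))))
      j₃ : ZVec n
      j₃ = proj₁ lift₃
      NH-rem : Xn.NH rem ≐ Xn.NH g₂
      NH-rem x = trans (Xn.NH-⊟ g₂ (vsum W) x) (trans (cong (_-_ (Xn.NH g₂ x)) (trans (Xn.NH-vsum W x)
        (∑-0 (λ a → trans (Xn.NH-⊟ (act PX (elem a) ·ᶻ ŷ a) (ŷ a) x) (ℤₚ.i≡j⇒i-j≡0 (Xn.NH-T _ _ (ŷ a) x)))))) (ℤₚ.+-identityʳ (Xn.NH g₂ x)))
      same : (ι ·ᶻ lhs) ≐ (ι ·ᶻ En.NH j₃)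
      same x = trans (ι-lhs x) (trans (sym (NH-rem x)) (trans (Xn.NH-cong (λ y → sym (proj₂ lift₃ y)) x) (sym (ιn.NH-map j₃ x))))
      a₁ b₁ : ℤ
      a₁ = proj₁ (norm-α j₃)
      b₁ = proj₁ (norm-β j₃)
      -- Modulo constants N 1A - p j equals N_H j₃. The difference of the coordinates at α and β
      -- removes the constant, and the norm is divisible by p at both letters.
      N≡ : + N ≡ + p * ((j α + a₁) - (j β + b₁))
      N≡ = begin
        + N                                                  ≡⟨ lem (+ N) (+ p) (j α) a₁ ⟩
        (+ N * + 1 - + p * j α - + p * a₁) + + p * (j α + a₁) ≡⟨ cong (_+ + p * (j α + a₁)) eq ⟩
        (+ N * + 0 - + p * j β - + p * b₁) + + p * (j α + a₁) ≡⟨ lem' (+ N) (+ p) (j α) a₁ (j β) b₁ ⟩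
        + p * ((j α + a₁) - (j β + b₁)) ∎
        where
        lem : ∀ n p j a → n ≡ (n * + 1 - p * j - p * a) + p * (j + a)
        lem = solve-∀
        lem' : ∀ n p j a j' b → (n * + 0 - p * j' - p * b) + p * (j + a) ≡ p * ((j + a) - (j' + b))
        lem' = solve-∀
        eq : + N * + 1 - + p * j α - + p * a₁ ≡ + N * + 0 - + p * j β - + p * b₁
        eq = trans (cong₂ (λ s t → + N * s - + p * j α - t) (sym 1A-α) (sym (proj₂ (norm-α j₃))))
          (trans (ι-≡ lhs (En.NH j₃) same α β) (cong₂ (λ s t → + N * s - + p * j β - t) 1A-β (proj₂ (norm-β j₃))))
      conclude : p ∣ N
      conclude = divides ∣ (j α + a₁) - (j β + b₁) ∣ (trans (cong ∣_∣ N≡) (trans (ℤₚ.abs-* (+ p) ((j α + a₁) - (j β + b₁))) (ℕₚ.*-comm p _)))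

-- The cyclic permutation i ↦ i + 1

-- `Fin` splits off its first element, whereas the successor map has to single out the last one.
lastOr : ∀ {m} (i : Fin (suc m)) → i ≡ fromℕ m ⊎ ∃ λ j → i ≡ inject₁ j
lastOr {zero} zero = inj₁ refl
lastOr {suc m} zero = inj₂ (zero , refl)
lastOr {suc m} (suc i) with lastOr i
... | inj₁ e = inj₁ (cong suc e)
... | inj₂ (j , e) = inj₂ (suc j , cong suc e)

next : ∀ {m} → Fin (suc m) → Fin (suc m)
next i with lastOr i
... | inj₁ _ = zero
... | inj₂ (j , _) = suc j

prev : ∀ {m} → Fin (suc m) → Fin (suc m)
prev {m} zero = fromℕ m
prev (suc i) = inject₁ i

next-fromℕ : ∀ m → next (fromℕ m) ≡ zero
next-fromℕ m with lastOr (fromℕ m)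
... | inj₁ _ = refl
... | inj₂ (j , e) = ⊥-elim (fromℕ≢inject₁ e)

next-inject₁ : ∀ {m} (i : Fin m) → next (inject₁ i) ≡ suc i
next-inject₁ i with lastOr (inject₁ i)
... | inj₁ e = ⊥-elim (fromℕ≢inject₁ (sym e))
... | inj₂ (j , e) = cong suc (sym (inject₁-injective e))

next-prev : ∀ {m} (i : Fin (suc m)) → next (prev i) ≡ i
next-prev {m} zero = next-fromℕ m
next-prev (suc i) = next-inject₁ i

prev-next : ∀ {m} (i : Fin (suc m)) → prev (next i) ≡ i
prev-next i with lastOr i
... | inj₁ e = sym e
... | inj₂ (j , e) = sym e

cyc : ∀ m → Sym (suc m)
cyc m = permutation next prev next-prev prev-next

cycPow : ∀ {m} → ℕ → Sym (suc m)
cycPow zero = idₚ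
cycPow {m} (suc c) = cyc m ∙ cycPow c

cycPow-+ : ∀ {m} c d (i : Fin (suc m)) → cycPow (c ℕ.+ d) ⟨$⟩ʳ i ≡ cycPow c ⟨$⟩ʳ (cycPow d ⟨$⟩ʳ i)
cycPow-+ zero d i = refl
cycPow-+ (suc c) d i = cong next (cycPow-+ c d i)

cycPow-comm : ∀ {m} c d (i : Fin (suc m)) → cycPow c ⟨$⟩ʳ (cycPow d ⟨$⟩ʳ i) ≡ cycPow d ⟨$⟩ʳ (cycPow c ⟨$⟩ʳ i)
cycPow-comm c d i = trans (sym (cycPow-+ c d i)) (trans (cong (λ x → cycPow x ⟨$⟩ʳ i) (ℕₚ.+-comm c d)) (cycPow-+ d c i))

cycPow-toℕ : ∀ {m} (i : Fin (suc m)) → cycPow (toℕ i) ⟨$⟩ʳ zero ≡ i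
cycPow-toℕ {m} i = go (toℕ i) i refl
  where
  go : ∀ k (i : Fin (suc m)) → toℕ i ≡ k → cycPow k ⟨$⟩ʳ zero ≡ i
  go zero zero e = refl
  go (suc k) (suc i) e = trans (cong next (go k (inject₁ i) (trans (toℕ-inject₁ i) (ℕₚ.suc-injective e)))) (next-inject₁ i)

cycPow-period : ∀ {m} (i : Fin (suc m)) → cycPow (suc m) ⟨$⟩ʳ i ≡ i
cycPow-period {m} i = begin
  cycPow (suc m) ⟨$⟩ʳ i                             ≡⟨ cong (cycPow (suc m) ⟨$⟩ʳ_) (sym (cycPow-toℕ i)) ⟩
  cycPow (suc m) ⟨$⟩ʳ (cycPow (toℕ i) ⟨$⟩ʳ zero)    ≡⟨ cycPow-comm (suc m) (toℕ i) zero ⟩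
  cycPow (toℕ i) ⟨$⟩ʳ (cycPow (suc m) ⟨$⟩ʳ zero)    ≡⟨ cong (cycPow (toℕ i) ⟨$⟩ʳ_) (trans (cong next full) (next-fromℕ m)) ⟩
  cycPow (toℕ i) ⟨$⟩ʳ zero                          ≡⟨ cycPow-toℕ i ⟩
  i ∎
  where
  full : cycPow m ⟨$⟩ʳ zero ≡ fromℕ m
  full = trans (cong (λ x → cycPow {m} x ⟨$⟩ʳ zero) (sym (toℕ-fromℕ m))) (cycPow-toℕ (fromℕ m))

cycPow-period* : ∀ {m} u (i : Fin (suc m)) → cycPow (u ℕ.* suc m) ⟨$⟩ʳ i ≡ i
cycPow-period* zero i = refl
cycPow-period* {m} (suc u) i = trans (cycPow-+ (suc m) (u ℕ.* suc m) i) (trans (cycPow-period _) (cycPow-period* u i))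

cycPow-faithful : ∀ {m k l} → k ℕ.< suc m → l ℕ.< suc m → cycPow {m} k ⟨$⟩ʳ zero ≡ cycPow l ⟨$⟩ʳ zero → k ≡ l
cycPow-faithful {m} k< l< e = trans (sym (at k<)) (trans (cong toℕ e) (at l<))
  where
  at : ∀ {k} → k ℕ.< suc m → toℕ (cycPow {m} k ⟨$⟩ʳ zero) ≡ k
  at {k} k< = trans (cong (λ x → toℕ (cycPow {m} x ⟨$⟩ʳ zero)) (sym (toℕ-fromℕ< k<))) (trans (cong toℕ (cycPow-toℕ (fromℕ< k<))) (toℕ-fromℕ< k<))

-- The orbit sum is unchanged when the starting letter moves by one step; averaging over all
-- starting letters identifies it with the full sum.
∑-cycle : ∀ {m} (w : Fin (suc m) → ℤ) r → ∑ {suc m} (λ t → w (cycPow (toℕ t) ⟨$⟩ˡ r)) ≡ ∑ w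
∑-cycle {m} w r = trans (const (toℕ r) r (cycPow-toℕ r)) (pos-*-cancel {+ suc m} refl (begin
  + suc m * φ zero                                                  ≡⟨ sym (∑-const (suc m) (φ zero)) ⟩
  ∑ {suc m} (λ _ → φ zero)                                          ≡⟨ ∑-cong {suc m} (λ i → sym (const (toℕ i) i (cycPow-toℕ i))) ⟩
  ∑ {suc m} (λ i → ∑ {suc m} (λ t → w (cycPow (toℕ t) ⟨$⟩ˡ i)))     ≡⟨ ∑-swap {suc m} {suc m} (λ i t → w (cycPow (toℕ t) ⟨$⟩ˡ i)) ⟩
  ∑ {suc m} (λ t → ∑ {suc m} (λ i → w (cycPow (toℕ t) ⟨$⟩ˡ i)))     ≡⟨ ∑-cong {suc m} (λ t → sym (∑-permute w (flip (cycPow (toℕ t))))) ⟩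
  ∑ {suc m} (λ t → ∑ w)                                             ≡⟨ ∑-const (suc m) (∑ w) ⟩
  + suc m * ∑ w ∎))
  where
  φ : Fin (suc m) → ℤ
  φ i = ∑ {suc m} (λ t → w (cycPow (toℕ t) ⟨$⟩ˡ i))
  step : ∀ i → φ (next i) ≡ φ i
  step i = trans (sym (∑-suc-toℕ (suc m) (λ t → w (cycPow t ⟨$⟩ˡ next i)) (cong w (periodˡ (next i)))))
    (∑-cong {suc m} (λ t → cong (λ x → w (cycPow (toℕ t) ⟨$⟩ˡ x)) (prev-next i)))
    where
    periodˡ : ∀ i → cycPow (suc m) ⟨$⟩ˡ i ≡ i
    periodˡ i = trans (cong (cycPow (suc m) ⟨$⟩ˡ_) (sym (cycPow-period i))) (inverseˡ (cycPow (suc m)))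
  const : ∀ k i → cycPow k ⟨$⟩ʳ zero ≡ i → φ i ≡ φ zero
  const zero i refl = refl
  const (suc k) i refl = trans (step (cycPow k ⟨$⟩ʳ zero)) (const k _ refl)

record Rotation (p : ℕ) : Set where
  field
    pow : ℕ → Sym p
    origin : Fin p
    pow-0 : ∀ r → pow 0 ⟨$⟩ʳ r ≡ r
    pow-+ : ∀ c d r → pow (c ℕ.+ d) ⟨$⟩ʳ r ≡ pow c ⟨$⟩ʳ (pow d ⟨$⟩ʳ r)
    pow-period : ∀ u r → pow (u ℕ.* p) ⟨$⟩ʳ r ≡ r
    pow-faithful : ∀ {k l} → k ℕ.< p → l ℕ.< p → pow k ⟨$⟩ʳ origin ≡ pow l ⟨$⟩ʳ origin → k ≡ l
    ∑-pow : ∀ (w : Fin p → ℤ) r → ∑ {p} (λ t → w (pow (toℕ t) ⟨$⟩ˡ r)) ≡ ∑ w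
    positive : ∃ λ m → + p ≡ + suc m

  pow-0ˡ : ∀ r → pow 0 ⟨$⟩ˡ r ≡ r
  pow-0ˡ r = trans (cong (pow 0 ⟨$⟩ˡ_) (sym (pow-0 r))) (inverseˡ (pow 0))

  point : Fin p → ℤ
  point = unit origin

  ∑-point : ∑ point ≡ + 1
  ∑-point = trans (∑-single point origin (λ j j≢ → χ-no (origin ≟ j) (λ e → j≢ (sym e)))) (χ-yes (origin ≟ origin) refl)

cyclicRotation : ∀ m → Rotation (suc m)
cyclicRotation m = record
  { pow = cycPow ; origin = zero ; pow-0 = λ _ → refl ; pow-+ = cycPow-+ ; pow-period = cycPow-period*
  ; pow-faithful = cycPow-faithful ; ∑-pow = ∑-cycle ; positive = m , refl }

-- Rotating the b blocks of size p independently

module Blocks (b p : ℕ) {{nz : ℕ.NonZero p}} (C : Rotation p) where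

  open Rotation C

  blk : Fin (b ℕ.* p) → Fin b
  blk x = proj₁ (remQuot p x)

  pos : Fin (b ℕ.* p) → Fin p
  pos x = proj₂ (remQuot {b} p x)

  blk-combine : ∀ i r → blk (combine i r) ≡ i
  blk-combine i r = cong proj₁ (remQuot-combine {b} {p} i r)

  pos-combine : ∀ i r → pos (combine i r) ≡ r
  pos-combine i r = cong proj₂ (remQuot-combine {b} {p} i r)

  combine-blk-pos : ∀ x → combine (blk x) (pos x) ≡ x
  combine-blk-pos = combine-remQuot {b} p

  rotate : (Fin b → ℕ) → Sym (b ℕ.* p)
  rotate s = permutation (λ x → combine (blk x) (pow (s (blk x)) ⟨$⟩ʳ pos x)) (λ x → combine (blk x) (pow (s (blk x)) ⟨$⟩ˡ pos x))
    (λ x → trans (cong₂ (λ i r → combine i (pow (s i) ⟨$⟩ʳ r)) (blk-combine _ _) (pos-combine (blk x) (pow (s (blk x)) ⟨$⟩ˡ pos x)))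
      (trans (cong (combine (blk x)) (inverseʳ (pow (s (blk x))))) (combine-blk-pos x)))
    (λ x → trans (cong₂ (λ i r → combine i (pow (s i) ⟨$⟩ˡ r)) (blk-combine _ _) (pos-combine (blk x) (pow (s (blk x)) ⟨$⟩ʳ pos x)))
      (trans (cong (combine (blk x)) (inverseˡ (pow (s (blk x))))) (combine-blk-pos x)))

  rotateʳ : ∀ s i r → rotate s ⟨$⟩ʳ combine i r ≡ combine i (pow (s i) ⟨$⟩ʳ r)
  rotateʳ s i r = cong₂ (λ i r → combine i (pow (s i) ⟨$⟩ʳ r)) (blk-combine i r) (pos-combine i r)

  rotateˡ : ∀ s i r → rotate s ⟨$⟩ˡ combine i r ≡ combine i (pow (s i) ⟨$⟩ˡ r)
  rotateˡ s i r = cong₂ (λ i r → combine i (pow (s i) ⟨$⟩ˡ r)) (blk-combine i r) (pos-combine i r)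

  blockwise : ∀ {P : Fin (b ℕ.* p) → Set} → (∀ i r → P (combine i r)) → ∀ x → P x
  blockwise {P} f x = subst P (combine-blk-pos x) (f (blk x) (pos x))

  block∑ : ZVec (b ℕ.* p) → Fin b → ℤ
  block∑ w i = ∑ {p} (λ r → w (combine i r))

  -- The group {rotate (s k l)} for a linear family of shifts whose values on the blocks i₀, i₁ are k, l.
  module Family (s : ℕ → ℕ → Fin b → ℕ) (s-+ : ∀ k l k' l' i → s (k ℕ.+ k') (l ℕ.+ l') i ≡ s k l i ℕ.+ s k' l' i)
                (s-0 : ∀ i → s 0 0 i ≡ 0) (s-p0 : ∀ i → ∃ λ u → s p 0 i ≡ u ℕ.* p) (s-0p : ∀ i → ∃ λ u → s 0 p i ≡ u ℕ.* p)
                (i₀ i₁ : Fin b) (s-i₀ : ∀ k l → s k l i₀ ≡ k) (s-i₁ : ∀ k l → s k l i₁ ≡ l) where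

    bicyclic : Bicyclic p (b ℕ.* p)
    bicyclic = record
      { h = λ k l → rotate (s k l)
      ; h-∙ = λ k l k' l' → blockwise λ i r → trans (cong (rotate (s k l) ⟨$⟩ʳ_) (rotateʳ (s k' l') i r)) (trans (rotateʳ (s k l) i _)
          (trans (cong (combine i) (trans (sym (pow-+ (s k l i) (s k' l' i) r)) (cong (λ x → pow x ⟨$⟩ʳ r) (sym (s-+ k l k' l' i)))))
            (sym (rotateʳ (s (k ℕ.+ k') (l ℕ.+ l')) i r))))
      ; h-0 = blockwise λ i r → trans (rotateʳ (s 0 0) i r) (cong (combine i) (trans (cong (λ x → pow x ⟨$⟩ʳ r) (s-0 i)) (pow-0 r)))
      ; h-p0 = blockwise λ i r → trans (rotateʳ (s p 0) i r) (cong (combine i) (trans (cong (λ x → pow x ⟨$⟩ʳ r) (proj₂ (s-p0 i))) (pow-period (proj₁ (s-p0 i)) r)))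
      ; h-0p = blockwise λ i r → trans (rotateʳ (s 0 p) i r) (cong (combine i) (trans (cong (λ x → pow x ⟨$⟩ʳ r) (proj₂ (s-0p i))) (pow-period (proj₁ (s-0p i)) r)))
      ; faithful = λ {k} {l} {k'} {l'} k< l< k'< l'< e →
          pow-faithful k< k'< (subst₂ (λ x y → pow x ⟨$⟩ʳ origin ≡ pow y ⟨$⟩ʳ origin) (s-i₀ k l) (s-i₀ k' l') (at k l k' l' e i₀)) ,
          pow-faithful l< l'< (subst₂ (λ x y → pow x ⟨$⟩ʳ origin ≡ pow y ⟨$⟩ʳ origin) (s-i₁ k l) (s-i₁ k' l') (at k l k' l' e i₁))
      }
      where
      at : ∀ k l k' l' → rotate (s k l) ≈ₚ rotate (s k' l') → ∀ i → pow (s k l i) ⟨$⟩ʳ origin ≡ pow (s k' l' i) ⟨$⟩ʳ origin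
      at k l k' l' e i = combine-injectiveʳ i _ i _ (trans (sym (rotateʳ (s k l) i origin)) (trans (e (combine i origin)) (rotateʳ (s k' l') i origin)))

    open BicyclicGroup bicyclic
    module En = Norms (GSet.lattice (points (b ℕ.* p))) (GSet.lattice-isGLattice (points (b ℕ.* p)))

    T-combine : ∀ k l w i r → En.T k l w (combine i r) ≡ w (combine i (pow (s k l i) ⟨$⟩ˡ r))
    T-combine k l w i r = trans (GSet.act-lattice (points (b ℕ.* p)) (rotate (s k l)) w (combine i r)) (cong w (rotateˡ (s k l) i r))

    block∑-T : ∀ k l w i → block∑ (En.T k l w) i ≡ block∑ w i
    block∑-T k l w i = trans (∑-cong {p} (λ r → T-combine k l w i r)) (sym (∑-permute (λ r → w (combine i r)) (flip (pow (s k l i)))))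

    -- Block sums are invariant under the group, so the sum of the norm over a block is p times the
    -- block sum, and it is also p κ.
    block∑-Nm : ∀ k l w κ → (∀ x → En.Nm k l w x ≡ κ) → ∀ i → block∑ w i ≡ κ
    block∑-Nm k l w κ e i = pos-*-cancel (proj₂ positive) (begin
      + p * block∑ w i                                                     ≡⟨ sym (∑-const p (block∑ w i)) ⟩
      ∑ {p} (λ _ → block∑ w i)                                             ≡⟨ ∑-cong {p} (λ t → sym (block∑-T (toℕ t ℕ.* k) (toℕ t ℕ.* l) w i)) ⟩
      ∑ {p} (λ t → block∑ (En.T (toℕ t ℕ.* k) (toℕ t ℕ.* l) w) i)          ≡⟨ ∑-swap {p} {p} (λ t r → En.T (toℕ t ℕ.* k) (toℕ t ℕ.* l) w (combine i r)) ⟩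
      ∑ {p} (λ r → En.Nm k l w (combine i r))                              ≡⟨ ∑-cong {p} (λ r → e (combine i r)) ⟩
      ∑ {p} (λ _ → κ)                                                      ≡⟨ ∑-const p κ ⟩
      + p * κ ∎)

    Nm-fixed : ∀ k l w i r → (∀ t → s (t ℕ.* k) (t ℕ.* l) i ≡ 0) → En.Nm k l w (combine i r) ≡ + p * w (combine i r)
    Nm-fixed k l w i r e = trans (∑-cong {p} (λ t → trans (T-combine (toℕ t ℕ.* k) (toℕ t ℕ.* l) w i r) (trans (cong (λ x → w (combine i (pow x ⟨$⟩ˡ r))) (e (toℕ t))) (cong (λ x → w (combine i x)) (pow-0ˡ r)))))
      (∑-const p (w (combine i r)))

    Nm-moved : ∀ k l w i r → (∀ t → s (t ℕ.* k) (t ℕ.* l) i ≡ t) → En.Nm k l w (combine i r) ≡ block∑ w i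
    Nm-moved k l w i r e = trans (∑-cong {p} (λ t → trans (T-combine (toℕ t ℕ.* k) (toℕ t ℕ.* l) w i r) (cong (λ x → w (combine i (pow x ⟨$⟩ˡ r))) (e (toℕ t)))))
      (∑-pow (λ r → w (combine i r)) r)

  onBlocks : (Fin b → ℤ) → (Fin p → ℤ) → ZVec (b ℕ.* p)
  onBlocks f g x = f (blk x) * g (pos x)

  onBlocks-combine : ∀ f g i r → onBlocks f g (combine i r) ≡ f i * g r
  onBlocks-combine f g i r = cong₂ (λ i r → f i * g r) (blk-combine i r) (pos-combine i r)

  block∑-onBlocks : ∀ f g i → block∑ (onBlocks f g) i ≡ f i * ∑ g
  block∑-onBlocks f g i = trans (∑-cong {p} (λ r → onBlocks-combine f g i r)) (∑-*ˡ (f i) g)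

-- a rotates the block i₀ and b all the others.
module OddBlocks (b p : ℕ) {{_ : ℕ.NonZero p}} (C : Rotation p) (i₀ i₁ : Fin b) (i₁≢i₀ : i₁ ≢ i₀) where

  open Rotation C
  open Blocks b p C

  s : ℕ → ℕ → Fin b → ℕ
  s k l i with i ≟ i₀
  ... | yes _ = k
  ... | no _ = l

  s-in : ∀ k l {i} → i ≡ i₀ → s k l i ≡ k
  s-in k l {i} e with i ≟ i₀
  ... | yes _ = refl
  ... | no ¬e = ⊥-elim (¬e e)

  s-out : ∀ k l {i} → i ≢ i₀ → s k l i ≡ l
  s-out k l {i} ¬e with i ≟ i₀
  ... | yes e = ⊥-elim (¬e e)
  ... | no _ = refl

  s-+ : ∀ k l k' l' i → s (k ℕ.+ k') (l ℕ.+ l') i ≡ s k l i ℕ.+ s k' l' i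
  s-+ k l k' l' i with i ≟ i₀
  ... | yes _ = refl
  ... | no _ = refl

  s-0 : ∀ i → s 0 0 i ≡ 0
  s-0 i with i ≟ i₀
  ... | yes _ = refl
  ... | no _ = refl

  s-p0 : ∀ i → ∃ λ u → s p 0 i ≡ u ℕ.* p
  s-p0 i with i ≟ i₀
  ... | yes _ = 1 , sym (ℕₚ.+-identityʳ p)
  ... | no _ = 0 , refl

  s-0p : ∀ i → ∃ λ u → s 0 p i ≡ u ℕ.* p
  s-0p i with i ≟ i₀
  ... | yes _ = 0 , refl
  ... | no _ = 1 , sym (ℕₚ.+-identityʳ p)

  open Family s s-+ s-0 s-p0 s-0p i₀ i₁ (λ k l → s-in k l refl) (λ k l → s-out k l i₁≢i₀) public

  -- Each block is rotated by exactly one of the two exponents: summing over that exponent gives the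
  -- block sum, and over the other a factor p.
  NH-combine : ∀ w i r → En.NH w (combine i r) ≡ + p * block∑ w i
  NH-combine w i r with i ≟ i₀
  ... | yes e = trans (∑-cong {p} (λ l → trans (∑-cong {p} (λ k → trans (T-combine (toℕ k) (toℕ l) w i r)
      (cong (λ x → w (combine i (pow x ⟨$⟩ˡ r))) (s-in (toℕ k) (toℕ l) e)))) (∑-pow (λ r → w (combine i r)) r)))
    (∑-const p (block∑ w i))
  ... | no ¬e = trans (∑-swap {p} {p} (λ l k → En.T (toℕ k) (toℕ l) w (combine i r)))
    (trans (∑-cong {p} (λ k → trans (∑-cong {p} (λ l → trans (T-combine (toℕ k) (toℕ l) w i r)
      (cong (λ x → w (combine i (pow x ⟨$⟩ˡ r))) (s-out (toℕ k) (toℕ l) ¬e)))) (∑-pow (λ r → w (combine i r)) r)))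
    (∑-const p (block∑ w i)))

  -- Modulo constants the indicator of block i₀ is minus that of all the other blocks. The second
  -- form, `f-B`, is a norm from the subgroups generated by a^i b, because these rotate every other
  -- block.
  fA fB f-B : Fin b → ℤ
  fA i = χ (i ≟ i₀)
  fB i = + 1 - χ (i ≟ i₀)
  f-B i = χ (i ≟ i₀) - + 1

  one : Fin p → ℤ
  one _ = + 1

  private
    fsupp fgen : Fin (suc p) → Fin b → ℤ
    fsupp zero = fA
    fsupp (suc _) = fB
    fgen zero = fA
    fgen (suc _) = f-B

    moved₀ : ∀ t → t ℕ.* 0 ≡ 0
    moved₀ = ℕₚ.*-zeroʳ
    moved₁ : ∀ t → t ℕ.* 1 ≡ t
    moved₁ = ℕₚ.*-identityʳ

    fA-in : ∀ {i} → i ≡ i₀ → fA i ≡ + 1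
    fA-in {i} e = χ-yes (i ≟ i₀) e
    fA-out : ∀ {i} → i ≢ i₀ → fA i ≡ + 0
    fA-out {i} ¬e = χ-no (i ≟ i₀) ¬e

    outside : ∀ κ a {x} → x ≡ + 0 → κ ≡ κ + x * a
    outside κ a refl = lem κ a
      where
      lem : ∀ κ a → κ ≡ κ + + 0 * a
      lem = solve-∀
    inside : ∀ κ a {x} → x ≡ + 1 → a ≡ κ + x * (a - κ)
    inside κ a refl = lem κ a
      where
      lem : ∀ κ a → a ≡ κ + + 1 * (a - κ)
      lem = solve-∀

    com-value : ∀ w κ r δ → (∀ x → En.Nm (dirₖ δ) (dirₗ δ) w x ≡ κ) → ∀ i → Dec (i ≡ i₀) →
                En.Nm (comₖ δ) (comₗ δ) w (combine i r) ≡ κ + fsupp δ i * (+ p * w (combine i r) - κ)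
    com-value w κ r zero e i (yes q) = trans (Nm-fixed 0 1 w i r (λ t → trans (s-in (t ℕ.* 0) (t ℕ.* 1) q) (moved₀ t))) (inside κ _ (fA-in q))
    com-value w κ r zero e i (no q) = trans (Nm-moved 0 1 w i r (λ t → trans (s-out (t ℕ.* 0) (t ℕ.* 1) q) (moved₁ t)))
      (trans (block∑-Nm 1 0 w κ e i) (outside κ _ (fA-out q)))
    com-value w κ r (suc j) e i (yes q) = trans (Nm-moved 1 0 w i r (λ t → trans (s-in (t ℕ.* 1) (t ℕ.* 0) q) (moved₁ t)))
      (trans (block∑-Nm (toℕ j) 1 w κ e i) (outside κ _ (cong (_-_ (+ 1)) (fA-in q))))
    com-value w κ r (suc j) e i (no q) = trans (Nm-fixed 1 0 w i r (λ t → trans (s-out (t ℕ.* 1) (t ℕ.* 0) q) (moved₀ t)))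
      (inside κ _ (cong (_-_ (+ 1)) (fA-out q)))

    total : ∀ f i → block∑ (onBlocks f point) i ≡ f i
    total f i = trans (block∑-onBlocks f point i) (trans (cong (f i *_) ∑-point) (ℤₚ.*-identityʳ (f i)))

    zeros : ∀ f i r k l → f i ≡ + 0 → En.Nm k l (onBlocks f point) (combine i r) ≡ f i
    zeros f i r k l e = trans (∑-0 {p} (λ t → trans (T-combine (toℕ t ℕ.* k) (toℕ t ℕ.* l) (onBlocks f point) i r)
      (trans (onBlocks-combine f point i (pow (s (toℕ t ℕ.* k) (toℕ t ℕ.* l) i) ⟨$⟩ˡ r)) (trans (cong (_* point (pow (s (toℕ t ℕ.* k) (toℕ t ℕ.* l) i) ⟨$⟩ˡ r)) e)
        (ℤₚ.*-zeroˡ (point (pow (s (toℕ t ℕ.* k) (toℕ t ℕ.* l) i) ⟨$⟩ˡ r))))))) (sym e)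

    gen-value : ∀ r δ i → Dec (i ≡ i₀) → En.Nm (dirₖ δ) (dirₗ δ) (onBlocks (fgen δ) point) (combine i r) ≡ fgen δ i
    gen-value r zero i (yes q) = trans (Nm-moved 1 0 (onBlocks fA point) i r (λ t → trans (s-in (t ℕ.* 1) (t ℕ.* 0) q) (moved₁ t))) (total fA i)
    gen-value r zero i (no q) = zeros fA i r 1 0 (fA-out q)
    gen-value r (suc j) i (yes q) = zeros f-B i r (toℕ j) 1 (cong (_- + 1) (fA-in q))
    gen-value r (suc j) i (no q) = trans (Nm-moved (toℕ j) 1 (onBlocks f-B point) i r (λ t → trans (s-out (t ℕ.* toℕ j) (t ℕ.* 1) q) (moved₁ t))) (total f-B i)

    fval : Fin (suc p) → ℤ
    fval zero = + 0
    fval (suc _) = + 1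

    fA-fgen : ∀ δ i → fA i - fgen δ i ≡ fval δ
    fA-fgen zero i = ℤₚ.+-inverseʳ (fA i)
    fA-fgen (suc _) i = lem (fA i)
      where
      lem : ∀ a → a - (a - + 1) ≡ + 1
      lem = solve-∀

    1A-gen : ∀ δ x → onBlocks fA one x - En.Nm (dirₖ δ) (dirₗ δ) (onBlocks (fgen δ) point) x ≡ fval δ
    1A-gen δ = blockwise λ i r → trans (cong₂ _-_ (trans (onBlocks-combine fA one i r) (ℤₚ.*-identityʳ (fA i))) (gen-value r δ i (i ≟ i₀))) (fA-fgen δ i)

  oddAction : OddAction bicyclic
  oddAction = record
    { 1A = onBlocks fA one
    ; supp = λ δ → onBlocks (fsupp δ) one
    ; base = λ δ → onBlocks (fsupp δ) point
    ; gen = λ δ → onBlocks (fgen δ) point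
    ; supp-inv = λ δ → blockwise λ i r → trans (cong (onBlocks (fsupp δ) one) (rotateˡ (s (dirₖ δ) (dirₗ δ)) i r))
        (trans (onBlocks-combine (fsupp δ) one i _) (sym (onBlocks-combine (fsupp δ) one i r)))
    ; norm-com = λ δ w κ e → blockwise λ i r → trans (com-value w κ r δ e i (i ≟ i₀))
        (cong (λ a → κ + a * (+ p * w (combine i r) - κ)) (sym (trans (onBlocks-combine (fsupp δ) one i r) (ℤₚ.*-identityʳ (fsupp δ i)))))
    ; supp-norm = λ δ → blockwise λ i r → trans (cong (+ p *_) (trans (onBlocks-combine (fsupp δ) one i r) (cong (fsupp δ i *_) (sym ∑-point))))
        (sym (trans (NH-combine (onBlocks (fsupp δ) point) i r) (cong (+ p *_) (block∑-onBlocks (fsupp δ) point i))))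
    ; 1A-norm = λ δ x y → trans (1A-gen δ x) (sym (1A-gen δ y))
    ; α = combine i₀ origin
    ; β = combine i₁ origin
    ; 1A-α = trans (onBlocks-combine fA one i₀ origin) (trans (ℤₚ.*-identityʳ (fA i₀)) (fA-in refl))
    ; 1A-β = trans (onBlocks-combine fA one i₁ origin) (trans (ℤₚ.*-identityʳ (fA i₁)) (fA-out i₁≢i₀))
    ; norm-α = λ w → block∑ w i₀ , NH-combine w i₀ origin
    ; norm-β = λ w → block∑ w i₁ , NH-combine w i₁ origin
    }

-- First homology of a Klein four-group with permutation coefficients: it is generated by the classes of
-- vectors f₁, f₂, f₃ invariant under the three involutions.
module Klein {r : ℕ} (α β : Fin r → Fin r) (αα : ∀ t → α (α t) ≡ t) (ββ : ∀ t → β (β t) ≡ t)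
             (αβ : ∀ t → α (β t) ≡ β (α t)) (Y Z : ZVec r)
             (rel : ∀ t → (Y (α t) - Y t) + (Z (β t) - Z t) ≡ + 0) where

  -- A label for the orbit of t under β: the smaller index in it.
  μ : Fin r → ℕ
  μ t = toℕ t ℕ.⊓ toℕ (β t)

  μ-β : ∀ t → μ (β t) ≡ μ t
  μ-β t = trans (cong (λ x → toℕ (β t) ℕ.⊓ toℕ x) (ββ t)) (ℕₚ.⊓-comm (toℕ (β t)) (toℕ t))

  μ-αβ : ∀ t → μ (α (β t)) ≡ μ (α t)
  μ-αβ t = trans (cong μ (αβ t)) (μ-β (α t))

  -- The β-orbits moved by α come in pairs, and this selects one orbit of each pair.
  Λ? : ∀ t → Dec (μ t ℕ.< μ (α t))
  Λ? t = μ t ℕ.<? μ (α t)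

  -- Y and Z are changed by the boundary of m, chosen so that Z' vanishes on the orbit of each pair
  -- that was not selected. The relation then forces Y' to be invariant under α on both orbits of
  -- the pair.
  m Y' Z' : ZVec r
  m t = χ (Λ? t) * Z (α t)
  Y' t = Y t + (m (β t) - m t)
  Z' t = Z t - (m (α t) - m t)

  rel' : ∀ t → (Y' (α t) - Y' t) + (Z' (β t) - Z' t) ≡ + 0
  rel' t = trans (cong (λ x → ((Y (α t) + (x - m (α t))) - Y' t) + (Z' (β t) - Z' t)) (cong m (sym (αβ t))))
    (trans (lem (Y (α t)) (Y t) (Z (β t)) (Z t) (m (α (β t))) (m (α t)) (m (β t)) (m t)) (rel t))
    where
    lem : ∀ y' y z' z ab a b o → ((y' + (ab - a)) - (y + (b - o))) + ((z' - (ab - b)) - (z - (a - o))) ≡ (y' - y) + (z' - z)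
    lem = solve-∀

  m-off : ∀ t → ¬ (μ t ℕ.< μ (α t)) → m t ≡ + 0
  m-off t ¬λ = trans (cong (_* Z (α t)) (χ-no (Λ? t) ¬λ)) (ℤₚ.*-zeroˡ (Z (α t)))

  Z'-α : ∀ t → μ t ℕ.< μ (α t) → Z' (α t) ≡ + 0
  Z'-α t λt = begin
    Z (α t) - (m (α (α t)) - m (α t))      ≡⟨ cong₂ (λ x y → Z (α t) - (x - y)) (trans (cong m (αα t)) (trans (cong (_* Z (α t)) (χ-yes (Λ? t) λt)) (ℤₚ.*-identityˡ (Z (α t)))))
                                                (m-off (α t) (λ q → ℕₚ.<-asym λt (subst (μ (α t) ℕ.<_) (cong μ (αα t)) q))) ⟩
    Z (α t) - (Z (α t) - + 0)              ≡⟨ lem (Z (α t)) ⟩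
    + 0 ∎
    where
    lem : ∀ z → z - (z - + 0) ≡ + 0
    lem = solve-∀

  zero-left : ∀ {a b : ℤ} → a + b ≡ + 0 → b ≡ + 0 → a ≡ + 0
  zero-left {a} e refl = trans (sym (ℤₚ.+-identityʳ a)) e

  zero-right : ∀ {a b : ℤ} → a + b ≡ + 0 → a ≡ + 0 → b ≡ + 0
  zero-right {b = b} e refl = trans (sym (ℤₚ.+-identityˡ b)) e

  Y'-less : ∀ t → μ t ℕ.< μ (α t) → Y' (α t) ≡ Y' t
  Y'-less t λt = sym (ℤₚ.i-j≡0⇒i≡j (Y' t) (Y' (α t)) (trans (cong (λ x → Y' x - Y' (α t)) (sym (αα t)))
    (zero-left (rel' (α t)) (ℤₚ.i≡j⇒i-j≡0 (trans (trans (cong Z' (sym (αβ t))) (Z'-α (β t) λβt)) (sym (Z'-α t λt)))))))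
    where
    λβt : μ (β t) ℕ.< μ (α (β t))
    λβt = subst₂ ℕ._<_ (sym (μ-β t)) (sym (μ-αβ t)) λt

  Y'-inv : ∀ t → μ t ≢ μ (α t) → Y' (α t) ≡ Y' t
  Y'-inv t ≢ with ℕₚ.<-cmp (μ t) (μ (α t))
  ... | tri< lt _ _ = Y'-less t lt
  ... | tri≈ _ e _ = ⊥-elim (≢ e)
  ... | tri> _ _ gt = sym (trans (cong Y' (sym (αα t))) (Y'-less (α t) (subst (μ (α t) ℕ.<_) (cong μ (sym (αα t))) gt)))

  Z'-inv : ∀ t → Y' (α t) ≡ Y' t → Z' (β t) ≡ Z' t
  Z'-inv t e = ℤₚ.i-j≡0⇒i≡j (Z' (β t)) (Z' t) (zero-right (rel' t) (ℤₚ.i≡j⇒i-j≡0 e))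

  -- Equal labels mean that α preserves the orbit of t under β, which has at most two points.
  μ-eq : ∀ t → μ t ≡ μ (α t) → α t ≡ t ⊎ α t ≡ β t
  μ-eq t e with ℕₚ.⊓-sel (toℕ t) (toℕ (β t)) | ℕₚ.⊓-sel (toℕ (α t)) (toℕ (β (α t)))
  ... | inj₁ p | inj₁ q = inj₁ (sym (toℕ-injective (trans (sym p) (trans e q))))
  ... | inj₁ p | inj₂ q = inj₂ (trans (sym (ββ (α t))) (cong β (sym (toℕ-injective (trans (sym p) (trans e q))))))
  ... | inj₂ p | inj₁ q = inj₂ (sym (toℕ-injective (trans (sym p) (trans e q))))
  ... | inj₂ p | inj₂ q = inj₁ (sym (trans (sym (ββ t)) (trans (cong β (toℕ-injective (trans (sym p) (trans e q)))) (ββ (α t)))))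

  E? : ∀ t → Dec (α t ≡ β t)
  E? t = α t ≟ β t

  E-α : ∀ t → α t ≡ β t → α (α t) ≡ β (α t)
  E-α t e = trans (cong α e) (αβ t)

  E-α⁻ : ∀ t → α (α t) ≡ β (α t) → α t ≡ β t
  E-α⁻ t e = trans (cong α (sym (αα t))) (trans (E-α (α t) e) (cong β (αα t)))

  E-β : ∀ t → α t ≡ β t → α (β t) ≡ β (β t)
  E-β t e = trans (αβ t) (cong β e)

  χ-α : ∀ t → χ (E? (α t)) ≡ χ (E? t)
  χ-α t = χ-cong (E? (α t)) (E? t) (E-α⁻ t) (E-α t)

  -- Where α and β agree, αβ is trivial and all of Y' can be given to `f₃`; elsewhere Y' is already
  -- invariant under α. The shift by `f₃ (α t)` in `f₂` comes from ab - 1 = (a - 1) + (b - 1) a.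
  f₁ f₂ f₃ : ZVec r
  f₃ t = χ (E? t) * Y' t
  f₁ t = Y' t - f₃ t
  f₂ t = Z' t - f₃ (α t)

  decompose-Y : ∀ t → Y t ≡ (f₁ t + f₃ t) - (m (β t) - m t)
  decompose-Y t = lem (Y t) (m (β t) - m t) (f₃ t)
    where
    lem : ∀ y d f → y ≡ ((y + d) - f + f) - d
    lem = solve-∀

  decompose-Z : ∀ t → Z t ≡ (f₂ t + f₃ (α t)) + (m (α t) - m t)
  decompose-Z t = lem (Z t) (m (α t) - m t) (f₃ (α t))
    where
    lem : ∀ y d f → y ≡ ((y - d) - f + f) + d
    lem = solve-∀

  f₁-inv : ∀ t → f₁ (α t) ≡ f₁ t
  f₁-inv t = by (E? t) (μ t ℕ.≟ μ (α t))
    where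
    zeroed : ∀ t → α t ≡ β t → f₁ t ≡ + 0
    zeroed t e = trans (cong (λ x → Y' t - x * Y' t) (χ-yes (E? t) e)) (lem (Y' t))
      where
      lem : ∀ y → y - + 1 * y ≡ + 0
      lem = solve-∀
    by : Dec (α t ≡ β t) → Dec (μ t ≡ μ (α t)) → f₁ (α t) ≡ f₁ t
    by (yes e) _ = trans (zeroed (α t) (E-α t e)) (sym (zeroed t e))
    by (no ¬e) (no ≢) = cong₂ (λ x y → x - y * x) (Y'-inv t ≢) (χ-α t)
    by (no ¬e) (yes e) with μ-eq t e
    ... | inj₁ q = cong f₁ q
    ... | inj₂ q = ⊥-elim (¬e q)

  f₂-inv : ∀ t → f₂ (β t) ≡ f₂ t
  f₂-inv t = by (E? t) (μ t ℕ.≟ μ (α t))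
    where
    lem : ∀ a b c d → (a - b) + (c - d) ≡ + 0 → c - b ≡ d - a
    lem a b c d e = ℤₚ.i-j≡0⇒i≡j (c - b) (d - a) (trans (lem' a b c d) e)
      where
      lem' : ∀ a b c d → (c - b) - (d - a) ≡ (a - b) + (c - d)
      lem' = solve-∀
    on : ∀ t → α t ≡ β t → f₃ t ≡ Y' t
    on t e = trans (cong (_* Y' t) (χ-yes (E? t) e)) (ℤₚ.*-identityˡ (Y' t))
    off : ∀ t → ¬ (α t ≡ β t) → f₃ t ≡ + 0
    off t ¬e = trans (cong (_* Y' t) (χ-no (E? t) ¬e)) (ℤₚ.*-zeroˡ (Y' t))
    same : ¬ (α t ≡ β t) → Z' (β t) ≡ Z' t → f₂ (β t) ≡ f₂ t
    same ¬e q = cong₂ _-_ q (trans (off (α (β t)) (λ e → ¬e (back e))) (sym (off (α t) (λ e → ¬e (E-α⁻ t e)))))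
      where
      back : α (α (β t)) ≡ β (α (β t)) → α t ≡ β t
      back e = trans (cong α (sym (ββ t))) (trans (E-β (β t) (E-α⁻ (β t) e)) (cong β (ββ t)))
    by : Dec (α t ≡ β t) → Dec (μ t ≡ μ (α t)) → f₂ (β t) ≡ f₂ t
    by (yes e) _ = trans (cong (_-_ (Z' (β t))) (trans (cong f₃ (trans (cong α (sym e)) (αα t))) (on t e)))
      (trans (lem (Y' (α t)) (Y' t) (Z' (β t)) (Z' t) (rel' t)) (cong (_-_ (Z' t)) (sym (on (α t) (E-α t e)))))
    by (no ¬e) (no ≢) = same ¬e (Z'-inv t (Y'-inv t ≢))
    by (no ¬e) (yes e) with μ-eq t e
    ... | inj₁ q = same ¬e (Z'-inv t (cong Y' q))
    ... | inj₂ q = ⊥-elim (¬e q)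

  f₃-inv : ∀ t → f₃ (α (β t)) ≡ f₃ t
  f₃-inv t with E? t
  ... | yes e = trans (cong f₃ (trans (cong α (sym e)) (αα t))) (cong (_* Y' t) (χ-yes (E? t) e))
  ... | no ¬e = trans (cong (_* Y' (α (β t))) (χ-no (E? (α (β t))) (λ e → ¬e (trans (cong α (sym (ββ t))) (trans (E-β (β t) (E-α⁻ (β t) e)) (cong β (ββ t)))))))
      (trans (ℤₚ.*-zeroˡ (Y' (α (β t)))) (sym (ℤₚ.*-zeroˡ (Y' t))))

-- θ detects the class of x̂ in Ĥ⁻¹ of ℤⁿ/ℤ: it vanishes mod p on everything coming from ⟨a⟩, ⟨b⟩ and ⟨ab⟩.
record TwoAction {p n : ℕ} {{nz : ℕ.NonZero p}} (B : Bicyclic p n) : Set where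
  open BicyclicGroup B using (module Norms)
  private module En = Norms (GSet.lattice (points n)) (GSet.lattice-isGLattice (points n))
  field
    weight : ZVec n
  θ : ZVec n → ℤ
  θ w = ∑ (λ i → weight i * w i)
  field
    θ-inv : ∀ k l w → θ (En.T k l w) ≡ θ w
    θ-const : ∀ w → (∀ i j → w i ≡ w j) → ∃ λ a → θ w ≡ + p * a
    θ-10 : ∀ w → (∀ i j → En.Nm 1 0 w i ≡ En.Nm 1 0 w j) → ∃ λ a → θ w ≡ + p * a
    θ-01 : ∀ w → (∀ i j → En.Nm 0 1 w i ≡ En.Nm 0 1 w j) → ∃ λ a → θ w ≡ + p * a
    θ-11 : ∀ w → (∀ i j → En.Nm 1 1 w i ≡ En.Nm 1 1 w j) → ∃ λ a → θ w ≡ + p * a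
    x̂ : ZVec n
    x̂-norm : ∀ i j → En.NH x̂ i ≡ En.NH x̂ j
    θ-x̂ : θ x̂ ≡ + 1

-- p = 2: the Klein four-group

module Two {n : ℕ} (𝒮 : Setting n) (B : Bicyclic 2 n) (A : TwoAction B) where

  open Setting 𝒮
  open Maps 𝒮
  open Bicyclic B
  open BicyclicGroup B
  open TwoAction A

  module En = Norms E E-lat
  module Xn = Norms PX PX-lat
  module Yn = Norms PY PY-lat
  module Fn = Norms F F-lat
  module ιn = NormMap E-lat PX-lat ιᵍ

  T² : ∀ {M} (L : IsGLattice M) k l v → (k ≡ 0 ⊎ k ≡ 1) → (l ≡ 0 ⊎ l ≡ 1) → Norms.T M L k l (Norms.T M L k l v) ≐ v
  T² {M} L k l v kk ll i = trans (Norms.T-∙ M L k l k l v i) (trans (Norms.T-≈ M L (two kk ll) v i) (Norms.T-0 M L v i))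
    where
    two : ∀ {k l} → (k ≡ 0 ⊎ k ≡ 1) → (l ≡ 0 ⊎ l ≡ 1) → h (k ℕ.+ k) (l ℕ.+ l) ≈ₚ h 0 0
    two (inj₁ refl) (inj₁ refl) i = refl
    two (inj₁ refl) (inj₂ refl) = h-+0p 0 0
    two (inj₂ refl) (inj₁ refl) = h-+p0 0 0
    two (inj₂ refl) (inj₂ refl) = h-+* 0 0 1 1

  H⁻¹X : ∃ λ (ys : Fin 4 → ZVec sizeX) → ∀ x → (ι ·ᶻ x̂) x ≡ ∑ (λ a → ys a ((elem a ⁻¹) ⋆ˣ x) - ys a x)
  H⁻¹X = Subgroup.Orbits.H⁻¹-functions elem isSubgroup X (ι ·ᶻ x̂) (λ x →
    trans (∑-cong (λ a → sym (GSet.act-lattice X (elem a) (ι ·ᶻ x̂) x))) (trans (Xn.NH≡∑elem (ι ·ᶻ x̂) x)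
    (trans (sym (ιn.NH-map x̂ x)) (ι-const (En.NH x̂) x̂-norm x))))

  -- The four elements are listed as 1, a, b, ab. The identity ab - 1 = (a - 1) b + (b - 1)
  -- distributes the contribution of ab over y and z.
  ya yb yab y z : ZVec sizeX
  ya = proj₁ H⁻¹X (suc zero)
  yb = proj₁ H⁻¹X (suc (suc zero))
  yab = proj₁ H⁻¹X (suc (suc (suc zero)))
  y = ya ⊞ Xn.T 0 1 yab
  z = yb ⊞ yab

  ιx̂ : ∀ x → (ι ·ᶻ x̂) x ≡ (Xn.T 1 0 y x - y x) + (Xn.T 0 1 z x - z x)
  ιx̂ x = trans (proj₂ H⁻¹X x) (trans (cong₂ _+_ (ℤₚ.i≡j⇒i-j≡0 triv) refl) (trans
    (cong₂ (λ s t → + 0 + (s + t)) (cong (_- ya x) (ev 1 0 ya))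
      (cong₂ (λ s t → s + (t + + 0)) (cong (_- yb x) (ev 0 1 yb)) (cong (_- yab x) (trans (ev 1 1 yab) (sym (Xn.T-∙ 1 0 0 1 yab x))))))
    (trans (lem (Xn.T 1 0 ya x) (ya x) (Xn.T 0 1 yb x) (yb x) (Xn.T 1 0 (Xn.T 0 1 yab) x) (yab x) (Xn.T 0 1 yab x))
      (cong₂ (λ s t → (s - y x) + (t - z x)) (sym (·-⊞ (act PX (h 1 0)) ya (Xn.T 0 1 yab) x)) (sym (·-⊞ (act PX (h 0 1)) yb yab x))))))
    where
    ev : ∀ k l (v : ZVec sizeX) → v ((h k l ⁻¹) ⋆ˣ x) ≡ Xn.T k l v x
    ev k l v = sym (GSet.act-lattice X (h k l) v x)
    triv : proj₁ H⁻¹X zero ((elem zero ⁻¹) ⋆ˣ x) ≡ proj₁ H⁻¹X zero x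
    triv = trans (ev 0 0 (proj₁ H⁻¹X zero)) (Xn.T-0 (proj₁ H⁻¹X zero) x)
    lem : ∀ a a' b b' c c' d → + 0 + ((a - a') + ((b - b') + ((c - c') + + 0))) ≡ ((a + c) - (a' + d)) + ((b + d) - (b' + c'))
    lem = solve-∀

  Y′ Z′ : ZVec sizeY
  Y′ = S ·ᶻ (π ·ᶻ y)
  Z′ = S ·ᶻ (π ·ᶻ z)

  α β : Fin sizeY → Fin sizeY
  α t = (h 1 0 ⁻¹) ⋆ʸ t
  β t = (h 0 1 ⁻¹) ⋆ʸ t

  private
    Sπ-T : ∀ k l v t → (S ·ᶻ (π ·ᶻ Xn.T k l v)) t ≡ (S ·ᶻ (π ·ᶻ v)) ((h k l ⁻¹) ⋆ʸ t)
    Sπ-T k l v t = trans (·-cong S (gmap-· πᵍ (h k l) v) t) (S-equiv (h k l) (π ·ᶻ v) t)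

    invol : ∀ k l → h (k ℕ.+ k) (l ℕ.+ l) ≈ₚ h 0 0 → ∀ t → (h k l ⁻¹) ⋆ʸ (h k l ⁻¹) ⋆ʸ t ≡ t
    invol k l e t = GSet.⋆-injective Y (h k l) (trans (GSet.⋆-⁻¹ʳ Y (h k l) _) (GSet.⋆-injective Y (h k l)
      (trans (GSet.⋆-⁻¹ʳ Y (h k l) t) (sym (trans (sym (GSet.⋆-∙ Y (h k l) (h k l) t)) (trans (GSet.⋆-cong Y (λ i → trans (h-∙ k l k l i) (trans (e i) (h-0 i))) t) (GSet.⋆-id Y t)))))))

  rel : ∀ t → (Y′ (α t) - Y′ t) + (Z′ (β t) - Z′ t) ≡ + 0
  rel t = begin
    (Y′ (α t) - Y′ t) + (Z′ (β t) - Z′ t)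
      ≡⟨ cong₂ (λ a b → (a - Y′ t) + (b - Z′ t)) (sym (Sπ-T 1 0 y t)) (sym (Sπ-T 0 1 z t)) ⟩
    (Sπ (Xn.T 1 0 y) t - Y′ t) + (Sπ (Xn.T 0 1 z) t - Z′ t)
      ≡⟨ sym (cong₂ _+_ (Sπ-⊟ (Xn.T 1 0 y) y t) (Sπ-⊟ (Xn.T 0 1 z) z t)) ⟩
    Sπ (Xn.T 1 0 y ⊟ y) t + Sπ (Xn.T 0 1 z ⊟ z) t
      ≡⟨ sym (trans (·-cong S (·-⊞ π (Xn.T 1 0 y ⊟ y) (Xn.T 0 1 z ⊟ z)) t) (·-⊞ S (π ·ᶻ (Xn.T 1 0 y ⊟ y)) (π ·ᶻ (Xn.T 0 1 z ⊟ z)) t)) ⟩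
    Sπ ((Xn.T 1 0 y ⊟ y) ⊞ (Xn.T 0 1 z ⊟ z)) t
      ≡⟨ ·-cong S (·-cong π (λ x → sym (ιx̂ x))) t ⟩
    Sπ (ι ·ᶻ x̂) t
      ≡⟨ trans (·-cong S (comp0 x̂) t) (·-zero S t) ⟩
    + 0 ∎
    where
    Sπ : ZVec sizeX → ZVec sizeY
    Sπ v = S ·ᶻ (π ·ᶻ v)
    Sπ-⊟ : ∀ v w t → Sπ (v ⊟ w) t ≡ Sπ v t - Sπ w t
    Sπ-⊟ v w t = trans (·-cong S (·-⊟ π v w) t) (·-⊟ S (π ·ᶻ v) (π ·ᶻ w) t)

  private
    αβ-comm : ∀ t → α (β t) ≡ β (α t)
    αβ-comm t = trans (sym (GSet.⋆-∙ Y (h 1 0 ⁻¹) (h 0 1 ⁻¹) t)) (trans (GSet.⋆-cong Y swap t) (GSet.⋆-∙ Y (h 0 1 ⁻¹) (h 1 0 ⁻¹) t))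
      where
      swap : ((h 1 0 ⁻¹) ∙ (h 0 1 ⁻¹)) ≈ₚ ((h 0 1 ⁻¹) ∙ (h 1 0 ⁻¹))
      swap i = begin
        h 1 0 ⟨$⟩ˡ (h 0 1 ⟨$⟩ˡ i)    ≡⟨ cong (λ j → h 1 0 ⟨$⟩ˡ (h 0 1 ⟨$⟩ˡ j)) (sym back) ⟩
        h 1 0 ⟨$⟩ˡ (h 0 1 ⟨$⟩ˡ (h 0 1 ⟨$⟩ʳ (h 1 0 ⟨$⟩ʳ (h 0 1 ⟨$⟩ˡ (h 1 0 ⟨$⟩ˡ i)))))
          ≡⟨ trans (cong (h 1 0 ⟨$⟩ˡ_) (inverseˡ (h 0 1))) (inverseˡ (h 1 0)) ⟩
        h 0 1 ⟨$⟩ˡ (h 1 0 ⟨$⟩ˡ i) ∎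
        where
        back : h 0 1 ⟨$⟩ʳ (h 1 0 ⟨$⟩ʳ (h 0 1 ⟨$⟩ˡ (h 1 0 ⟨$⟩ˡ i))) ≡ i
        back = trans (trans (h-∙ 0 1 1 0 _) (sym (h-∙ 1 0 0 1 _))) (trans (cong (h 1 0 ⟨$⟩ʳ_) (inverseʳ (h 0 1))) (inverseʳ (h 1 0)))

  module K = Klein α β (invol 1 0 (h-+p0 0 0)) (invol 0 1 (h-+0p 0 0)) αβ-comm Y′ Z′ rel

  lift : ZVec sizeY → ZVec sizeX
  lift f = proj₁ (π-surj (R ·ᶻ f))

  π-lift : ∀ f → (π ·ᶻ lift f) ≐ (R ·ᶻ f)
  π-lift f = proj₂ (π-surj (R ·ᶻ f))

  eval : ∀ k l f t → Yn.T k l f t ≡ f ((h k l ⁻¹) ⋆ʸ t)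
  eval k l = GSet.act-lattice Y (h k l)

  -- An invariant f lifts to g with d g - g = ι w, and then w has constant norm.
  defect : ∀ k l → (k ≡ 0 ⊎ k ≡ 1) → (l ≡ 0 ⊎ l ≡ 1) → ∀ f → Yn.T k l f ≐ f →
           ∃ λ w → ((ι ·ᶻ w) ≐ (Xn.T k l (lift f) ⊟ lift f)) × (∀ i j → w i + En.T k l w i ≡ w j + En.T k l w j)
  defect k l kk ll f inv = w , ιw , λ i j → ι-inj (w ⊞ En.T k l w) (λ x → begin
      (ι ·ᶻ (w ⊞ En.T k l w)) x                  ≡⟨ ·-⊞ ι w (En.T k l w) x ⟩
      (ι ·ᶻ w) x + (ι ·ᶻ En.T k l w) x           ≡⟨ cong (_+_ ((ι ·ᶻ w) x)) (gmap-· ιᵍ (h k l) w x) ⟩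
      (ι ·ᶻ w) x + Xn.T k l (ι ·ᶻ w) x           ≡⟨ cong₂ _+_ (ιw x) (Xn.T-cong {k} {l} ιw x) ⟩
      (Xn.T k l g x - g x) + Xn.T k l (Xn.T k l g ⊟ g) x
        ≡⟨ cong (_+_ (Xn.T k l g x - g x)) (trans (·-⊟ (act PX (h k l)) (Xn.T k l g) g x) (cong (_- Xn.T k l g x) (T² PX-lat k l g kk ll x))) ⟩
      (Xn.T k l g x - g x) + (g x - Xn.T k l g x) ≡⟨ lem (Xn.T k l g x) (g x) ⟩
      + 0 ∎) i j
    where
    g = lift f
    lem : ∀ a b → (a - b) + (b - a) ≡ + 0
    lem = solve-∀
    pre : ∃ λ w → (ι ·ᶻ w) ≐ (Xn.T k l g ⊟ g)
    pre = exact (Xn.T k l g ⊟ g) (λ i → trans (·-⊟ π (Xn.T k l g) g i) (ℤₚ.i≡j⇒i-j≡0 (trans (gmap-· πᵍ (h k l) g i)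
      (trans (·-cong (act F (h k l)) (π-lift f) i) (trans (sym (gmap-· Rᵍ (h k l) f i)) (trans (·-cong R inv i) (sym (π-lift f i))))))))
    w = proj₁ pre
    ιw : (ι ·ᶻ w) ≐ (Xn.T k l g ⊟ g)
    ιw = proj₂ pre

  D₁ = defect 1 0 (inj₂ refl) (inj₁ refl) K.f₁ (λ t → trans (eval 1 0 K.f₁ t) (K.f₁-inv t))
  D₂ = defect 0 1 (inj₁ refl) (inj₂ refl) K.f₂ (λ t → trans (eval 0 1 K.f₂ t) (K.f₂-inv t))
  D₃ = defect 1 1 (inj₂ refl) (inj₂ refl) K.f₃ (λ t → trans (sym (Yn.T-∙ 0 1 1 0 K.f₃ t))
    (trans (eval 0 1 (Yn.T 1 0 K.f₃) t) (trans (eval 1 0 K.f₃ (β t)) (K.f₃-inv t))))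

  -- The decompositions of Y′ and Z′ are lifted term by term. In (a - 1) Ny + (b - 1) Nz the terms
  -- with m̂ cancel and those with g₃ add up to (ab - 1) g₃.
  g₁ g₂ g₃ m̂ Ny Nz : ZVec sizeX
  g₁ = lift K.f₁
  g₂ = lift K.f₂
  g₃ = lift K.f₃
  m̂ = lift K.m
  Ny = (g₁ ⊞ g₃) ⊟ (Xn.T 0 1 m̂ ⊟ m̂)
  Nz = (g₂ ⊞ Xn.T 1 0 g₃) ⊞ (Xn.T 1 0 m̂ ⊟ m̂)

  private
    π-T-lift : ∀ k l f → (π ·ᶻ Xn.T k l (lift f)) ≐ (R ·ᶻ (λ t → f ((h k l ⁻¹) ⋆ʸ t)))
    π-T-lift k l f i = trans (gmap-· πᵍ (h k l) (lift f) i) (trans (·-cong (act F (h k l)) (π-lift f) i)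
      (trans (sym (gmap-· Rᵍ (h k l) f i)) (·-cong R (eval k l f) i)))

    π-Ny : (π ·ᶻ Ny) ≐ (R ·ᶻ Y′)
    π-Ny i = begin
      (π ·ᶻ Ny) i
        ≡⟨ trans (·-⊟ π (g₁ ⊞ g₃) (Xn.T 0 1 m̂ ⊟ m̂) i) (cong₂ _-_ (·-⊞ π g₁ g₃ i) (·-⊟ π (Xn.T 0 1 m̂) m̂ i)) ⟩
      ((π ·ᶻ g₁) i + (π ·ᶻ g₃) i) - ((π ·ᶻ Xn.T 0 1 m̂) i - (π ·ᶻ m̂) i)
        ≡⟨ cong₂ _-_ (cong₂ _+_ (π-lift K.f₁ i) (π-lift K.f₃ i)) (cong₂ _-_ (π-T-lift 0 1 K.m i) (π-lift K.m i)) ⟩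
      ((R ·ᶻ K.f₁) i + (R ·ᶻ K.f₃) i) - ((R ·ᶻ (λ t → K.m (β t))) i - (R ·ᶻ K.m) i)
        ≡⟨ sym (trans (·-⊟ R (K.f₁ ⊞ K.f₃) ((λ t → K.m (β t)) ⊟ K.m) i) (cong₂ _-_ (·-⊞ R K.f₁ K.f₃ i) (·-⊟ R (λ t → K.m (β t)) K.m i))) ⟩
      (R ·ᶻ ((K.f₁ ⊞ K.f₃) ⊟ ((λ t → K.m (β t)) ⊟ K.m))) i
        ≡⟨ ·-cong R (λ t → sym (K.decompose-Y t)) i ⟩
      (R ·ᶻ Y′) i ∎

    π-Nz : (π ·ᶻ Nz) ≐ (R ·ᶻ Z′)
    π-Nz i = begin
      (π ·ᶻ Nz) i
        ≡⟨ trans (·-⊞ π (g₂ ⊞ Xn.T 1 0 g₃) (Xn.T 1 0 m̂ ⊟ m̂) i) (cong₂ _+_ (·-⊞ π g₂ (Xn.T 1 0 g₃) i) (·-⊟ π (Xn.T 1 0 m̂) m̂ i)) ⟩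
      ((π ·ᶻ g₂) i + (π ·ᶻ Xn.T 1 0 g₃) i) + ((π ·ᶻ Xn.T 1 0 m̂) i - (π ·ᶻ m̂) i)
        ≡⟨ cong₂ _+_ (cong₂ _+_ (π-lift K.f₂ i) (π-T-lift 1 0 K.f₃ i)) (cong₂ _-_ (π-T-lift 1 0 K.m i) (π-lift K.m i)) ⟩
      ((R ·ᶻ K.f₂) i + (R ·ᶻ (λ t → K.f₃ (α t))) i) + ((R ·ᶻ (λ t → K.m (α t))) i - (R ·ᶻ K.m) i)
        ≡⟨ sym (trans (·-⊞ R (K.f₂ ⊞ (λ t → K.f₃ (α t))) ((λ t → K.m (α t)) ⊟ K.m) i) (cong₂ _+_ (·-⊞ R K.f₂ (λ t → K.f₃ (α t)) i) (·-⊟ R (λ t → K.m (α t)) K.m i))) ⟩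
      (R ·ᶻ ((K.f₂ ⊞ (λ t → K.f₃ (α t))) ⊞ ((λ t → K.m (α t)) ⊟ K.m))) i
        ≡⟨ ·-cong R (λ t → sym (K.decompose-Z t)) i ⟩
      (R ·ᶻ Z′) i ∎

  correction : ∀ (v v' : ZVec sizeX) → (π ·ᶻ v') ≐ (R ·ᶻ (S ·ᶻ (π ·ᶻ v))) → ∃ λ j → (ι ·ᶻ j) ≐ (+ N ⊡ v ⊟ v')
  correction v v' e = exact (+ N ⊡ v ⊟ v') (λ i → trans (·-⊟ π (+ N ⊡ v) v' i) (ℤₚ.i≡j⇒i-j≡0
    (trans (·-⊡ π (+ N) v i) (trans (sym (RS (π ·ᶻ v) i)) (sym (e i))))))

  jy jz w₁ w₂ w₃ rhs : ZVec n
  jy = proj₁ (correction y Ny π-Ny)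
  jz = proj₁ (correction z Nz π-Nz)
  w₁ = proj₁ D₁
  w₂ = proj₁ D₂
  w₃ = proj₁ D₃
  rhs = (w₁ ⊞ w₂ ⊞ w₃) ⊞ (En.T 1 0 jy ⊟ jy) ⊞ (En.T 0 1 jz ⊟ jz)

  private
    expand : ∀ k l v v' j → (ι ·ᶻ j) ≐ (+ N ⊡ v ⊟ v') → ∀ x → + N * (Xn.T k l v x - v x) ≡ (Xn.T k l v' x - v' x) + ((ι ·ᶻ En.T k l j) x - (ι ·ᶻ j) x)
    expand k l v v' j e x = begin
      + N * (Xn.T k l v x - v x)
        ≡⟨ lem (+ N) (Xn.T k l v x) (v x) (Xn.T k l v' x) (v' x) ⟩
      (Xn.T k l v' x - v' x) + ((+ N * Xn.T k l v x - Xn.T k l v' x) - (+ N * v x - v' x))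
        ≡⟨ cong (_+_ (Xn.T k l v' x - v' x)) (cong₂ _-_ (sym Tj) (sym (e x))) ⟩
      (Xn.T k l v' x - v' x) + ((ι ·ᶻ En.T k l j) x - (ι ·ᶻ j) x) ∎
      where
      lem : ∀ n a b c d → n * (a - b) ≡ (c - d) + ((n * a - c) - (n * b - d))
      lem = solve-∀
      Tj : (ι ·ᶻ En.T k l j) x ≡ + N * Xn.T k l v x - Xn.T k l v' x
      Tj = trans (gmap-· ιᵍ (h k l) j x) (trans (Xn.T-cong {k} {l} e x) (trans (·-⊟ (act PX (h k l)) (+ N ⊡ v) v' x) (cong (_- Xn.T k l v' x) (·-⊡ (act PX (h k l)) (+ N) v x))))

  -- N y and N z differ from the lifts `Ny` and `Nz` by elements of J. Besides the boundaries of
  -- these, only the defects w₁, w₂, w₃ of the three involutions remain.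
  N-x̂ : (ι ·ᶻ (+ N ⊡ x̂)) ≐ (ι ·ᶻ rhs)
  N-x̂ x = begin
    (ι ·ᶻ (+ N ⊡ x̂)) x
      ≡⟨ trans (·-⊡ ι (+ N) x̂ x) (trans (cong (+ N *_) (ιx̂ x)) (ℤₚ.*-distribˡ-+ (+ N) (Xn.T 1 0 y x - y x) (Xn.T 0 1 z x - z x))) ⟩
    + N * (Xn.T 1 0 y x - y x) + + N * (Xn.T 0 1 z x - z x)
      ≡⟨ cong₂ _+_ (expand 1 0 y Ny jy (proj₂ (correction y Ny π-Ny)) x) (expand 0 1 z Nz jz (proj₂ (correction z Nz π-Nz)) x) ⟩
    ((Xn.T 1 0 Ny x - Ny x) + Jy) + ((Xn.T 0 1 Nz x - Nz x) + Jz)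
      ≡⟨ cong₂ (λ s t → ((s - Ny x) + Jy) + ((t - Nz x) + Jz)) T-Ny T-Nz ⟩
    ((((Xn.T 1 0 g₁ x + Xn.T 1 0 g₃ x) - (Xn.T 1 0 (Xn.T 0 1 m̂) x - Xn.T 1 0 m̂ x)) - Ny x) + Jy) +
      ((((Xn.T 0 1 g₂ x + Xn.T 1 1 g₃ x) + (Xn.T 1 0 (Xn.T 0 1 m̂) x - Xn.T 0 1 m̂ x)) - Nz x) + Jz)
      ≡⟨ lem (Xn.T 1 0 g₁ x) (g₁ x) (Xn.T 1 0 g₃ x) (g₃ x) (Xn.T 1 0 (Xn.T 0 1 m̂) x) (Xn.T 1 0 m̂ x) (Xn.T 0 1 m̂ x) (m̂ x) (Xn.T 0 1 g₂ x) (g₂ x) (Xn.T 1 1 g₃ x) Jy Jz ⟩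
    (((Xn.T 1 0 g₁ x - g₁ x) + (Xn.T 0 1 g₂ x - g₂ x)) + (Xn.T 1 1 g₃ x - g₃ x)) + Jy + Jz
      ≡⟨ cong (λ s → s + Jy + Jz) (cong₂ _+_ (cong₂ _+_ (sym (proj₁ (proj₂ D₁) x)) (sym (proj₁ (proj₂ D₂) x))) (sym (proj₁ (proj₂ D₃) x))) ⟩
    (((ι ·ᶻ w₁) x + (ι ·ᶻ w₂) x) + (ι ·ᶻ w₃) x) + Jy + Jz
      ≡⟨ sym (trans (·-⊞ ι ((w₁ ⊞ w₂ ⊞ w₃) ⊞ (En.T 1 0 jy ⊟ jy)) (En.T 0 1 jz ⊟ jz) x) (cong₂ _+_
           (trans (·-⊞ ι (w₁ ⊞ w₂ ⊞ w₃) (En.T 1 0 jy ⊟ jy) x) (cong₂ _+_ (trans (·-⊞ ι (w₁ ⊞ w₂) w₃ x) (cong (_+ (ι ·ᶻ w₃) x) (·-⊞ ι w₁ w₂ x))) (·-⊟ ι (En.T 1 0 jy) jy x)))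
           (·-⊟ ι (En.T 0 1 jz) jz x))) ⟩
    (ι ·ᶻ rhs) x ∎
    where
    Jy Jz : ℤ
    Jy = (ι ·ᶻ En.T 1 0 jy) x - (ι ·ᶻ jy) x
    Jz = (ι ·ᶻ En.T 0 1 jz) x - (ι ·ᶻ jz) x
    T-Ny : Xn.T 1 0 Ny x ≡ (Xn.T 1 0 g₁ x + Xn.T 1 0 g₃ x) - (Xn.T 1 0 (Xn.T 0 1 m̂) x - Xn.T 1 0 m̂ x)
    T-Ny = trans (·-⊟ (act PX (h 1 0)) (g₁ ⊞ g₃) (Xn.T 0 1 m̂ ⊟ m̂) x) (cong₂ _-_ (·-⊞ (act PX (h 1 0)) g₁ g₃ x) (·-⊟ (act PX (h 1 0)) (Xn.T 0 1 m̂) m̂ x))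
    T-Nz : Xn.T 0 1 Nz x ≡ (Xn.T 0 1 g₂ x + Xn.T 1 1 g₃ x) + (Xn.T 1 0 (Xn.T 0 1 m̂) x - Xn.T 0 1 m̂ x)
    T-Nz = trans (·-⊞ (act PX (h 0 1)) (g₂ ⊞ Xn.T 1 0 g₃) (Xn.T 1 0 m̂ ⊟ m̂) x) (cong₂ _+_
      (trans (·-⊞ (act PX (h 0 1)) g₂ (Xn.T 1 0 g₃) x) (cong (_+_ (Xn.T 0 1 g₂ x)) (Xn.T-∙ 0 1 1 0 g₃ x)))
      (trans (·-⊟ (act PX (h 0 1)) (Xn.T 1 0 m̂) m̂ x) (cong (_- Xn.T 0 1 m̂ x) (Xn.T-comm 0 1 1 0 m̂ x))))
    lem : ∀ ag₁ g₁ ag₃ g₃ abm am bm m bg₂ g₂ abg₃ jy jz →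
      ((((ag₁ + ag₃) - (abm - am)) - ((g₁ + g₃) - (bm - m))) + jy) + ((((bg₂ + abg₃) + (abm - bm)) - ((g₂ + ag₃) + (am - m))) + jz)
      ≡ (((ag₁ - g₁) + (bg₂ - g₂)) + (abg₃ - g₃)) + jy + jz
    lem = solve-∀

  private
    θ-⊞ : ∀ u v → θ (u ⊞ v) ≡ θ u + θ v
    θ-⊞ u v = trans (∑-cong (λ i → ℤₚ.*-distribˡ-+ (weight i) (u i) (v i))) (∑-+ (λ i → weight i * u i) (λ i → weight i * v i))
    θ-⊟ : ∀ u v → θ (u ⊟ v) ≡ θ u - θ v
    θ-⊟ u v = trans (∑-cong (λ i → lem (weight i) (u i) (v i))) (∑-- (λ i → weight i * u i) (λ i → weight i * v i))
      where
      lem : ∀ a b c → a * (b - c) ≡ a * b - a * c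
      lem = solve-∀
    θ-⊡ : ∀ c u → θ (c ⊡ u) ≡ c * θ u
    θ-⊡ c u = trans (∑-cong (λ i → lem (weight i) c (u i))) (∑-*ˡ c (λ i → weight i * u i))
      where
      lem : ∀ a b c → a * (b * c) ≡ b * (a * c)
      lem = solve-∀
    Nm-two : ∀ k l w i → (En.Nm k l w i) ≡ w i + En.T (1 ℕ.* k) (1 ℕ.* l) w i
    Nm-two k l w i = cong₂ _+_ (En.T-0 w i) (ℤₚ.+-identityʳ _)
    even₁ : ∃ λ a → θ w₁ ≡ + 2 * a
    even₁ = θ-10 w₁ (λ i j → trans (Nm-two 1 0 w₁ i) (trans (proj₂ (proj₂ D₁) i j) (sym (Nm-two 1 0 w₁ j))))
    even₂ : ∃ λ a → θ w₂ ≡ + 2 * a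
    even₂ = θ-01 w₂ (λ i j → trans (Nm-two 0 1 w₂ i) (trans (proj₂ (proj₂ D₂) i j) (sym (Nm-two 0 1 w₂ j))))
    even₃ : ∃ λ a → θ w₃ ≡ + 2 * a
    even₃ = θ-11 w₃ (λ i j → trans (Nm-two 1 1 w₃ i) (trans (proj₂ (proj₂ D₃) i j) (sym (Nm-two 1 1 w₃ j))))
    even₀ : ∃ λ a → θ (+ N ⊡ x̂ ⊟ rhs) ≡ + 2 * a
    even₀ = θ-const (+ N ⊡ x̂ ⊟ rhs) (ι-≡ (+ N ⊡ x̂) rhs N-x̂)
    θ-T : ∀ k l j → θ (En.T k l j ⊟ j) ≡ + 0
    θ-T k l j = trans (θ-⊟ (En.T k l j) j) (ℤₚ.i≡j⇒i-j≡0 (θ-inv k l j))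

  two-divides-N : 2 ∣ N
  two-divides-N = divides ∣ s ∣ (trans (cong ∣_∣ N≡) (trans (ℤₚ.abs-* (+ 2) s) (ℕₚ.*-comm 2 ∣ s ∣)))
    where
    -- θ is even on constants and on the three defects, zero on (a - 1) jy and (b - 1) jz, and 1 on
    -- x̂; comparing both sides gives N = 2 s.
    s : ℤ
    s = proj₁ even₀ + (proj₁ even₁ + proj₁ even₂ + proj₁ even₃)
    θ-rhs : θ rhs ≡ (+ 2 * proj₁ even₁ + + 2 * proj₁ even₂ + + 2 * proj₁ even₃) + + 0 + + 0
    θ-rhs = trans (θ-⊞ ((w₁ ⊞ w₂ ⊞ w₃) ⊞ (En.T 1 0 jy ⊟ jy)) (En.T 0 1 jz ⊟ jz)) (cong₂ _+_
      (trans (θ-⊞ (w₁ ⊞ w₂ ⊞ w₃) (En.T 1 0 jy ⊟ jy)) (cong₂ _+_ (trans (θ-⊞ (w₁ ⊞ w₂) w₃) (cong₂ _+_ (trans (θ-⊞ w₁ w₂) (cong₂ _+_ (proj₂ even₁) (proj₂ even₂))) (proj₂ even₃))) (θ-T 1 0 jy)))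
      (θ-T 0 1 jz))
    N≡ : + N ≡ + 2 * s
    N≡ = begin
      + N                                             ≡⟨ lem (+ N) (θ rhs) ⟩
      (+ N * + 1 - θ rhs) + θ rhs                     ≡⟨ cong (λ a → (+ N * a - θ rhs) + θ rhs) (sym θ-x̂) ⟩
      (+ N * θ x̂ - θ rhs) + θ rhs                     ≡⟨ cong (_+ θ rhs) (trans (cong (_- θ rhs) (sym (θ-⊡ (+ N) x̂))) (sym (θ-⊟ (+ N ⊡ x̂) rhs))) ⟩
      θ (+ N ⊡ x̂ ⊟ rhs) + θ rhs                       ≡⟨ cong₂ _+_ (proj₂ even₀) θ-rhs ⟩
      + 2 * proj₁ even₀ + ((+ 2 * proj₁ even₁ + + 2 * proj₁ even₂ + + 2 * proj₁ even₃) + + 0 + + 0)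
        ≡⟨ lem' (proj₁ even₀) (proj₁ even₁) (proj₁ even₂) (proj₁ even₃) ⟩
      + 2 * s ∎
      where
      lem : ∀ n t → n ≡ (n * + 1 - t) + t
      lem = solve-∀
      lem' : ∀ a b c d → + 2 * a + ((+ 2 * b + + 2 * c + + 2 * d) + + 0 + + 0) ≡ + 2 * (a + (b + c + d))
      lem' = solve-∀

-- Three blocks with pairwise distinct stabilisers, the third one repeated.
module ThreeBlocks (b p : ℕ) {{nz : ℕ.NonZero p}} (C : Rotation p) (i₀ i₁ i₂ : Fin b)
                   (i₁≢i₀ : i₁ ≢ i₀) (i₂≢i₀ : i₂ ≢ i₀) (i₂≢i₁ : i₂ ≢ i₁) where

  open Rotation C
  open Blocks b p C

  -- p - 1 stands for -1: blocks of the third kind are rotated by k - l, so that ab fixes them.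
  q : ℕ
  q = p ℕ.∸ 1

  data Kind (i : Fin b) : Set where
    isA : i ≡ i₀ → Kind i
    isB : i ≢ i₀ → i ≡ i₁ → Kind i
    isC : i ≢ i₀ → i ≢ i₁ → Kind i

  kind : ∀ i → Kind i
  kind i with i ≟ i₀
  ... | yes e = isA e
  ... | no ≢₀ with i ≟ i₁
  ...   | yes e = isB ≢₀ e
  ...   | no ≢₁ = isC ≢₀ ≢₁

  sK : ∀ {i} → ℕ → ℕ → Kind i → ℕ
  sK k l (isA _) = k
  sK k l (isB _ _) = l
  sK k l (isC _ _) = k ℕ.+ q ℕ.* l

  s : ℕ → ℕ → Fin b → ℕ
  s k l i = sK k l (kind i)

  sK-+ : ∀ {i} (κ : Kind i) k l k' l' → sK (k ℕ.+ k') (l ℕ.+ l') κ ≡ sK k l κ ℕ.+ sK k' l' κ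
  sK-+ (isA _) k l k' l' = refl
  sK-+ (isB _ _) k l k' l' = refl
  sK-+ (isC _ _) k l k' l' = trans (cong (k ℕ.+ k' ℕ.+_) (ℕₚ.*-distribˡ-+ q l l')) (interchange ℕₚ.+-commutativeSemigroup k k' (q ℕ.* l) (q ℕ.* l'))

  sK-0 : ∀ {i} (κ : Kind i) → sK 0 0 κ ≡ 0
  sK-0 (isA _) = refl
  sK-0 (isB _ _) = refl
  sK-0 (isC _ _) = ℕₚ.*-zeroʳ q

  sK-p0 : ∀ {i} (κ : Kind i) → ∃ λ u → sK p 0 κ ≡ u ℕ.* p
  sK-p0 (isA _) = 1 , sym (ℕₚ.+-identityʳ p)
  sK-p0 (isB _ _) = 0 , refl
  sK-p0 (isC _ _) = 1 , cong (p ℕ.+_) (ℕₚ.*-zeroʳ q)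

  sK-0p : ∀ {i} (κ : Kind i) → ∃ λ u → sK 0 p κ ≡ u ℕ.* p
  sK-0p (isA _) = 0 , refl
  sK-0p (isB _ _) = 1 , sym (ℕₚ.+-identityʳ p)
  sK-0p (isC _ _) = q , refl

  sK-A : ∀ k l {i} (κ : Kind i) → i ≡ i₀ → sK k l κ ≡ k
  sK-A k l (isA _) e = refl
  sK-A k l (isB ≢ _) e = ⊥-elim (≢ e)
  sK-A k l (isC ≢ _) e = ⊥-elim (≢ e)

  sK-B : ∀ k l {i} (κ : Kind i) → i ≡ i₁ → sK k l κ ≡ l
  sK-B k l (isA e') e = ⊥-elim (i₁≢i₀ (trans (sym e) e'))
  sK-B k l (isB _ _) e = refl
  sK-B k l (isC _ ≢) e = ⊥-elim (≢ e)

  sK-C : ∀ k l {i} (κ : Kind i) → i ≡ i₂ → sK k l κ ≡ k ℕ.+ q ℕ.* l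
  sK-C k l (isA e') e = ⊥-elim (i₂≢i₀ (trans (sym e) e'))
  sK-C k l (isB _ e') e = ⊥-elim (i₂≢i₁ (trans (sym e) e'))
  sK-C k l (isC _ _) e = refl

  open Family s (λ k l k' l' i → sK-+ (kind i) k l k' l') (λ i → sK-0 (kind i)) (λ i → sK-p0 (kind i)) (λ i → sK-0p (kind i))
    i₀ i₁ (λ k l → sK-A k l (kind i₀) refl) (λ k l → sK-B k l (kind i₁) refl) public

  one : ∀ {r} → Fin r → ℤ
  one _ = + 1

  private
    weight₀ : ZVec (b ℕ.* p)
    weight₀ = onBlocks (unit i₀) one

    θ₀ : ZVec (b ℕ.* p) → ℤ
    θ₀ w = ∑ (λ x → weight₀ x * w x)

    θ≡block∑ : ∀ w → θ₀ w ≡ block∑ w i₀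
    θ≡block∑ w = begin
      ∑ (λ x → weight₀ x * w x)                                     ≡⟨ ∑-combine b {p} (λ x → weight₀ x * w x) ⟩
      ∑ {b} (λ i → ∑ {p} (λ r → weight₀ (combine i r) * w (combine i r))) ≡⟨ ∑-cong {b} (λ i → trans (∑-cong {p} (λ r → cong (_* w (combine i r)) (trans (onBlocks-combine (unit i₀) one i r) (ℤₚ.*-identityʳ (unit i₀ i)))))
                                                                        (∑-*ˡ {p} (unit i₀ i) (λ r → w (combine i r)))) ⟩
      ∑ (λ i → unit i₀ i * block∑ w i)                              ≡⟨ ∑-χ i₀ (block∑ w) ⟩
      block∑ w i₀ ∎

    powˡ-period : ∀ u r → pow (u ℕ.* p) ⟨$⟩ˡ r ≡ r
    powˡ-period u r = trans (cong (pow (u ℕ.* p) ⟨$⟩ˡ_) (sym (pow-period u r))) (inverseˡ (pow (u ℕ.* p)))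

    powˡ-+ : ∀ c d r → pow (c ℕ.+ d) ⟨$⟩ˡ r ≡ pow d ⟨$⟩ˡ (pow c ⟨$⟩ˡ r)
    powˡ-+ c d r = trans (cong (pow (c ℕ.+ d) ⟨$⟩ˡ_) (sym (trans (pow-+ c d _) (trans (cong (pow c ⟨$⟩ʳ_) (inverseʳ (pow d))) (inverseʳ (pow c)))))) (inverseˡ (pow (c ℕ.+ d)))

    -- θ is the sum over block i₀. A constant norm equals every block sum, and in a block that the
    -- element fixes it is p times a coordinate.
    constant : ∀ k l w → (∀ x y → En.Nm k l w x ≡ En.Nm k l w y) → ∀ i r → (∀ t → ∃ λ u → s (t ℕ.* k) (t ℕ.* l) i ≡ u ℕ.* p) → ∃ λ a → θ₀ w ≡ + p * a
    constant k l w e i r fixed = w (combine i r) , (begin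
      θ₀ w                               ≡⟨ θ≡block∑ w ⟩
      block∑ w i₀                        ≡⟨ block∑-Nm k l w (En.Nm k l w (combine i r)) (λ x → e x (combine i r)) i₀ ⟩
      En.Nm k l w (combine i r)          ≡⟨ ∑-cong {p} (λ t → trans (T-combine (toℕ t ℕ.* k) (toℕ t ℕ.* l) w i r) (cong (λ x → w (combine i x))
                                              (trans (cong (λ a → pow a ⟨$⟩ˡ r) (proj₂ (fixed (toℕ t)))) (powˡ-period (proj₁ (fixed (toℕ t))) r)))) ⟩
      ∑ {p} (λ t → w (combine i r))      ≡⟨ ∑-const p (w (combine i r)) ⟩
      + p * w (combine i r) ∎)

    x₀ : ZVec (b ℕ.* p)
    x₀ = onBlocks one point

    row : ∀ i (g : ℕ → ℕ) r → (∀ w r → ∑ {p} (λ t → w (pow (g (toℕ t)) ⟨$⟩ˡ r)) ≡ ∑ w) → ∑ {p} (λ t → x₀ (combine i (pow (g (toℕ t)) ⟨$⟩ˡ r))) ≡ + 1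
    row i g r full = trans (∑-cong {p} (λ t → trans (onBlocks-combine one point i (pow (g (toℕ t)) ⟨$⟩ˡ r)) (ℤₚ.*-identityˡ (point (pow (g (toℕ t)) ⟨$⟩ˡ r))))) (trans (full point r) ∑-point)

    NH-x₀ : ∀ i r → Kind i → En.NH x₀ (combine i r) ≡ + p * + 1
    NH-x₀ i r (isA e) = trans (∑-cong {p} (λ l → trans (∑-cong {p} (λ k → trans (T-combine (toℕ k) (toℕ l) x₀ i r)
      (cong (λ a → x₀ (combine i (pow a ⟨$⟩ˡ r))) (sK-A (toℕ k) (toℕ l) (kind i) e)))) (row i (λ k → k) r ∑-pow))) (∑-const p (+ 1))
    NH-x₀ i r (isB _ e) = trans (∑-swap {p} {p} (λ l k → En.T (toℕ k) (toℕ l) x₀ (combine i r))) (trans (∑-cong {p} (λ k → trans (∑-cong {p} (λ l → trans (T-combine (toℕ k) (toℕ l) x₀ i r)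
      (cong (λ a → x₀ (combine i (pow a ⟨$⟩ˡ r))) (sK-B (toℕ k) (toℕ l) (kind i) e)))) (row i (λ k → k) r ∑-pow))) (∑-const p (+ 1)))
    NH-x₀ i r (isC ≢₀ ≢₁) = trans (∑-cong {p} (λ l → trans (∑-cong {p} (λ k → trans (T-combine (toℕ k) (toℕ l) x₀ i r)
      (cong (λ a → x₀ (combine i (pow a ⟨$⟩ˡ r))) (other (toℕ k) (toℕ l) (kind i))))) (row i (λ k → k ℕ.+ q ℕ.* toℕ l) r (shifted (q ℕ.* toℕ l))))) (∑-const p (+ 1))
      where
      other : ∀ k l (κ : Kind i) → sK k l κ ≡ k ℕ.+ q ℕ.* l
      other k l (isA e) = ⊥-elim (≢₀ e)
      other k l (isB _ e) = ⊥-elim (≢₁ e)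
      other k l (isC _ _) = refl
      shifted : ∀ c (w : Fin p → ℤ) r → ∑ {p} (λ t → w (pow (toℕ t ℕ.+ c) ⟨$⟩ˡ r)) ≡ ∑ w
      shifted c w r = trans (∑-cong {p} (λ t → cong w (powˡ-+ (toℕ t) c r))) (trans (∑-pow (λ y → w (pow c ⟨$⟩ˡ y)) r) (sym (∑-permute w (flip (pow c)))))

  twoAction : TwoAction bicyclic
  twoAction = record
    { weight = weight₀
    ; θ-inv = λ k l w → trans (θ≡block∑ (En.T k l w)) (trans (block∑-T k l w i₀) (sym (θ≡block∑ w)))
    ; θ-const = λ w c → w (combine i₀ origin) , trans (θ≡block∑ w) (trans (∑-cong {p} (λ r → c (combine i₀ r) (combine i₀ origin))) (∑-const p (w (combine i₀ origin))))
    ; θ-10 = λ w e → constant 1 0 w e i₁ origin (λ t → 0 , trans (sK-B (t ℕ.* 1) (t ℕ.* 0) (kind i₁) refl) (ℕₚ.*-zeroʳ t))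
    ; θ-01 = λ w e → constant 0 1 w e i₀ origin (λ t → 0 , trans (sK-A (t ℕ.* 0) (t ℕ.* 1) (kind i₀) refl) (ℕₚ.*-zeroʳ t))
    ; θ-11 = λ w e → constant 1 1 w e i₂ origin (λ t → t , trans (sK-C (t ℕ.* 1) (t ℕ.* 1) (kind i₂) refl) (diagonal t))
    ; x̂ = x₀
    ; x̂-norm = λ x y → trans (blockwise {λ x → En.NH x₀ x ≡ + p * + 1} (λ i r → NH-x₀ i r (kind i)) x) (sym (blockwise {λ x → En.NH x₀ x ≡ + p * + 1} (λ i r → NH-x₀ i r (kind i)) y))
    ; θ-x̂ = trans (θ≡block∑ x₀) (trans (block∑-onBlocks one point i₀) (trans (cong (+ 1 *_) ∑-point) refl))
    }
    where
    diagonal : ∀ t → t ℕ.* 1 ℕ.+ q ℕ.* (t ℕ.* 1) ≡ t ℕ.* p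
    diagonal t = trans (cong₂ (λ a c → a ℕ.+ q ℕ.* c) (ℕₚ.*-identityʳ t) (ℕₚ.*-identityʳ t)) (trans (cong (ℕ._* t) (ℕₚ.suc-pred p)) (ℕₚ.*-comm p t))

-- The regular action on p² letters

module Regular (p : ℕ) {{nz : ℕ.NonZero p}} (C : Rotation p) where

  open Rotation C
  open Blocks p p C

  move : ℕ → ℕ → Sym (p ℕ.* p)
  move k l = permutation (λ x → combine (pow l ⟨$⟩ʳ blk x) (pow k ⟨$⟩ʳ pos x)) (λ x → combine (pow l ⟨$⟩ˡ blk x) (pow k ⟨$⟩ˡ pos x))
    (λ x → trans (cong₂ (λ i r → combine (pow l ⟨$⟩ʳ i) (pow k ⟨$⟩ʳ r)) (blk-combine _ _) (pos-combine (pow l ⟨$⟩ˡ blk x) (pow k ⟨$⟩ˡ pos x)))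
      (trans (cong₂ combine (inverseʳ (pow l)) (inverseʳ (pow k))) (combine-blk-pos x)))
    (λ x → trans (cong₂ (λ i r → combine (pow l ⟨$⟩ˡ i) (pow k ⟨$⟩ˡ r)) (blk-combine _ _) (pos-combine (pow l ⟨$⟩ʳ blk x) (pow k ⟨$⟩ʳ pos x)))
      (trans (cong₂ combine (inverseˡ (pow l)) (inverseˡ (pow k))) (combine-blk-pos x)))

  moveʳ : ∀ k l i r → move k l ⟨$⟩ʳ combine i r ≡ combine (pow l ⟨$⟩ʳ i) (pow k ⟨$⟩ʳ r)
  moveʳ k l i r = cong₂ (λ i r → combine (pow l ⟨$⟩ʳ i) (pow k ⟨$⟩ʳ r)) (blk-combine i r) (pos-combine i r)

  moveˡ : ∀ k l i r → move k l ⟨$⟩ˡ combine i r ≡ combine (pow l ⟨$⟩ˡ i) (pow k ⟨$⟩ˡ r)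
  moveˡ k l i r = cong₂ (λ i r → combine (pow l ⟨$⟩ˡ i) (pow k ⟨$⟩ˡ r)) (blk-combine i r) (pos-combine i r)

  pow-p : ∀ r → pow p ⟨$⟩ʳ r ≡ r
  pow-p r = trans (cong (λ a → pow a ⟨$⟩ʳ r) (sym (ℕₚ.+-identityʳ p))) (pow-period 1 r)

  bicyclic : Bicyclic p (p ℕ.* p)
  bicyclic = record
    { h = move
    ; h-∙ = λ k l k' l' → blockwise λ i r → trans (cong (move k l ⟨$⟩ʳ_) (moveʳ k' l' i r)) (trans (moveʳ k l _ _)
        (trans (cong₂ combine (sym (pow-+ l l' i)) (sym (pow-+ k k' r))) (sym (moveʳ (k ℕ.+ k') (l ℕ.+ l') i r))))
    ; h-0 = blockwise λ i r → trans (moveʳ 0 0 i r) (cong₂ combine (pow-0 i) (pow-0 r))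
    ; h-p0 = blockwise λ i r → trans (moveʳ p 0 i r) (cong₂ combine (pow-0 i) (pow-p r))
    ; h-0p = blockwise λ i r → trans (moveʳ 0 p i r) (cong₂ combine (pow-p i) (pow-0 r))
    ; faithful = λ {k} {l} {k'} {l'} k< l< k'< l'< e →
        let at = trans (sym (moveʳ k l origin origin)) (trans (e (combine origin origin)) (moveʳ k' l' origin origin)) in
        pow-faithful k< k'< (combine-injectiveʳ (pow l ⟨$⟩ʳ origin) _ (pow l' ⟨$⟩ʳ origin) _ at) ,
        pow-faithful l< l'< (combine-injectiveˡ (pow l ⟨$⟩ʳ origin) (pow k ⟨$⟩ʳ origin) (pow l' ⟨$⟩ʳ origin) (pow k' ⟨$⟩ʳ origin) at)
    }

  open BicyclicGroup bicyclic
  module En = Norms (GSet.lattice (points (p ℕ.* p))) (GSet.lattice-isGLattice (points (p ℕ.* p)))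

  private
    θ₀ : ZVec (p ℕ.* p) → ℤ
    θ₀ w = ∑ (λ x → + 1 * w x)

    θ≡∑ : ∀ w → θ₀ w ≡ ∑ w
    θ≡∑ w = ∑-cong (λ x → ℤₚ.*-identityˡ (w x))

    ∑-T : ∀ k l w → ∑ (En.T k l w) ≡ ∑ w
    ∑-T k l w = trans (∑-cong (λ x → GSet.act-lattice (points (p ℕ.* p)) (move k l) w x)) (sym (∑-permute w (flip (move k l))))

    o : Fin (p ℕ.* p)
    o = combine origin origin

    -- θ is the sum of all coordinates. Summing a constant norm κ over the p² letters gives p² κ,
    -- and also p times θ w.
    constant : ∀ k l w → (∀ x y → En.Nm k l w x ≡ En.Nm k l w y) → ∃ λ a → θ₀ w ≡ + p * a
    constant k l w e = κ , trans (θ≡∑ w) (pos-*-cancel (proj₂ positive) (begin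
      + p * ∑ w                                                    ≡⟨ sym (∑-const p (∑ w)) ⟩
      ∑ {p} (λ _ → ∑ w)                                            ≡⟨ ∑-cong {p} (λ t → sym (∑-T (toℕ t ℕ.* k) (toℕ t ℕ.* l) w)) ⟩
      ∑ {p} (λ t → ∑ (En.T (toℕ t ℕ.* k) (toℕ t ℕ.* l) w))         ≡⟨ ∑-swap {p} (λ t x → En.T (toℕ t ℕ.* k) (toℕ t ℕ.* l) w x) ⟩
      ∑ (λ x → En.Nm k l w x)                                      ≡⟨ ∑-cong (λ x → e x o) ⟩
      ∑ {p ℕ.* p} (λ _ → κ)                                        ≡⟨ ∑-const (p ℕ.* p) κ ⟩
      + (p ℕ.* p) * κ                                              ≡⟨ trans (cong (_* κ) (ℤₚ.pos-* p p)) (ℤₚ.*-assoc (+ p) (+ p) κ) ⟩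
      + p * (+ p * κ) ∎))
      where κ = En.Nm k l w o

    NH-o : ∀ i r → En.NH (unit o) (combine i r) ≡ + 1
    NH-o i r = begin
      ∑ {p} (λ l → ∑ {p} (λ k → En.T (toℕ k) (toℕ l) (unit o) (combine i r)))
        ≡⟨ ∑-cong {p} (λ l → ∑-cong {p} (λ k → trans (GSet.act-lattice (points (p ℕ.* p)) (move (toℕ k) (toℕ l)) (unit o) (combine i r))
             (trans (cong (unit o) (moveˡ (toℕ k) (toℕ l) i r)) (split (pow (toℕ l) ⟨$⟩ˡ i) (pow (toℕ k) ⟨$⟩ˡ r))))) ⟩
      ∑ {p} (λ l → ∑ {p} (λ k → point (pow (toℕ l) ⟨$⟩ˡ i) * point (pow (toℕ k) ⟨$⟩ˡ r)))
        ≡⟨ ∑-cong {p} (λ l → trans (∑-*ˡ {p} (point (pow (toℕ l) ⟨$⟩ˡ i)) (λ k → point (pow (toℕ k) ⟨$⟩ˡ r)))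
             (trans (cong (point (pow (toℕ l) ⟨$⟩ˡ i) *_) (trans (∑-pow point r) ∑-point)) (ℤₚ.*-identityʳ (point (pow (toℕ l) ⟨$⟩ˡ i))))) ⟩
      ∑ {p} (λ l → point (pow (toℕ l) ⟨$⟩ˡ i))
        ≡⟨ trans (∑-pow point i) ∑-point ⟩
      + 1 ∎
      where
      split : ∀ i r → unit o (combine i r) ≡ point i * point r
      split i r with origin ≟ i | origin ≟ r
      ... | yes refl | yes refl = χ-yes (o ≟ combine i r) refl
      ... | yes refl | no ≢ = χ-no (o ≟ combine i r) (λ e → ≢ (combine-injectiveʳ origin origin i r e))
      ... | no ≢ | d = trans (χ-no (o ≟ combine i r) (λ e → ≢ (combine-injectiveˡ origin origin i r e))) (sym (ℤₚ.*-zeroˡ (χ d)))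

  twoAction : TwoAction bicyclic
  twoAction = record
    { weight = λ _ → + 1
    ; θ-inv = λ k l w → trans (θ≡∑ (En.T k l w)) (trans (∑-T k l w) (sym (θ≡∑ w)))
    ; θ-const = λ w c → + p * w o , trans (θ≡∑ w) (trans (∑-cong (λ x → c x o)) (trans (∑-const (p ℕ.* p) (w o)) (trans (cong (_* w o) (ℤₚ.pos-* p p)) (ℤₚ.*-assoc (+ p) (+ p) (w o)))))
    ; θ-10 = constant 1 0
    ; θ-01 = constant 0 1
    ; θ-11 = constant 1 1
    ; x̂ = unit o
    ; x̂-norm = λ x y → trans (blockwise {λ x → En.NH (unit o) x ≡ + 1} NH-o x) (sym (blockwise {λ x → En.NH (unit o) x ≡ + 1} NH-o y))
    ; θ-x̂ = trans (θ≡∑ (unit o)) (trans (∑-single (unit o) o (λ j j≢ → χ-no (o ≟ j) (λ e → j≢ (sym e)))) (χ-yes (o ≟ o) refl))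
    }

-- Composite degrees

odd-or-two : ∀ {p} → Prime p → p ≡ 2 ⊎ ∃ λ q → p ≡ suc (q ℕ.+ q)
odd-or-two {p} pp with half p
  where
  half : ∀ p → ∃ λ q → p ≡ q ℕ.+ q ⊎ p ≡ suc (q ℕ.+ q)
  half zero = 0 , inj₁ refl
  half (suc p) with half p
  ... | q , inj₁ e = q , inj₂ (cong suc e)
  ... | q , inj₂ e = suc q , inj₁ (cong suc (trans e (sym (ℕₚ.+-suc q q))))
... | q , inj₂ e = inj₂ (q , e)
... | q , inj₁ e with prime⇒irreducible pp (divides q (trans e (trans (cong (q ℕ.+_) (sym (ℕₚ.+-identityʳ q))) (ℕₚ.*-comm 2 q))))
...   | inj₁ ()
...   | inj₂ 2≡p = inj₁ (sym 2≡p)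

-- For p = 2 and n = 4 there are only two blocks, too few for three different stabilisers; this case
-- is left to the regular action.
setting⇒∣N : ∀ {p} → Prime p → ∀ b → (𝒮 : Setting (suc (suc b) ℕ.* p)) → p ∣ Setting.N 𝒮
setting⇒∣N {p} pp b 𝒮 = by p pp (odd-or-two pp) b 𝒮
  where
  by : ∀ p → Prime p → p ≡ 2 ⊎ ∃ (λ q → p ≡ suc (q ℕ.+ q)) → ∀ b → (𝒮 : Setting (suc (suc b) ℕ.* p)) → p ∣ Setting.N 𝒮
  by p pp (inj₁ refl) zero 𝒮 = Two.two-divides-N 𝒮 (Regular.bicyclic 2 (cyclicRotation 1)) (Regular.twoAction 2 (cyclicRotation 1))
  by p pp (inj₁ refl) (suc b) 𝒮 = Two.two-divides-N 𝒮 TB.bicyclic TB.twoAction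
    where module TB = ThreeBlocks (suc (suc (suc b))) 2 (cyclicRotation 1) zero (suc zero) (suc (suc zero)) (λ ()) (λ ()) (λ ())
  by (suc m) pp (inj₂ (q , e)) b 𝒮 = Odd.divides-N 𝒮 {q = q} pp e OB.bicyclic OB.oddAction
    where module OB = OddBlocks (suc (suc b)) (suc m) (cyclicRotation m) zero (suc zero) (λ ())

not-pInvertible : ∀ {n p} → Prime p → ¬ Prime n → p ∣ n → 2 ℕ.≤ n → ¬ FlasqueClassPInvertible p (J n)
-- The cofactors 0 and 1 are excluded by 2 ≤ n and by n being composite, so that there are at least
-- two blocks of size p.
not-pInvertible pp ¬prime (divides zero refl) ()
not-pInvertible {n} {p} pp ¬prime (divides (suc zero) e) 2≤n _ = ¬prime (subst Prime (sym (trans e (ℕₚ.+-identityʳ p))) pp)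
not-pInvertible {n} {p} pp ¬prime (divides (suc (suc b)) e) 2≤n inv = conclude n e 2≤n inv
  where
  conclude : ∀ n → n ≡ suc (suc b) ℕ.* p → 2 ℕ.≤ n → ¬ FlasqueClassPInvertible p (J n)
  conclude (suc m) e 2≤n inv = proj₂ st (transported (suc m) e (proj₁ st))
    where
    st : Σ (Setting (suc m)) λ s → ¬ p ∣ Setting.N s
    st = mkSetting pp inv
    transported : ∀ n → n ≡ suc (suc b) ℕ.* p → (𝒮 : Setting n) → p ∣ Setting.N 𝒮
    transported n refl 𝒮 = setting⇒∣N pp b 𝒮

-- Enumerating the complement of an injection

record Complement {m r : ℕ} (b : Fin m → Fin r) : Set where
  field
    size : ℕ
    c : Fin size → Fin r
    decode : Fin r → Fin m ⊎ Fin size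
    decode-b : ∀ i → decode (b i) ≡ inj₁ i
    decode-c : ∀ j → decode (c j) ≡ inj₂ j
    cases : ∀ x → (∃ λ i → x ≡ b i) ⊎ (∃ λ j → x ≡ c j)

complement : ∀ {m r} (b : Fin m → Fin r) → (∀ {i j} → b i ≡ b j → i ≡ j) → Complement b
complement {zero} {r} b inj = record
  { size = r ; c = λ x → x ; decode = inj₂ ; decode-b = λ () ; decode-c = λ _ → refl ; cases = λ x → inj₂ (x , refl) }
complement {suc m} {zero} b inj with b zero
... | ()
complement {suc m} {suc r} b inj = record
  { size = R.size ; c = c ; decode = decode ; decode-b = decode-b ; decode-c = decode-c ; cases = cases }
  where
  b₀ : Fin (suc r)
  b₀ = b zero
  ≢₀ : ∀ i → b₀ ≢ b (suc i)
  ≢₀ i e with inj e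
  ... | ()
  b' : Fin m → Fin r
  b' i = punchOut (≢₀ i)
  module R = Complement (complement b' (λ {i} {j} e → suc-injective (inj (punchOut-injective (≢₀ i) (≢₀ j) e))))
  c : Fin R.size → Fin (suc r)
  c j = punchIn b₀ (R.c j)
  up : Fin m ⊎ Fin R.size → Fin (suc m) ⊎ Fin R.size
  up (inj₁ i) = inj₁ (suc i)
  up (inj₂ j) = inj₂ j
  dec : ∀ x → Dec (b₀ ≡ x) → Fin (suc m) ⊎ Fin R.size
  dec x (yes _) = inj₁ zero
  dec x (no ≢) = up (R.decode (punchOut ≢))
  decode : Fin (suc r) → Fin (suc m) ⊎ Fin R.size
  decode x = dec x (b₀ ≟ x)
  decode-b : ∀ i → decode (b i) ≡ inj₁ i
  decode-b zero with b₀ ≟ b₀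
  ... | yes _ = refl
  ... | no ≢ = ⊥-elim (≢ refl)
  decode-b (suc i) with b₀ ≟ b (suc i)
  ... | yes e = ⊥-elim (≢₀ i e)
  ... | no ≢ = cong up (trans (cong R.decode (punchOut-cong b₀ refl)) (R.decode-b i))
  decode-c : ∀ j → decode (c j) ≡ inj₂ j
  decode-c j with b₀ ≟ c j
  ... | yes e = ⊥-elim (punchInᵢ≢i b₀ (R.c j) (sym e))
  ... | no ≢ = cong up (trans (cong R.decode (trans (punchOut-cong b₀ refl) (punchOut-punchIn b₀))) (R.decode-c j))
  cases : ∀ x → (∃ λ i → x ≡ b i) ⊎ (∃ λ j → x ≡ c j)
  cases x with b₀ ≟ x
  ... | yes e = inj₁ (zero , sym e)
  ... | no ≢ with R.cases (punchOut ≢)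
  ...   | inj₁ (i , e) = inj₁ (suc i , trans (sym (punchIn-punchOut ≢)) (trans (cong (punchIn b₀) e) (punchIn-punchOut (≢₀ i))))
  ...   | inj₂ (j , e) = inj₂ (j , trans (sym (punchIn-punchOut ≢)) (cong (punchIn b₀) e))

-- Bézout for a finite family

∣∣-sign : ∀ a → ∃ λ ε → (ε * a ≡ + ∣ a ∣) × (a ≡ ε * + ∣ a ∣)
∣∣-sign (+ n) = + 1 , ℤₚ.*-identityˡ (+ n) , sym (ℤₚ.*-identityˡ (+ n))
∣∣-sign a@(-[1+ n ]) = - + 1 , ℤₚ.-1*i≡-i a , sym (ℤₚ.-1*i≡-i (+ suc n))

-- The identity for the absolute values is transported along the signs of a and b.
bézout₂ : ∀ a b → ∃ λ g → ∃₂ λ x y → ∃₂ λ a' b' → (x * a + y * b ≡ g) × (a ≡ a' * g) × (b ≡ b' * g)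
bézout₂ a b = build (Bézout.lemma ∣ a ∣ ∣ b ∣) (∣∣-sign a) (∣∣-sign b)
  where
  quotient : ∀ {d k ε c} → d ∣ k → c ≡ ε * + k → ∃ λ c' → c ≡ c' * + d
  quotient {d} {k} {ε} (divides q refl) e = ε * + q , trans e (trans (cong (ε *_) (ℤₚ.pos-* q d)) (sym (ℤₚ.*-assoc ε (+ q) (+ d))))
  combination : ∀ {d ε ε'} → Bézout.Identity d ∣ a ∣ ∣ b ∣ → ε * a ≡ + ∣ a ∣ → ε' * b ≡ + ∣ b ∣ → ∃₂ λ x y → x * a + y * b ≡ + d
  combination {d} {ε} {ε'} (Bézout.+- x y eq) e e' = + x * ε , - (+ y) * ε' , (begin
    + x * ε * a + - (+ y) * ε' * b        ≡⟨ cong₂ _+_ (ℤₚ.*-assoc (+ x) ε a) (ℤₚ.*-assoc (- (+ y)) ε' b) ⟩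
    + x * (ε * a) + - (+ y) * (ε' * b)    ≡⟨ cong₂ (λ s t → + x * s + - (+ y) * t) e e' ⟩
    + x * + ∣ a ∣ + - (+ y) * + ∣ b ∣     ≡⟨ cong (_+ - (+ y) * + ∣ b ∣) (trans (sym (ℤₚ.pos-* x ∣ a ∣)) (trans (cong +_ (sym eq)) (trans (ℤₚ.pos-+ d (y ℕ.* ∣ b ∣)) (cong (_+_ (+ d)) (ℤₚ.pos-* y ∣ b ∣))))) ⟩
    + d + + y * + ∣ b ∣ + - (+ y) * + ∣ b ∣ ≡⟨ lem (+ d) (+ y) (+ ∣ b ∣) ⟩
    + d ∎)
    where
    lem : ∀ d y b → d + y * b + - y * b ≡ d
    lem = solve-∀
  combination {d} {ε} {ε'} (Bézout.-+ x y eq) e e' = - (+ x) * ε , + y * ε' , (begin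
    - (+ x) * ε * a + + y * ε' * b        ≡⟨ cong₂ _+_ (ℤₚ.*-assoc (- (+ x)) ε a) (ℤₚ.*-assoc (+ y) ε' b) ⟩
    - (+ x) * (ε * a) + + y * (ε' * b)    ≡⟨ cong₂ (λ s t → - (+ x) * s + + y * t) e e' ⟩
    - (+ x) * + ∣ a ∣ + + y * + ∣ b ∣     ≡⟨ cong (_+_ (- (+ x) * + ∣ a ∣)) (trans (sym (ℤₚ.pos-* y ∣ b ∣)) (trans (cong +_ (sym eq)) (trans (ℤₚ.pos-+ d (x ℕ.* ∣ a ∣)) (cong (_+_ (+ d)) (ℤₚ.pos-* x ∣ a ∣))))) ⟩
    - (+ x) * + ∣ a ∣ + (+ d + + x * + ∣ a ∣) ≡⟨ lem (+ d) (+ x) (+ ∣ a ∣) ⟩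
    + d ∎)
    where
    lem : ∀ d x a → - x * a + (d + x * a) ≡ d
    lem = solve-∀
  build : Bézout.Lemma ∣ a ∣ ∣ b ∣ → (∃ λ ε → (ε * a ≡ + ∣ a ∣) × (a ≡ ε * + ∣ a ∣)) → (∃ λ ε → (ε * b ≡ + ∣ b ∣) × (b ≡ ε * + ∣ b ∣)) →
          ∃ λ g → ∃₂ λ x y → ∃₂ λ a' b' → (x * a + y * b ≡ g) × (a ≡ a' * g) × (b ≡ b' * g)
  build (Bézout.result d g i) (ε , e₁ , e₂) (ε' , e₁' , e₂') =
    let (x , y , eq) = combination {d} {ε} {ε'} i e₁ e₁'
        (a' , qa) = quotient {ε = ε} (GCD.gcd∣m g) e₂
        (b' , qb) = quotient {ε = ε'} (GCD.gcd∣n g) e₂'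
    in + d , x , y , a' , b' , eq , qa , qb

record Bezout {n : ℕ} (s : Fin n → ℤ) : Set where
  field
    g : ℤ
    coef quot : Fin n → ℤ
    combination : ∑ (λ i → coef i * s i) ≡ g
    divisible : ∀ i → s i ≡ quot i * g

bézout : ∀ {n} (s : Fin n → ℤ) → Bezout s
bézout {zero} s = record { g = + 0 ; coef = λ () ; quot = λ () ; combination = refl ; divisible = λ () }
bézout {suc n} s = step (bézout (λ i → s (suc i))) (bézout₂ (s zero) (Bezout.g (bézout (λ i → s (suc i)))))
  where
  step : (R : Bezout (λ i → s (suc i))) →
         (∃ λ g → ∃₂ λ x y → ∃₂ λ a' b' → (x * s zero + y * Bezout.g R ≡ g) × (s zero ≡ a' * g) × (Bezout.g R ≡ b' * g)) → Bezout s
  step R (g , x , y , a' , b' , eq , qa , qb) = record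
    { g = g ; coef = coef' ; quot = quot' ; combination = comb ; divisible = div }
    where
    open Bezout R renaming (g to g'; coef to coef₀; quot to quot₀)
    coef' quot' : Fin (suc n) → ℤ
    coef' zero = x
    coef' (suc i) = y * coef₀ i
    quot' zero = a'
    quot' (suc i) = quot₀ i * b'
    comb : x * s zero + ∑ (λ i → y * coef₀ i * s (suc i)) ≡ g
    comb = trans (cong (_+_ (x * s zero)) (trans (∑-cong (λ i → ℤₚ.*-assoc y (coef₀ i) (s (suc i)))) (trans (∑-*ˡ y (λ i → coef₀ i * s (suc i))) (cong (y *_) combination)))) eq
    div : ∀ i → s i ≡ quot' i * g
    div zero = qa
    div (suc i) = trans (divisible i) (trans (cong (quot₀ i *_) qb) (sym (ℤₚ.*-assoc (quot₀ i) b' g)))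

-- Relations on n letters, and for each letter a sum-zero combination of the rows

module Relations (n : ℕ) where

  -- Codes of all n × n matrices with entries 0 and 1. The orbit relations of subgroups are among
  -- them, and finiteness holds by construction.
  Code : Set
  Code = Fin ((2 ℕ.^ n) ℕ.^ n)

  entry : Code → Fin n → Fin n → ℤ
  entry o i j = + toℕ (finToFun {2} {n} (finToFun {2 ℕ.^ n} {n} o i) j)

  bit : ∀ {P : Set} → Dec P → Fin 2
  bit (yes _) = suc zero
  bit (no _) = zero

  toℕ-bit : ∀ {P : Set} (d : Dec P) → + toℕ (bit d) ≡ χ d
  toℕ-bit (yes _) = refl
  toℕ-bit (no _) = refl

  code : {P : Fin n → Fin n → Set} → (∀ i j → Dec (P i j)) → Code
  code D = funToFin (λ i → funToFin (λ j → bit (D i j)))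

  entry-code : {P : Fin n → Fin n → Set} (D : ∀ i j → Dec (P i j)) → ∀ i j → entry (code D) i j ≡ χ (D i j)
  entry-code D i j = trans (cong (λ x → + toℕ x) (trans (cong (λ x → finToFun {2} {n} x j) (finToFun-funToFin (λ i → funToFin (λ j → bit (D i j))) i))
    (finToFun-funToFin (λ j → bit (D i j)) j))) (toℕ-bit (D i j))

  rowsum : Code → Fin n → ℤ
  rowsum o i = ∑ (entry o i)

  module Bz (o : Code) = Bezout (bézout (rowsum o))

  -- For an orbit relation, row i is the indicator of the orbit of i. The Bézout combination of the
  -- rows has sum g, which divides every row sum, so a multiple of it brings the sum of row i to
  -- zero. Every subgroup with this orbit relation fixes the result.
  combo : Code → Fin n → ZVec n
  combo o i j = entry o i j - Bz.quot o i * ∑ (λ l → Bz.coef o l * entry o l j)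

  ∑-combo : ∀ o i → ∑ (combo o i) ≡ + 0
  ∑-combo o i = begin
    ∑ (combo o i)
      ≡⟨ ∑-- (entry o i) (λ j → Bz.quot o i * ∑ (λ l → Bz.coef o l * entry o l j)) ⟩
    rowsum o i - ∑ (λ j → Bz.quot o i * ∑ (λ l → Bz.coef o l * entry o l j))
      ≡⟨ cong (_-_ (rowsum o i)) (trans (∑-*ˡ (Bz.quot o i) (λ j → ∑ (λ l → Bz.coef o l * entry o l j)))
           (cong (Bz.quot o i *_) (trans (∑-swap (λ j l → Bz.coef o l * entry o l j)) (trans (∑-cong (λ l → ∑-*ˡ (Bz.coef o l) (entry o l))) (Bz.combination o))))) ⟩
    rowsum o i - Bz.quot o i * Bz.g o
      ≡⟨ ℤₚ.i≡j⇒i-j≡0 (Bz.divisible o i) ⟩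
    + 0 ∎

-- A finite G-set of vectors of sum zero

record Cover (n : ℕ) : Set where
  open Relations n public
  field
    X : GSet n
  open GSet X public
  field
    φ : Fin size → ZVec n
    ∑-φ : ∀ x → ∑ (φ x) ≡ + 0
    φ-⋆ : ∀ σ x i → φ (σ ⋆ x) i ≡ φ x (σ ⟨$⟩ˡ i)
    -- The edges e_i - e_j make ι split over ℤ and recover differences of coordinates from its
    -- image; the vectors `vec o i` are there for flasqueness.
    edge : Fin n → Fin n → Fin size
    φ-edge : ∀ i j k → φ (edge i j) k ≡ χ (i ≟ k) - χ (j ≟ k)
    edge-⋆ : ∀ σ i j → σ ⋆ edge i j ≡ edge (σ ⟨$⟩ʳ i) (σ ⟨$⟩ʳ j)
    vec : Code → Fin n → Fin size
    φ-vec : ∀ o i → φ (vec o i) ≐ combo o i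
    vec-fixed : ∀ o i σ → (combo o i ◁ σ) ≐ combo o i → σ ⋆ vec o i ≡ vec o i

upperBound : ∀ {r} (f : Fin r → ℕ) → ∃ λ B → ∀ i → f i ℕ.≤ B
upperBound {zero} f = 0 , λ ()
upperBound {suc r} f with upperBound (λ i → f (suc i))
... | B , le = f zero ℕ.⊔ B , λ { zero → ℕₚ.m≤m⊔n (f zero) B ; (suc i) → ℕₚ.≤-trans (le i) (ℕₚ.m≤n⊔m (f zero) B) }

funToFin-cong : ∀ {m n} {f g : Fin m → Fin n} → (∀ i → f i ≡ g i) → funToFin f ≡ funToFin g
funToFin-cong {zero} e = refl
funToFin-cong {suc m} e = cong₂ combine (e zero) (funToFin-cong (λ i → e (suc i)))

module BoundedVectors (n B : ℕ) where

  -- The digits 0, ..., 2B stand for the entries -B, ..., B.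
  w : ℕ
  w = suc (B ℕ.+ B)

  X : Set
  X = Fin (w ℕ.^ n)

  value : Fin w → ℤ
  value d = + toℕ d - + B

  digit : ℤ → Fin w
  digit z = fromℕ< (ℕ.m%n<n ∣ z + + B ∣ w)

  value-digit : ∀ z → ∣ z ∣ ℕ.≤ B → value (digit z) ≡ z
  value-digit z le = begin
    + toℕ (digit z) - + B            ≡⟨ cong (λ a → + a - + B) (trans (toℕ-fromℕ< (ℕ.m%n<n ∣ z + + B ∣ w)) (ℕ.m<n⇒m%n≡m small)) ⟩
    + ∣ z + + B ∣ - + B              ≡⟨ cong (_- + B) (ℤₚ.0≤i⇒+∣i∣≡i nonneg) ⟩
    (z + + B) - + B                  ≡⟨ lem z (+ B) ⟩
    z ∎
    where
    lem : ∀ a b → (a + b) - b ≡ a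
    lem = solve-∀
    small : ∣ z + + B ∣ ℕ.< w
    small = ℕ.s≤s (ℕₚ.≤-trans (ℤₚ.∣i+j∣≤∣i∣+∣j∣ z (+ B)) (ℕₚ.+-monoˡ-≤ B le))
    nonneg : + 0 ℤ.≤ z + + B
    nonneg = go z le
      where
      go : ∀ z → ∣ z ∣ ℕ.≤ B → + 0 ℤ.≤ z + + B
      go (+ k) le = +≤+ ℕ.z≤n
      go -[1+ k ] le = subst (+ 0 ℤ.≤_) (sym (ℤₚ.⊖-≥ le)) (+≤+ ℕ.z≤n)

  value-injective : ∀ {d d'} → value d ≡ value d' → d ≡ d'
  value-injective {d} {d'} e = toℕ-injective (ℤₚ.+-injective (trans (sym (lem (+ toℕ d) (+ B))) (trans (cong (_+ + B) e) (lem (+ toℕ d') (+ B)))))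
    where
    lem : ∀ a b → (a - b) + b ≡ a
    lem = solve-∀

  coord : X → ZVec n
  coord x i = value (finToFun {w} {n} x i)

  coord-injective : ∀ {x y} → coord x ≐ coord y → x ≡ y
  coord-injective {x} {y} e = trans (sym (funToFin-finToFin {n} {w} x)) (trans (funToFin-cong {n} {w} (λ i → value-injective (e i))) (funToFin-finToFin {n} {w} y))

  encode : ZVec n → X
  encode v = funToFin (λ i → digit (v i))

  coord-encode : ∀ v → (∀ i → ∣ v i ∣ ℕ.≤ B) → coord (encode v) ≐ v
  coord-encode v le i = trans (cong value (finToFun-funToFin (λ i → digit (v i)) i)) (value-digit (v i) (le i))

  set : GSet n
  set = record
    { size = w ℕ.^ n
    ; _⋆_ = move
    ; ⋆-cong = λ {σ} {τ} e x → coord-injective (λ i → trans (coord-move σ x i) (trans (cong (coord x) (inverse-cong σ τ e i)) (sym (coord-move τ x i))))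
    ; ⋆-id = λ x → coord-injective (coord-move idₚ x)
    ; ⋆-∙ = λ σ τ x → coord-injective (λ i → trans (coord-move (σ ∙ τ) x i) (sym (trans (coord-move σ (move τ x) i) (coord-move τ x (σ ⟨$⟩ˡ i)))))
    }
    where
    move : Sym n → X → X
    move σ x = funToFin (λ i → finToFun {w} {n} x (σ ⟨$⟩ˡ i))
    coord-move : ∀ σ x i → coord (move σ x) i ≡ coord x (σ ⟨$⟩ˡ i)
    coord-move σ x i = cong value (finToFun-funToFin (λ i → finToFun {w} {n} x (σ ⟨$⟩ˡ i)) i)
    inverse-cong : ∀ σ τ → σ ≈ₚ τ → ∀ i → σ ⟨$⟩ˡ i ≡ τ ⟨$⟩ˡ i
    inverse-cong σ τ e i = trans (sym (inverseˡ τ)) (cong (τ ⟨$⟩ˡ_) (trans (sym (e (σ ⟨$⟩ˡ i))) (inverseʳ σ)))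

  open GSet set

  coord-⋆ : ∀ σ x i → coord (σ ⋆ x) i ≡ coord x (σ ⟨$⟩ˡ i)
  coord-⋆ σ x i = cong value (finToFun-funToFin (λ i → finToFun {w} {n} x (σ ⟨$⟩ˡ i)) i)

  balanced? : ∀ x → Dec (∑ (coord x) ≡ + 0)
  balanced? x = ∑ (coord x) ℤ.≟ + 0

  -- A vector of nonzero sum stays in X but is assigned 0, so that X is a full set of words and no
  -- subset has to be enumerated.
  φ : X → ZVec n
  φ x i = χ (balanced? x) * coord x i

  ∑-φ : ∀ x → ∑ (φ x) ≡ + 0
  ∑-φ x = trans (∑-*ˡ (χ (balanced? x)) (coord x)) (by (balanced? x))
    where
    by : (d : Dec (∑ (coord x) ≡ + 0)) → χ d * ∑ (coord x) ≡ + 0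
    by (yes e) = cong (+ 1 *_) e
    by (no _) = ℤₚ.*-zeroˡ (∑ (coord x))

  φ-⋆ : ∀ σ x i → φ (σ ⋆ x) i ≡ φ x (σ ⟨$⟩ˡ i)
  φ-⋆ σ x i = cong₂ _*_ (χ-cong (balanced? (σ ⋆ x)) (balanced? x) (trans (sym same)) (trans same)) (coord-⋆ σ x i)
    where
    same : ∑ (coord (σ ⋆ x)) ≡ ∑ (coord x)
    same = trans (∑-cong (coord-⋆ σ x)) (sym (∑-permute (coord x) (flip σ)))

  φ-encode : ∀ v → (∀ i → ∣ v i ∣ ℕ.≤ B) → ∑ v ≡ + 0 → φ (encode v) ≐ v
  φ-encode v le e i = trans (cong₂ _*_ (χ-yes (balanced? (encode v)) (trans (∑-cong (coord-encode v le)) e)) (coord-encode v le i)) (ℤₚ.*-identityˡ (v i))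

cover : ∀ n → Cover n
cover n = record
  { X = set ; φ = φ ; ∑-φ = ∑-φ ; φ-⋆ = φ-⋆
  ; edge = λ i j → encode (edgeV i j)
  ; φ-edge = λ i j → φ-encode (edgeV i j) (edge-bound i j) (edge-sum i j)
  ; edge-⋆ = λ σ i j → coord-injective (λ k → trans (coord-⋆ σ (encode (edgeV i j)) k) (trans (coord-encode (edgeV i j) (edge-bound i j) (σ ⟨$⟩ˡ k))
      (trans (cong₂ _-_ (moved σ i k) (moved σ j k)) (sym (coord-encode (edgeV (σ ⟨$⟩ʳ i) (σ ⟨$⟩ʳ j)) (edge-bound (σ ⟨$⟩ʳ i) (σ ⟨$⟩ʳ j)) k)))))
  ; vec = λ o i → encode (combo o i)
  ; φ-vec = λ o i → φ-encode (combo o i) (combo-bound o i) (∑-combo o i)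
  ; vec-fixed = λ o i σ e → coord-injective (λ k → trans (coord-⋆ σ (encode (combo o i)) k) (trans (coord-encode (combo o i) (combo-bound o i) (σ ⟨$⟩ˡ k))
      (trans (e k) (sym (coord-encode (combo o i) (combo-bound o i) k)))))
  }
  where
  open Relations n
  bound : ∃ λ B → ∀ o → proj₁ (upperBound (λ i → proj₁ (upperBound (λ j → ∣ combo o i j ∣)))) ℕ.≤ B
  bound = upperBound (λ o → proj₁ (upperBound (λ i → proj₁ (upperBound (λ j → ∣ combo o i j ∣)))))
  -- The successor makes the bound at least 1, as the edges e_i - e_j require.
  open BoundedVectors n (suc (proj₁ bound))
  open GSet set
  combo-bound : ∀ o i j → ∣ combo o i j ∣ ℕ.≤ suc (proj₁ bound)
  combo-bound o i j = ℕₚ.m≤n⇒m≤1+n (ℕₚ.≤-trans (proj₂ (upperBound (λ j → ∣ combo o i j ∣)) j)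
    (ℕₚ.≤-trans (proj₂ (upperBound (λ i → proj₁ (upperBound (λ j → ∣ combo o i j ∣)))) i) (proj₂ bound o)))
  edgeV : Fin n → Fin n → ZVec n
  edgeV i j k = χ (i ≟ k) - χ (j ≟ k)
  edge-bound : ∀ i j k → ∣ edgeV i j k ∣ ℕ.≤ suc (proj₁ bound)
  edge-bound i j k with i ≟ k | j ≟ k
  ... | yes _ | yes _ = ℕ.z≤n
  ... | yes _ | no _ = ℕ.s≤s ℕ.z≤n
  ... | no _ | yes _ = ℕ.s≤s ℕ.z≤n
  ... | no _ | no _ = ℕ.z≤n
  ∑-unit : ∀ i → ∑ (λ k → χ (i ≟ k)) ≡ + 1
  ∑-unit i = trans (∑-single (λ k → χ (i ≟ k)) i (λ k k≢ → χ-no (i ≟ k) (λ e → k≢ (sym e)))) (χ-yes (i ≟ i) refl)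
  edge-sum : ∀ i j → ∑ (edgeV i j) ≡ + 0
  edge-sum i j = trans (∑-- (λ k → χ (i ≟ k)) (λ k → χ (j ≟ k))) (cong₂ _-_ (∑-unit i) (∑-unit j))
  moved : ∀ (σ : Sym n) i k → χ (i ≟ (σ ⟨$⟩ˡ k)) ≡ χ ((σ ⟨$⟩ʳ i) ≟ k)
  moved σ i k = χ-cong (i ≟ (σ ⟨$⟩ˡ k)) ((σ ⟨$⟩ʳ i) ≟ k) (λ { refl → inverseʳ σ }) (λ { refl → sym (inverseˡ σ) })

-- The flasque resolution of J

module Resolution {m : ℕ} (𝒞 : Cover (suc m)) where

  open Cover 𝒞

  n : ℕ
  n = suc m

  P : Rep n
  P = lattice

  P-lat : IsGLattice P
  P-lat = lattice-isGLattice

  ⟨_,_⟩ : ZVec n → ZVec n → ℤ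
  ⟨ v , u ⟩ = ∑ (λ i → v i * u i)

  K : ZMat size m
  K x i = φ x (inject₁ i)

  -- As `φ x` has sum zero, subtracting the last coordinate from all of u does not change the
  -- pairing.
  K-diff : ∀ u x → (K ·ᶻ (diff m ·ᶻ u)) x ≡ ⟨ φ x , u ⟩
  K-diff u x = begin
    ∑ (λ i → φ x (inject₁ i) * (diff m ·ᶻ u) i)     ≡⟨ ∑-cong (λ i → cong (φ x (inject₁ i) *_) (diff-· u i)) ⟩
    ∑ (λ i → f (inject₁ i))                         ≡⟨ sym (ℤₚ.+-identityʳ _) ⟩
    ∑ (λ i → f (inject₁ i)) + + 0                   ≡⟨ cong (_+_ (∑ (λ i → f (inject₁ i)))) (sym (lem (φ x l) (u l))) ⟩
    ∑ (λ i → f (inject₁ i)) + f l                   ≡⟨ sym (∑-last f) ⟩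
    ∑ f                                             ≡⟨ ∑-cong (λ j → lem' (φ x j) (u j) (u l)) ⟩
    ∑ (λ j → φ x j * u j - φ x j * u l)             ≡⟨ ∑-- (λ j → φ x j * u j) (λ j → φ x j * u l) ⟩
    ⟨ φ x , u ⟩ - ∑ (λ j → φ x j * u l)             ≡⟨ cong (_-_ ⟨ φ x , u ⟩) (trans (∑-*ʳ (u l) (φ x)) (trans (cong (_* u l) (∑-φ x)) (ℤₚ.*-zeroˡ (u l)))) ⟩
    ⟨ φ x , u ⟩ - + 0                               ≡⟨ ℤₚ.+-identityʳ _ ⟩
    ⟨ φ x , u ⟩ ∎
    where
    l = fromℕ m
    f : ZVec n
    f j = φ x j * (u j - u l)
    lem : ∀ a b → a * (b - b) ≡ + 0
    lem = solve-∀
    lem' : ∀ a b c → a * (b - c) ≡ a * b - a * c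
    lem' = solve-∀

  K-ext : ∀ y x → (K ·ᶻ y) x ≡ ⟨ φ x , ext y ⟩
  K-ext y x = trans (·-cong K (λ i → sym (diff-ext y i)) x) (K-diff (ext y) x)

  pair-◁ : ∀ σ u x → ⟨ φ x , u ◁ σ ⟩ ≡ ⟨ φ ((σ ⁻¹) ⋆ x) , u ⟩
  pair-◁ σ u x = begin
    ∑ (λ i → φ x i * u (σ ⟨$⟩ˡ i))                   ≡⟨ ∑-permute (λ i → φ x i * u (σ ⟨$⟩ˡ i)) σ ⟩
    ∑ (λ i → φ x (σ ⟨$⟩ʳ i) * u (σ ⟨$⟩ˡ (σ ⟨$⟩ʳ i)))  ≡⟨ ∑-cong {n} (λ i → cong₂ _*_ (sym (φ-⋆ (σ ⁻¹) x i)) (cong u (inverseˡ σ {i}))) ⟩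
    ∑ (λ i → φ ((σ ⁻¹) ⋆ x) i * u i) ∎

  ι : GMap (J n) P
  ι = mkGMap K λ σ y x → begin
    (K ·ᶻ (act (J n) σ ·ᶻ y)) x                    ≡⟨ ·-cong K (λ i → trans (·-cong (act (J n) σ) (λ j → sym (diff-ext y j)) i) (J-act σ (ext y) i)) x ⟩
    (K ·ᶻ (diff m ·ᶻ (ext y ◁ σ))) x               ≡⟨ K-diff (ext y ◁ σ) x ⟩
    ⟨ φ x , ext y ◁ σ ⟩                            ≡⟨ pair-◁ σ (ext y) x ⟩
    ⟨ φ ((σ ⁻¹) ⋆ x) , ext y ⟩                     ≡⟨ sym (K-ext y ((σ ⁻¹) ⋆ x)) ⟩
    (K ·ᶻ y) ((σ ⁻¹) ⋆ x)                          ≡⟨ sym (act-lattice σ (K ·ᶻ y) x) ⟩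
    (act P σ ·ᶻ (K ·ᶻ y)) x ∎

  -- The rows of K at these m points form the identity matrix. Hence J is a direct summand of ℤ[X]
  -- as an abelian group, and the remaining points index a ℤ-basis of the quotient F.
  b : Fin m → Fin size
  b i = edge (inject₁ i) (fromℕ m)

  K-b : ∀ i k → K (b i) k ≡ χ (i ≟ k)
  K-b i k = trans (φ-edge (inject₁ i) (fromℕ m) (inject₁ k)) (trans (cong₂ _-_
    (χ-cong (inject₁ i ≟ inject₁ k) (i ≟ k) inject₁-injective (cong inject₁)) (χ-no (fromℕ m ≟ inject₁ k) fromℕ≢inject₁)) (ℤₚ.+-identityʳ (χ (i ≟ k))))

  K-at-b : ∀ y i → (K ·ᶻ y) (b i) ≡ y i
  K-at-b y i = trans (∑-cong (λ k → cong (_* y k) (K-b i k))) (∑-χ i y)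

  b-injective : ∀ {i j} → b i ≡ b j → i ≡ j
  b-injective {i} {j} e with i ≟ j
  ... | yes q = q
  ... | no ¬q with trans (sym (trans (K-b i i) (χ-yes (i ≟ i) refl))) (trans (cong (λ x → K x i) e) (trans (K-b j i) (χ-no (j ≟ i) (λ q → ¬q (sym q)))))
  ...   | ()

  compl : Complement b
  compl = complement b b-injective

  module C = Complement compl

  -- The element of J that agrees with z on b is subtracted, and the result is read at the other
  -- points.
  Πm : ZMat C.size size
  Πm j x = χ (C.c j ≟ x) - ∑ (λ i → K (C.c j) i * χ (b i ≟ x))

  Π-· : ∀ z j → (Πm ·ᶻ z) j ≡ z (C.c j) - ∑ (λ i → K (C.c j) i * z (b i))
  Π-· z j = begin
    ∑ (λ x → (χ (C.c j ≟ x) - ∑ (λ i → K (C.c j) i * χ (b i ≟ x))) * z x)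
      ≡⟨ ∑-cong (λ x → trans (lem (χ (C.c j ≟ x)) (∑ (λ i → K (C.c j) i * χ (b i ≟ x))) (z x)) (cong (_-_ (χ (C.c j ≟ x) * z x))
           (trans (sym (∑-*ʳ (z x) (λ i → K (C.c j) i * χ (b i ≟ x)))) (∑-cong (λ i → ℤₚ.*-assoc (K (C.c j) i) (χ (b i ≟ x)) (z x)))))) ⟩
    ∑ (λ x → χ (C.c j ≟ x) * z x - ∑ (λ i → K (C.c j) i * (χ (b i ≟ x) * z x)))
      ≡⟨ ∑-- (λ x → χ (C.c j ≟ x) * z x) (λ x → ∑ (λ i → K (C.c j) i * (χ (b i ≟ x) * z x))) ⟩
    ∑ (λ x → χ (C.c j ≟ x) * z x) - ∑ (λ x → ∑ (λ i → K (C.c j) i * (χ (b i ≟ x) * z x)))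
      ≡⟨ cong₂ _-_ (∑-χ (C.c j) z) (trans (∑-swap (λ x i → K (C.c j) i * (χ (b i ≟ x) * z x)))
           (∑-cong (λ i → trans (∑-*ˡ (K (C.c j) i) (λ x → χ (b i ≟ x) * z x)) (cong (K (C.c j) i *_) (∑-χ (b i) z))))) ⟩
    z (C.c j) - ∑ (λ i → K (C.c j) i * z (b i)) ∎
    where
    lem : ∀ a b c → (a - b) * c ≡ a * c - b * c
    lem = solve-∀

  place : Fin m ⊎ Fin C.size → Fin C.size → ℤ
  place (inj₁ _) j = + 0
  place (inj₂ k) j = χ (k ≟ j)

  Inc : ZMat size C.size
  Inc x = place (C.decode x)

  Inc-b : ∀ w i → (Inc ·ᶻ w) (b i) ≡ + 0
  Inc-b w i = ∑-0 (λ j → trans (cong (λ d → place d j * w j) (C.decode-b i)) (ℤₚ.*-zeroˡ (w j)))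

  Inc-c : ∀ w j → (Inc ·ᶻ w) (C.c j) ≡ w j
  Inc-c w j = trans (∑-cong (λ k → cong (λ d → place d k * w k) (C.decode-c j))) (∑-χ j w)

  Π-Inc : ∀ w → (Πm ·ᶻ (Inc ·ᶻ w)) ≐ w
  Π-Inc w j = trans (Π-· (Inc ·ᶻ w) j) (trans (cong₂ _-_ (Inc-c w j)
    (∑-0 (λ i → trans (cong (K (C.c j) i *_) (Inc-b w i)) (ℤₚ.*-zeroʳ (K (C.c j) i))))) (ℤₚ.+-identityʳ (w j)))

  Π-K : ∀ y → (Πm ·ᶻ (K ·ᶻ y)) ≐ zeroV
  Π-K y j = trans (Π-· (K ·ᶻ y) j) (ℤₚ.i≡j⇒i-j≡0 (∑-cong (λ i → cong (K (C.c j) i *_) (sym (K-at-b y i)))))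

  splitting : ∀ z x → z x ≡ (Inc ·ᶻ (Πm ·ᶻ z)) x + (K ·ᶻ (λ i → z (b i))) x
  splitting z x with C.cases x
  ... | inj₁ (i , refl) = sym (trans (cong₂ _+_ (Inc-b (Πm ·ᶻ z) i) (K-at-b (λ i → z (b i)) i)) (ℤₚ.+-identityˡ (z (b i))))
  ... | inj₂ (j , refl) = sym (trans (cong (_+ (K ·ᶻ (λ i → z (b i))) (C.c j)) (trans (Inc-c (Πm ·ᶻ z) j) (Π-· z j))) (lem (z (C.c j)) ((K ·ᶻ (λ i → z (b i))) (C.c j))))
    where
    lem : ∀ a b → (a - b) + b ≡ a
    lem = solve-∀

  F : Rep n
  F = record { rank = C.size ; act = λ σ → Πm ⊗ᶻ (act P σ ⊗ᶻ Inc) }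

  F-· : ∀ σ w → (act F σ ·ᶻ w) ≐ (Πm ·ᶻ (act P σ ·ᶻ (Inc ·ᶻ w)))
  F-· σ w j = trans (⊗-· Πm (act P σ ⊗ᶻ Inc) w j) (·-cong Πm (⊗-· (act P σ) Inc w) j)

  -- z and `Inc ·ᶻ (Πm ·ᶻ z)` differ by an element of J, which is stable under the action and killed
  -- by `Πm`.
  Π-act : ∀ σ z → (Πm ·ᶻ (act P σ ·ᶻ z)) ≐ (act F σ ·ᶻ (Πm ·ᶻ z))
  Π-act σ z j = begin
    (Πm ·ᶻ (act P σ ·ᶻ z)) j
      ≡⟨ ·-cong Πm (·-cong (act P σ) (splitting z)) j ⟩
    (Πm ·ᶻ (act P σ ·ᶻ ((Inc ·ᶻ (Πm ·ᶻ z)) ⊞ (K ·ᶻ zb)))) j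
      ≡⟨ trans (·-cong Πm (·-⊞ (act P σ) (Inc ·ᶻ (Πm ·ᶻ z)) (K ·ᶻ zb)) j) (·-⊞ Πm (act P σ ·ᶻ (Inc ·ᶻ (Πm ·ᶻ z))) (act P σ ·ᶻ (K ·ᶻ zb)) j) ⟩
    (Πm ·ᶻ (act P σ ·ᶻ (Inc ·ᶻ (Πm ·ᶻ z)))) j + (Πm ·ᶻ (act P σ ·ᶻ (K ·ᶻ zb))) j
      ≡⟨ cong₂ _+_ (sym (F-· σ (Πm ·ᶻ z) j)) (trans (·-cong Πm (λ x → sym (gmap-· ι σ zb x)) j) (Π-K (act (J n) σ ·ᶻ zb) j)) ⟩
    (act F σ ·ᶻ (Πm ·ᶻ z)) j + + 0
      ≡⟨ ℤₚ.+-identityʳ _ ⟩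
    (act F σ ·ᶻ (Πm ·ᶻ z)) j ∎
    where
    zb : ZVec m
    zb i = z (b i)

  π : GMap P F
  π = mkGMap Πm Π-act

  F-lat : IsGLattice F
  F-lat = record
    { act-cong = λ {σ} {τ} e → ≋-ext λ w j → trans (F-· σ w j) (trans (·-cong Πm (≋-· (IsGLattice.act-cong P-lat e) (Inc ·ᶻ w)) j) (sym (F-· τ w j)))
    ; act-id = ≋-ext λ w j → trans (F-· idₚ w j) (trans (·-cong Πm (λ x → trans (≋-· (IsGLattice.act-id P-lat) (Inc ·ᶻ w) x) (I-· (Inc ·ᶻ w) x)) j) (trans (Π-Inc w j) (sym (I-· w j))))
    ; act-∙ = λ σ τ → ≋-ext λ w j → begin
        (act F (σ ∙ τ) ·ᶻ w) j                                ≡⟨ F-· (σ ∙ τ) w j ⟩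
        (Πm ·ᶻ (act P (σ ∙ τ) ·ᶻ (Inc ·ᶻ w))) j               ≡⟨ ·-cong Πm (act-∙-· P-lat σ τ (Inc ·ᶻ w)) j ⟩
        (Πm ·ᶻ (act P σ ·ᶻ (act P τ ·ᶻ (Inc ·ᶻ w)))) j        ≡⟨ Π-act σ (act P τ ·ᶻ (Inc ·ᶻ w)) j ⟩
        (act F σ ·ᶻ (Πm ·ᶻ (act P τ ·ᶻ (Inc ·ᶻ w)))) j        ≡⟨ ·-cong (act F σ) (λ i → sym (F-· τ w i)) j ⟩
        (act F σ ·ᶻ (act F τ ·ᶻ w)) j                         ≡⟨ sym (⊗-· (act F σ) (act F τ) w j) ⟩
        ((act F σ ⊗ᶻ act F τ) ·ᶻ w) j ∎
    }

  exact : ∀ z → (Πm ·ᶻ z) ≐ zeroV → ∀ x → (K ·ᶻ (λ i → z (b i))) x ≡ z x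
  exact z e x = sym (trans (splitting z x) (trans (cong (_+ (K ·ᶻ (λ i → z (b i))) x) (trans (·-cong Inc e x) (·-zero Inc x))) (ℤₚ.+-identityˡ _)))

  pair-edge : ∀ v i j → ⟨ φ (edge i j) , v ⟩ ≡ v i - v j
  pair-edge v i j = trans (∑-cong (λ k → trans (cong (_* v k) (φ-edge i j k)) (lem (χ (i ≟ k)) (χ (j ≟ k)) (v k))))
    (trans (∑-- (λ k → χ (i ≟ k) * v k) (λ k → χ (j ≟ k) * v k)) (cong₂ _-_ (∑-χ i v) (∑-χ j v)))
    where
    lem : ∀ a b c → (a - b) * c ≡ a * c - b * c
    lem = solve-∀

  module Vanishing {k : ℕ} (e : Fin k → Sym n) (H : IsSubgroup e) (w : ZVec C.size)
                   (Nw : ∀ j → ∑ (λ h → (act F (e h) ·ᶻ w) j) ≡ + 0) where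

    open Subgroup e H
    module XO = Orbits X
    module LO = Orbits (points n)

    z Nz : ZVec size
    z = Inc ·ᶻ w
    Nz x = ∑ (λ h → z ((e h ⁻¹) ⋆ x))

    Π-Nz : (Πm ·ᶻ Nz) ≐ zeroV
    Π-Nz j = begin
      (Πm ·ᶻ Nz) j                                      ≡⟨ ·-cong Πm (λ x → ∑-cong (λ h → sym (act-lattice (e h) z x))) j ⟩
      (Πm ·ᶻ vsum (λ h → act P (e h) ·ᶻ z)) j           ≡⟨ ·-vsum Πm (λ h → act P (e h) ·ᶻ z) j ⟩
      ∑ (λ h → (Πm ·ᶻ (act P (e h) ·ᶻ z)) j)            ≡⟨ ∑-cong (λ h → sym (F-· (e h) w j)) ⟩
      ∑ (λ h → (act F (e h) ·ᶻ w) j)                    ≡⟨ Nw j ⟩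
      + 0 ∎

    u : ZVec n
    u = ext (λ i → Nz (b i))

    u-pair : ∀ x → ⟨ φ x , u ⟩ ≡ Nz x
    u-pair x = trans (sym (K-ext (λ i → Nz (b i)) x)) (exact Nz Π-Nz x)

    Nz-inv : ∀ a x → Nz (e a ⋆ x) ≡ Nz x
    Nz-inv a x = begin
      ∑ (λ h → z ((e h ⁻¹) ⋆ (e a ⋆ x)))          ≡⟨ ∑-inv (λ σ → z (σ ⋆ (e a ⋆ x))) (λ q → cong z (⋆-cong q _)) ⟩
      ∑ (λ h → z (e h ⋆ (e a ⋆ x)))               ≡⟨ ∑-cong (λ h → cong z (trans (sym (⋆-∙ (e h) (e a) x)) (⋆-cong {e h ∙ e a} {((e a ⁻¹) ∙ (e h ⁻¹)) ⁻¹} (λ i → refl) x))) ⟩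
      ∑ (λ h → G ((e a ⁻¹) ∙ (e h ⁻¹)))           ≡⟨ ∑-inv (λ σ → G ((e a ⁻¹) ∙ σ)) (λ q → G-cong (λ i → cong (e a ⟨$⟩ˡ_) (q i))) ⟩
      ∑ (λ h → G ((e a ⁻¹) ∙ e h))                ≡⟨ ∑-cong {k} (λ h → G-cong {(e a ⁻¹) ∙ e h} {e (inv a) ∙ e h} (λ i → sym (e-inv a (e h ⟨$⟩ʳ i)))) ⟩
      ∑ (λ h → G (e (inv a) ∙ e h))               ≡⟨ ∑-left G G-cong (inv a) ⟩
      ∑ (λ h → G (e h)) ∎
      where
      G : Sym n → ℤ
      G σ = z ((σ ⁻¹) ⋆ x)
      G-cong : ∀ {σ τ} → σ ≈ₚ τ → G σ ≡ G τ
      G-cong {σ} {τ} q = cong z (⋆-cong {σ ⁻¹} {τ ⁻¹} (λ i → trans (sym (inverseˡ τ)) (cong (τ ⟨$⟩ˡ_) (trans (sym (q (σ ⟨$⟩ˡ i))) (inverseʳ σ)))) x)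

    -- Pairing with the edges shows that u (a i) - u i is the same for all letters i. These
    -- differences add up to zero, so each of them is zero.
    u-inv : ∀ a i → u (e a ⟨$⟩ʳ i) ≡ u i
    u-inv a i = ℤₚ.i-j≡0⇒i≡j _ _ (pos-*-zero {+ n} refl (begin
      + n * (u (e a ⟨$⟩ʳ i) - u i)               ≡⟨ sym (∑-const n (u (e a ⟨$⟩ʳ i) - u i)) ⟩
      ∑ {n} (λ j → u (e a ⟨$⟩ʳ i) - u i)         ≡⟨ ∑-cong {n} (λ j → shift i j) ⟩
      ∑ {n} (λ j → u (e a ⟨$⟩ʳ j) - u j)         ≡⟨ ∑-- {n} (λ j → u (e a ⟨$⟩ʳ j)) u ⟩
      ∑ {n} (λ j → u (e a ⟨$⟩ʳ j)) - ∑ {n} u     ≡⟨ ℤₚ.i≡j⇒i-j≡0 (sym (∑-permute u (e a))) ⟩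
      + 0 ∎))
      where
      shift : ∀ i j → u (e a ⟨$⟩ʳ i) - u i ≡ u (e a ⟨$⟩ʳ j) - u j
      shift i j = lem (u (e a ⟨$⟩ʳ i)) (u (e a ⟨$⟩ʳ j)) (u i) (u j) (begin
        u (e a ⟨$⟩ʳ i) - u (e a ⟨$⟩ʳ j)                     ≡⟨ sym (pair-edge u (e a ⟨$⟩ʳ i) (e a ⟨$⟩ʳ j)) ⟩
        ⟨ φ (edge (e a ⟨$⟩ʳ i) (e a ⟨$⟩ʳ j)) , u ⟩          ≡⟨ u-pair _ ⟩
        Nz (edge (e a ⟨$⟩ʳ i) (e a ⟨$⟩ʳ j))                 ≡⟨ cong Nz (sym (edge-⋆ (e a) i j)) ⟩
        Nz (e a ⋆ edge i j)                                 ≡⟨ Nz-inv a (edge i j) ⟩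
        Nz (edge i j)                                       ≡⟨ sym (u-pair (edge i j)) ⟩
        ⟨ φ (edge i j) , u ⟩                                ≡⟨ pair-edge u i j ⟩
        u i - u j ∎)
        where
        lem : ∀ a b c d → a - b ≡ c - d → a - c ≡ b - d
        lem a b c d q = ℤₚ.i-j≡0⇒i≡j (a - c) (b - d) (trans (lem' a b c d) (ℤₚ.i≡j⇒i-j≡0 q))
          where
          lem' : ∀ a b c d → (a - c) - (b - d) ≡ (a - b) - (c - d)
          lem' = solve-∀

    o : Code
    o = code LO.Orb?

    ent : ∀ i j → entry o i j ≡ χ (LO.Orb? i j)
    ent = entry-code LO.Orb?

    combo-inv : ∀ a i → (combo o i ◁ e a) ≐ combo o i
    combo-inv a i j = cong₂ (λ s t → s - Bz.quot o i * t) (row i) (∑-cong (λ l → cong (Bz.coef o l *_) (row l)))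
      where
      row : ∀ i → entry o i (e a ⟨$⟩ˡ j) ≡ entry o i j
      row i = trans (ent i (e a ⟨$⟩ˡ j)) (trans (χ-cong (LO.Orb? i (e a ⟨$⟩ˡ j)) (LO.Orb? i j)
        (λ q → LO.Orb-trans q (a , inverseʳ (e a))) (λ q → LO.Orb-trans q (LO.Orb-sym (a , inverseʳ (e a))))) (sym (ent i j)))

    xs : Fin n → Fin size
    xs = vec o

    xs-fixed : ∀ a i → (e a ⁻¹) ⋆ xs i ≡ xs i
    xs-fixed a i = trans (cong ((e a ⁻¹) ⋆_) (sym (vec-fixed o i (e a) (combo-inv a i)))) (⋆-⁻¹ˡ (e a) (xs i))

    s : Fin n → ℤ
    s = rowsum o

    -- The constant to be subtracted from u, which leaves the element of J unchanged.
    c : ℤ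
    c = ∑ (λ l → Bz.coef o l * (Bz.quot o l * u l))

    row-u : ∀ i → ∑ (λ j → entry o i j * u j) ≡ s i * u i
    row-u i = trans (∑-cong (λ j → trans (cong (_* u j) (ent i j)) (trans (χ-*-cong (LO.Orb? i j) (λ { (a , refl) → u-inv a i })) (cong (_* u i) (sym (ent i j)))))) (∑-*ʳ (u i) (entry o i))

    combo-u : ∀ i → ⟨ combo o i , u ⟩ ≡ s i * (u i - c)
    combo-u i = begin
      ∑ (λ j → combo o i j * u j)
        ≡⟨ ∑-cong (λ j → trans (lem (entry o i j) (Bz.quot o i) (∑ (λ l → Bz.coef o l * entry o l j)) (u j))
             (cong (λ t → entry o i j * u j - Bz.quot o i * t) (trans (sym (∑-*ʳ (u j) (λ l → Bz.coef o l * entry o l j))) (∑-cong (λ l → ℤₚ.*-assoc (Bz.coef o l) (entry o l j) (u j)))))) ⟩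
      ∑ (λ j → entry o i j * u j - Bz.quot o i * ∑ (λ l → Bz.coef o l * (entry o l j * u j)))
        ≡⟨ ∑-- (λ j → entry o i j * u j) (λ j → Bz.quot o i * ∑ (λ l → Bz.coef o l * (entry o l j * u j))) ⟩
      ∑ (λ j → entry o i j * u j) - ∑ (λ j → Bz.quot o i * ∑ (λ l → Bz.coef o l * (entry o l j * u j)))
        ≡⟨ cong₂ _-_ (row-u i) (trans (∑-*ˡ (Bz.quot o i) (λ j → ∑ (λ l → Bz.coef o l * (entry o l j * u j)))) (cong (Bz.quot o i *_) total)) ⟩
      s i * u i - Bz.quot o i * (Bz.g o * c)
        ≡⟨ cong (_-_ (s i * u i)) (trans (sym (ℤₚ.*-assoc (Bz.quot o i) (Bz.g o) c)) (cong (_* c) (sym (Bz.divisible o i)))) ⟩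
      s i * u i - s i * c
        ≡⟨ lem' (s i) (u i) c ⟩
      s i * (u i - c) ∎
      where
      lem : ∀ a q t u → (a - q * t) * u ≡ a * u - q * (t * u)
      lem = solve-∀
      lem' : ∀ a b c → a * b - a * c ≡ a * (b - c)
      lem' = solve-∀
      lem″ : ∀ a q g u → a * (q * g * u) ≡ g * (a * (q * u))
      lem″ = solve-∀
      total : ∑ (λ j → ∑ (λ l → Bz.coef o l * (entry o l j * u j))) ≡ Bz.g o * c
      total = trans (∑-swap (λ j l → Bz.coef o l * (entry o l j * u j))) (trans (∑-cong (λ l → trans (∑-*ˡ (Bz.coef o l) (λ j → entry o l j * u j))
        (trans (cong (Bz.coef o l *_) (trans (row-u l) (cong (_* u l) (Bz.divisible o l)))) (lem″ (Bz.coef o l) (Bz.quot o l) (Bz.g o) (u l)))))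
        (∑-*ˡ (Bz.g o) (λ l → Bz.coef o l * (Bz.quot o l * u l))))

    -- The pairs (h, j) with h i = j are counted in both orders.
    orbit-stabiliser : ∀ i → s i * LO.stab i ≡ + k
    orbit-stabiliser i = begin
      s i * LO.stab i                                     ≡⟨ sym (∑-*ʳ (LO.stab i) (entry o i)) ⟩
      ∑ (λ j → entry o i j * LO.stab i)                   ≡⟨ ∑-cong (λ j → trans (cong (_* LO.stab i) (ent i j)) (by j (LO.Orb? i j))) ⟩
      ∑ (λ j → ∑ (λ h → χ ((e h ⟨$⟩ʳ i) ≟ j)))            ≡⟨ ∑-swap (λ j h → χ ((e h ⟨$⟩ʳ i) ≟ j)) ⟩
      ∑ (λ h → ∑ (λ j → χ ((e h ⟨$⟩ʳ i) ≟ j)))            ≡⟨ ∑-cong (λ h → trans (∑-single (λ j → χ ((e h ⟨$⟩ʳ i) ≟ j)) (e h ⟨$⟩ʳ i) (λ j j≢ → χ-no ((e h ⟨$⟩ʳ i) ≟ j) (λ q → j≢ (sym q))))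
                                                               (χ-yes ((e h ⟨$⟩ʳ i) ≟ (e h ⟨$⟩ʳ i)) refl)) ⟩
      ∑ {k} (λ h → + 1)                                   ≡⟨ trans (∑-const k (+ 1)) (ℤₚ.*-identityʳ (+ k)) ⟩
      + k ∎
      where
      by : ∀ j (d : Dec (LO.Orb i j)) → χ d * LO.stab i ≡ ∑ (λ h → χ ((e h ⟨$⟩ʳ i) ≟ j))
      by j (yes q) = trans (ℤₚ.*-identityˡ (LO.stab i)) (sym (LO.transporters q))
      by j (no ¬q) = trans (ℤₚ.*-zeroˡ (LO.stab i)) (sym (∑-0 (λ h → χ-no ((e h ⟨$⟩ʳ i) ≟ j) (λ q → ¬q (h , q)))))

    s-pos : ∀ i → ∃ λ a → s i ≡ + suc a
    s-pos i = let (a , q) = ∑χ-pos (λ j → LO.Orb? i j) i (LO.Orb-refl i) in a , trans (∑-cong (ent i)) q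

    ζ w' : ZVec n
    ζ i = z (xs i)
    w' = LO.onReps ζ

    -- The norm of z at the H-fixed point `xs i` is k ζ i with k = s i · stab i, and it is also the
    -- pairing computed in `combo-u`; the factor s i is then cancelled.
    ζ-stab : ∀ i → ζ i * LO.stab i ≡ u i - c
    ζ-stab i = pos-*-cancel (proj₂ (s-pos i)) (begin
      s i * (ζ i * LO.stab i)             ≡⟨ lem (s i) (ζ i) (LO.stab i) ⟩
      s i * LO.stab i * ζ i               ≡⟨ cong (_* ζ i) (orbit-stabiliser i) ⟩
      + k * ζ i                           ≡⟨ sym (∑-const k (ζ i)) ⟩
      ∑ {k} (λ h → z (xs i))              ≡⟨ ∑-cong (λ h → cong z (sym (xs-fixed h i))) ⟩
      Nz (xs i)                           ≡⟨ sym (u-pair (xs i)) ⟩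
      ⟨ φ (xs i) , u ⟩                    ≡⟨ ∑-cong (λ j → cong (_* u j) (φ-vec o i j)) ⟩
      ⟨ combo o i , u ⟩                   ≡⟨ combo-u i ⟩
      s i * (u i - c) ∎)
      where
      lem : ∀ a b c → a * (b * c) ≡ a * c * b
      lem = solve-∀

    norm-w' : ∀ i → ∑ (λ h → w' (e h ⟨$⟩ˡ i)) ≡ u i - c
    norm-w' i = trans (LO.norm-onReps ζ i) (trans (ζ-stab (LO.rep i)) (cong (_- c) (u-rep (LO.rep-Orb i))))
      where
      u-rep : ∀ {j} → LO.Orb i j → u j ≡ u i
      u-rep (a , refl) = u-inv a i

    y' : ZVec m
    y' = diff m ·ᶻ w'

    norm-Ky' : ∀ x → ∑ (λ h → (K ·ᶻ y') ((e h ⁻¹) ⋆ x)) ≡ Nz x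
    norm-Ky' x = begin
      ∑ (λ h → (K ·ᶻ y') ((e h ⁻¹) ⋆ x))           ≡⟨ ∑-cong (λ h → trans (K-diff w' ((e h ⁻¹) ⋆ x)) (sym (pair-◁ (e h) w' x))) ⟩
      ∑ (λ h → ∑ (λ i → φ x i * w' (e h ⟨$⟩ˡ i)))  ≡⟨ ∑-swap (λ h i → φ x i * w' (e h ⟨$⟩ˡ i)) ⟩
      ∑ (λ i → ∑ (λ h → φ x i * w' (e h ⟨$⟩ˡ i)))  ≡⟨ ∑-cong (λ i → trans (∑-*ˡ (φ x i) (λ h → w' (e h ⟨$⟩ˡ i))) (trans (cong (φ x i *_) (norm-w' i)) (lem (φ x i) (u i) c))) ⟩
      ∑ (λ i → φ x i * u i - φ x i * c)            ≡⟨ ∑-- (λ i → φ x i * u i) (λ i → φ x i * c) ⟩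
      ⟨ φ x , u ⟩ - ∑ (λ i → φ x i * c)            ≡⟨ cong₂ _-_ (u-pair x) (trans (∑-*ʳ c (φ x)) (trans (cong (_* c) (∑-φ x)) (ℤₚ.*-zeroˡ c))) ⟩
      Nz x - + 0                                   ≡⟨ ℤₚ.+-identityʳ (Nz x) ⟩
      Nz x ∎
      where
      lem : ∀ a b c → a * (b - c) ≡ a * b - a * c
      lem = solve-∀

    -- Changing the lift by an element of J makes its norm vanish in ℤ[X] itself, and then Ĥ⁻¹(H,
    -- ℤ[X]) = 0 applies.
    z' : ZVec size
    z' = z ⊟ (K ·ᶻ y')

    boundary : ∃ λ (ys : Fin k → ZVec size) → ∀ x → z' x ≡ ∑ (λ h → ys h ((e h ⁻¹) ⋆ x) - ys h x)
    boundary = XO.H⁻¹-functions z' (λ x → trans (∑-- (λ h → z ((e h ⁻¹) ⋆ x)) (λ h → (K ·ᶻ y') ((e h ⁻¹) ⋆ x))) (ℤₚ.i≡j⇒i-j≡0 (sym (norm-Ky' x))))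

    vanishing : ∃ λ (ys : Fin k → ZVec C.size) → ∀ j → w j ≡ ∑ (λ h → (act F (e h) ·ᶻ ys h) j - ys h j)
    vanishing = (λ h → Πm ·ᶻ ys h) , λ j → begin
      w j                                                          ≡⟨ sym (Π-Inc w j) ⟩
      (Πm ·ᶻ z) j                                                  ≡⟨ sym (trans (·-⊟ Πm z (K ·ᶻ y') j) (trans (cong (_-_ ((Πm ·ᶻ z) j)) (Π-K y' j)) (ℤₚ.+-identityʳ _))) ⟩
      (Πm ·ᶻ z') j                                                 ≡⟨ ·-cong Πm (λ x → trans (proj₂ boundary x) (∑-cong (λ h → cong (_- ys h x) (sym (act-lattice (e h) (ys h) x))))) j ⟩
      (Πm ·ᶻ vsum (λ h → (act P (e h) ·ᶻ ys h) ⊟ ys h)) j          ≡⟨ ·-vsum Πm (λ h → (act P (e h) ·ᶻ ys h) ⊟ ys h) j ⟩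
      ∑ (λ h → (Πm ·ᶻ ((act P (e h) ·ᶻ ys h) ⊟ ys h)) j)           ≡⟨ ∑-cong (λ h → trans (·-⊟ Πm (act P (e h) ·ᶻ ys h) (ys h) j) (cong (_- (Πm ·ᶻ ys h) j) (Π-act (e h) (ys h) j))) ⟩
      ∑ (λ h → (act F (e h) ·ᶻ (Πm ·ᶻ ys h)) j - (Πm ·ᶻ ys h) j) ∎
      where
      ys : Fin k → ZVec size
      ys = proj₁ boundary

  F-flasque : IsFlasque F
  F-flasque = F-lat , λ k e H w Nw → Vanishing.vanishing e H w Nw

  resolution : FlasqueResolution (J n)
  resolution = record
    { P = P ; F = F ; P-perm = lattice-isPermutation ; F-flasque = F-flasque ; ι = ι ; π = π
    ; ι-inj = λ y e i → trans (sym (K-at-b y i)) (e (b i))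
    ; π-surj = λ w → Inc ·ᶻ w , Π-Inc w
    ; exact = λ z e → (λ i → z (b i)) , exact z e
    ; comp0 = Π-K
    }

  -- A kills J, so it factors through F = ℤ[X]/J.
  retract : ∀ {p} {Q : Rep n} (A : GMap P Q) (R : GMap Q F) (N : ℕ) → ¬ p ∣ N →
            (∀ u → (mat A ·ᶻ (K ·ᶻ (diff m ·ᶻ u))) ≐ zeroV) →
            (∀ z → (mat R ·ᶻ (mat A ·ᶻ z)) ≐ (+ N ⊡ (Πm ·ᶻ z))) → Retract p F Q
  retract {p} {Q} A R N p∤N AK RA = record
    { into = mkGMap (mat A ⊗ᶻ Inc) (λ σ w x → begin
        ((mat A ⊗ᶻ Inc) ·ᶻ (act F σ ·ᶻ w)) x                     ≡⟨ ⊗-· (mat A) Inc (act F σ ·ᶻ w) x ⟩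
        (mat A ·ᶻ (Inc ·ᶻ (act F σ ·ᶻ w))) x                     ≡⟨ ·-cong (mat A) (·-cong Inc (F-· σ w)) x ⟩
        (mat A ·ᶻ (Inc ·ᶻ (Πm ·ᶻ (act P σ ·ᶻ (Inc ·ᶻ w))))) x    ≡⟨ A-IncΠ (act P σ ·ᶻ (Inc ·ᶻ w)) x ⟩
        (mat A ·ᶻ (act P σ ·ᶻ (Inc ·ᶻ w))) x                     ≡⟨ gmap-· A σ (Inc ·ᶻ w) x ⟩
        (act Q σ ·ᶻ (mat A ·ᶻ (Inc ·ᶻ w))) x                     ≡⟨ ·-cong (act Q σ) (λ y → sym (⊗-· (mat A) Inc w y)) x ⟩
        (act Q σ ·ᶻ ((mat A ⊗ᶻ Inc) ·ᶻ w)) x ∎)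
    ; back = R
    ; index = N
    ; p∤index = p∤N
    ; back-into = ≋-ext {A = mat R ⊗ᶻ (mat A ⊗ᶻ Inc)} {B = λ i j → + N * Iᶻ i j} (λ w j → begin
        ((mat R ⊗ᶻ (mat A ⊗ᶻ Inc)) ·ᶻ w) j                       ≡⟨ trans (⊗-· (mat R) (mat A ⊗ᶻ Inc) w j) (·-cong (mat R) (⊗-· (mat A) Inc w) j) ⟩
        (mat R ·ᶻ (mat A ·ᶻ (Inc ·ᶻ w))) j                       ≡⟨ RA (Inc ·ᶻ w) j ⟩
        + N * (Πm ·ᶻ (Inc ·ᶻ w)) j                               ≡⟨ cong (+ N *_) (trans (Π-Inc w j) (sym (I-· w j))) ⟩
        + N * (Iᶻ ·ᶻ w) j                                        ≡⟨ sym (trans (∑-cong (λ k → ℤₚ.*-assoc (+ N) (Iᶻ j k) (w k))) (∑-*ˡ (+ N) (λ k → Iᶻ j k * w k))) ⟩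
        ((λ i j → + N * Iᶻ i j) ·ᶻ w) j ∎)
    }
    where
    A-K : ∀ y → (mat A ·ᶻ (K ·ᶻ y)) ≐ zeroV
    A-K y x = trans (·-cong (mat A) (·-cong K (λ i → sym (diff-ext y i))) x) (AK (ext y) x)
    A-IncΠ : ∀ z → (mat A ·ᶻ (Inc ·ᶻ (Πm ·ᶻ z))) ≐ (mat A ·ᶻ z)
    A-IncΠ z x = sym (trans (·-cong (mat A) (splitting z) x) (trans (·-⊞ (mat A) (Inc ·ᶻ (Πm ·ᶻ z)) (K ·ᶻ (λ i → z (b i))) x)
      (trans (cong (_+_ ((mat A ·ᶻ (Inc ·ᶻ (Πm ·ᶻ z))) x)) (A-K (λ i → z (b i)) x)) (ℤₚ.+-identityʳ _))))

-- Matrices from linear forms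

Form : ∀ {a} → (ZVec a → ℤ) → Set
Form {a} f = ∃ λ (row : ZVec a) → ∀ z → ∑ (λ y → row y * z y) ≡ f z

form-coord : ∀ {a} (y : Fin a) → Form (λ z → z y)
form-coord y = unit y , ∑-χ y

form-zero : ∀ {a} → Form {a} (λ _ → + 0)
form-zero = (λ _ → + 0) , λ z → ∑-0 (λ y → ℤₚ.*-zeroˡ (z y))

form-+ : ∀ {a} {f g : ZVec a → ℤ} → Form f → Form g → Form (λ z → f z + g z)
form-+ (r , e) (r' , e') = r ⊞ r' , λ z → trans (∑-cong (λ y → ℤₚ.*-distribʳ-+ (z y) (r y) (r' y)))
  (trans (∑-+ (λ y → r y * z y) (λ y → r' y * z y)) (cong₂ _+_ (e z) (e' z)))

form-* : ∀ {a} (c : ℤ) {f : ZVec a → ℤ} → Form f → Form (λ z → c * f z)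
form-* c (r , e) = c ⊡ r , λ z → trans (∑-cong (λ y → ℤₚ.*-assoc c (r y) (z y))) (trans (∑-*ˡ c (λ y → r y * z y)) (cong (c *_) (e z)))

form-- : ∀ {a} {f g : ZVec a → ℤ} → Form f → Form g → Form (λ z → f z - g z)
form-- {f = f} {g} F (r , e) = form-+ F ((- + 1) ⊡ r , λ z → trans (proj₂ (form-* (- + 1) (r , e)) z) (ℤₚ.-1*i≡-i (g z)))

form-∑ : ∀ {a k} {f : Fin k → ZVec a → ℤ} → (∀ i → Form (f i)) → Form (λ z → ∑ (λ i → f i z))
form-∑ {k = zero} F = form-zero
form-∑ {k = suc k} F = form-+ (F zero) (form-∑ (λ i → F (suc i)))

-- p does not divide n

module Coprime {m : ℕ} (𝒞 : Cover (suc m)) where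

  open Cover 𝒞
  open Resolution 𝒞

  -- On the image of u this is n u up to a constant. So n z minus the image of ρ z vanishes on J,
  -- and it agrees with n z modulo J.
  ρ : ZVec size → ZVec n
  ρ z i = ∑ (λ j → z (edge i j))

  A-form : ∀ x → Form (λ z → + n * z x - ⟨ φ x , ρ z ⟩)
  A-form x = form-- (form-* (+ n) (form-coord x)) (form-∑ (λ i → form-* (φ x i) (form-∑ (λ j → form-coord (edge i j)))))

  Am : ZMat size size
  Am x = proj₁ (A-form x)

  A-· : ∀ z x → (Am ·ᶻ z) x ≡ + n * z x - ⟨ φ x , ρ z ⟩
  A-· z x = proj₂ (A-form x) z

  ρ-act : ∀ σ z i → ρ (act P σ ·ᶻ z) i ≡ (ρ z ◁ σ) i
  ρ-act σ z i = begin
    ∑ (λ j → (act P σ ·ᶻ z) (edge i j))            ≡⟨ ∑-cong {n} (λ j → trans (act-lattice σ z (edge i j)) (cong z (edge-⋆ (σ ⁻¹) i j))) ⟩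
    ∑ (λ j → z (edge (σ ⟨$⟩ˡ i) (σ ⟨$⟩ˡ j)))       ≡⟨ sym (∑-permute {n} (λ j → z (edge (σ ⟨$⟩ˡ i) j)) (flip σ)) ⟩
    ∑ (λ j → z (edge (σ ⟨$⟩ˡ i) j)) ∎

  A : GMap P P
  A = mkGMap Am λ σ z x → begin
    (Am ·ᶻ (act P σ ·ᶻ z)) x                                       ≡⟨ A-· (act P σ ·ᶻ z) x ⟩
    + n * (act P σ ·ᶻ z) x - ⟨ φ x , ρ (act P σ ·ᶻ z) ⟩            ≡⟨ cong₂ (λ s t → + n * s - t) (act-lattice σ z x) (trans (∑-cong {n} (λ i → cong (φ x i *_) (ρ-act σ z i))) (pair-◁ σ (ρ z) x)) ⟩
    + n * z ((σ ⁻¹) ⋆ x) - ⟨ φ ((σ ⁻¹) ⋆ x) , ρ z ⟩                ≡⟨ sym (A-· z ((σ ⁻¹) ⋆ x)) ⟩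
    (Am ·ᶻ z) ((σ ⁻¹) ⋆ x)                                         ≡⟨ sym (act-lattice σ (Am ·ᶻ z) x) ⟩
    (act P σ ·ᶻ (Am ·ᶻ z)) x ∎

  A-K : ∀ u → (Am ·ᶻ (K ·ᶻ (diff m ·ᶻ u))) ≐ zeroV
  A-K u x = begin
    (Am ·ᶻ Ku) x                                              ≡⟨ A-· Ku x ⟩
    + n * Ku x - ⟨ φ x , ρ Ku ⟩                               ≡⟨ cong₂ (λ s t → + n * s - t) (K-diff u x) (∑-cong {n} (λ i → trans (cong (φ x i *_) (ρK i)) (lem (φ x i) (+ n) (u i) (∑ u)))) ⟩
    + n * ⟨ φ x , u ⟩ - ∑ (λ i → + n * (φ x i * u i) - φ x i * ∑ u) ≡⟨ cong (_-_ (+ n * ⟨ φ x , u ⟩)) (trans (∑-- {n} (λ i → + n * (φ x i * u i)) (λ i → φ x i * ∑ u))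
                                                                     (cong₂ _-_ (∑-*ˡ {n} (+ n) (λ i → φ x i * u i)) (trans (∑-*ʳ {n} (∑ u) (φ x)) (trans (cong (_* ∑ u) (∑-φ x)) (ℤₚ.*-zeroˡ (∑ u)))))) ⟩
    + n * ⟨ φ x , u ⟩ - (+ n * ⟨ φ x , u ⟩ - + 0)             ≡⟨ lem' (+ n * ⟨ φ x , u ⟩) ⟩
    + 0 ∎
    where
    Ku : ZVec size
    Ku = K ·ᶻ (diff m ·ᶻ u)
    ρK : ∀ i → ρ Ku i ≡ + n * u i - ∑ u
    ρK i = trans (∑-cong {n} (λ j → trans (K-diff u (edge i j)) (pair-edge u i j))) (trans (∑-- {n} (λ _ → u i) u) (cong (_- ∑ u) (∑-const n (u i))))
    lem : ∀ a n u s → a * (n * u - s) ≡ n * (a * u) - a * s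
    lem = solve-∀
    lem' : ∀ a → a - (a - + 0) ≡ + 0
    lem' = solve-∀

  Π-A : ∀ z → (Πm ·ᶻ (Am ·ᶻ z)) ≐ (+ n ⊡ (Πm ·ᶻ z))
  Π-A z j = begin
    (Πm ·ᶻ (Am ·ᶻ z)) j                                        ≡⟨ ·-cong Πm (λ x → trans (A-· z x) (cong (_-_ (+ n * z x)) (sym (K-diff (ρ z) x)))) j ⟩
    (Πm ·ᶻ (+ n ⊡ z ⊟ (K ·ᶻ (diff m ·ᶻ ρ z)))) j               ≡⟨ ·-⊟ Πm (+ n ⊡ z) (K ·ᶻ (diff m ·ᶻ ρ z)) j ⟩
    (Πm ·ᶻ (+ n ⊡ z)) j - (Πm ·ᶻ (K ·ᶻ (diff m ·ᶻ ρ z))) j     ≡⟨ cong₂ _-_ (·-⊡ Πm (+ n) z j) (Π-K (diff m ·ᶻ ρ z) j) ⟩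
    + n * (Πm ·ᶻ z) j - + 0                                    ≡⟨ ℤₚ.+-identityʳ _ ⟩
    + n * (Πm ·ᶻ z) j ∎

  coprime-retract : ∀ {p} → ¬ p ∣ n → Retract p F P
  coprime-retract p∤n = retract A π n p∤n A-K Π-A

coprime⇒pInvertible : ∀ {m p} → Prime p → ¬ p ∣ suc m → FlasqueClassPInvertible p (J (suc m))
coprime⇒pInvertible {m} {p} pp p∤n = go (cover (suc m))
  where
  go : Cover (suc m) → FlasqueClassPInvertible p (J (suc m))
  go 𝒞 = Resolution.resolution 𝒞 , retract⇒pInvertible pp (GSet.lattice-isPermutation (Cover.X 𝒞)) (Coprime.coprime-retract 𝒞 p∤n)

-- Enumeration of the symmetric group

-- Mixed radix digits: the leading one is the image of 0, and the others describe the permutation of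
-- the remaining letters.
decodeP : ∀ m → Fin (m !) → Sym m
decodeP zero _ = idₚ
decodeP (suc m) x = insert zero (proj₁ (remQuot {suc m} (m !) x)) (decodeP m (proj₂ (remQuot {suc m} (m !) x)))

codeP : ∀ m → Sym m → Fin (m !)
codeP zero _ = zero
codeP (suc m) σ = combine (σ ⟨$⟩ʳ zero) (codeP m (remove zero σ))

remove-cong : ∀ {m} (σ τ : Sym (suc m)) → σ ≈ₚ τ → remove zero σ ≈ₚ remove zero τ
remove-cong σ τ e j = punchIn-injective (σ ⟨$⟩ʳ zero) _ _ (begin
  punchIn (σ ⟨$⟩ʳ zero) (remove zero σ ⟨$⟩ʳ j)  ≡⟨ sym (punchIn-permute σ zero j) ⟩
  σ ⟨$⟩ʳ punchIn zero j                         ≡⟨ e (punchIn zero j) ⟩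
  τ ⟨$⟩ʳ punchIn zero j                         ≡⟨ punchIn-permute τ zero j ⟩
  punchIn (τ ⟨$⟩ʳ zero) (remove zero τ ⟨$⟩ʳ j)  ≡⟨ cong (λ x → punchIn x (remove zero τ ⟨$⟩ʳ j)) (sym (e zero)) ⟩
  punchIn (σ ⟨$⟩ʳ zero) (remove zero τ ⟨$⟩ʳ j) ∎)

insert-cong : ∀ {m} i (σ τ : Sym m) → σ ≈ₚ τ → insert zero i σ ≈ₚ insert zero i τ
insert-cong i σ τ e zero = refl
insert-cong i σ τ e (suc k) = cong (punchIn i) (e k)

codeP-cong : ∀ m (σ τ : Sym m) → σ ≈ₚ τ → codeP m σ ≡ codeP m τ
codeP-cong zero σ τ e = refl
codeP-cong (suc m) σ τ e = cong₂ combine (e zero) (codeP-cong m (remove zero σ) (remove zero τ) (remove-cong σ τ e))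

decode-code : ∀ m σ → decodeP m (codeP m σ) ≈ₚ σ
decode-code zero σ ()
decode-code (suc m) σ i = begin
  insert zero (proj₁ rq) (decodeP m (proj₂ rq)) ⟨$⟩ʳ i                     ≡⟨ cong (λ r → insert zero (proj₁ r) (decodeP m (proj₂ r)) ⟨$⟩ʳ i) (remQuot-combine {suc m} {m !} (σ ⟨$⟩ʳ zero) (codeP m (remove zero σ))) ⟩
  insert zero (σ ⟨$⟩ʳ zero) (decodeP m (codeP m (remove zero σ))) ⟨$⟩ʳ i   ≡⟨ insert-cong (σ ⟨$⟩ʳ zero) _ (remove zero σ) (decode-code m (remove zero σ)) i ⟩
  insert zero (σ ⟨$⟩ʳ zero) (remove zero σ) ⟨$⟩ʳ i                         ≡⟨ insert-remove zero σ i ⟩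
  σ ⟨$⟩ʳ i ∎
  where rq = remQuot {suc m} (m !) (codeP (suc m) σ)

code-decode : ∀ m x → codeP m (decodeP m x) ≡ x
code-decode zero zero = refl
code-decode (suc m) x = trans (cong (combine (proj₁ rq)) (trans (codeP-cong m (remove zero (insert zero (proj₁ rq) (decodeP m (proj₂ rq)))) (decodeP m (proj₂ rq)) (remove-insert zero (proj₁ rq) (decodeP m (proj₂ rq)))) (code-decode m (proj₂ rq))))
  (combine-remQuot {suc m} (m !) x)
  where rq = remQuot {suc m} (m !) x

-- Cyclic orders: permutations up to rotation of the source, normalised to fix 0.

module CyclicOrders (m : ℕ) where

  n : ℕ
  n = suc m

  base : Fin (m !) → Sym n
  base x = lift₀ (decodeP m x)

  normal : Sym n → Sym n
  normal s = s ∙ cycPow (toℕ (s ⟨$⟩ˡ zero))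

  normal-zero : ∀ s → normal s ⟨$⟩ʳ zero ≡ zero
  normal-zero s = trans (cong (s ⟨$⟩ʳ_) (cycPow-toℕ (s ⟨$⟩ˡ zero))) (inverseʳ s)

  -- Rotations commute and act transitively, so each is determined by its value at 0.
  cycPow-determined : ∀ a b → cycPow {m} a ⟨$⟩ʳ zero ≡ cycPow b ⟨$⟩ʳ zero → cycPow {m} a ≈ₚ cycPow b
  cycPow-determined a b e i = begin
    cycPow a ⟨$⟩ʳ i                              ≡⟨ cong (cycPow a ⟨$⟩ʳ_) (sym (cycPow-toℕ i)) ⟩
    cycPow a ⟨$⟩ʳ (cycPow (toℕ i) ⟨$⟩ʳ zero)     ≡⟨ cycPow-comm a (toℕ i) zero ⟩
    cycPow (toℕ i) ⟨$⟩ʳ (cycPow a ⟨$⟩ʳ zero)     ≡⟨ cong (cycPow (toℕ i) ⟨$⟩ʳ_) e ⟩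
    cycPow (toℕ i) ⟨$⟩ʳ (cycPow b ⟨$⟩ʳ zero)     ≡⟨ cycPow-comm (toℕ i) b zero ⟩
    cycPow b ⟨$⟩ʳ (cycPow (toℕ i) ⟨$⟩ʳ zero)     ≡⟨ cong (cycPow b ⟨$⟩ʳ_) (cycPow-toℕ i) ⟩
    cycPow b ⟨$⟩ʳ i ∎

  -- A class modulo rotations of the source contains only one permutation that fixes 0. The laws of
  -- the action on cyclic orders reduce to this uniqueness.
  normal-unique : ∀ s (f : Sym n) k → f ≈ₚ (s ∙ cycPow k) → f ⟨$⟩ʳ zero ≡ zero → f ≈ₚ normal s
  normal-unique s f k e f0 i = trans (e i) (cong (s ⟨$⟩ʳ_) (cycPow-determined k (toℕ (s ⟨$⟩ˡ zero)) (trans (sym (inverseˡ s)) (trans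
    (cong (s ⟨$⟩ˡ_) (trans (sym (e zero)) (trans f0 (sym (normal-zero s))))) (inverseˡ s))) i))

  move : Sym n → Fin (m !) → Fin (m !)
  move σ x = codeP m (remove zero (normal (σ ∙ base x)))

  base-move : ∀ σ x → base (move σ x) ≈ₚ normal (σ ∙ base x)
  base-move σ x i = trans (lift₀-cong (decodeP m (move σ x)) (remove zero (normal (σ ∙ base x))) (decode-code m (remove zero (normal (σ ∙ base x)))) i)
    (lift₀-remove (normal (σ ∙ base x)) (normal-zero (σ ∙ base x)) i)

  base-injective : ∀ x y → base x ≈ₚ base y → x ≡ y
  base-injective x y e = trans (sym (code-decode m x)) (trans (codeP-cong m (decodeP m x) (decodeP m y) (λ i → suc-injective (e (suc i)))) (code-decode m y))

  set : GSet n
  set = record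
    { size = m !
    ; _⋆_ = move
    ; ⋆-cong = λ {σ} {τ} e x → base-injective (move σ x) (move τ x) λ i → trans (base-move σ x i) (trans
        (normal-unique (τ ∙ base x) (normal (σ ∙ base x)) (toℕ ((σ ∙ base x) ⟨$⟩ˡ zero)) (λ j → e _) (normal-zero (σ ∙ base x)) i) (sym (base-move τ x i)))
    ; ⋆-id = λ x → base-injective (move idₚ x) x (base-move idₚ x)
    ; ⋆-∙ = λ σ τ x → base-injective (move (σ ∙ τ) x) (move σ (move τ x)) λ i → trans (base-move (σ ∙ τ) x i) (sym (
        normal-unique ((σ ∙ τ) ∙ base x) (base (move σ (move τ x)))
          (toℕ ((τ ∙ base x) ⟨$⟩ˡ zero) ℕ.+ toℕ ((σ ∙ base (move τ x)) ⟨$⟩ˡ zero))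
          (λ j → trans (base-move σ (move τ x) j) (cong (σ ⟨$⟩ʳ_) (trans (base-move τ x _)
            (cong (λ y → τ ⟨$⟩ʳ (base x ⟨$⟩ʳ y)) (sym (cycPow-+ (toℕ ((τ ∙ base x) ⟨$⟩ˡ zero)) (toℕ ((σ ∙ base (move τ x)) ⟨$⟩ˡ zero)) j))))))
          refl i))
    }

  -- The representative of the moved cyclic order differs from `σ ∙ base x` by a rotation, which is
  -- a power of the single step under which f is invariant. Functions of t thus descend to cyclic
  -- orders equivariantly.
  invariant-base : ∀ {V : Set} (f : Sym n → V) → (∀ {s t} → s ≈ₚ t → f s ≡ f t) → (∀ s → f (s ∙ cyc m) ≡ f s) →
                   ∀ σ x → f (base (GSet._⋆_ set σ x)) ≡ f (σ ∙ base x)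
  invariant-base f f-cong f-cyc σ x = trans (f-cong (base-move σ x)) (rotated (toℕ ((σ ∙ base x) ⟨$⟩ˡ zero)) (σ ∙ base x))
    where
    rotated : ∀ k s → f (s ∙ cycPow k) ≡ f s
    rotated zero s = f-cong (λ i → refl)
    rotated (suc k) s = trans (f-cong {s ∙ cycPow (suc k)} {(s ∙ cyc m) ∙ cycPow k} (λ i → refl)) (trans (rotated k (s ∙ cyc m)) (f-cyc s))

record CyclicSet (m : ℕ) : Set₁ where
  field
    set : GSet (suc m)
    size≡ : GSet.size set ≡ m !
    base : Fin (GSet.size set) → Sym (suc m)
    invariant-base : ∀ {V : Set} (f : Sym (suc m) → V) → (∀ {s t} → s ≈ₚ t → f s ≡ f t) → (∀ s → f (s ∙ cyc m) ≡ f s) →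
                     ∀ σ x → f (base (GSet._⋆_ set σ x)) ≡ f (σ ∙ base x)

cyclicSet : ∀ m → CyclicSet m
cyclicSet m = record { set = CO.set ; size≡ = refl ; base = CO.base ; invariant-base = CO.invariant-base }
  where module CO = CyclicOrders m

-- Disjoint unions of finite G-sets

union : ∀ {n} → GSet n → GSet n → GSet n
union {n} X Y = record
  { size = X.size ℕ.+ Y.size
  ; _⋆_ = λ σ x → join X.size Y.size (step σ (splitAt X.size x))
  ; ⋆-cong = λ {σ} {τ} e x → cong (join X.size Y.size) (step-cong e (splitAt X.size x))
  ; ⋆-id = λ x → trans (cong (join X.size Y.size) (step-id (splitAt X.size x))) (join-splitAt X.size Y.size x)
  ; ⋆-∙ = λ σ τ x → cong (join X.size Y.size) (trans (step-∙ σ τ (splitAt X.size x)) (cong (step σ) (sym (splitAt-join X.size Y.size (step τ (splitAt X.size x))))))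
  }
  where
  module X = GSet X
  module Y = GSet Y
  step : Sym n → Fin X.size ⊎ Fin Y.size → Fin X.size ⊎ Fin Y.size
  step σ = Sum.map (X._⋆_ σ) (Y._⋆_ σ)
  step-cong : ∀ {σ τ} → σ ≈ₚ τ → ∀ v → step σ v ≡ step τ v
  step-cong e (inj₁ x) = cong inj₁ (X.⋆-cong e x)
  step-cong e (inj₂ y) = cong inj₂ (Y.⋆-cong e y)
  step-id : ∀ v → step idₚ v ≡ v
  step-id (inj₁ x) = cong inj₁ (X.⋆-id x)
  step-id (inj₂ y) = cong inj₂ (Y.⋆-id y)
  step-∙ : ∀ σ τ v → step (σ ∙ τ) v ≡ step σ (step τ v)
  step-∙ σ τ (inj₁ x) = cong inj₁ (X.⋆-∙ σ τ x)
  step-∙ σ τ (inj₂ y) = cong inj₂ (Y.⋆-∙ σ τ y)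

union-↑ˡ : ∀ {n} (X Y : GSet n) σ x → GSet._⋆_ (union X Y) σ (x ↑ˡ GSet.size Y) ≡ GSet._⋆_ X σ x ↑ˡ GSet.size Y
union-↑ˡ X Y σ x = cong (λ v → join (GSet.size X) (GSet.size Y) (Sum.map (GSet._⋆_ X σ) (GSet._⋆_ Y σ) v)) (splitAt-↑ˡ (GSet.size X) x (GSet.size Y))

union-↑ʳ : ∀ {n} (X Y : GSet n) σ y → GSet._⋆_ (union X Y) σ (GSet.size X ↑ʳ y) ≡ GSet.size X ↑ʳ GSet._⋆_ Y σ y
union-↑ʳ X Y σ y = cong (λ v → join (GSet.size X) (GSet.size Y) (Sum.map (GSet._⋆_ X σ) (GSet._⋆_ Y σ) v)) (splitAt-↑ʳ (GSet.size X) (GSet.size Y) y)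

prime∤! : ∀ {p} → Prime p → ∀ k → k ℕ.< p → ¬ p ∣ k !
prime∤! pp zero k<p d = prime∤1 pp d
prime∤! pp (suc k) k<p d with euclidsLemma (suc k) (k !) pp d
... | inj₁ d₁ = ℕₚ.<⇒≱ k<p (∣⇒≤ d₁)
... | inj₂ d₂ = prime∤! pp k (ℕₚ.<-trans (ℕₚ.n<1+n k) k<p) d₂

-- Inclusive partial sums along a cycle, and integer division

incl : ∀ {m} → (Fin (suc m) → ℤ) → Fin (suc m) → ℤ
incl f zero = f zero
incl {suc m} f (suc i) = f zero + incl (λ j → f (suc j)) i

incl-cong : ∀ {m} {f g : Fin (suc m) → ℤ} → (∀ i → f i ≡ g i) → ∀ i → incl f i ≡ incl g i
incl-cong e zero = e zero
incl-cong {suc m} e (suc i) = cong₂ _+_ (e zero) (incl-cong (λ j → e (suc j)) i)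

incl-last : ∀ {m} (f : Fin (suc m) → ℤ) → incl f (fromℕ m) ≡ ∑ f
incl-last {zero} f = sym (ℤₚ.+-identityʳ (f zero))
incl-last {suc m} f = cong (_+_ (f zero)) (incl-last (λ j → f (suc j)))

-- Starting one place later omits the first term.
incl-shift : ∀ {m} (f g : Fin (suc m) → ℤ) → (∀ j → f (inject₁ j) ≡ g (suc j)) → ∀ i → incl f (inject₁ i) + g zero ≡ incl g (suc i)
incl-shift {suc m} f g e zero = trans (ℤₚ.+-comm (f zero) (g zero)) (cong (_+_ (g zero)) (e zero))
incl-shift {suc m} f g e (suc i) = begin
  (f zero + incl (λ j → f (suc j)) (inject₁ i)) + g zero   ≡⟨ cong (λ a → (a + incl (λ j → f (suc j)) (inject₁ i)) + g zero) (e zero) ⟩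
  (g (suc zero) + incl (λ j → f (suc j)) (inject₁ i)) + g zero ≡⟨ lem (g (suc zero)) (incl (λ j → f (suc j)) (inject₁ i)) (g zero) ⟩
  g zero + (incl (λ j → f (suc j)) (inject₁ i) + g (suc zero)) ≡⟨ cong (_+_ (g zero)) (incl-shift (λ j → f (suc j)) (λ j → g (suc j)) (λ j → e (suc j)) i) ⟩
  g zero + incl (λ j → g (suc j)) (suc i) ∎
  where
  lem : ∀ a b c → (a + b) + c ≡ c + (b + a)
  lem = solve-∀

incl-step : ∀ {m} (f : Fin (suc m) → ℤ) i → incl f (suc i) ≡ incl f (inject₁ i) + f (suc i)
incl-step {suc m} f zero = refl
incl-step {suc m} f (suc i) = trans (cong (_+_ (f zero)) (incl-step (λ j → f (suc j)) i)) (sym (ℤₚ.+-assoc (f zero) (incl (λ j → f (suc j)) (inject₁ i)) (f (suc (suc i)))))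

incl-telescope : ∀ {m} (v : Fin (suc m) → ℤ) i → incl (λ j → v j - v (prev j)) i ≡ v i - v (fromℕ m)
incl-telescope {m} v i = go (toℕ i) i refl
  where
  go : ∀ k i → toℕ i ≡ k → incl (λ j → v j - v (prev j)) i ≡ v i - v (fromℕ m)
  go k zero e = refl
  go (suc k) (suc i) e = trans (incl-step (λ j → v j - v (prev j)) i) (trans (cong (_+ (v (suc i) - v (inject₁ i))) (go k (inject₁ i) (trans (toℕ-inject₁ i) (ℕₚ.suc-injective e))))
    (lem (v (inject₁ i)) (v (fromℕ m)) (v (suc i))))
    where
    lem : ∀ a b c → (a - b) + (c - a) ≡ c - b
    lem = solve-∀

∑-next : ∀ {m} (g f : Fin (suc m) → ℤ) → ∑ (λ i → g i * f (next i)) ≡ ∑ (λ i → g (inject₁ i) * f (suc i)) + g (fromℕ m) * f zero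
∑-next {m} g f = trans (∑-last (λ i → g i * f (next i))) (cong₂ _+_ (∑-cong (λ i → cong (λ a → g (inject₁ i) * f a) (next-inject₁ i))) (cong (λ a → g (fromℕ m) * f a) (next-fromℕ m)))

-- Comparing the two divisions with remainder, d times the gap between the quotients is a difference
-- of remainders, hence smaller than d in absolute value.
/ℕ-shift : ∀ d .{{_ : ℕ.NonZero d}} a k → (a + + d * k) /ℕ d ≡ a /ℕ d + k
/ℕ-shift d a k = ℤₚ.i-j≡0⇒i≡j _ _ (small gap (begin
  gap * + d                                      ≡⟨ lem (+ (b %ℕ d)) (b /ℕ d) (+ (a %ℕ d)) (a /ℕ d) (+ d) k ⟩
  ((+ (b %ℕ d) + (b /ℕ d) * + d) - (+ (a %ℕ d) + (a /ℕ d) * + d) - + d * k) + (+ (a %ℕ d) - + (b %ℕ d))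
    ≡⟨ cong (_+ (+ (a %ℕ d) - + (b %ℕ d))) (trans (cong₂ (λ s t → s - t - + d * k) (sym (a≡a%ℕn+[a/ℕn]*n b d)) (sym (a≡a%ℕn+[a/ℕn]*n a d))) (lem' a (+ d * k))) ⟩
  + 0 + (+ (a %ℕ d) - + (b %ℕ d))                 ≡⟨ ℤₚ.+-identityˡ _ ⟩
  + (a %ℕ d) - + (b %ℕ d) ∎) (n%ℕd<d a d) (n%ℕd<d b d))
  where
  b gap : ℤ
  b = a + + d * k
  gap = b /ℕ d - (a /ℕ d + k)
  lem : ∀ rb qb ra qa d k → (qb - (qa + k)) * d ≡ ((rb + qb * d) - (ra + qa * d) - d * k) + (ra - rb)
  lem = solve-∀
  lem' : ∀ a x → (a + x) - a - x ≡ + 0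
  lem' = solve-∀
  small : ∀ (q : ℤ) {r s : ℕ} → q * + d ≡ + r - + s → r ℕ.< d → s ℕ.< d → q ≡ + 0
  small q {r} {s} e r< s< = ℤₚ.∣i∣≡0⇒i≡0 (zero-quotient ℤ.∣ q ∣ (subst (ℕ._< d) (sym (trans (sym (ℤₚ.abs-* q (+ d))) (cong ℤ.∣_∣ e))) bound))
    where
    bound : ℤ.∣ + r - + s ∣ ℕ.< d
    bound = subst (ℕ._< d) (cong ℤ.∣_∣ (sym (ℤₚ.m-n≡m⊖n r s))) (ℕₚ.≤-<-trans (ℤₚ.∣m⊝n∣≤m⊔n r s) (ℕₚ.⊔-lub r< s<))
    zero-quotient : ∀ x → x ℕ.* d ℕ.< d → x ≡ 0
    zero-quotient zero _ = refl
    zero-quotient (suc x) lt = ⊥-elim (ℕₚ.<⇒≱ lt (ℕₚ.m≤m+n d (x ℕ.* d)))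

-- The splitting given by cyclic orders

module PrimeDegree {m : ℕ} (𝒞 : Cover (suc m)) (𝒯 : CyclicSet m) where

  open Cover 𝒞
  open Resolution 𝒞
  module T = CyclicSet 𝒯
  module TS = GSet T.set
  open T using (base)

  -- On the image of u these are the differences of consecutive values of u along the cyclic order
  -- t. Their sum `aug` vanishes on J, and their partial sums give u back up to a constant.
  ε : Sym n → ZVec size → Fin n → ℤ
  ε t z i = z (edge (t ⟨$⟩ʳ i) (t ⟨$⟩ʳ prev i))

  aug : Sym n → ZVec size → ℤ
  aug t z = ∑ (ε t z)

  -- Off J the partial sums in `path` jump by `aug t z` at one letter when the starting letter
  -- moves. The function -W / n would compensate this jump rationally; by `W-cyc` the numerator
  -- moves by a multiple of n, so the floor compensates it just as well.
  W z₀ : Sym n → Fin size → ℤ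
  W t x = ∑ {n} (λ i → + toℕ i * φ x (t ⟨$⟩ʳ i))
  z₀ t x = - (W t x /ℕ n)

  path : Sym n → ZVec size → ZVec n
  path t z j = incl (ε t z) (t ⟨$⟩ˡ j)

  -- An endomorphism of ℤ[X] that is the identity on J and, modulo J, sends z to `aug t z` times the
  -- class of `z₀ t`. By `H-cyc` it depends on the cyclic order alone.
  H : Sym n → ZVec size → ZVec size
  H t z x = aug t z * z₀ t x + ⟨ φ x , path t z ⟩

  path-pair : ∀ t z x → ⟨ φ x , path t z ⟩ ≡ ∑ {n} (λ i → φ x (t ⟨$⟩ʳ i) * incl (ε t z) i)
  path-pair t z x = trans (∑-permute {n} (λ j → φ x j * path t z j) t) (∑-cong {n} (λ i → cong (λ a → φ x (t ⟨$⟩ʳ i) * incl (ε t z) a) (inverseˡ t {i})))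

  ∑-φ∘ : ∀ t x → ∑ {n} (λ i → φ x (t ⟨$⟩ʳ i)) ≡ + 0
  ∑-φ∘ t x = trans (sym (∑-permute {n} (φ x) t)) (∑-φ x)

  ε-cong : ∀ s t → s ≈ₚ t → ∀ z i → ε s z i ≡ ε t z i
  ε-cong s t e z i = cong₂ (λ a b → z (edge a b)) (e i) (e (prev i))

  aug-cong : ∀ z {s t} → s ≈ₚ t → aug s z ≡ aug t z
  aug-cong z {s} {t} e = ∑-cong {n} (ε-cong s t e z)

  z₀-cong : ∀ x {s t} → s ≈ₚ t → z₀ s x ≡ z₀ t x
  z₀-cong x e = cong (λ a → - (a /ℕ n)) (∑-cong {n} (λ i → cong (λ a → + toℕ i * φ x a) (e i)))

  H-cong : ∀ z x {s t} → s ≈ₚ t → H s z x ≡ H t z x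
  H-cong z x {s} {t} e = cong₂ _+_ (cong₂ _*_ (aug-cong z {s} {t} e) (z₀-cong x {s} {t} e)) (trans (path-pair s z x) (trans
    (∑-cong {n} (λ i → cong₂ (λ a b → φ x a * b) (e i) (incl-cong (ε-cong s t e z) i))) (sym (path-pair t z x))))

  ε-cyc : ∀ t z i → ε (t ∙ cyc m) z i ≡ ε t z (next i)
  ε-cyc t z i = cong (λ a → z (edge (t ⟨$⟩ʳ next i) (t ⟨$⟩ʳ a))) (trans (next-prev i) (sym (prev-next i)))

  aug-cyc : ∀ z t → aug (t ∙ cyc m) z ≡ aug t z
  aug-cyc z t = trans (∑-cong {n} (ε-cyc t z)) (sym (∑-permute {n} (ε t z) (cyc m)))

  W-cyc : ∀ t x → W (t ∙ cyc m) x ≡ W t x + + n * φ x (t ⟨$⟩ʳ zero)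
  W-cyc t x = begin
    ∑ {n} (λ i → + toℕ i * g (next i))                      ≡⟨ ∑-next (λ i → + toℕ i) g ⟩
    ∑ (λ i → + toℕ (inject₁ i) * g (suc i)) + + toℕ (fromℕ m) * g zero
      ≡⟨ cong₂ _+_ (∑-cong (λ i → trans (cong (λ a → + a * g (suc i)) (toℕ-inject₁ i)) (lem (+ toℕ i) (g (suc i))))) (cong (λ a → + a * g zero) (toℕ-fromℕ m)) ⟩
    ∑ (λ i → + suc (toℕ i) * g (suc i) - g (suc i)) + + m * g zero
      ≡⟨ cong (_+ + m * g zero) (∑-- (λ i → + suc (toℕ i) * g (suc i)) (λ i → g (suc i))) ⟩
    (∑ (λ i → + suc (toℕ i) * g (suc i)) - ∑ (λ i → g (suc i))) + + m * g zero
      ≡⟨ lem' (∑ (λ i → + suc (toℕ i) * g (suc i))) (∑ (λ i → g (suc i))) (g zero) (+ m) ⟩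
    ((+ 0 * g zero + ∑ (λ i → + suc (toℕ i) * g (suc i))) + (+ 1 + + m) * g zero) - (g zero + ∑ (λ i → g (suc i)))
      ≡⟨ cong (_-_ (W t x + + n * g zero)) (∑-φ∘ t x) ⟩
    (W t x + + n * g zero) - + 0
      ≡⟨ ℤₚ.+-identityʳ _ ⟩
    W t x + + n * g zero ∎
    where
    g : Fin n → ℤ
    g i = φ x (t ⟨$⟩ʳ i)
    lem : ∀ a b → a * b ≡ (+ 1 + a) * b - b
    lem = solve-∀
    lem' : ∀ a s g m → (a - s) + m * g ≡ ((+ 0 * g + a) + (+ 1 + m) * g) - (g + s)
    lem' = solve-∀

  z₀-cyc : ∀ t x → z₀ (t ∙ cyc m) x ≡ z₀ t x - φ x (t ⟨$⟩ʳ zero)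
  z₀-cyc t x = trans (cong (λ a → - (a /ℕ n)) (W-cyc t x)) (trans (cong -_ (/ℕ-shift n (W t x) (φ x (t ⟨$⟩ʳ zero)))) (ℤₚ.neg-distrib-+ (W t x /ℕ n) (φ x (t ⟨$⟩ʳ zero))))

  -- Moving the start by one step lowers the partial sums by the first term, a constant to which
  -- `φ x` is orthogonal. Only the letter t 0, now the last one, gains the total in addition.
  path-cyc : ∀ t z x → ⟨ φ x , path (t ∙ cyc m) z ⟩ ≡ ⟨ φ x , path t z ⟩ + φ x (t ⟨$⟩ʳ zero) * aug t z
  path-cyc t z x = begin
    ⟨ φ x , path (t ∙ cyc m) z ⟩                              ≡⟨ path-pair (t ∙ cyc m) z x ⟩
    ∑ {n} (λ i → g (next i) * incl (ε (t ∙ cyc m) z) i)       ≡⟨ ∑-cong {n} (λ i → trans (cong (g (next i) *_) (incl-cong (ε-cyc t z) i)) (ℤₚ.*-comm (g (next i)) (incl E' i))) ⟩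
    ∑ {n} (λ i → incl E' i * g (next i))                      ≡⟨ ∑-next (incl E') g ⟩
    ∑ (λ i → incl E' (inject₁ i) * g (suc i)) + incl E' (fromℕ m) * g zero
      ≡⟨ cong₂ _+_ (∑-cong (λ i → trans (cong (_* g (suc i)) (prefix i)) (lem (incl E (suc i)) (E zero) (g (suc i)))))
           (cong (_* g zero) (trans (incl-last E') (sym (∑-permute {n} E (cyc m))))) ⟩
    ∑ (λ i → g (suc i) * incl E (suc i) - E zero * g (suc i)) + aug t z * g zero
      ≡⟨ cong (_+ aug t z * g zero) (trans (∑-- (λ i → g (suc i) * incl E (suc i)) (λ i → E zero * g (suc i))) (cong (_-_ (∑ (λ i → g (suc i) * incl E (suc i)))) (∑-*ˡ (E zero) (λ i → g (suc i))))) ⟩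
    (∑ (λ i → g (suc i) * incl E (suc i)) - E zero * ∑ (λ i → g (suc i))) + aug t z * g zero
      ≡⟨ lem' (∑ (λ i → g (suc i) * incl E (suc i))) (E zero) (∑ (λ i → g (suc i))) (aug t z) (g zero) ⟩
    ((g zero * E zero + ∑ (λ i → g (suc i) * incl E (suc i))) + g zero * aug t z) - E zero * (g zero + ∑ (λ i → g (suc i)))
      ≡⟨ cong₂ (λ a b → (a + g zero * aug t z) - E zero * b) (sym (path-pair t z x)) (∑-φ∘ t x) ⟩
    (⟨ φ x , path t z ⟩ + g zero * aug t z) - E zero * + 0
      ≡⟨ lem″ (⟨ φ x , path t z ⟩ + g zero * aug t z) (E zero) ⟩
    ⟨ φ x , path t z ⟩ + g zero * aug t z ∎
    where
    g E E' : Fin n → ℤ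
    g i = φ x (t ⟨$⟩ʳ i)
    E = ε t z
    E' i = E (next i)
    prefix : ∀ i → incl E' (inject₁ i) ≡ incl E (suc i) - E zero
    prefix i = trans (add (incl E' (inject₁ i)) (E zero)) (cong (_- E zero) (incl-shift E' E (λ j → cong E (next-inject₁ j)) i))
      where
      add : ∀ a b → a ≡ (a + b) - b
      add = solve-∀
    lem : ∀ a b c → (a - b) * c ≡ c * a - b * c
    lem = solve-∀
    lem' : ∀ a e s u g → (a - e * s) + u * g ≡ ((g * e + a) + g * u) - e * (g + s)
    lem' = solve-∀
    lem″ : ∀ a b → a - b * + 0 ≡ a
    lem″ = solve-∀

  H-cyc : ∀ z x t → H (t ∙ cyc m) z x ≡ H t z x
  H-cyc z x t = trans (cong₂ _+_ (cong₂ _*_ (aug-cyc z t) (z₀-cyc t x)) (path-cyc t z x)) (lem (aug t z) (z₀ t x) (φ x (t ⟨$⟩ʳ zero)) ⟨ φ x , path t z ⟩)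
    where
    lem : ∀ a z g p → a * (z - g) + (p + g * a) ≡ a * z + p
    lem = solve-∀

  Π-z₀-cyc : ∀ j t → (Πm ·ᶻ z₀ (t ∙ cyc m)) j ≡ (Πm ·ᶻ z₀ t) j
  Π-z₀-cyc j t = begin
    (Πm ·ᶻ z₀ (t ∙ cyc m)) j                                                      ≡⟨ ·-cong Πm (λ x → trans (z₀-cyc t x) (cong (_-_ (z₀ t x)) (sym (trans (K-diff (unit (t ⟨$⟩ʳ zero)) x) (pick x))))) j ⟩
    (Πm ·ᶻ (z₀ t ⊟ (K ·ᶻ (diff m ·ᶻ unit (t ⟨$⟩ʳ zero))))) j                      ≡⟨ ·-⊟ Πm (z₀ t) (K ·ᶻ (diff m ·ᶻ unit (t ⟨$⟩ʳ zero))) j ⟩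
    (Πm ·ᶻ z₀ t) j - (Πm ·ᶻ (K ·ᶻ (diff m ·ᶻ unit (t ⟨$⟩ʳ zero)))) j              ≡⟨ cong (_-_ ((Πm ·ᶻ z₀ t) j)) (Π-K (diff m ·ᶻ unit (t ⟨$⟩ʳ zero)) j) ⟩
    (Πm ·ᶻ z₀ t) j - + 0                                                          ≡⟨ ℤₚ.+-identityʳ _ ⟩
    (Πm ·ᶻ z₀ t) j ∎
    where
    pick : ∀ x → ⟨ φ x , unit (t ⟨$⟩ʳ zero) ⟩ ≡ φ x (t ⟨$⟩ʳ zero)
    pick x = trans (∑-cong {n} (λ i → ℤₚ.*-comm (φ x i) (unit (t ⟨$⟩ʳ zero) i))) (∑-χ (t ⟨$⟩ʳ zero) (φ x))

  ε-act : ∀ σ t z i → ε (σ ∙ t) (act P σ ·ᶻ z) i ≡ ε t z i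
  ε-act σ t z i = trans (act-lattice σ z _) (cong z (trans (edge-⋆ (σ ⁻¹) _ _) (cong₂ edge (inverseˡ σ) (inverseˡ σ))))

  aug-act : ∀ σ t z → aug (σ ∙ t) (act P σ ·ᶻ z) ≡ aug t z
  aug-act σ t z = ∑-cong {n} (ε-act σ t z)

  z₀-act : ∀ σ t x → z₀ (σ ∙ t) x ≡ z₀ t ((σ ⁻¹) ⋆ x)
  z₀-act σ t x = cong (λ a → - (a /ℕ n)) (∑-cong {n} (λ i → cong (+ toℕ i *_) (sym (φ-⋆ (σ ⁻¹) x (t ⟨$⟩ʳ i)))))

  H-act : ∀ σ t z x → H (σ ∙ t) (act P σ ·ᶻ z) x ≡ H t z ((σ ⁻¹) ⋆ x)
  H-act σ t z x = cong₂ _+_ (cong₂ _*_ (aug-act σ t z) (z₀-act σ t x)) (begin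
    ⟨ φ x , path (σ ∙ t) (act P σ ·ᶻ z) ⟩                                              ≡⟨ path-pair (σ ∙ t) (act P σ ·ᶻ z) x ⟩
    ∑ {n} (λ i → φ x (σ ⟨$⟩ʳ (t ⟨$⟩ʳ i)) * incl (ε (σ ∙ t) (act P σ ·ᶻ z)) i)          ≡⟨ ∑-cong {n} (λ i → cong₂ _*_ (sym (φ-⋆ (σ ⁻¹) x (t ⟨$⟩ʳ i))) (incl-cong (ε-act σ t z) i)) ⟩
    ∑ {n} (λ i → φ ((σ ⁻¹) ⋆ x) (t ⟨$⟩ʳ i) * incl (ε t z) i)                           ≡⟨ sym (path-pair t z ((σ ⁻¹) ⋆ x)) ⟩
    ⟨ φ ((σ ⁻¹) ⋆ x) , path t z ⟩ ∎)

  N : ℕ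
  N = TS.size

  QS : GSet n
  QS = union X T.set

  module QS = GSet QS

  Q : Rep n
  Q = QS.lattice

  -- The component in ℤ[X] vanishes on J because each of the N maps `H` is the identity there. The
  -- `aug` coordinates record what the maps `H` take away modulo J, and R restores it as multiples
  -- of the classes of `z₀`.
  A-value : ZVec size → Fin size ⊎ Fin N → ℤ
  A-value z (inj₁ x) = + N * z x - ∑ (λ τ → H (base τ) z x)
  A-value z (inj₂ τ) = aug (base τ) z

  incl-form : ∀ {a k} (f : Fin (suc k) → ZVec a → ℤ) → (∀ i → Form (f i)) → ∀ i → Form (λ z → incl (λ j → f j z) i)
  incl-form f F zero = F zero
  incl-form {k = suc k} f F (suc i) = form-+ (F zero) (incl-form (λ j → f (suc j)) (λ j → F (suc j)) i)

  A-form : ∀ v → Form (λ z → A-value z v)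
  A-form (inj₁ x) = form-- (form-* (+ N) (form-coord x)) (form-∑ (λ τ → form-+ (aug-z₀ τ)
    (form-∑ {k = n} (λ i → form-* (φ x i) (incl-form (λ j z → ε (base τ) z j) (ε-form τ) (base τ ⟨$⟩ˡ i))))))
    where
    ε-form : ∀ τ j → Form (λ z → ε (base τ) z j)
    ε-form τ j = form-coord (edge (base τ ⟨$⟩ʳ j) (base τ ⟨$⟩ʳ prev j))
    aug-z₀ : ∀ τ → Form (λ z → aug (base τ) z * z₀ (base τ) x)
    aug-z₀ τ = let (r , e) = form-* (z₀ (base τ) x) (form-∑ {k = n} (ε-form τ)) in r , λ z → trans (e z) (ℤₚ.*-comm (z₀ (base τ) x) (aug (base τ) z))
  A-form (inj₂ τ) = form-∑ {k = n} (λ j → form-coord (edge (base τ ⟨$⟩ʳ j) (base τ ⟨$⟩ʳ prev j)))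

  Am : ZMat QS.size size
  Am q = proj₁ (A-form (splitAt size q))

  A-↑ˡ : ∀ z x → (Am ·ᶻ z) (x ↑ˡ N) ≡ + N * z x - ∑ (λ τ → H (base τ) z x)
  A-↑ˡ z x = trans (proj₂ (A-form (splitAt size (x ↑ˡ N))) z) (cong (A-value z) (splitAt-↑ˡ size x N))

  A-↑ʳ : ∀ z τ → (Am ·ᶻ z) (size ↑ʳ τ) ≡ aug (base τ) z
  A-↑ʳ z τ = trans (proj₂ (A-form (splitAt size (size ↑ʳ τ))) z) (cong (A-value z) (splitAt-↑ʳ size N τ))

  by-parts : ∀ {V : Fin QS.size → Set} → (∀ x → V (x ↑ˡ N)) → (∀ τ → V (size ↑ʳ τ)) → ∀ q → V q
  by-parts {V} l r q = subst V (join-splitAt size N q) (parts (splitAt size q))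
    where
    parts : ∀ v → V (join size N v)
    parts (inj₁ x) = l x
    parts (inj₂ τ) = r τ

  A-act : ∀ σ z q → (Am ·ᶻ (act P σ ·ᶻ z)) q ≡ (act Q σ ·ᶻ (Am ·ᶻ z)) q
  A-act σ z = by-parts {λ q → (Am ·ᶻ (act P σ ·ᶻ z)) q ≡ (act Q σ ·ᶻ (Am ·ᶻ z)) q}
    (λ x → begin
      (Am ·ᶻ (act P σ ·ᶻ z)) (x ↑ˡ N)                                            ≡⟨ A-↑ˡ (act P σ ·ᶻ z) x ⟩
      + N * (act P σ ·ᶻ z) x - ∑ (λ τ → H (base τ) (act P σ ·ᶻ z) x)             ≡⟨ cong₂ (λ a b → + N * a - b) (act-lattice σ z x) (left x) ⟩
      + N * z ((σ ⁻¹) ⋆ x) - ∑ (λ τ → H (base τ) z ((σ ⁻¹) ⋆ x))                 ≡⟨ sym (A-↑ˡ z ((σ ⁻¹) ⋆ x)) ⟩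
      (Am ·ᶻ z) (((σ ⁻¹) ⋆ x) ↑ˡ N)                                              ≡⟨ cong (Am ·ᶻ z) (sym (union-↑ˡ X T.set (σ ⁻¹) x)) ⟩
      (Am ·ᶻ z) ((σ ⁻¹) QS.⋆ (x ↑ˡ N))                                           ≡⟨ sym (QS.act-lattice σ (Am ·ᶻ z) (x ↑ˡ N)) ⟩
      (act Q σ ·ᶻ (Am ·ᶻ z)) (x ↑ˡ N) ∎)
    (λ τ → begin
      (Am ·ᶻ (act P σ ·ᶻ z)) (size ↑ʳ τ)                                         ≡⟨ A-↑ʳ (act P σ ·ᶻ z) τ ⟩
      aug (base τ) (act P σ ·ᶻ z)                                                ≡⟨ right τ ⟩
      aug (base ((σ ⁻¹) TS.⋆ τ)) z                                               ≡⟨ sym (A-↑ʳ z ((σ ⁻¹) TS.⋆ τ)) ⟩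
      (Am ·ᶻ z) (size ↑ʳ ((σ ⁻¹) TS.⋆ τ))                                        ≡⟨ cong (Am ·ᶻ z) (sym (union-↑ʳ X T.set (σ ⁻¹) τ)) ⟩
      (Am ·ᶻ z) ((σ ⁻¹) QS.⋆ (size ↑ʳ τ))                                        ≡⟨ sym (QS.act-lattice σ (Am ·ᶻ z) (size ↑ʳ τ)) ⟩
      (act Q σ ·ᶻ (Am ·ᶻ z)) (size ↑ʳ τ) ∎)
    where
    left : ∀ x → ∑ (λ τ → H (base τ) (act P σ ·ᶻ z) x) ≡ ∑ (λ τ → H (base τ) z ((σ ⁻¹) ⋆ x))
    left x = trans (TS.∑-⋆ σ (λ τ → H (base τ) (act P σ ·ᶻ z) x)) (∑-cong {N} (λ τ →
      trans (T.invariant-base (λ t → H t (act P σ ·ᶻ z) x) (λ {s} {t} → H-cong (act P σ ·ᶻ z) x {s} {t}) (H-cyc (act P σ ·ᶻ z) x) σ τ) (H-act σ (base τ) z x)))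
    right : ∀ τ → aug (base τ) (act P σ ·ᶻ z) ≡ aug (base ((σ ⁻¹) TS.⋆ τ)) z
    right τ = trans (cong (λ a → aug (base a) (act P σ ·ᶻ z)) (sym (TS.⋆-⁻¹ʳ σ τ)))
      (trans (T.invariant-base (λ t → aug t (act P σ ·ᶻ z)) (λ {s} {t} → aug-cong (act P σ ·ᶻ z) {s} {t}) (aug-cyc (act P σ ·ᶻ z)) σ ((σ ⁻¹) TS.⋆ τ)) (aug-act σ (base ((σ ⁻¹) TS.⋆ τ)) z))

  A : GMap P Q
  A = mkGMap Am A-act

  A-K : ∀ u → (Am ·ᶻ (K ·ᶻ (diff m ·ᶻ u))) ≐ zeroV
  A-K u = by-parts {λ q → (Am ·ᶻ (K ·ᶻ (diff m ·ᶻ u))) q ≡ + 0}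
    (λ x → trans (A-↑ˡ Ku x) (trans (cong₂ (λ a b → + N * a - b) (K-diff u x) (trans (∑-cong {N} (λ τ → H-K (base τ) x)) (∑-const N ⟨ φ x , u ⟩)))
      (ℤₚ.+-inverseʳ (+ N * ⟨ φ x , u ⟩))))
    (λ τ → trans (A-↑ʳ Ku τ) (aug-K (base τ)))
    where
    Ku : ZVec size
    Ku = K ·ᶻ (diff m ·ᶻ u)
    ε-K : ∀ t i → ε t Ku i ≡ u (t ⟨$⟩ʳ i) - u (t ⟨$⟩ʳ prev i)
    ε-K t i = trans (K-diff u _) (pair-edge u _ _)
    aug-K : ∀ t → aug t Ku ≡ + 0
    aug-K t = trans (∑-cong {n} (ε-K t)) (trans (∑-- {n} (λ i → u (t ⟨$⟩ʳ i)) (λ i → u (t ⟨$⟩ʳ prev i))) (ℤₚ.i≡j⇒i-j≡0 (∑-permute {n} (λ i → u (t ⟨$⟩ʳ i)) (flip (cyc m)))))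
    H-K : ∀ t x → H t Ku x ≡ ⟨ φ x , u ⟩
    H-K t x = begin
      aug t Ku * z₀ t x + ⟨ φ x , path t Ku ⟩                       ≡⟨ cong₂ _+_ (trans (cong (_* z₀ t x) (aug-K t)) (ℤₚ.*-zeroˡ (z₀ t x))) (∑-cong {n} (λ j → cong (φ x j *_) (path-K j))) ⟩
      + 0 + ∑ {n} (λ j → φ x j * (u j - l))                         ≡⟨ trans (ℤₚ.+-identityˡ _) (∑-cong {n} (λ j → lem (φ x j) (u j) l)) ⟩
      ∑ {n} (λ j → φ x j * u j - φ x j * l)                         ≡⟨ ∑-- {n} (λ j → φ x j * u j) (λ j → φ x j * l) ⟩
      ⟨ φ x , u ⟩ - ∑ {n} (λ j → φ x j * l)                         ≡⟨ cong (_-_ ⟨ φ x , u ⟩) (trans (∑-*ʳ {n} l (φ x)) (trans (cong (_* l) (∑-φ x)) (ℤₚ.*-zeroˡ l))) ⟩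
      ⟨ φ x , u ⟩ - + 0                                             ≡⟨ ℤₚ.+-identityʳ _ ⟩
      ⟨ φ x , u ⟩ ∎
      where
      l = u (t ⟨$⟩ʳ fromℕ m)
      lem : ∀ a b c → a * (b - c) ≡ a * b - a * c
      lem = solve-∀
      path-K : ∀ j → path t Ku j ≡ u j - l
      path-K j = trans (incl-cong (ε-K t) (t ⟨$⟩ˡ j)) (trans (incl-telescope (λ i → u (t ⟨$⟩ʳ i)) (t ⟨$⟩ˡ j)) (cong (λ a → u a - l) (inverseʳ t)))

  Rm : ZMat C.size QS.size
  Rm j q = [ (λ x → Πm j x) , (λ τ → (Πm ·ᶻ z₀ (base τ)) j) ]′ (splitAt size q)

  R-· : ∀ f j → (Rm ·ᶻ f) j ≡ (Πm ·ᶻ (λ x → f (x ↑ˡ N))) j + ∑ (λ τ → (Πm ·ᶻ z₀ (base τ)) j * f (size ↑ʳ τ))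
  R-· f j = trans (∑-++ size (λ q → Rm j q * f q)) (cong₂ _+_
    (∑-cong (λ x → cong (λ v → [ (λ x → Πm j x) , (λ τ → (Πm ·ᶻ z₀ (base τ)) j) ]′ v * f (x ↑ˡ N)) (splitAt-↑ˡ size x N)))
    (∑-cong (λ τ → cong (λ v → [ (λ x → Πm j x) , (λ τ → (Πm ·ᶻ z₀ (base τ)) j) ]′ v * f (size ↑ʳ τ)) (splitAt-↑ʳ size N τ))))

  R-act : ∀ σ f j → (Rm ·ᶻ (act Q σ ·ᶻ f)) j ≡ (act F σ ·ᶻ (Rm ·ᶻ f)) j
  R-act σ f j = begin
    (Rm ·ᶻ (act Q σ ·ᶻ f)) j
      ≡⟨ R-· (act Q σ ·ᶻ f) j ⟩
    (Πm ·ᶻ (λ x → (act Q σ ·ᶻ f) (x ↑ˡ N))) j + ∑ (λ τ → (Πm ·ᶻ z₀ (base τ)) j * (act Q σ ·ᶻ f) (size ↑ʳ τ))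
      ≡⟨ cong₂ _+_ (trans (·-cong Πm left j) (Π-act σ fX j)) right ⟩
    (act F σ ·ᶻ (Πm ·ᶻ fX)) j + ∑ (λ τ → (act F σ ·ᶻ V τ) j)
      ≡⟨ sym (trans (·-⊞ (act F σ) (Πm ·ᶻ fX) (vsum V) j) (cong (_+_ ((act F σ ·ᶻ (Πm ·ᶻ fX)) j)) (·-vsum (act F σ) V j))) ⟩
    (act F σ ·ᶻ ((Πm ·ᶻ fX) ⊞ vsum V)) j
      ≡⟨ ·-cong (act F σ) (λ i → trans (cong (_+_ ((Πm ·ᶻ fX) i)) (∑-cong {N} (λ τ → ℤₚ.*-comm (f (size ↑ʳ τ)) ((Πm ·ᶻ z₀ (base τ)) i)))) (sym (R-· f i))) j ⟩
    (act F σ ·ᶻ (Rm ·ᶻ f)) j ∎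
    where
    fX : ZVec size
    fX x = f (x ↑ˡ N)
    V : Fin N → ZVec C.size
    V τ = f (size ↑ʳ τ) ⊡ (Πm ·ᶻ z₀ (base τ))
    left : ∀ x → (act Q σ ·ᶻ f) (x ↑ˡ N) ≡ (act P σ ·ᶻ fX) x
    left x = trans (QS.act-lattice σ f (x ↑ˡ N)) (trans (cong f (union-↑ˡ X T.set (σ ⁻¹) x)) (sym (act-lattice σ fX x)))
    right : ∑ (λ τ → (Πm ·ᶻ z₀ (base τ)) j * (act Q σ ·ᶻ f) (size ↑ʳ τ)) ≡ ∑ (λ τ → (act F σ ·ᶻ V τ) j)
    right = trans (TS.∑-⋆ σ (λ τ → (Πm ·ᶻ z₀ (base τ)) j * (act Q σ ·ᶻ f) (size ↑ʳ τ))) (∑-cong {N} (λ τ → begin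
      (Πm ·ᶻ z₀ (base (σ TS.⋆ τ))) j * (act Q σ ·ᶻ f) (size ↑ʳ (σ TS.⋆ τ))
        ≡⟨ cong₂ _*_ (T.invariant-base (λ t → (Πm ·ᶻ z₀ t) j) (λ {s} {t} e → ·-cong Πm (λ x → z₀-cong x {s} {t} e) j) (Π-z₀-cyc j) σ τ)
             (trans (QS.act-lattice σ f _) (cong f (trans (union-↑ʳ X T.set (σ ⁻¹) (σ TS.⋆ τ)) (cong (size ↑ʳ_) (TS.⋆-⁻¹ˡ σ τ))))) ⟩
      (Πm ·ᶻ z₀ (σ ∙ base τ)) j * f (size ↑ʳ τ)
        ≡⟨ cong (_* f (size ↑ʳ τ)) (trans (·-cong Πm (λ x → trans (z₀-act σ (base τ) x) (sym (act-lattice σ (z₀ (base τ)) x))) j) (Π-act σ (z₀ (base τ)) j)) ⟩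
      (act F σ ·ᶻ (Πm ·ᶻ z₀ (base τ))) j * f (size ↑ʳ τ)
        ≡⟨ trans (ℤₚ.*-comm ((act F σ ·ᶻ (Πm ·ᶻ z₀ (base τ))) j) (f (size ↑ʳ τ))) (sym (·-⊡ (act F σ) (f (size ↑ʳ τ)) (Πm ·ᶻ z₀ (base τ)) j)) ⟩
      (act F σ ·ᶻ V τ) j ∎))

  R : GMap Q F
  R = mkGMap Rm R-act

  RA : ∀ z → (Rm ·ᶻ (Am ·ᶻ z)) ≐ (+ N ⊡ (Πm ·ᶻ z))
  RA z j = begin
    (Rm ·ᶻ (Am ·ᶻ z)) j
      ≡⟨ R-· (Am ·ᶻ z) j ⟩
    (Πm ·ᶻ (λ x → (Am ·ᶻ z) (x ↑ˡ N))) j + ∑ (λ τ → (Πm ·ᶻ z₀ (base τ)) j * (Am ·ᶻ z) (size ↑ʳ τ))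
      ≡⟨ cong₂ _+_ (trans (·-cong Πm (A-↑ˡ z) j) (trans (·-⊟ Πm (+ N ⊡ z) (vsum (λ τ → H (base τ) z)) j) (cong₂ _-_ (·-⊡ Πm (+ N) z j) (·-vsum Πm (λ τ → H (base τ) z) j))))
           (∑-cong {N} (λ τ → trans (cong ((Πm ·ᶻ z₀ (base τ)) j *_) (A-↑ʳ z τ)) (sym (Π-H (base τ))))) ⟩
    (+ N * (Πm ·ᶻ z) j - ∑ (λ τ → (Πm ·ᶻ H (base τ) z) j)) + ∑ (λ τ → (Πm ·ᶻ H (base τ) z) j)
      ≡⟨ lem (+ N * (Πm ·ᶻ z) j) (∑ (λ τ → (Πm ·ᶻ H (base τ) z) j)) ⟩
    + N * (Πm ·ᶻ z) j ∎
    where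
    lem : ∀ a b → (a - b) + b ≡ a
    lem = solve-∀
    Π-H : ∀ t → (Πm ·ᶻ H t z) j ≡ (Πm ·ᶻ z₀ t) j * aug t z
    Π-H t = begin
      (Πm ·ᶻ H t z) j                                                         ≡⟨ ·-cong Πm (λ x → cong (_+_ (aug t z * z₀ t x)) (sym (K-diff (path t z) x))) j ⟩
      (Πm ·ᶻ ((aug t z ⊡ z₀ t) ⊞ (K ·ᶻ (diff m ·ᶻ path t z)))) j              ≡⟨ ·-⊞ Πm (aug t z ⊡ z₀ t) (K ·ᶻ (diff m ·ᶻ path t z)) j ⟩
      (Πm ·ᶻ (aug t z ⊡ z₀ t)) j + (Πm ·ᶻ (K ·ᶻ (diff m ·ᶻ path t z))) j      ≡⟨ cong₂ _+_ (·-⊡ Πm (aug t z) (z₀ t) j) (Π-K (diff m ·ᶻ path t z) j) ⟩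
      aug t z * (Πm ·ᶻ z₀ t) j + + 0                                          ≡⟨ trans (ℤₚ.+-identityʳ _) (ℤₚ.*-comm (aug t z) ((Πm ·ᶻ z₀ t) j)) ⟩
      (Πm ·ᶻ z₀ t) j * aug t z ∎

  prime-retract : ∀ {p} → ¬ p ∣ N → Retract p F Q
  prime-retract p∤N = retract A R N p∤N A-K RA

prime⇒pInvertible : ∀ {m} → Prime (suc m) → FlasqueClassPInvertible (suc m) (J (suc m))
prime⇒pInvertible {m} pp = go (cover (suc m)) (cyclicSet m)
  where
  go : Cover (suc m) → CyclicSet m → FlasqueClassPInvertible (suc m) (J (suc m))
  go 𝒞 𝒯 = Resolution.resolution 𝒞 , retract⇒pInvertible pp (GSet.lattice-isPermutation (PrimeDegree.QS 𝒞 𝒯))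
    (PrimeDegree.prime-retract 𝒞 𝒯 (subst (λ k → ¬ suc m ∣ k) (sym (CyclicSet.size≡ 𝒯)) (prime∤! pp m (ℕₚ.n<1+n m))))

theorem4p3 : (n p : ℕ) → 2 ≤ n → Prime p →
    FlasqueClassPInvertible p (J n) ⇔ (Prime n ⊎ (¬ Prime n × ¬ (p ∣ n)))
theorem4p3 (suc m) p 2≤n pp = mk⇔ (forth (prime? (suc m))) back
  where
  forth : Dec (Prime (suc m)) → FlasqueClassPInvertible p (J (suc m)) → Prime (suc m) ⊎ (¬ Prime (suc m) × ¬ (p ∣ suc m))
  forth (yes n-prime) _ = inj₁ n-prime
  forth (no ¬prime) inv = inj₂ (¬prime , λ p∣n → not-pInvertible pp ¬prime p∣n 2≤n inv)
  primeCase : Prime (suc m) → Dec (p ∣ suc m) → FlasqueClassPInvertible p (J (suc m))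
  primeCase n-prime (no p∤n) = coprime⇒pInvertible pp p∤n
  primeCase n-prime (yes p∣n) with prime⇒irreducible n-prime p∣n
  ... | inj₁ refl = ⊥-elim (prime∤1 pp (∣-refl))
  ... | inj₂ refl = prime⇒pInvertible pp
  back : Prime (suc m) ⊎ (¬ Prime (suc m) × ¬ (p ∣ suc m)) → FlasqueClassPInvertible p (J (suc m))
  back (inj₁ n-prime) = primeCase n-prime (p ∣? suc m)
  back (inj₂ (_ , p∤n)) = coprime⇒pInvertible pp p∤n
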